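{- There exists an algorithm with running time $k^{O(k)} n^{O(1)}$ such that, given an instance $(D,C,k)$ of \textsc{Symmetric Directed Vertex Multicut}, where $k$ is an integer and $n=|V(D)|$, either it concludes that there is no solution of size at most $k$, or it returns a solution of size at most $2k$.
   Context: \textsc{Symmetric Directed Vertex Multicut} is the following problem. Input: a digraph $D$, a set of pairs of vertices of $D$ (the cut requests) $C=\{(s_1,t_1),\dots,(s_\ell,t_\ell)\}$, and an integer $k$. A solution is a set $X\subseteq V(D)$ whose removal cuts, for every $i=1,\dots,\ell$, either all $(s_i,t_i)$-paths or all $(t_i,s_i)$-paths. Equivalently, for every $i$ such that $s_i,t_i\notin X$, the vertices $s_i$ and $t_i$ lie in distinct strongly connected components of $D-X$. The set $X$ is allowed to contain vertices $s_i$ or $t_i$; a cut request with an endpoint in $X$ is considered to be cut. The exact problem asks for a solution of size at most $k$, if one exists. -}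

module Defs where

open import Data.Bool.Base using (Bool; T; not; if_then_else_)
open import Data.Fin.Base using (Fin; toℕ)
open import Data.Fin.Subset using (Subset; ∣_∣; _∈_)
open import Data.List.Base using (List; []; _∷_; [_]; _++_; map; concatMap; allFin)
open import Data.List.Relation.Unary.Any using (Any)
open import Data.List.Relation.Unary.Unique.Propositional using (Unique)
open import Data.Maybe.Base using (Maybe; just; nothing)
open import Data.Nat.Base using (ℕ; zero; suc; _+_; _*_; _∸_; _≤_; _≡ᵇ_)
open import Data.Product.Base using (_×_; ∃-syntax)
open import Data.Sum.Base using (_⊎_)
open import Data.Vec.Base using (tabulate)
open import Relation.Binary.Construct.Closure.ReflexiveTransitive using (Star; ε; _◅_)
open import Relation.Binary.PropositionalEquality using (_≡_; _≢_)
open import Relation.Nullary.Negation using (¬_)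

------------------------------------------------------------------------
-- Symmetric Directed Vertex Multicut

-- A set of ordered pairs of vertices, given by its characteristic function.
Pairs : ℕ → Set
Pairs n = Fin n → Fin n → Bool

record Digraph : Set where
  field
    n   : ℕ
    arc : Pairs n

  Vertex : Set
  Vertex = Fin n

  Walk : Vertex → Vertex → Set
  Walk = Star (λ u v → T (arc u v))

  -- All vertices of a walk, both endpoints included.
  vertices : ∀ {s t} → Walk s t → List Vertex
  vertices {s} ε       = [ s ]
  vertices {s} (_ ◅ w) = s ∷ vertices w

  IsPath : ∀ {s t} → Walk s t → Set
  IsPath w = Unique (vertices w)

  -- Removing X destroys every (s,t)-path. X may contain s or t, in which
  -- case this holds automatically.
  CutsAllPaths : Subset n → Vertex → Vertex → Set
  CutsAllPaths X s t = (w : Walk s t) → IsPath w → Any (_∈ X) (vertices w)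

record Instance : Set where
  field
    digraph : Digraph

  open Digraph digraph public

  field
    request : Pairs n
    k       : ℕ

  IsSolution : Subset n → Set
  IsSolution X = ∀ s t → T (request s t) →
                 CutsAllPaths X s t ⊎ CutsAllPaths X t s

  -- What an answer of the 2-approximation has to satisfy; `nothing` is the
  -- claim that there is no solution of size at most k.
  Correct : Maybe (Subset n) → Set
  Correct nothing  = ¬ (∃[ X ] IsSolution X × ∣ X ∣ ≤ k)
  Correct (just X) = IsSolution X × ∣ X ∣ ≤ 2 * k

------------------------------------------------------------------------
-- Random access machine, programmed with structured control flow

Memory : Set
Memory = ℕ → ℕ

_[_↦_] : Memory → ℕ → ℕ → Memory
(σ [ a ↦ v ]) b = if b ≡ᵇ a then v else σ b

infixl 6 _⊕_ _⊖_
infix  4 _≔_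
infixr 3 _⨾_
infix  2 IF_THEN_ELSE_ WHILE_DO_

-- There is no multiplication, so that in t steps numbers grow by only O(t)
-- bits and unit-cost time is polynomially related to Turing machine time.
data Exp : Set where
  lit     : ℕ → Exp
  cell    : Exp → Exp          -- contents of the cell with the given address
  _⊕_ _⊖_ : Exp → Exp → Exp

⟦_⟧ : Exp → Memory → ℕ
⟦ lit m ⟧   σ = m
⟦ cell e ⟧  σ = σ (⟦ e ⟧ σ)
⟦ e ⊕ f ⟧   σ = ⟦ e ⟧ σ + ⟦ f ⟧ σ
⟦ e ⊖ f ⟧   σ = ⟦ e ⟧ σ ∸ ⟦ f ⟧ σ

data Program : Set where
  skip          : Program
  _≔_           : Exp → Exp → Program   -- the left expression is an address
  _⨾_           : Program → Program → Program
  IF_THEN_ELSE_ : Exp → Program → Program → Program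
  WHILE_DO_     : Exp → Program → Program

-- P ⊢ σ ⇓ σ′ in-time t: started on memory σ, the program P halts with memory
-- σ′ after t steps. Evaluating an expression is part of one step: a program
-- is fixed independently of its input, so its expressions have bounded size.
infix 4 _⊢_⇓_in-time_

data _⊢_⇓_in-time_ : Program → Memory → Memory → ℕ → Set where

  skip : ∀ {σ} → skip ⊢ σ ⇓ σ in-time 1

  assign : ∀ {e f σ} →
    (e ≔ f) ⊢ σ ⇓ σ [ ⟦ e ⟧ σ ↦ ⟦ f ⟧ σ ] in-time 1

  seq : ∀ {P Q σ σ′ σ″ t u} →
    P ⊢ σ ⇓ σ′ in-time t →
    Q ⊢ σ′ ⇓ σ″ in-time u →
    (P ⨾ Q) ⊢ σ ⇓ σ″ in-time t + u

  if-nonzero : ∀ {e P Q σ σ′ t} →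
    ⟦ e ⟧ σ ≢ 0 →
    P ⊢ σ ⇓ σ′ in-time t →
    (IF e THEN P ELSE Q) ⊢ σ ⇓ σ′ in-time suc t

  if-zero : ∀ {e P Q σ σ′ t} →
    ⟦ e ⟧ σ ≡ 0 →
    Q ⊢ σ ⇓ σ′ in-time t →
    (IF e THEN P ELSE Q) ⊢ σ ⇓ σ′ in-time suc t

  while-nonzero : ∀ {e P σ σ′ σ″ t u} →
    ⟦ e ⟧ σ ≢ 0 →
    P ⊢ σ ⇓ σ′ in-time t →
    (WHILE e DO P) ⊢ σ′ ⇓ σ″ in-time u →
    (WHILE e DO P) ⊢ σ ⇓ σ″ in-time suc (t + u)

  while-zero : ∀ {e P σ} →
    ⟦ e ⟧ σ ≡ 0 →
    (WHILE e DO P) ⊢ σ ⇓ σ in-time 1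

------------------------------------------------------------------------
-- Input and output conventions

-- The list is stored from address 0 on; all further cells contain 0.
load : List ℕ → Memory
load []       _       = 0
load (m ∷ _)  zero    = m
load (_ ∷ ms) (suc a) = load ms a

-- 0/1 matrix, row by row.
matrix : ∀ {n} → Pairs n → List ℕ
matrix {n} A =
  concatMap (λ u → map (λ v → if A u v then 1 else 0) (allFin n)) (allFin n)

encode : Instance → Memory
encode I = load (n ∷ k ∷ matrix arc ++ matrix request)
  where open Instance I

-- Cell 0 tells whether a set is returned; if so, vertex v belongs to it
-- exactly if cell 1 + v is nonzero.
decode : ∀ n → Memory → Maybe (Subset n)
decode n σ =
  if σ 0 ≡ᵇ 0
  then nothing
  else just (tabulate (λ (v : Fin n) → not (σ (suc (toℕ v)) ≡ᵇ 0)))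

{-# OPTIONS --safe #-}

-- Iterative compression: the requests are taken into account source by source,
-- and a solution W with at most 2k + 1 vertices is replaced by one with at most
-- 2k vertices. Let X be a hidden solution with at most k vertices. The vertices
-- of W get labels: 0 for those in X, and otherwise the rank of their strong
-- component of D − X in a topological order. Phase one deletes at most k
-- vertices so that differently labelled vertices of W lie in different
-- components: level by level, take the minimum vertex cut nearest to the sources
-- and one of its vertices. Either X contains the vertex, which is then deleted,
-- or it becomes a sink, and the minimum cut grows. By submodularity X may be
-- pushed beyond the nearest cut, and thus 2k steps and one for each level
-- suffice. Phase two deletes at most k vertices more to solve the requests
-- inside the components: since X solves them, it cuts an endpoint of an unsolved
-- request from W in one of the two directions, and the same steps apply with
-- this endpoint as sink. All choices form an advice string of length 8k + 6 over
-- 2k + 4 digits. All strings are tried, and only verified candidates are used.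
--
-- The algorithm is a program of bulk assignments to matrices with indices below
-- M = O(n + k), which is compiled to the random access machine.

module Submission where

open import Defs
open import Data.Bool.Base using (Bool; true; false; T; not; if_then_else_; _∧_; _∨_)
open import Data.Nat.DivMod using (_%_; [m+kn]%n≡m%n; m<n⇒m%n≡m)
open import Data.Nat.Solver using (module +-*-Solver)
open import Data.Product.Base using (_×_; _,_; proj₁; proj₂; ∃-syntax; Σ-syntax)
open import Data.Sum.Base using (_⊎_; inj₁; inj₂; [_,_]′)
open import Data.Empty using (⊥; ⊥-elim)
open import Data.Unit.Base using (tt)
open import Data.Fin.Base using (Fin; zero; suc; toℕ; fromℕ<)
open import Data.Vec.Base using (Vec; []; _∷_; lookup; tabulate)
open import Data.Bool.Properties using (T?)
open import Relation.Nullary.Negation using (¬_; contradiction)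
open import Relation.Nullary.Decidable.Core using (Dec; yes; no)
open import Function.Base using (_∘_; id; case_of_)
open import Data.List.Base using (List; []; _∷_; length; _++_; map; concatMap; allFin)
open import Data.Fin.Properties using (toℕ<n; toℕ-fromℕ<; toℕ-injective)
open import Data.Fin.Subset using (Subset; ∣_∣; _∈_)
open import Data.Maybe.Base using (just; nothing)
open import Data.Vec.Properties using (tabulate-cong; lookup∘tabulate; []=⇒lookup; lookup⇒[]=)
open import Data.List.Properties using (length-++; length-map; length-tabulate)
open import Relation.Binary.Definitions using (tri<; tri≈; tri>)
open import Relation.Binary.Construct.Closure.ReflexiveTransitive using (Star; ε; _◅_; _◅◅_)
open import Data.Fin.Subset.Properties using (_∈?_)
open import Data.List.Relation.Unary.All.Properties using (¬Any⇒All¬; All¬⇒¬Any)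
open import Data.List.Relation.Unary.AllPairs using ([]; _∷_)
open import Data.Nat.Base
open import Data.Nat.Properties
open import Relation.Binary.PropositionalEquality
open import Data.List.Base as List using ()
import Relation.Binary.Construct.Closure.ReflexiveTransitive as RT
open import Data.Fin.Properties as Fin using ()
open import Data.List.Relation.Unary.Any as Any using (Any; any?)
open import Data.List.Relation.Unary.All as All using (All; []; _∷_)

-- The hidden solution `X` changes during the run, since each step may replace it by a pushed set.
-- So the digits cannot be read off `X` in advance; they are chosen along the run and only then
-- spliced into one advice string that leads to the same states. Pushing must not spoil what `X`
-- still has to achieve. It only shrinks what the sources reach, and this dominance preserves the
-- later levels, whose sources are among the present ones. The requests are not covered by this
-- argument in phase one. Therefore phase two starts again from the original `X` with a fresh budget
-- of `k`: this is the factor 2. Steps are counted by the potential `2 * κ` minus `ℓ`, where `κ` is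
-- the budget left and `ℓ` a lower bound on the minimum cut. A deletion lowers `κ` by 1 and `ℓ` by
-- at most 1; a new sink raises `ℓ`. The advice has `2 * k + 2` places for labels, which are at most
-- `2 * k + 1`, then `4 * k + 3` and `2 * k + 1` digits for the two phases; these digits are at most
-- 3. The range `M = 2 * n + 8 * k + 8` has room for the split vertices and for all positions of the
-- advice.

sum : ℕ → (ℕ → ℕ) → ℕ
sum zero    f = 0
sum (suc n) f = sum n f + f n

any : ℕ → (ℕ → Bool) → Bool
any zero    p = false
any (suc n) p = any n p ∨ p n

iter : ∀ {A : Set} → ℕ → (A → A) → A → A
iter zero    f x = x
iter (suc n) f x = f (iter n f x)

-- Expressions over matrices indexed by numbers below M

data Ty : Set where
  nat bool : Ty

Val : Ty → Set
Val nat  = ℕ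
Val bool = Bool

-- Every array is a matrix. A scalar is read at entry (0, 0) and a vector from row 0, hence the
-- constant index `z`.
data Ix (g : ℕ) : Set where
  z : Ix g
  v : Fin g → Ix g

infixl 6 _⊞_ _⊟_
infix  5 _⊲_ _≐_
infixr 4 _&&_
infixr 3 _||_

data Ex : Ty → ℕ → Set where
  lit′          : ∀ {g} → ℕ → Ex nat g
  #n #k #M      : ∀ {g} → Ex nat g
  inp           : ∀ {g} → Ex nat g → Ex nat g
  ix            : ∀ {g} → Fin g → Ex nat g
  rd            : ∀ {g} t → ℕ → Ix g → Ix g → Ex t g
  _⊞_ _⊟_       : ∀ {g} → Ex nat g → Ex nat g → Ex nat g
  ite           : ∀ {t g} → Ex bool g → Ex t g → Ex t g → Ex t g
  _⊲_ _≐_       : ∀ {g} → Ex nat g → Ex nat g → Ex bool g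
  _&&_ _||_       : ∀ {g} → Ex bool g → Ex bool g → Ex bool g
  neg           : ∀ {g} → Ex bool g → Ex bool g
  Σ̂             : ∀ {g} → Ex nat (suc g) → Ex nat g
  ∃̂             : ∀ {g} → Ex bool (suc g) → Ex bool g

infixr 2 _⍮_

-- An assignment computes all entries from the old state; row index first.
data Stm : Set where
  assign : ∀ t → ℕ → Ex t 2 → Stm
  _⍮_    : Stm → Stm → Stm
  loop   : Stm → Stm
  rep    : Stm → Stm

State : Set
State = (t : Ty) → ℕ → ℕ → ℕ → Val t

-- All repetition counts are fixed before the run: `loop` takes `cM` rounds and `rep` takes `cE`. So
-- `run` is a total function and time bounds follow the syntax of the program. `cI` is the number of
-- readable input cells.
record Context : Set where
  field
    cn ck cM cE cI : ℕ
    input : ℕ → ℕ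

ixv : ∀ {g} → Vec ℕ g → Ix g → ℕ
ixv ρ z     = 0
ixv ρ (v i) = lookup ρ i

upd : State → ∀ t → ℕ → (ℕ → ℕ → Val t) → State
upd st nat  a f nat  b = if b ≡ᵇ a then f else st nat b
upd st nat  a f bool b = st bool b
upd st bool a f nat  b = st nat b
upd st bool a f bool b = if b ≡ᵇ a then f else st bool b

module Semantics (C : Context) where
  open Context C

  eval : ∀ {t g} → State → Vec ℕ g → Ex t g → Val t
  eval st ρ (lit′ m)    = m
  eval st ρ #n          = cn
  eval st ρ #k          = ck
  eval st ρ #M          = cM
  eval st ρ (inp e)     = if eval st ρ e <ᵇ cI then input (eval st ρ e) else 0
  eval st ρ (ix i)      = lookup ρ i
  eval st ρ (rd t a i j) = st t a (ixv ρ i) (ixv ρ j)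
  eval st ρ (e ⊞ f)     = eval st ρ e + eval st ρ f
  eval st ρ (e ⊟ f)     = eval st ρ e ∸ eval st ρ f
  eval st ρ (ite b e f) = if eval st ρ b then eval st ρ e else eval st ρ f
  eval st ρ (e ⊲ f)     = eval st ρ e <ᵇ eval st ρ f
  eval st ρ (e ≐ f)     = eval st ρ e ≡ᵇ eval st ρ f
  eval st ρ (e && f)    = eval st ρ e ∧ eval st ρ f
  eval st ρ (e || f)    = eval st ρ e ∨ eval st ρ f
  eval st ρ (neg e)     = not (eval st ρ e)
  eval st ρ (Σ̂ e)       = sum cM (λ x → eval st (x ∷ ρ) e)
  eval st ρ (∃̂ e)       = any cM (λ x → eval st (x ∷ ρ) e)

  run : Stm → State → State
  run (assign t a e) st = upd st t a (λ i j → eval st (j ∷ i ∷ []) e)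
  run (s ⍮ s′)       st = run s′ (run s st)
  run (loop s)       st = iter cM (run s) st
  run (rep s)        st = iter cE (run s) st

-- Hoare triples with time bounds

record Run (P : Program) (σ : Memory) (b : ℕ) (Post : Memory → Set) : Set where
  constructor mkRun
  field
    {final} : Memory
    {time}  : ℕ
    exec    : P ⊢ σ ⇓ final in-time time
    bound   : time ≤ b
    post    : Post final

mono : ∀ {P σ b b′} {Post Post′ : Memory → Set} → b ≤ b′ → (∀ {σ′} → Post σ′ → Post′ σ′) →
       Run P σ b Post → Run P σ b′ Post′
mono b≤ f (mkRun e t p) = mkRun e (≤-trans t b≤) (f p)

seqR : ∀ {P Q σ b c} {Mid Post : Memory → Set} → Run P σ b Mid →
       (∀ {σ′} → Mid σ′ → Run Q σ′ c Post) → Run (P ⨾ Q) σ (b + c) Post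
seqR (mkRun e t p) f with f p
... | mkRun e′ t′ p′ = mkRun (seq e e′) (+-mono-≤ t t′) p′

asgR : ∀ {e f σ} {Post : Memory → Set} → Post (σ [ ⟦ e ⟧ σ ↦ ⟦ f ⟧ σ ]) → Run (e ≔ f) σ 1 Post
asgR p = mkRun assign ≤-refl p

ifR : ∀ {e P Q σ b c} {Post : Memory → Set} →
      (⟦ e ⟧ σ ≢ 0 → Run P σ b Post) → (⟦ e ⟧ σ ≡ 0 → Run Q σ c Post) →
      Run (IF e THEN P ELSE Q) σ (suc (b + c)) Post
ifR {e} {σ = σ} {b} {c} f g with ⟦ e ⟧ σ ≟ 0
... | yes q = case g q of λ { (mkRun x t p) → mkRun (if-zero q x) (s≤s (≤-trans t (m≤n+m c b))) p }
... | no  q = case f q of λ { (mkRun x t p) → mkRun (if-nonzero q x) (s≤s (≤-trans t (m≤m+n b c))) p }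

-- Every loop of the machine programs counts up to a fixed `N`, and its guard evaluates to the
-- number of rounds left. This gives termination and the time bound together.
whileR : ∀ {e P N b} (Inv : ℕ → Memory → Set) →
         (∀ {i σ} → Inv i σ → ⟦ e ⟧ σ ≡ N ∸ i) →
         (∀ {i σ} → i < N → Inv i σ → Run P σ b (Inv (suc i))) →
         ∀ {σ} → Inv 0 σ → Run (WHILE e DO P) σ (suc (N * suc b)) (Inv N)
whileR {e} {P} {N} {b} Inv cond body {σ} inv₀ = go N 0 (+-identityʳ N) inv₀
  where
  go : ∀ r i → r + i ≡ N → ∀ {σ} → Inv i σ → Run (WHILE e DO P) σ (suc (r * suc b)) (Inv N)
  go zero    i refl inv = mkRun (while-zero (trans (cond inv) (n∸n≡0 i))) ≤-refl inv
  go (suc r) i refl inv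
    with body (s≤s (m≤n+m i r)) inv
  ... | mkRun x t p with go r (suc i) (+-suc r i) p
  ...   | mkRun x′ t′ p′ = mkRun (while-nonzero ne x x′) (s≤s (≤-trans (+-mono-≤ t t′) (≤-reflexive (+-suc b (r * suc b))))) p′
    where
    ne : ⟦ e ⟧ _ ≢ 0
    ne q = contradiction (trans (sym (m+n∸n≡m (suc r) i)) (trans (sym (cond inv)) q)) λ ()

-- Memory updates and numbering of the arrays

≡ᵇ-refl : ∀ a → (a ≡ᵇ a) ≡ true
≡ᵇ-refl zero    = refl
≡ᵇ-refl (suc a) = ≡ᵇ-refl a

≡ᵇ-≢ : ∀ {a b} → a ≢ b → (a ≡ᵇ b) ≡ false
≡ᵇ-≢ {a} {b} ne with a ≡ᵇ b in q
... | false = refl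
... | true  = contradiction (≡ᵇ⇒≡ a b (subst T (sym q) tt)) ne

↦-same : ∀ σ a x → (σ [ a ↦ x ]) a ≡ x
↦-same σ a x rewrite ≡ᵇ-refl a = refl

↦-other : ∀ σ a x {b} → b ≢ a → (σ [ a ↦ x ]) b ≡ σ b
↦-other σ a x ne rewrite ≡ᵇ-≢ ne = refl

enc : ∀ {t} → Val t → ℕ
enc {nat}  x = x
enc {bool} b = if b then 1 else 0

-- Arrays of both types share one memory: the `nat` arrays get the odd slots, the `bool` arrays the
-- positive even ones. Slot 0 stays free as a buffer for simultaneous assignment.
slot : Ty → ℕ → ℕ
slot nat  zero    = 1
slot bool zero    = 2
slot t    (suc a) = 2 + slot t a

slot≢0 : ∀ t a → slot t a ≢ 0
slot≢0 nat  zero ()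
slot≢0 bool zero ()
slot≢0 nat  (suc a) ()
slot≢0 bool (suc a) ()

slot-inj : ∀ t a t′ a′ → slot t a ≡ slot t′ a′ → t ≡ t′ × a ≡ a′
slot-inj nat  zero    nat  zero    q = refl , refl
slot-inj bool zero    bool zero    q = refl , refl
slot-inj nat  zero    bool zero    ()
slot-inj bool zero    nat  zero    ()
slot-inj nat  zero    nat  (suc b) ()
slot-inj nat  zero    bool (suc b) ()
slot-inj bool zero    nat  (suc b) q = contradiction (sym (suc-injective (suc-injective q))) (slot≢0 nat b)
slot-inj bool zero    bool (suc b) q = contradiction (sym (suc-injective (suc-injective q))) (slot≢0 bool b)
slot-inj nat  (suc a) nat  zero    ()
slot-inj bool (suc a) nat  zero    ()
slot-inj nat  (suc a) bool zero    q = contradiction (suc-injective (suc-injective q)) (slot≢0 nat a)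
slot-inj bool (suc a) bool zero    q = contradiction (suc-injective (suc-injective q)) (slot≢0 bool a)
slot-inj nat  (suc a) nat  (suc b) q with slot-inj nat a nat b (suc-injective (suc-injective q))
... | p , refl = p , refl
slot-inj nat  (suc a) bool (suc b) q with slot-inj nat a bool b (suc-injective (suc-injective q))
... | p , refl = p , refl
slot-inj bool (suc a) nat  (suc b) q with slot-inj bool a nat b (suc-injective (suc-injective q))
... | p , refl = p , refl
slot-inj bool (suc a) bool (suc b) q with slot-inj bool a bool b (suc-injective (suc-injective q))
... | p , refl = p , refl

-- Cell 2 holds the address B of register 0. Registers 0 to 3 hold M, M * M,
-- the length of the input and the repetition count.

ra : ℕ → Exp
ra r = cell (lit 2) ⊕ lit r

reg : ℕ → Exp
reg r = cell (ra r)

-- The machine has no multiplication, but `m` is a constant of the program, so this is an expression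
-- of fixed size.
times : ℕ → Exp → Exp
times zero    e = lit 0
times (suc m) e = e ⊕ times m e

⟦times⟧ : ∀ m e σ → ⟦ times m e ⟧ σ ≡ m * ⟦ e ⟧ σ
⟦times⟧ zero    e σ = refl
⟦times⟧ (suc m) e σ = cong (⟦ e ⟧ σ +_) (⟦times⟧ m e σ)

ixE : ∀ {g} → Vec ℕ g → Ix g → Exp
ixE ρ z     = lit 0
ixE ρ (v i) = reg (lookup ρ i)

-- The compiler

module Compile (K : ℕ) where

  -- A product `i * M` of two run-time values is not an expression. Therefore a table behind the `K`
  -- registers holds the address at which row `i` of slot 0 starts; register 1 holds the distance
  -- `M * M` between consecutive slots.
  cellE : ℕ → Exp → Exp → Exp
  cellE s i j = (cell (cell (lit 2) ⊕ (lit K ⊕ i)) ⊕ times s (reg 1)) ⊕ j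

  -- The value of e goes to register d; only registers from d on are changed.
  compE : ∀ {t g} → ℕ → Vec ℕ g → Ex t g → Program
  compE d ρ (lit′ m)     = ra d ≔ lit m
  compE d ρ #n           = ra d ≔ cell (lit 0)
  compE d ρ #k           = ra d ≔ cell (lit 1)
  compE d ρ #M           = ra d ≔ reg 0
  compE d ρ (inp e)      = compE d ρ e ⨾ (IF reg 2 ⊖ reg d THEN ra d ≔ cell (reg d) ELSE (ra d ≔ lit 0))
  compE d ρ (ix i)       = ra d ≔ reg (lookup ρ i)
  compE d ρ (rd t a i j) = ra d ≔ cell (cellE (slot t a) (ixE ρ i) (ixE ρ j))
  compE d ρ (e ⊞ f)      = compE d ρ e ⨾ compE (suc d) ρ f ⨾ ra d ≔ reg d ⊕ reg (suc d)
  compE d ρ (e ⊟ f)      = compE d ρ e ⨾ compE (suc d) ρ f ⨾ ra d ≔ reg d ⊖ reg (suc d)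
  compE d ρ (ite b e f)  = compE d ρ b ⨾ (IF reg d THEN compE d ρ e ELSE compE d ρ f)
  compE d ρ (e ⊲ f)      = compE d ρ e ⨾ compE (suc d) ρ f ⨾
                           (IF reg (suc d) ⊖ reg d THEN ra d ≔ lit 1 ELSE (ra d ≔ lit 0))
  compE d ρ (e ≐ f)      = compE d ρ e ⨾ compE (suc d) ρ f ⨾
                           (IF (reg (suc d) ⊖ reg d) ⊕ (reg d ⊖ reg (suc d)) THEN ra d ≔ lit 0 ELSE (ra d ≔ lit 1))
  compE d ρ (e && f)     = compE d ρ e ⨾ (IF reg d THEN compE d ρ f ELSE skip)
  compE d ρ (e || f)     = compE d ρ e ⨾ (IF reg d THEN skip ELSE compE d ρ f)
  compE d ρ (neg e)      = compE d ρ e ⨾ ra d ≔ lit 1 ⊖ reg d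
  compE d ρ (Σ̂ e)        = ra d ≔ lit 0 ⨾ ra (1 + d) ≔ lit 0 ⨾
    (WHILE reg 0 ⊖ reg (1 + d) DO
      (compE (2 + d) (1 + d ∷ ρ) e ⨾ ra d ≔ reg d ⊕ reg (2 + d) ⨾ ra (1 + d) ≔ reg (1 + d) ⊕ lit 1))
  compE d ρ (∃̂ e)        = ra d ≔ lit 0 ⨾ ra (1 + d) ≔ lit 0 ⨾
    (WHILE reg 0 ⊖ reg (1 + d) DO
      (compE (2 + d) (1 + d ∷ ρ) e ⨾ (IF reg (2 + d) THEN ra d ≔ lit 1 ELSE skip) ⨾ ra (1 + d) ≔ reg (1 + d) ⊕ lit 1))

  loopE : ℕ → ℕ → Program → Program
  loopE N d P = ra d ≔ lit 0 ⨾ (WHILE reg N ⊖ reg d DO (P ⨾ ra d ≔ reg d ⊕ lit 1))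

  comp : ℕ → Stm → Program
  comp d (assign t a e) =
    -- All entries go to the buffer in slot 0 and are copied only afterwards, because `e` may read
    -- the array that is being assigned.
    loopE 0 d (loopE 0 (1 + d)
      (compE (2 + d) (1 + d ∷ d ∷ []) e ⨾ cellE 0 (reg d) (reg (1 + d)) ≔ reg (2 + d))) ⨾
    loopE 0 d (loopE 0 (1 + d)
      (cellE (slot t a) (reg d) (reg (1 + d)) ≔ cell (cellE 0 (reg d) (reg (1 + d)))))
  comp d (s ⍮ s′) = comp d s ⨾ comp d s′
  comp d (loop s) = loopE 0 d (comp (1 + d) s)
  comp d (rep s)  = loopE 3 d (comp (1 + d) s)

-- Registers and time needed by compiled programs

need : ∀ {t g} → Ex t g → ℕ
need (lit′ _)     = 1
need #n           = 1
need #k           = 1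
need #M           = 1
need (inp e)      = need e
need (ix _)       = 1
need (rd _ _ _ _) = 1
need (e ⊞ f)      = need e ⊔ suc (need f)
need (e ⊟ f)      = need e ⊔ suc (need f)
need (ite b e f)  = need b ⊔ (need e ⊔ need f)
need (e ⊲ f)      = need e ⊔ suc (need f)
need (e ≐ f)      = need e ⊔ suc (need f)
need (e && f)     = need e ⊔ need f
need (e || f)     = need e ⊔ need f
need (neg e)      = need e
need (Σ̂ e)        = 2 + need e
need (∃̂ e)        = 2 + need e

needS : Stm → ℕ
needS (assign _ _ e) = 2 + need e
needS (s ⍮ s′)       = needS s ⊔ needS s′
needS (loop s)       = 1 + needS s
needS (rep s)        = 1 + needS s

cost : ∀ {t g} → Ex t g → ℕ → ℕ
cost (lit′ _)     M = 1
cost #n           M = 1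
cost #k           M = 1
cost #M           M = 1
cost (inp e)      M = cost e M + 3
cost (ix _)       M = 1
cost (rd _ _ _ _) M = 1
cost (e ⊞ f)      M = cost e M + (cost f M + 1)
cost (e ⊟ f)      M = cost e M + (cost f M + 1)
cost (ite b e f)  M = cost b M + suc (cost e M + cost f M)
cost (e ⊲ f)      M = cost e M + (cost f M + 3)
cost (e ≐ f)      M = cost e M + (cost f M + 3)
cost (e && f)     M = cost e M + suc (cost f M + 1)
cost (e || f)     M = cost e M + suc (1 + cost f M)
cost (neg e)      M = cost e M + 1
cost (Σ̂ e)        M = 1 + (1 + suc (M * suc (cost e M + 2)))
cost (∃̂ e)        M = 1 + (1 + suc (M * suc (cost e M + (3 + 1))))

loopCost : ℕ → ℕ → ℕ
loopCost N b = 1 + suc (N * suc (b + 1))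

costS : Stm → ℕ → ℕ → ℕ
costS (assign _ _ e) M E = loopCost M (loopCost M (cost e M + 1)) + loopCost M (loopCost M 1)
costS (s ⍮ s′)       M E = costS s M E + costS s′ M E
costS (loop s)       M E = loopCost M (costS s M E)
costS (rep s)        M E = loopCost E (costS s M E)

⊔ˡ : ∀ d {a b K} → d + (a ⊔ b) ≤ K → d + a ≤ K
⊔ˡ d {a} {b} h = ≤-trans (+-monoʳ-≤ d (m≤m⊔n a b)) h

⊔ʳ : ∀ d {a b K} → d + (a ⊔ b) ≤ K → d + b ≤ K
⊔ʳ d {a} {b} h = ≤-trans (+-monoʳ-≤ d (m≤n⊔m a b)) h

⊔ʳ⁺ : ∀ d {a b K} → d + (a ⊔ suc b) ≤ K → suc d + b ≤ K
⊔ʳ⁺ d {a} {b} h = ≤-trans (≤-reflexive (sym (+-suc d b))) (⊔ʳ d {a} h)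

need>0 : ∀ {t g} (e : Ex t g) → 0 < need e
need>0 (lit′ _)     = s≤s z≤n
need>0 #n           = s≤s z≤n
need>0 #k           = s≤s z≤n
need>0 #M           = s≤s z≤n
need>0 (inp e)      = need>0 e
need>0 (ix _)       = s≤s z≤n
need>0 (rd _ _ _ _) = s≤s z≤n
need>0 (e ⊞ f)      = ≤-trans (need>0 e) (m≤m⊔n _ _)
need>0 (e ⊟ f)      = ≤-trans (need>0 e) (m≤m⊔n _ _)
need>0 (ite b e f)  = ≤-trans (need>0 b) (m≤m⊔n _ _)
need>0 (e ⊲ f)      = ≤-trans (need>0 e) (m≤m⊔n _ _)
need>0 (e ≐ f)      = ≤-trans (need>0 e) (m≤m⊔n _ _)
need>0 (e && f)     = ≤-trans (need>0 e) (m≤m⊔n _ _)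
need>0 (e || f)     = ≤-trans (need>0 e) (m≤m⊔n _ _)
need>0 (neg e)      = need>0 e
need>0 (Σ̂ e)        = s≤s z≤n
need>0 (∃̂ e)        = s≤s z≤n

register< : ∀ {d m K} → 0 < m → d + m ≤ K → d < K
register< {d} {m} p h = ≤-trans (≤-trans (≤-reflexive (+-comm 1 d)) (+-monoʳ-≤ d p)) h

digits-unique : ∀ m a x b y → x < m → y < m → a * m + x ≡ b * m + y → a ≡ b × x ≡ y
digits-unique m a x b y p q h = *-cancelʳ-≡ a b m {{nz}} (+-cancelʳ-≡ x (a * m) (b * m) (trans h (cong (b * m +_) (sym e)))) , e
  where
  nz : NonZero m
  nz = >-nonZero (≤-trans (s≤s z≤n) p)
  rem : ∀ c w → w < m → (_%_ (c * m + w) m {{nz}}) ≡ w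
  rem c w h = trans (cong (λ u → _%_ u m {{nz}}) (+-comm (c * m) w))
              (trans ([m+kn]%n≡m%n w c m {{nz}}) (m<n⇒m%n≡m {{nz}} h))
  e : x ≡ y
  e = trans (sym (rem a x p)) (trans (cong (λ u → _%_ u m {{nz}}) h) (rem b y q))

combine< : ∀ m {i j} → i < m → j < m → i * m + j < m * m
combine< m {i} {j} p q = ≤-trans (≤-trans (≤-reflexive (sym (+-suc (i * m) j))) (+-monoʳ-≤ (i * m) q))
  (≤-trans (≤-reflexive (+-comm (i * m) m)) (*-monoˡ-≤ m p))

<ᵇ-true : ∀ {a b} → a < b → (a <ᵇ b) ≡ true
<ᵇ-true {a} {b} h with a <ᵇ b in q
... | true  = refl
... | false = contradiction (subst T q (<⇒<ᵇ h)) id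

<ᵇ-false : ∀ {a b} → b ≤ a → (a <ᵇ b) ≡ false
<ᵇ-false {a} {b} h with a <ᵇ b in q
... | false = refl
... | true  = contradiction (≤-trans (<ᵇ⇒< a b (subst T (sym q) tt)) h) (n≮n a)

-- Correctness of the compiler

module Correct (C : Context) (K B : ℕ) (3≤B : 3 ≤ B) (I≤B : Context.cI C ≤ B) (4≤K : 4 ≤ K) where
  open Context C renaming (cM to M)
  open Semantics C
  open Compile K

  P₀ Q : ℕ
  P₀ = B + (K + M)
  Q  = M * M

  addr : ℕ → ℕ → ℕ → ℕ
  addr s i j = ((P₀ + i * M) + s * Q) + j

  record Static (σ : Memory) : Set where
    field
      s0   : σ 0 ≡ cn
      s1   : σ 1 ≡ ck
      s2   : σ 2 ≡ B
      r0   : σ (B + 0) ≡ M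
      r1   : σ (B + 1) ≡ Q
      r2   : σ (B + 2) ≡ cI
      r3   : σ (B + 3) ≡ cE
      rows : ∀ {i} → i < M → σ (B + (K + i)) ≡ P₀ + i * M
      inps : ∀ {x} → x < cI → σ x ≡ input x
  open Static

  Arr : State → Memory → Set
  Arr st σ = ∀ t a {i j} → i < M → j < M → σ (addr (slot t a) i j) ≡ enc (st t a i j)

  -- Registers are used as a stack: evaluation at depth `d` may change only those from `d` up to
  -- `K`, so the operands below and the arrays above survive.
  Same : ℕ → Memory → Memory → Set
  Same d σ σ′ = ∀ x → x < B + d ⊎ B + K ≤ x → σ′ x ≡ σ x

  same-refl : ∀ {d σ} → Same d σ σ
  same-refl _ _ = refl

  same-trans : ∀ {d σ σ′ σ″} → Same d σ σ′ → Same d σ′ σ″ → Same d σ σ″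
  same-trans p q x h = trans (q x h) (p x h)

  same-weaken : ∀ {d d′ σ σ′} → d ≤ d′ → Same d′ σ σ′ → Same d σ σ′
  same-weaken d≤ p x (inj₁ h) = p x (inj₁ (≤-trans h (+-monoʳ-≤ B d≤)))
  same-weaken d≤ p x (inj₂ h) = p x (inj₂ h)

  static-resp : ∀ {σ σ′} → Same 4 σ σ′ → Static σ → Static σ′
  static-resp p s = record
    { s0 = trans (p _ (lo (≤-trans (s≤s z≤n) 3≤B))) (s0 s)
    ; s1 = trans (p _ (lo (≤-trans (s≤s (s≤s z≤n)) 3≤B))) (s1 s)
    ; s2 = trans (p _ (lo 3≤B)) (s2 s)
    ; r0 = trans (p _ (inj₁ (+-monoʳ-< B (s≤s z≤n)))) (r0 s)
    ; r1 = trans (p _ (inj₁ (+-monoʳ-< B (s≤s (s≤s z≤n))))) (r1 s)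
    ; r2 = trans (p _ (inj₁ (+-monoʳ-< B (s≤s (s≤s (s≤s z≤n)))))) (r2 s)
    ; r3 = trans (p _ (inj₁ (+-monoʳ-< B (s≤s (s≤s (s≤s (s≤s z≤n))))))) (r3 s)
    ; rows = λ {i} h → trans (p _ (inj₂ (+-monoʳ-≤ B (m≤m+n K i)))) (rows s h)
    ; inps = λ h → trans (p _ (lo (≤-trans h I≤B))) (inps s h) }
    where
    lo : ∀ {x} → x < B → x < B + 4 ⊎ B + K ≤ x
    lo h = inj₁ (≤-trans h (m≤m+n B 4))

  P₀≤addr : ∀ s i j → P₀ ≤ addr s i j
  P₀≤addr s i j = ≤-trans (m≤m+n P₀ (i * M)) (≤-trans (m≤m+n _ (s * Q)) (m≤m+n _ j))

  BK≤addr : ∀ s i j → B + K ≤ addr s i j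
  BK≤addr s i j = ≤-trans (+-monoʳ-≤ B (m≤m+n K M)) (P₀≤addr s i j)

  arr-resp : ∀ {d st σ σ′} → Same d σ σ′ → Arr st σ → Arr st σ′
  arr-resp p q t a {i} {j} i< j< = trans (p _ (inj₂ (BK≤addr (slot t a) i j))) (q t a i< j<)

  -- Up to the offset `P₀`, an address has the digits `s` and `i * M + j` in base `Q`, and the
  -- second one has the digits `i` and `j` in base `M`.
  addr-inj : ∀ s i j s′ i′ j′ → i < M → j < M → i′ < M → j′ < M →
             addr s i j ≡ addr s′ i′ j′ → s ≡ s′ × i ≡ i′ × j ≡ j′
  addr-inj s i j s′ i′ j′ p q p′ q′ h
    with digits-unique Q s (i * M + j) s′ (i′ * M + j′) (combine< M p q) (combine< M p′ q′)
         (+-cancelˡ-≡ P₀ _ _ (trans (sym (re P₀ (i * M) (s * Q) j)) (trans h (re P₀ (i′ * M) (s′ * Q) j′))))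
    where
    re : ∀ p a b c → ((p + a) + b) + c ≡ p + (b + (a + c))
    re = solve 4 (λ p a b c → ((p :+ a) :+ b) :+ c := p :+ (b :+ (a :+ c))) refl
      where open +-*-Solver
  ... | e , e′ with digits-unique M i j i′ j′ q q′ e′
  ...   | e₁ , e₂ = e , e₁ , e₂

  evalR : ∀ {σ} → Static σ → ∀ r → ⟦ reg r ⟧ σ ≡ σ (B + r)
  evalR {σ} s r = cong (λ b → σ (b + r)) (s2 s)

  setReg : ∀ {σ} r f → Static σ →
           Run (ra r ≔ f) σ 1 (λ σ′ → σ′ (B + r) ≡ ⟦ f ⟧ σ × (∀ x → x ≢ B + r → σ′ x ≡ σ x))
  setReg {σ} r f s = asgR (subst (λ a → (σ [ σ 2 + r ↦ ⟦ f ⟧ σ ]) a ≡ ⟦ f ⟧ σ) eq (↦-same σ (σ 2 + r) _) ,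
                           λ x ne → ↦-other σ (σ 2 + r) _ (λ q → ne (trans q eq)))
    where
    eq : σ 2 + r ≡ B + r
    eq = cong (_+ r) (s2 s)

  only→same : ∀ {d r σ σ′} → d ≤ r → r < K → (∀ x → x ≢ B + r → σ′ x ≡ σ x) → Same d σ σ′
  only→same d≤ r< p x (inj₁ h) = p x λ { refl → n≮n _ (≤-trans h (+-monoʳ-≤ B d≤)) }
  only→same d≤ r< p x (inj₂ h) = p x λ { refl → n≮n _ (≤-trans (+-monoʳ-< B r<) h) }

  record Env {g} (d : ℕ) (ρ vals : Vec ℕ g) (st : State) (σ : Memory) : Set where
    field
      static : Static σ
      arr    : Arr st σ
      regs   : ∀ i → lookup ρ i < d × σ (B + lookup ρ i) ≡ lookup vals i × lookup vals i < M
  open Env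

  env-mono : ∀ {g d d′ σ σ′ st} {ρ vals : Vec ℕ g} → 4 ≤ d → d ≤ d′ → Same d σ σ′ →
             Env d ρ vals st σ → Env d′ ρ vals st σ′
  env-mono {d = d} 4≤ d≤ p E = record
    { static = static-resp (same-weaken 4≤ p) (static E)
    ; arr = arr-resp p (arr E)
    ; regs = λ i → let (l , q , b) = regs E i in
        ≤-trans l d≤ , trans (p _ (inj₁ (+-monoʳ-< B l))) q , b }

  env-push : ∀ {g d σ st r x} {ρ vals : Vec ℕ g} → r < d → σ (B + r) ≡ x → x < M →
             Env d ρ vals st σ → Env d (r ∷ ρ) (x ∷ vals) st σ
  env-push l q b E = record { static = static E ; arr = arr E
    ; regs = λ { zero → l , q , b ; (suc i) → regs E i } }

  eval-ix : ∀ {g d σ st} {ρ vals : Vec ℕ g} → 0 < M → Env d ρ vals st σ → ∀ i →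
            ⟦ ixE ρ i ⟧ σ ≡ ixv vals i × ixv vals i < M
  eval-ix M>0 E z     = refl , M>0
  eval-ix M>0 E (v i) = let (_ , q , b) = regs E i in trans (evalR (static E) _) q , b

  -- Assumes three memory facts in place of `Static`, because arrays are still read while the output
  -- overwrites the input cells that `Static` mentions.
  eval-cell₀ : ∀ {σ s ie je i j} → σ 2 ≡ B → σ (B + 1) ≡ Q → σ (B + (K + i)) ≡ P₀ + i * M →
               ⟦ ie ⟧ σ ≡ i → ⟦ je ⟧ σ ≡ j → ⟦ cellE s ie je ⟧ σ ≡ addr s i j
  eval-cell₀ {σ} {s} {ie} {je} {i} {j} s2 r1 row p q = cong₂ _+_ (cong₂ _+_
    (trans (cong₂ (λ b c → σ (b + (K + c))) s2 p) row)
    (trans (⟦times⟧ s (reg 1) σ) (cong (s *_) (trans (cong (λ b → σ (b + 1)) s2) r1)))) q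

  eval-cell : ∀ {σ s ie je i j} → Static σ → i < M → ⟦ ie ⟧ σ ≡ i → ⟦ je ⟧ σ ≡ j →
              ⟦ cellE s ie je ⟧ σ ≡ addr s i j
  eval-cell {s = s} {ie} {je} S i< p q = eval-cell₀ {s = s} {ie} {je} (s2 S) (r1 S) (rows S i<) p q

  enc-if : ∀ {b : Bool} → enc {bool} b ≢ 0 → b ≡ true
  enc-if {true}  _ = refl
  enc-if {false} h = contradiction refl h

  enc-else : ∀ {b : Bool} → enc {bool} b ≡ 0 → b ≡ false
  enc-else {false} _ = refl

  Post : ℕ → ℕ → Memory → Memory → Set
  Post d x σ σ′ = σ′ (B + d) ≡ x × Same d σ σ′

  set : ∀ {d σ x} f → Static σ → d < K → ⟦ f ⟧ σ ≡ x → Run (ra d ≔ f) σ 1 (Post d x σ)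
  set {d = d} f S d< q = mono ≤-refl (λ (p , o) → trans p q , only→same ≤-refl d< o) (setReg d f S)

  -- The loop shared by Σ̂ and ∃̂: accumulator in register d, counter in 1 + d.
  accumulate : ∀ {d σ P Q a b} (F : ℕ → ℕ) → F 0 ≡ 0 → 4 ≤ d → suc d < K → Static σ →
    (∀ {i σ₁} → i < M → Same d σ σ₁ → Static σ₁ → σ₁ (B + d) ≡ F i → σ₁ (B + suc d) ≡ i →
      Run P σ₁ a (λ σ₂ → Run Q σ₂ b (λ σ₃ → σ₃ (B + d) ≡ F (suc i) × σ₃ (B + suc d) ≡ i × Same d σ₁ σ₃))) →
    Run (ra d ≔ lit 0 ⨾ ra (1 + d) ≔ lit 0 ⨾ (WHILE reg 0 ⊖ reg (1 + d) DO (P ⨾ Q ⨾ ra (1 + d) ≔ reg (1 + d) ⊕ lit 1)))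
        σ (1 + (1 + suc (M * suc (a + (b + 1))))) (Post d (F M) σ)
  accumulate {d} {σ} {P} {Q} F F0 4≤ d< S body =
    seqR (set (lit 0) S (<-trans (n<1+n d) d<) refl) λ (p₁ , o₁) →
    let S₁ = static-resp (same-weaken 4≤ o₁) S in
    seqR (set (lit 0) S₁ d< refl) λ (p₂ , o₂) →
    mono ≤-refl (λ (_ , p , _ , o) → p , o)
      (whileR Inv cond step
        (static-resp (same-weaken (≤-trans 4≤ (n≤1+n d)) o₂) S₁ ,
         trans (o₂ _ (inj₁ (+-monoʳ-< B ≤-refl))) (trans p₁ (sym F0)) , p₂ ,
         same-trans o₁ (same-weaken (n≤1+n d) o₂)))
    where
    Inv : ℕ → Memory → Set
    Inv i σ′ = Static σ′ × σ′ (B + d) ≡ F i × σ′ (B + suc d) ≡ i × Same d σ σ′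
    cond : ∀ {i σ′} → Inv i σ′ → ⟦ reg 0 ⊖ reg (1 + d) ⟧ σ′ ≡ M ∸ i
    cond (S′ , _ , q , _) = cong₂ _∸_ (trans (evalR S′ 0) (r0 S′)) (trans (evalR S′ (1 + d)) q)
    step : ∀ {i σ′} → i < M → Inv i σ′ → Run (P ⨾ Q ⨾ ra (1 + d) ≔ reg (1 + d) ⊕ lit 1) σ′ _ (Inv (suc i))
    step {i} i< (S′ , p , q , o) =
      seqR (body i< o S′ p q) λ h → seqR h λ (p₃ , q₃ , o₃) →
      let S₃ = static-resp (same-weaken 4≤ o₃) S′ in
      mono ≤-refl (λ (q₄ , o₄) →
          static-resp (same-weaken (≤-trans 4≤ (n≤1+n d)) o₄) S₃ ,
          trans (o₄ _ (inj₁ (+-monoʳ-< B ≤-refl))) p₃ , q₄ ,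
          same-trans o (same-trans o₃ (same-weaken (n≤1+n d) o₄)))
        (set (reg (1 + d) ⊕ lit 1) S₃ d< (trans (cong (_+ 1) (trans (evalR S₃ (1 + d)) q₃)) (+-comm i 1)))

  compE-ok : ∀ {t g} (e : Ex t g) {d ρ vals st σ} → 0 < M → 4 ≤ d → d + need e ≤ K →
             Env d ρ vals st σ → Run (compE d ρ e) σ (cost e M) (Post d (enc (eval st vals e)) σ)

  -- Two operands, in registers d and 1 + d.
  compE₂ : ∀ {t t′ g} (e : Ex t g) (f : Ex t′ g) {d ρ vals st σ P b x} → 0 < M → 4 ≤ d →
           d + (need e ⊔ suc (need f)) ≤ K → Env d ρ vals st σ →
           (∀ {σ′} → Static σ′ → ⟦ reg d ⟧ σ′ ≡ enc (eval st vals e) → ⟦ reg (suc d) ⟧ σ′ ≡ enc (eval st vals f) →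
             Run P σ′ b (Post d x σ′)) →
           Run (compE d ρ e ⨾ compE (suc d) ρ f ⨾ P) σ (cost e M + (cost f M + b)) (Post d x σ)
  compE₂ e f {d} M>0 4≤ h E k =
    seqR (compE-ok e M>0 4≤ (⊔ˡ d h) E) λ (p , o) →
    let E₁ = env-mono 4≤ (n≤1+n d) o E in
    seqR (compE-ok f M>0 (≤-trans 4≤ (n≤1+n d)) (⊔ʳ⁺ d {need e} h) E₁) λ (p′ , o′) →
    let S₂ = static-resp (same-weaken (≤-trans 4≤ (n≤1+n d)) o′) (static E₁) in
    mono ≤-refl (λ (p″ , o″) → p″ , same-trans o (same-trans (same-weaken (n≤1+n d) o′) o″))
      (k S₂ (trans (evalR S₂ d) (trans (o′ _ (inj₁ (+-monoʳ-< B ≤-refl))) p)) (trans (evalR S₂ (suc d)) p′))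

  cond-set : ∀ {d σ c b} x y → Static σ → d < K → (⟦ c ⟧ σ ≢ 0 → x ≡ enc b) → (⟦ c ⟧ σ ≡ 0 → y ≡ enc b) →
             Run (IF c THEN ra d ≔ lit x ELSE (ra d ≔ lit y)) σ 3 (Post d (enc {bool} b) σ)
  cond-set x y S d< f g = ifR (λ q → set (lit x) S d< (f q)) (λ q → set (lit y) S d< (g q))

  compE-ok (lit′ m) M>0 4≤ h E = set _ (static E) (register< (s≤s z≤n) h) refl
  compE-ok #n M>0 4≤ h E = set _ (static E) (register< (s≤s z≤n) h) (s0 (static E))
  compE-ok #k M>0 4≤ h E = set _ (static E) (register< (s≤s z≤n) h) (s1 (static E))
  compE-ok #M M>0 4≤ h E = set _ (static E) (register< (s≤s z≤n) h) (trans (evalR (static E) 0) (r0 (static E)))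
  compE-ok (inp e) {d} {ρ} {vals} {st} M>0 4≤ h E =
    seqR (compE-ok e M>0 4≤ h E) λ {σ₁} (p , o) →
    let S₁ = static-resp (same-weaken 4≤ o) (static E)
        q₂ = trans (evalR S₁ 2) (r2 S₁)
        qd = trans (evalR S₁ d) p
        w  = eval st vals e in
    mono ≤-refl (λ (p′ , o′) → p′ , same-trans o o′)
    (ifR {σ = σ₁}
      (λ ne → let lt = ≰⇒> (λ le → ne (trans (cong₂ _∸_ q₂ qd) (m≤n⇒m∸n≡0 le))) in
        set _ S₁ (register< (need>0 e) h) (trans (cong σ₁ qd) (trans (inps S₁ lt)
          (sym (cong (λ b → if b then input w else 0) (<ᵇ-true lt))))))
      (λ eq → set _ S₁ (register< (need>0 e) h)
          (sym (cong (λ b → if b then input w else 0)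
            (<ᵇ-false {w} {cI} (m∸n≡0⇒m≤n (trans (sym (cong₂ _∸_ q₂ qd)) eq)))))))
  compE-ok (ix i) M>0 4≤ h E = set _ (static E) (register< (s≤s z≤n) h)
    (trans (evalR (static E) _) (proj₁ (proj₂ (regs E i))))
  compE-ok (rd t a i j) {σ = σ} M>0 4≤ h E =
    let (p , i<) = eval-ix M>0 E i
        (q , j<) = eval-ix M>0 E j in
    set _ (static E) (register< (s≤s z≤n) h)
      (trans (cong σ (eval-cell {s = slot t a} {ie = ixE _ i} {je = ixE _ j} (static E) i< p q)) (arr E t a i< j<))
  compE-ok (e ⊞ f) M>0 4≤ h E =
    compE₂ e f M>0 4≤ h E λ S p q → set _ S (register< (≤-trans (need>0 e) (m≤m⊔n _ _)) h) (cong₂ _+_ p q)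
  compE-ok (e ⊟ f) M>0 4≤ h E =
    compE₂ e f M>0 4≤ h E λ S p q → set _ S (register< (≤-trans (need>0 e) (m≤m⊔n _ _)) h) (cong₂ _∸_ p q)
  compE-ok (ite b e f) {d} {vals = vals} {st} M>0 4≤ h E =
    seqR (compE-ok b M>0 4≤ (⊔ˡ d h) E) λ (p , o) →
    let E₁ = env-mono 4≤ ≤-refl o E
        q  = trans (evalR (static E₁) d) p in
    mono ≤-refl (λ (p′ , o′) → p′ , same-trans o o′)
    (ifR (λ ne → mono ≤-refl (λ (p′ , o′) → trans p′ (cong (λ c → enc (if c then eval st vals e else eval st vals f))
                    (sym (enc-if (λ u → ne (trans q u))))) , o′)
             (compE-ok e M>0 4≤ (⊔ˡ d {need e} (⊔ʳ d {need b} h)) E₁))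
         (λ eq → mono ≤-refl (λ (p′ , o′) → trans p′ (cong (λ c → enc (if c then eval st vals e else eval st vals f))
                    (sym (enc-else (trans (sym q) eq)))) , o′)
             (compE-ok f M>0 4≤ (⊔ʳ d {need e} (⊔ʳ d {need b} h)) E₁)))
  compE-ok (e ⊲ f) {vals = vals} {st} M>0 4≤ h E =
    compE₂ e f M>0 4≤ h E λ S p q → cond-set 1 0 S (register< (≤-trans (need>0 e) (m≤m⊔n _ _)) h)
      (λ ne → cong (enc {bool}) (sym (<ᵇ-true {eval st vals e} {eval st vals f} (≰⇒> (λ le → ne (trans (cong₂ _∸_ q p) (m≤n⇒m∸n≡0 le)))))))
      (λ eq → cong (enc {bool}) (sym (<ᵇ-false {eval st vals e} {eval st vals f} (m∸n≡0⇒m≤n (trans (sym (cong₂ _∸_ q p)) eq)))))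
  compE-ok (e ≐ f) {vals = vals} {st} M>0 4≤ h E =
    compE₂ e f M>0 4≤ h E λ S p q → cond-set 0 1 S (register< (≤-trans (need>0 e) (m≤m⊔n _ _)) h)
      (λ ne → cong (enc {bool}) (sym (≡ᵇ-≢ {eval st vals e} {eval st vals f} (λ u → ne (trans (cong₂ _+_ (cong₂ _∸_ q p) (cong₂ _∸_ p q))
         (cong₂ _+_ (m≤n⇒m∸n≡0 (≤-reflexive (sym u))) (m≤n⇒m∸n≡0 (≤-reflexive u))))))))
      (λ eq → let w = trans (sym (cong₂ _+_ (cong₂ _∸_ q p) (cong₂ _∸_ p q))) eq
                  a = eval st vals e
                  b = eval st vals f in
        cong (enc {bool}) (trans (sym (≡ᵇ-refl a)) (cong (a ≡ᵇ_) (≤-antisym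
          (m∸n≡0⇒m≤n (m+n≡0⇒n≡0 (b ∸ a) w)) (m∸n≡0⇒m≤n (m+n≡0⇒m≡0 (b ∸ a) w))))))
  compE-ok (e && f) {d} {vals = vals} {st} M>0 4≤ h E =
    seqR (compE-ok e M>0 4≤ (⊔ˡ d h) E) λ (p , o) →
    let E₁ = env-mono 4≤ ≤-refl o E
        q  = trans (evalR (static E₁) d) p in
    mono ≤-refl (λ (p′ , o′) → p′ , same-trans o o′)
    (ifR (λ ne → mono ≤-refl (λ (p′ , o′) → trans p′ (cong (λ c → enc (c ∧ eval st vals f))
                    (sym (enc-if (λ u → ne (trans q u))))) , o′)
             (compE-ok f M>0 4≤ (⊔ʳ d {need e} h) E₁))
         (λ eq → mkRun skip ≤-refl (trans p (trans (trans (sym q) eq)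
             (cong (λ c → enc (c ∧ eval st vals f)) (sym (enc-else (trans (sym q) eq))))) , same-refl)))
  compE-ok (e || f) {d} {vals = vals} {st} M>0 4≤ h E =
    seqR (compE-ok e M>0 4≤ (⊔ˡ d h) E) λ (p , o) →
    let E₁ = env-mono 4≤ ≤-refl o E
        q  = trans (evalR (static E₁) d) p in
    mono ≤-refl (λ (p′ , o′) → p′ , same-trans o o′)
    (ifR (λ ne → let u = enc-if (λ u → ne (trans q u)) in
             mkRun skip ≤-refl (trans p (trans (cong enc u) (cong (λ c → enc (c ∨ eval st vals f)) (sym u))) , same-refl))
         (λ eq → mono ≤-refl (λ (p′ , o′) → trans p′ (cong (λ c → enc (c ∨ eval st vals f))
                    (sym (enc-else (trans (sym q) eq)))) , o′)
             (compE-ok f M>0 4≤ (⊔ʳ d {need e} h) E₁)))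
  compE-ok (neg e) {d} {vals = vals} {st} M>0 4≤ h E =
    seqR (compE-ok e M>0 4≤ h E) λ (p , o) →
    let S₁ = static-resp (same-weaken 4≤ o) (static E) in
    mono ≤-refl (λ (p′ , o′) → p′ , same-trans o o′)
      (set _ S₁ (register< (need>0 e) h) (trans (cong (1 ∸_) (trans (evalR S₁ d) p)) (lemma (eval st vals e))))
    where
    lemma : ∀ b → 1 ∸ enc {bool} b ≡ enc (not b)
    lemma true  = refl
    lemma false = refl
  compE-ok (Σ̂ e) {d} {ρ} {vals} {st} {σ} M>0 4≤ h E =
    accumulate (λ i → sum i (λ x → eval st (x ∷ vals) e)) refl 4≤ (≤-trans (n≤1+n _) h‴) (static E) λ {i} {σ₁} i< s S p q →
      let E₁ = env-push ≤-refl q i< (env-mono 4≤ (m≤n+m d 2) s E) in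
      mono ≤-refl (λ {σ₂} (p₂ , o₂) →
        let S₂ = static-resp (same-weaken (≤-trans 4≤ (m≤n+m d 2)) o₂) S in
        mono ≤-refl (λ (p₃ , o₃) → p₃ , trans (o₃ _ (λ u → m+1+n≢m d (trans (+-comm d 1) (+-cancelˡ-≡ B _ _ u))))
                                          (trans (o₂ _ (inj₁ (+-monoʳ-< B ≤-refl))) q) ,
                     same-trans (same-weaken (m≤n+m d 2) o₂) (only→same ≤-refl (≤-trans (m≤n+m _ 2) h‴) o₃))
          (mono ≤-refl (λ (u , o) → trans u (cong₂ _+_ (trans (evalR S₂ d) (trans (o₂ _ (inj₁ (+-monoʳ-< B (m≤n+m _ 1)))) p))
                                     (trans (evalR S₂ (2 + d)) p₂)) , o) (setReg d (reg d ⊕ reg (2 + d)) S₂)))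
        (compE-ok e M>0 (≤-trans 4≤ (m≤n+m d 2)) h″ E₁)
    where
    h″ : 2 + d + need e ≤ K
    h″ = ≤-trans (≤-reflexive (trans (cong (_+ need e) (+-comm 2 d)) (+-assoc d 2 (need e)))) h
    h‴ : 2 + d < K
    h‴ = register< (need>0 e) h″
  compE-ok (∃̂ e) {d} {ρ} {vals} {st} {σ} M>0 4≤ h E =
    accumulate (λ i → enc {bool} (any i (λ x → eval st (x ∷ vals) e))) refl 4≤ (≤-trans (n≤1+n _) h‴) (static E) λ {i} {σ₁} i< s S p q →
      let E₁ = env-push ≤-refl q i< (env-mono 4≤ (m≤n+m d 2) s E) in
      mono ≤-refl (λ {σ₂} (p₂ , o₂) →
        let S₂ = static-resp (same-weaken (≤-trans 4≤ (m≤n+m d 2)) o₂) S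
            o₂′ = same-weaken (m≤n+m d 2) o₂
            q₂ = trans (o₂ _ (inj₁ (+-monoʳ-< B ≤-refl))) q
            x₂ = trans (evalR S₂ (2 + d)) p₂ in
        ifR (λ ne → mono ≤-refl (λ (p₃ , o₃) →
                       trans p₃ (or-true (enc-if (λ u → ne (trans x₂ u)))) ,
                       trans (o₃ _ (λ u → m+1+n≢m d (trans (+-comm d 1) (+-cancelˡ-≡ B _ _ u)))) q₂ ,
                       same-trans o₂′ (only→same ≤-refl (≤-trans (m≤n+m _ 2) h‴) o₃))
                     (setReg d (lit 1) S₂))
            (λ eq → mkRun skip ≤-refl
                      (trans (trans (o₂ _ (inj₁ (+-monoʳ-< B (m≤n+m _ 1)))) p) (or-false (enc-else (trans (sym x₂) eq))) , q₂ , o₂′)))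
        (compE-ok e M>0 (≤-trans 4≤ (m≤n+m d 2)) h″ E₁)
    where
    h″ : 2 + d + need e ≤ K
    h″ = ≤-trans (≤-reflexive (trans (cong (_+ need e) (+-comm 2 d)) (+-assoc d 2 (need e)))) h
    h‴ : 2 + d < K
    h‴ = register< (need>0 e) h″
    or-true : ∀ {a b} → b ≡ true → 1 ≡ enc {bool} (a ∨ b)
    or-true {false} refl = refl
    or-true {true}  refl = refl
    or-false : ∀ {a b} → b ≡ false → enc {bool} a ≡ enc {bool} (a ∨ b)
    or-false {false} refl = refl
    or-false {true}  refl = refl

  loopE-ok : ∀ r N {d P b σ} (Inv : ℕ → Memory → Set) → 4 ≤ d → d < K →
    (∀ {σ} → Static σ → σ (B + r) ≡ N) → (∀ {i σ} → Inv i σ → Static σ) →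
    (∀ {i σ σ′} → Same d σ σ′ → Inv i σ → Inv i σ′) →
    (∀ {i σ} → i < N → Inv i σ → σ (B + d) ≡ i → Run P σ b (λ σ′ → Inv (suc i) σ′ × σ′ (B + d) ≡ i)) →
    Inv 0 σ → Run (loopE r d P) σ (loopCost N b) (Inv N)
  loopE-ok r N {d} {P} Inv 4≤ d< rN st resp body inv =
    seqR (set (lit 0) (st inv) d< refl) λ (p , o) →
    mono ≤-refl proj₁ (whileR (λ i σ → Inv i σ × σ (B + d) ≡ i)
      (λ (inv , q) → cong₂ _∸_ (trans (evalR (st inv) r) (rN (st inv))) (trans (evalR (st inv) d) q))
      (λ {i} i< (inv , q) → seqR (body i< inv q) λ (inv′ , q′) →
        mono ≤-refl (λ (q″ , o) → resp o inv′ , q″)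
          (set (reg d ⊕ lit 1) (st inv′) d< (trans (cong (_+ 1) (trans (evalR (st inv′) d) q′)) (+-comm i 1))))
      (resp o inv , p))

  -- Serves both passes of an assignment. `Common` is invariant, `Cell i j` holds once the entry has
  -- been visited, and each round has to keep it for the entries visited before.
  cells-ok : ∀ {d P b σ} (Common : Memory → Set) (Cell : ℕ → ℕ → Memory → Set) → 4 ≤ d → suc d < K →
    (∀ {σ} → Common σ → Static σ) →
    (∀ {σ σ′} → Same d σ σ′ → Common σ → Common σ′) →
    (∀ {i j σ σ′} → i < M → j < M → Same d σ σ′ → Cell i j σ → Cell i j σ′) →
    (∀ {i j σ} → i < M → j < M → Common σ → σ (B + d) ≡ i → σ (B + suc d) ≡ j →
      Run P σ b (λ σ′ → Common σ′ × Cell i j σ′ × (∀ {i′ j′} → i′ < M → j′ < M → Cell i′ j′ σ → Cell i′ j′ σ′) ×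
                        σ′ (B + d) ≡ i × σ′ (B + suc d) ≡ j)) →
    Common σ → Run (loopE 0 d (loopE 0 (1 + d) P)) σ (loopCost M (loopCost M b))
                   (λ σ′ → Common σ′ × (∀ {i j} → i < M → j < M → Cell i j σ′))
  cells-ok {d} {P} {b} Common Cell 4≤ d< st rC rL body c =
    loopE-ok 0 M Outer 4≤ (<-trans (n<1+n d) d<) r0 (st ∘ proj₁)
      (λ o (c , l) → rC o c , λ i< j< lt → rL i< j< o (l i< j< lt))
      (λ {i} i< (c , l) q →
        mono ≤-refl (λ (c , l , l′ , q) → (c , λ {i′} {j} i′< j< lt → [ (λ lt → l i′< j< lt) , (λ { refl → l′ j< j< }) ]′ (m≤n⇒m<n∨m≡n (≤-pred lt))) , q)
          (loopE-ok 0 M (Inner i) (≤-trans 4≤ (n≤1+n d)) d< r0 (st ∘ proj₁)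
            (λ o (c , l , l′ , q) → let o′ = same-weaken (n≤1+n d) o in
              rC o′ c , (λ i< j< lt → rL i< j< o′ (l i< j< lt)) , (λ j< lt → rL i< j< o′ (l′ j< lt)) ,
              trans (o _ (inj₁ (+-monoʳ-< B ≤-refl))) q)
            (λ {j} j< (c , l , l′ , q) qj → mono ≤-refl
              (λ (c , here , keep , q , qj) → (c , (λ i< j< lt → keep i< j< (l i< j< lt)) ,
                (λ {j′} j′< lt → [ (λ lt → keep i< j′< (l′ j′< lt)) , (λ { refl → here }) ]′ (m≤n⇒m<n∨m≡n (≤-pred lt))) , q) , qj)
              (body i< j< c q qj))
            (c , l , (λ _ ()) , q)))
      (c , λ _ _ ()) ∣> λ (c , l) → c , λ i< j< → l i< j< i<
    where
    Outer : ℕ → Memory → Set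
    Outer i σ = Common σ × (∀ {i′ j} → i′ < M → j < M → i′ < i → Cell i′ j σ)
    Inner : ℕ → ℕ → Memory → Set
    Inner i j σ = Common σ × (∀ {i′ j} → i′ < M → j < M → i′ < i → Cell i′ j σ) ×
                  (∀ {j′} → j′ < M → j′ < j → Cell i j′ σ) × σ (B + d) ≡ i
    _∣>_ : ∀ {P σ b} {Post Post′ : Memory → Set} → Run P σ b Post → (∀ {σ′} → Post σ′ → Post′ σ′) → Run P σ b Post′
    r ∣> f = mono ≤-refl f r

  static-high : ∀ {σ σ′} → (∀ x → x < P₀ → σ′ x ≡ σ x) → Static σ → Static σ′
  static-high p s = record
    { s0 = trans (p _ (lo (≤-trans (s≤s z≤n) 3≤B))) (s0 s)
    ; s1 = trans (p _ (lo (≤-trans (s≤s (s≤s z≤n)) 3≤B))) (s1 s)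
    ; s2 = trans (p _ (lo 3≤B)) (s2 s)
    ; r0 = trans (p _ (inFile (s≤s z≤n))) (r0 s)
    ; r1 = trans (p _ (inFile (s≤s (s≤s z≤n)))) (r1 s)
    ; r2 = trans (p _ (inFile (s≤s (s≤s (s≤s z≤n))))) (r2 s)
    ; r3 = trans (p _ (inFile (s≤s (s≤s (s≤s (s≤s z≤n)))))) (r3 s)
    ; rows = λ h → trans (p _ (+-monoʳ-< B (+-monoʳ-< K h))) (rows s h)
    ; inps = λ h → trans (p _ (lo (≤-trans h I≤B))) (inps s h) }
    where
    lo : ∀ {x} → x < B → x < P₀
    lo h = ≤-trans h (m≤m+n B _)
    inFile : ∀ {r} → r < 4 → B + r < P₀
    inFile h = +-monoʳ-< B (≤-trans h (≤-trans 4≤K (m≤m+n K M)))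

  writeCell : ∀ {σ s ie je i j f} → Static σ → i < M → ⟦ ie ⟧ σ ≡ i → ⟦ je ⟧ σ ≡ j →
    Run (cellE s ie je ≔ f) σ 1 (λ σ′ → σ′ (addr s i j) ≡ ⟦ f ⟧ σ × (∀ x → x ≢ addr s i j → σ′ x ≡ σ x))
  writeCell {σ} {s} {ie} {je} {i} {j} {f} S i< p q = asgR
    (subst (λ a → (σ [ a ↦ ⟦ f ⟧ σ ]) (addr s i j) ≡ ⟦ f ⟧ σ) (sym eq) (↦-same σ (addr s i j) _) ,
     λ x ne → ↦-other σ _ _ (λ u → ne (trans u eq)))
    where
    eq : ⟦ cellE s ie je ⟧ σ ≡ addr s i j
    eq = eval-cell {s = s} {ie = ie} {je = je} S i< p q

  high : ∀ {s i j x} → x < P₀ → x ≢ addr s i j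
  high {s} {i} {j} h refl = n≮n _ (≤-trans h (P₀≤addr s i j))

  reg<P₀ : ∀ {r} → r < K → B + r < P₀
  reg<P₀ h = +-monoʳ-< B (≤-trans h (m≤m+n K M))

  upd-same : ∀ st t a f i j → upd st t a f t a i j ≡ f i j
  upd-same st nat  a f i j = cong (λ b → (if b then f else st nat a) i j) (≡ᵇ-refl a)
  upd-same st bool a f i j = cong (λ b → (if b then f else st bool a) i j) (≡ᵇ-refl a)

  upd-other : ∀ st t a f t′ b → slot t′ b ≢ slot t a → ∀ i j → upd st t a f t′ b i j ≡ st t′ b i j
  upd-other st nat  a f bool b ne i j = refl
  upd-other st bool a f nat  b ne i j = refl
  upd-other st nat  a f nat  b ne i j = cong (λ c → (if c then f else st nat b) i j) (≡ᵇ-≢ {b} {a} λ { refl → ne refl })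
  upd-other st bool a f bool b ne i j = cong (λ c → (if c then f else st bool b) i j) (≡ᵇ-≢ {b} {a} λ { refl → ne refl })

  iter-ok : ∀ r N s {d st σ} → (∀ {σ} → Static σ → σ (B + r) ≡ N) → 0 < M → 4 ≤ d → d + suc (needS s) ≤ K →
            Static σ → Arr st σ →
            Run (loopE r d (comp (1 + d) s)) σ (loopCost N (costS s M cE)) (λ σ′ → Static σ′ × Arr (iter N (run s) st) σ′ ×
              (∀ x → x < B + d → B ≤ x → σ′ x ≡ σ x))

  comp-ok : ∀ s {d st σ} → 0 < M → 4 ≤ d → d + needS s ≤ K → Static σ → Arr st σ →
            Run (comp d s) σ (costS s M cE) (λ σ′ → Static σ′ × Arr (run s st) σ′ ×
              (∀ x → x < B + d → B ≤ x → σ′ x ≡ σ x))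
  comp-ok (s ⍮ s′) {d} M>0 4≤ h S A =
    seqR (comp-ok s M>0 4≤ (⊔ˡ d h) S A) λ (S₁ , A₁ , o₁) →
    mono ≤-refl (λ (S₂ , A₂ , o₂) → S₂ , A₂ , λ x l g → trans (o₂ x l g) (o₁ x l g))
      (comp-ok s′ M>0 4≤ (⊔ʳ d {needS s} h) S₁ A₁)
  comp-ok (loop s) M>0 4≤ h S A = iter-ok 0 M s r0 M>0 4≤ h S A
  comp-ok (rep s)  M>0 4≤ h S A = iter-ok 3 cE s r3 M>0 4≤ h S A
  comp-ok (assign t a e) {d} {st} {σ} M>0 4≤ h S A =
    seqR (cells-ok Common₁ Cell₁ 4≤ d< (proj₁ ∘ proj₁) stable₁
           (λ {i} {j} i< j< o p → trans (o _ (inj₂ (BK≤addr 0 i j))) p)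
           (λ {i} {j} i< j< ((S , A) , p) qi qj →
             let E = env-push {r = suc d} ≤-refl qj j< (env-push {r = d} {vals = []} (m≤n+m _ 1) qi i<
                       (record { static = S ; arr = A ; regs = λ () })) in
             seqR (compE-ok e M>0 (≤-trans 4≤ (m≤n+m d 2)) h″ E) λ {σ₁} (p₁ , o₁) →
             let S₁ = static-resp (same-weaken (≤-trans 4≤ (m≤n+m d 2)) o₁) S
                 qi₁ = trans (o₁ _ (inj₁ (+-monoʳ-< B (m≤n+m _ 1)))) qi
                 qj₁ = trans (o₁ _ (inj₁ (+-monoʳ-< B ≤-refl))) qj in
             mono ≤-refl (λ {σ₂} (w , o) →
               ((static-high (λ x l → o x (high {0} {i} {j} l)) S₁ ,
                 λ t a {i′} {j′} i′< j′< → trans (o _ (λ u → slot≢0 t a (proj₁ (addr-inj (slot t a) i′ j′ 0 i j i′< j′< i< j< u))))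
                                             (arr-resp o₁ A t a i′< j′<)) ,
                λ x l g → trans (o x (high {0} {i} {j} (≤-trans l (<⇒≤ (reg<P₀ (<-trans (n<1+n d) d<))))))
                            (trans (o₁ x (inj₁ (≤-trans l (+-monoʳ-≤ B (m≤n+m d 2))))) (p x l g))) ,
               trans w (trans (evalR S₁ (2 + d)) p₁) ,
               (λ {i′} {j′} i′< j′< c → keep {σ₁} {σ₂} {0} o i′< j′< i< j< (trans w (trans (evalR S₁ (2 + d)) p₁)) (trans (o₁ _ (inj₂ (BK≤addr 0 i′ j′))) c)) ,
               trans (o _ (high {0} {i} {j} (reg<P₀ (<-trans (n<1+n d) d<)))) qi₁ ,
               trans (o _ (high {0} {i} {j} (reg<P₀ d<))) qj₁)
               (writeCell {s = 0} {ie = reg d} {je = reg (suc d)} {f = reg (2 + d)} S₁ i< (trans (evalR S₁ d) qi₁) (trans (evalR S₁ (suc d)) qj₁)))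
           ((S , A) , λ _ _ _ → refl))
      λ (((S₁ , A₁) , p₁) , c₁) →
    mono ≤-refl (λ {σ₂} ((S₂ , A₂ , _ , p₂) , c₂) → S₂ , (λ t′ b {i} {j} i< j< → case slot t′ b ≟ slot t a of λ
        { (yes q) → same t′ b q {σ′ = σ₂} i< j< c₂
        ; (no ne) → trans (A₂ t′ b ne i< j<) (cong enc (sym (upd-other st t a val t′ b ne i j))) }) , p₂)
      (cells-ok Common₂ Cell₂ 4≤ d< proj₁ stable₂
        (λ {i} {j} i< j< o p → trans (o _ (inj₂ (BK≤addr s i j))) p)
        (λ {i} {j} {σ₁} i< j< (S , A , c , p) qi qj →
          mono ≤-refl (λ {σ₂} (w , o) →
            let w′ = trans w (trans (cong σ₁ (eval-cell {s = 0} {ie = reg d} {je = reg (suc d)} S i< (trans (evalR S d) qi) (trans (evalR S (suc d)) qj))) (c i< j<)) in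
            (static-high (λ x l → o x (high {s} {i} {j} l)) S ,
             (λ t′ b ne {i′} {j′} i′< j′< → trans (o _ (λ u → ne (proj₁ (addr-inj (slot t′ b) i′ j′ s i j i′< j′< i< j< u)))) (A t′ b ne i′< j′<)) ,
             (λ {i′} {j′} i′< j′< → trans (o _ (λ u → slot≢0 t a (sym (proj₁ (addr-inj 0 i′ j′ s i j i′< j′< i< j< u))))) (c i′< j′<)) ,
             λ x l g → trans (o x (high {s} {i} {j} (≤-trans l (<⇒≤ (reg<P₀ (<-trans (n<1+n d) d<)))))) (p x l g)) ,
            w′ , (λ {i′} {j′} i′< j′< c′ → keep {σ₁} {σ₂} {s} o i′< j′< i< j< w′ c′) ,
            trans (o _ (high {s} {i} {j} (reg<P₀ (<-trans (n<1+n d) d<)))) qi ,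
            trans (o _ (high {s} {i} {j} (reg<P₀ d<))) qj)
          (writeCell {s = s} {ie = reg d} {je = reg (suc d)} S i< (trans (evalR S d) qi) (trans (evalR S (suc d)) qj)))
        (S₁ , (λ t′ b _ → A₁ t′ b) , c₁ , p₁))
    where
    s = slot t a
    val : ℕ → ℕ → Val t
    val i j = eval st (j ∷ i ∷ []) e
    h″ : 2 + d + need e ≤ K
    h″ = ≤-trans (≤-reflexive (trans (cong (_+ need e) (+-comm 2 d)) (+-assoc d 2 (need e)))) h
    d< : suc d < K
    d< = <-trans (n<1+n _) (register< (need>0 e) h″)
    Common₁ Common₂ : Memory → Set
    Common₁ σ′ = (Static σ′ × Arr st σ′) × (∀ x → x < B + d → B ≤ x → σ′ x ≡ σ x)
    Cell₁ Cell₂ : ℕ → ℕ → Memory → Set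
    Cell₁ i j σ′ = σ′ (addr 0 i j) ≡ enc (val i j)
    -- While copying, the target array mixes old and new entries, so only the other arrays are known
    -- to represent `st`; the values come from the finished buffer.
    Common₂ σ′ = Static σ′ × (∀ t′ b → slot t′ b ≢ s → ∀ {i j} → i < M → j < M → σ′ (addr (slot t′ b) i j) ≡ enc (st t′ b i j)) ×
                 (∀ {i j} → i < M → j < M → Cell₁ i j σ′) × (∀ x → x < B + d → B ≤ x → σ′ x ≡ σ x)
    Cell₂ i j σ′ = σ′ (addr s i j) ≡ enc (val i j)
    stable₁ : ∀ {σ σ′} → Same d σ σ′ → Common₁ σ → Common₁ σ′
    stable₁ o ((S , A) , p) = (static-resp (same-weaken 4≤ o) S , arr-resp o A) , λ x l g → trans (o x (inj₁ l)) (p x l g)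
    stable₂ : ∀ {σ σ′} → Same d σ σ′ → Common₂ σ → Common₂ σ′
    stable₂ o (S , A , c , p) = static-resp (same-weaken 4≤ o) S , (λ t′ b ne {i} {j} i< j< → trans (o _ (inj₂ (BK≤addr (slot t′ b) i j))) (A t′ b ne i< j<)) ,
      (λ {i} {j} i< j< → trans (o _ (inj₂ (BK≤addr 0 i j))) (c i< j<)) , λ x l g → trans (o x (inj₁ l)) (p x l g)
    keep : ∀ {σ₁ σ₂ s i j i′ j′} → (∀ x → x ≢ addr s i j → σ₂ x ≡ σ₁ x) → i′ < M → j′ < M → i < M → j < M →
           σ₂ (addr s i j) ≡ enc (val i j) → σ₁ (addr s i′ j′) ≡ enc (val i′ j′) → σ₂ (addr s i′ j′) ≡ enc (val i′ j′)
    keep {σ₁} {σ₂} {s} {i} {j} {i′} {j′} o i′< j′< i< j< w c with i′ ≟ i | j′ ≟ j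
    ... | yes refl | yes refl = w
    ... | no ne    | _        = trans (o _ (λ u → ne (proj₁ (proj₂ (addr-inj s i′ j′ s i j i′< j′< i< j< u))))) c
    ... | yes _    | no ne    = trans (o _ (λ u → ne (proj₂ (proj₂ (addr-inj s i′ j′ s i j i′< j′< i< j< u))))) c
    same : ∀ t′ b → slot t′ b ≡ slot t a → ∀ {i j σ′} → i < M → j < M → (∀ {i j} → i < M → j < M → Cell₂ i j σ′) →
           σ′ (addr (slot t′ b) i j) ≡ enc (upd st t a val t′ b i j)
    same t′ b q {i} {j} i< j< c with slot-inj t′ b t a q
    ... | refl , refl = trans (c i< j<) (cong enc (sym (upd-same st t a val i j)))


  iter-ok r N s {d} {st} {σ} rN M>0 4≤ h S A = loopE-ok r N
    (λ i σ′ → Static σ′ × Arr (iter i (run s) st) σ′ × (∀ x → x < B + d → B ≤ x → σ′ x ≡ σ x))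
    4≤ (register< (s≤s z≤n) h) rN proj₁
    (λ o (S , A , p) → static-resp (same-weaken 4≤ o) S , arr-resp o A , λ x l g → trans (o x (inj₁ l)) (p x l g))
    (λ i< (S , A , p) q → mono ≤-refl
      (λ (S′ , A′ , p′) → (S′ , A′ , λ x l g → trans (p′ x (≤-trans l (+-monoʳ-≤ B (n≤1+n d))) g) (p x l g)) ,
                          trans (p′ _ (+-monoʳ-< B ≤-refl) (m≤m+n B d)) q)
      (comp-ok s M>0 (≤-trans 4≤ (n≤1+n d)) (≤-trans (≤-reflexive (sym (+-suc d (needS s)))) h) S A))
    (S , A , λ _ _ _ → refl)

-- Setting up the memory

memSize : ℕ → ℕ → ℕ
memSize n k = (2 * n + 8 * k) + 8

-- The base address is written to cell 2, using cell n + 3 as a counter. Both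
-- cells hold diagonal entries of the arc matrix, which do not matter.
setBase : Program
setBase =
  IF cell (lit 0) ⊖ lit 1
  THEN lit 2 ≔ lit 0 ⨾ cell (lit 0) ⊕ lit 3 ≔ lit 0 ⨾
       (WHILE cell (lit 0) ⊖ cell (cell (lit 0) ⊕ lit 3) DO
         (lit 2 ≔ cell (lit 2) ⊕ (cell (lit 0) ⊕ cell (lit 0)) ⨾
          cell (lit 0) ⊕ lit 3 ≔ cell (cell (lit 0) ⊕ lit 3) ⊕ lit 1)) ⨾
       lit 2 ≔ cell (lit 2) ⊕ lit 4
  ELSE (lit 2 ≔ lit 10)

prelude : ℕ → Program
prelude K =
  setBase ⨾
  ra 2 ≔ cell (lit 2) ⨾ ra 3 ≔ lit 0 ⨾
  ra 0 ≔ (times 2 (cell (lit 0)) ⊕ times 8 (cell (lit 1))) ⊕ lit 8 ⨾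
  ra 5 ≔ cell (lit 2) ⊕ (lit K ⊕ reg 0) ⨾ ra 4 ≔ lit 0 ⨾
  (WHILE reg 0 ⊖ reg 4 DO
    (cell (lit 2) ⊕ (lit K ⊕ reg 4) ≔ reg 5 ⨾ ra 5 ≔ reg 5 ⊕ reg 0 ⨾ ra 4 ≔ reg 4 ⊕ lit 1)) ⨾
  ra 1 ≔ reg 5 ⊖ (cell (lit 2) ⊕ (lit K ⊕ reg 0))

-- The base lies beyond the input. There the memory is still 0, which represents the state with all
-- arrays empty.
record Based (n k : ℕ) (σ₀ σ : Memory) : Set where
  field
    b0   : σ 0 ≡ n
    b1   : σ 1 ≡ k
    big  : 10 ≤ σ 2
    len  : 2 + (n * n + n * n) ≤ σ 2
    keep : ∀ x → x ≢ 2 → x ≢ n + 3 → σ x ≡ σ₀ x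
    zero′ : ∀ x → σ 2 ≤ x → σ x ≡ 0

module _ (n k : ℕ) (σ₀ : Memory) (z0 : σ₀ 0 ≡ n) (z1 : σ₀ 1 ≡ k)
         (beyond : ∀ x → 2 + (n * n + n * n) ≤ x → σ₀ x ≡ 0) where

  private
    c = n + 3

  base : Run setBase σ₀ (suc ((1 + (1 + (suc (n * 3) + 1))) + 1)) (Based n k σ₀)
  base = ifR big-case small-case
    where
    small-case : σ₀ 0 ∸ 1 ≡ 0 → Run (lit 2 ≔ lit 10) σ₀ 1 (Based n k σ₀)
    small-case q = asgR record { b0 = z0 ; b1 = z1 ; big = ≤-refl
      ; len = +-mono-≤ (≤-refl {2}) (≤-trans (+-mono-≤ (*-mono-≤ n≤1 n≤1) (*-mono-≤ n≤1 n≤1)) (≤ᵇ⇒≤ 2 8 tt))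
      ; keep = λ x ne _ → ↦-other σ₀ 2 10 ne
      ; zero′ = λ x h → trans (↦-other σ₀ 2 10 (λ { refl → contradiction h λ { (s≤s (s≤s ())) } }))
                 (beyond x (≤-trans (+-mono-≤ (≤-refl {2}) (≤-trans (+-mono-≤ (*-mono-≤ n≤1 n≤1) (*-mono-≤ n≤1 n≤1)) (≤ᵇ⇒≤ 2 8 tt))) h)) }
      where
      n≤1 : n ≤ 1
      n≤1 = m∸n≡0⇒m≤n (trans (cong (_∸ 1) (sym z0)) q)
    Inv : ℕ → Memory → Set
    Inv i σ = σ 0 ≡ n × σ 1 ≡ k × σ c ≡ i × σ 2 ≡ i * (n + n) × (∀ x → x ≢ 2 → x ≢ c → σ x ≡ σ₀ x)
    set2 : ∀ {σ i f} j → ⟦ f ⟧ σ ≡ j → 2 ≤ n → (σ 0 ≡ n × σ 1 ≡ k × σ c ≡ i × (∀ x → x ≢ 2 → x ≢ c → σ x ≡ σ₀ x)) →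
           Run (lit 2 ≔ f) σ 1 (λ σ′ → σ′ 0 ≡ n × σ′ 1 ≡ k × σ′ c ≡ i × σ′ 2 ≡ j × (∀ x → x ≢ 2 → x ≢ c → σ′ x ≡ σ₀ x))
    set2 {σ} j q n≥2 (a , b , d , e) = asgR
      (a , b , trans (↦-other σ 2 _ c≢2) d , q , λ x ne ne′ → trans (↦-other σ 2 _ ne) (e x ne ne′))
      where
      c≢2 : c ≢ 2
      c≢2 u = contradiction (subst (5 ≤_) u (+-monoˡ-≤ 3 n≥2)) λ { (s≤s (s≤s ())) }
    setc : ∀ {σ f j} i → ⟦ f ⟧ σ ≡ i → 2 ≤ n → (σ 0 ≡ n × σ 1 ≡ k × σ 2 ≡ j × (∀ x → x ≢ 2 → x ≢ c → σ x ≡ σ₀ x)) →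
           Run (cell (lit 0) ⊕ lit 3 ≔ f) σ 1 (λ σ′ → σ′ 0 ≡ n × σ′ 1 ≡ k × σ′ c ≡ i × σ′ 2 ≡ j × (∀ x → x ≢ 2 → x ≢ c → σ′ x ≡ σ₀ x))
    setc {σ} {f} {j} i q n≥2 (a , b , d , e) = asgR (subst (λ y → P (σ [ y ↦ ⟦ f ⟧ σ ])) (sym (cong (_+ 3) a))
      (trans (oth 0 (λ ())) a , trans (oth 1 (λ { (s≤s ()) })) b , trans (↦-same σ c _) q ,
       trans (oth 2 (λ { (s≤s (s≤s ())) })) d , λ x ne ne′ → trans (↦-other σ c _ ne′) (e x ne ne′)))
      where
      P : Memory → Set
      P σ′ = σ′ 0 ≡ n × σ′ 1 ≡ k × σ′ c ≡ i × σ′ 2 ≡ j × (∀ x → x ≢ 2 → x ≢ c → σ′ x ≡ σ₀ x)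
      oth : ∀ x → ¬ 5 ≤ x → (σ [ c ↦ ⟦ f ⟧ σ ]) x ≡ σ x
      oth x h = ↦-other σ c _ λ { refl → h (+-monoˡ-≤ 3 n≥2) }
    big-case : σ₀ 0 ∸ 1 ≢ 0 → Run _ σ₀ (1 + (1 + (suc (n * 3) + 1))) (Based n k σ₀)
    big-case ne =
      seqR (asgR {Post = λ σ → σ 0 ≡ n × σ 1 ≡ k × σ 2 ≡ 0 × (∀ x → x ≢ 2 → x ≢ c → σ x ≡ σ₀ x)}
             (z0 , z1 , refl , λ x ne _ → ↦-other σ₀ 2 _ ne)) λ h →
      seqR (setc 0 refl n≥2 h) λ inv →
      seqR (whileR Inv (λ {i} {σ} (a , _ , q , _) → cong₂ _∸_ a (trans (cong (λ y → σ (y + 3)) a) q))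
        (λ {i} {σ} _ (a , b , q , p , e) → seqR (set2 (suc i * (n + n)) (trans (cong₂ _+_ p (cong₂ _+_ a a)) (+-comm (i * (n + n)) (n + n))) n≥2 (a , b , q , e))
          λ {σ′} (a , b , q , p , e) → setc (suc i) (trans (cong (_+ 1) (trans (cong (λ y → σ′ (y + 3)) a) q)) (+-comm i 1)) n≥2 (a , b , p , e)) inv)
      λ {σ} (a , b , q , p , e) → mono ≤-refl (λ {σ′} (a , b , q , p , e) → record { b0 = a ; b1 = b
        ; big = subst (10 ≤_) (sym p) (≤-trans (≤ᵇ⇒≤ 10 12 tt) (+-monoˡ-≤ 4 (*-mono-≤ n≥2 (+-mono-≤ n≥2 n≥2))))
        ; len = subst (2 + (n * n + n * n) ≤_) (sym p) (≤-trans (≤-reflexive (+-comm 2 _)) (+-mono-≤ (≤-reflexive (sym (*-distribˡ-+ n n n))) (≤ᵇ⇒≤ 2 4 tt)))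
        ; keep = e
        ; zero′ = λ x h → let h′ = ≤-trans (≤-reflexive (sym p)) h
                              5≤ = ≤-trans (≤ᵇ⇒≤ 5 12 tt) (≤-trans (+-monoˡ-≤ 4 (*-mono-≤ n≥2 (+-mono-≤ n≥2 n≥2))) h′) in
            trans (e x (λ { refl → contradiction 5≤ λ { (s≤s (s≤s ())) } })
                       (λ { refl → n≮n (n + 3) (≤-trans (≤-reflexive (sym (+-suc n 3))) (≤-trans (+-monoˡ-≤ 4 (≤-trans (m≤m+n n n) (≤-trans (m≤m*n′ (n + n) n≥2) (≤-reflexive (*-comm (n + n) n))))) h′)) }))
              (beyond x (≤-trans (≤-trans (≤-reflexive (+-comm 2 _)) (+-mono-≤ (≤-reflexive (sym (*-distribˡ-+ n n n))) (≤ᵇ⇒≤ 2 4 tt))) h′)) })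
        (set2 (n * (n + n) + 4) (cong (_+ 4) p) n≥2 (a , b , q , e))
      where
      n≥2 : 2 ≤ n
      n≥2 = ≰⇒> λ le → ne (trans (cong (_∸ 1) z0) (m≤n⇒m∸n≡0 le))
      m≤m*n′ : ∀ m → 2 ≤ n → m ≤ m * n
      m≤m*n′ m h = m≤m*n m n {{>-nonZero (≤-trans (s≤s z≤n) h)}}

context : (n k B E : ℕ) → Memory → Context
context n k B E σ = record { cn = n ; ck = k ; cM = memSize n k ; cE = E ; cI = B ; input = σ }

empty : State
empty nat  _ _ _ = 0
empty bool _ _ _ = false

preCost : ℕ → ℕ → ℕ
preCost n M = suc ((1 + (1 + (suc (n * 3) + 1))) + 1) + (1 + (1 + (1 + (1 + (1 + (suc (M * 4) + 1))))))

module Prelude (K : ℕ) (6≤K : 6 ≤ K) (n k : ℕ) (σ₀ : Memory) (z0 : σ₀ 0 ≡ n) (z1 : σ₀ 1 ≡ k)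
         (beyond : ∀ x → 2 + (n * n + n * n) ≤ x → σ₀ x ≡ 0) where

  private
    M = memSize n k
    4≤K : 4 ≤ K
    4≤K = ≤-trans (≤ᵇ⇒≤ 4 6 tt) 6≤K

  module Rest {σ₁} (bs : Based n k σ₀ σ₁) where
    open Based bs
    B = σ₁ 2
    3≤B : 3 ≤ B
    3≤B = ≤-trans (≤ᵇ⇒≤ 3 10 tt) big
    open Correct (context n k B 0 σ₁) K B 3≤B ≤-refl 4≤K public

    Outside : Memory → Set
    Outside σ = ∀ x → x < B ⊎ P₀ ≤ x → σ x ≡ σ₁ x

    put : ∀ {σ} r f → Outside σ → Run (ra r ≔ f) σ 1 (λ σ′ → σ′ (B + r) ≡ ⟦ f ⟧ σ × (∀ x → x ≢ B + r → σ′ x ≡ σ x))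
    put {σ} r f o = asgR
      (subst (λ y → (σ [ y + r ↦ ⟦ f ⟧ σ ]) (B + r) ≡ ⟦ f ⟧ σ) (sym e) (↦-same σ (B + r) _) ,
       λ x ne → ↦-other σ (σ 2 + r) _ (λ q → ne (trans q (cong (_+ r) e))))
      where
      e : σ 2 ≡ B
      e = o 2 (inj₁ 3≤B)

    outside : ∀ {σ σ′ r} → r < K → (∀ x → x ≢ B + r → σ′ x ≡ σ x) → Outside σ → Outside σ′
    outside {r = r} r< p o x h = trans (p x ([ (λ l → λ { refl → n≮n _ (≤-trans l (m≤m+n B r)) }) , (λ l → λ { refl → n≮n _ (≤-trans (reg<P₀ r<) l) }) ]′ h)) (o x h)

    reg≢ : ∀ {r r′} → r′ ≢ r → B + r′ ≢ B + r
    reg≢ ne q = ne (+-cancelˡ-≡ B _ _ q)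

    getR : ∀ {σ} → Outside σ → ∀ r → ⟦ reg r ⟧ σ ≡ σ (B + r)
    getR {σ} o r = cong (λ b → σ (b + r)) (o 2 (inj₁ 3≤B))

    r< : ∀ {r} → r < 6 → r < K
    r< h = ≤-trans h 6≤K

    Inv : ℕ → Memory → Set
    Inv i σ = Outside σ × σ (B + 2) ≡ B × σ (B + 3) ≡ 0 × σ (B + 0) ≡ M × σ (B + 5) ≡ P₀ + i * M × σ (B + 4) ≡ i ×
              (∀ {j} → j < i → σ (B + (K + j)) ≡ P₀ + j * M)

    body : ∀ {i σ} → i < M → Inv i σ →
      Run (cell (lit 2) ⊕ (lit K ⊕ reg 4) ≔ reg 5 ⨾ ra 5 ≔ reg 5 ⊕ reg 0 ⨾ ra 4 ≔ reg 4 ⊕ lit 1) σ 3 (Inv (suc i))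
    body {i} {σ} i< (o , q2 , q3 , q0 , q5 , q4 , rw) =
      seqR (asgR {Post = λ σ′ → σ′ (B + (K + i)) ≡ P₀ + i * M × (∀ x → x ≢ B + (K + i) → σ′ x ≡ σ x)}
        (subst (λ y → (σ [ y ↦ ⟦ reg 5 ⟧ σ ]) (B + (K + i)) ≡ P₀ + i * M) (sym adr)
           (trans (↦-same σ (B + (K + i)) _) (trans (getR o 5) q5)) ,
         λ x ne → ↦-other σ _ _ (λ q → ne (trans q adr)))) λ {σ₂} (w , p) →
      let o₂ : Outside σ₂
          o₂ x h = trans (p x (row≢ h)) (o x h)
          keep : ∀ r → r < 6 → σ₂ (B + r) ≡ σ (B + r)
          keep r l = p _ (λ q → n≮n K (≤-trans (s≤s (m≤m+n K i)) (≤-trans (≤-reflexive (cong suc (sym (+-cancelˡ-≡ B _ _ q)))) (r< l))))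
      in seqR (put 5 (reg 5 ⊕ reg 0) o₂) λ {σ₃} (w₃ , p₃) →
      let o₃ = outside (r< (≤ᵇ⇒≤ 6 6 tt)) p₃ o₂ in
      mono ≤-refl (λ {σ₄} (w₄ , p₄) →
        let keep′ : ∀ x → x ≢ B + 4 → x ≢ B + 5 → σ₄ x ≡ σ₂ x
            keep′ x n4 n5 = trans (p₄ x n4) (p₃ x n5) in
        outside (r< (≤ᵇ⇒≤ 5 6 tt)) p₄ o₃ ,
        trans (keep′ _ (reg≢ λ ()) (reg≢ λ ())) (trans (keep 2 (≤ᵇ⇒≤ 3 6 tt)) q2) ,
        trans (keep′ _ (reg≢ λ ()) (reg≢ λ ())) (trans (keep 3 (≤ᵇ⇒≤ 4 6 tt)) q3) ,
        trans (keep′ _ (reg≢ λ ()) (reg≢ λ ())) (trans (keep 0 (≤ᵇ⇒≤ 1 6 tt)) q0) ,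
        trans (p₄ _ (reg≢ λ ())) (trans w₃ (trans (cong₂ _+_ (trans (getR o₂ 5) (trans (keep 5 (≤ᵇ⇒≤ 6 6 tt)) q5))
                (trans (getR o₂ 0) (trans (keep 0 (≤ᵇ⇒≤ 1 6 tt)) q0))) (trans (+-assoc P₀ (i * M) M) (cong (P₀ +_) (+-comm (i * M) M))))) ,
        trans w₄ (trans (cong (_+ 1) (trans (getR o₃ 4) (trans (p₃ _ (reg≢ λ ())) (trans (keep 4 (≤ᵇ⇒≤ 5 6 tt)) q4)))) (+-comm i 1)) ,
        λ {j} j< → trans (keep′ _ (row≢reg j 4 (≤ᵇ⇒≤ 5 6 tt)) (row≢reg j 5 (≤ᵇ⇒≤ 6 6 tt)))
                    ([ (λ l → trans (p _ (λ q → <⇒≢ l (+-cancelˡ-≡ K _ _ (+-cancelˡ-≡ B _ _ q)))) (rw l)) , (λ { refl → w }) ]′ (m≤n⇒m<n∨m≡n (≤-pred j<))))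
        (put 4 (reg 4 ⊕ lit 1) o₃)
      where
      adr : ⟦ cell (lit 2) ⊕ (lit K ⊕ reg 4) ⟧ σ ≡ B + (K + i)
      adr = cong₂ (λ b c → b + (K + c)) (o 2 (inj₁ 3≤B)) (trans (getR o 4) q4)
      row≢ : ∀ {x} → x < B ⊎ P₀ ≤ x → x ≢ B + (K + i)
      row≢ (inj₁ l) refl = n≮n _ (≤-trans l (m≤m+n B _))
      row≢ (inj₂ l) refl = n≮n _ (≤-trans (+-monoʳ-< B (+-monoʳ-< K i<)) l)
      row≢reg : ∀ j r → r < 6 → B + (K + j) ≢ B + r
      row≢reg j r l q = n≮n K (≤-trans (s≤s (m≤m+n K j)) (≤-trans (≤-reflexive (cong suc (+-cancelˡ-≡ B _ _ q))) (r< l)))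

    rest : Run (ra 2 ≔ cell (lit 2) ⨾ ra 3 ≔ lit 0 ⨾
                ra 0 ≔ (times 2 (cell (lit 0)) ⊕ times 8 (cell (lit 1))) ⊕ lit 8 ⨾
                ra 5 ≔ cell (lit 2) ⊕ (lit K ⊕ reg 0) ⨾ ra 4 ≔ lit 0 ⨾
                (WHILE reg 0 ⊖ reg 4 DO
                  (cell (lit 2) ⊕ (lit K ⊕ reg 4) ≔ reg 5 ⨾ ra 5 ≔ reg 5 ⊕ reg 0 ⨾ ra 4 ≔ reg 4 ⊕ lit 1)) ⨾
                ra 1 ≔ reg 5 ⊖ (cell (lit 2) ⊕ (lit K ⊕ reg 0)))
               σ₁ (1 + (1 + (1 + (1 + (1 + (suc (M * 4) + 1)))))) (λ σ → Static σ × Arr empty σ)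
    rest =
      seqR (put 2 (cell (lit 2)) (λ _ _ → refl)) λ (w₂ , p₂) →
      let o₂ = outside (r< (≤ᵇ⇒≤ 3 6 tt)) p₂ (λ _ _ → refl) in
      seqR (put 3 (lit 0) o₂) λ {σ₃} (w₃ , p₃) →
      let o₃ = outside (r< (≤ᵇ⇒≤ 4 6 tt)) p₃ o₂ in
      seqR (put 0 _ o₃) λ {σ₄} (w₄ , p₄) →
      let o₄ = outside (r< (≤ᵇ⇒≤ 1 6 tt)) p₄ o₃
          m₄ : σ₄ (B + 0) ≡ M
          m₄ = trans w₄ (cong (_+ 8) (cong₂ _+_ (trans (⟦times⟧ 2 (cell (lit 0)) σ₃) (cong (2 *_) (trans (o₃ 0 (inj₁ (≤-trans (s≤s z≤n) 3≤B))) b0)))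
                                         (trans (⟦times⟧ 8 (cell (lit 1)) σ₃) (cong (8 *_) (trans (o₃ 1 (inj₁ (≤-trans (s≤s (s≤s z≤n)) 3≤B))) b1))))) in
      seqR (put 5 (cell (lit 2) ⊕ (lit K ⊕ reg 0)) o₄) λ (w₅ , p₅) →
      let o₅ = outside (r< (≤ᵇ⇒≤ 6 6 tt)) p₅ o₄ in
      seqR (put 4 (lit 0) o₅) λ {σ₆} (w₆ , p₆) →
      let o₆ = outside (r< (≤ᵇ⇒≤ 5 6 tt)) p₆ o₅ in
      seqR (whileR Inv
        (λ (o , _ , _ , q0 , _ , q4 , _) → cong₂ _∸_ (trans (getR o 0) q0) (trans (getR o 4) q4)) body
        (o₆ ,
         trans (p₆ _ (reg≢ λ ())) (trans (p₅ _ (reg≢ λ ())) (trans (p₄ _ (reg≢ λ ())) (trans (p₃ _ (reg≢ λ ())) w₂))) ,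
         trans (p₆ _ (reg≢ λ ())) (trans (p₅ _ (reg≢ λ ())) (trans (p₄ _ (reg≢ λ ())) w₃)) ,
         trans (p₆ _ (reg≢ λ ())) (trans (p₅ _ (reg≢ λ ())) m₄) ,
         trans (p₆ _ (reg≢ λ ())) (trans w₅ (trans (cong₂ (λ b m → b + (K + m)) (o₄ 2 (inj₁ 3≤B)) (trans (getR o₄ 0) m₄)) (sym (+-identityʳ P₀)))) ,
         w₆ , λ ()))
      λ {σ₇} (o , q2 , q3 , q0 , q5 , q4 , rw) →
      mono ≤-refl (λ {σ₈} (w , p) →
        let o₈ = outside (r< (≤ᵇ⇒≤ 2 6 tt)) p o
            a0 : ∀ s i j → σ₈ (addr s i j) ≡ 0
            a0 s i j = trans (o₈ _ (inj₂ (P₀≤addr s i j))) (zero′ _ (≤-trans (m≤m+n B _) (P₀≤addr s i j)))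
        in record
        { s0 = trans (o₈ 0 (inj₁ (≤-trans (s≤s z≤n) 3≤B))) b0
        ; s1 = trans (o₈ 1 (inj₁ (≤-trans (s≤s (s≤s z≤n)) 3≤B))) b1
        ; s2 = o₈ 2 (inj₁ 3≤B)
        ; r0 = trans (p _ (reg≢ λ ())) q0
        ; r1 = trans w (trans (cong₂ _∸_ (trans (getR o 5) q5) (cong₂ (λ b m → b + (K + m)) (o 2 (inj₁ 3≤B)) (trans (getR o 0) q0))) (m+n∸m≡n P₀ (M * M)))
        ; r2 = trans (p _ (reg≢ λ ())) q2
        ; r3 = trans (p _ (reg≢ λ ())) q3
        ; rows = λ {i} h → trans (p _ (λ q → n≮n K (≤-trans (s≤s (m≤m+n K i)) (≤-trans (≤-reflexive (cong suc (+-cancelˡ-≡ B _ _ q))) (r< (≤ᵇ⇒≤ 2 6 tt)))))) (rw h)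
        ; inps = λ h → o₈ _ (inj₁ h) } ,
        λ { nat a {i} {j} _ _ → a0 (slot nat a) i j ; bool a {i} {j} _ _ → a0 (slot bool a) i j })
        (put 1 _ o)

  record Ready (σ : Memory) : Set where
    field
      {σ₁}   : Memory
      based  : Based n k σ₀ σ₁
      static : Rest.Static based σ
      arr    : Rest.Arr based empty σ

  prelude-ok : Run (prelude K) σ₀ (preCost n M) Ready
  prelude-ok = seqR (base n k σ₀ z0 z1 beyond) λ bs →
    mono ≤-refl (λ (S , A) → record { based = bs ; static = S ; arr = A }) (Rest.rest bs)

-- Cell 2 is written last because the base address is read from it.
postlude : ℕ → ℕ → ℕ → Program
postlude K ok w =
  ra 4 ≔ lit 0 ⨾
  (WHILE cell (lit 0) ⊖ reg 4 DO
    ((IF (reg 4 ⊖ lit 1) ⊕ (lit 1 ⊖ reg 4)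
      THEN reg 4 ⊕ lit 1 ≔ cell (Compile.cellE K (slot bool w) (lit 0) (reg 4))
      ELSE skip) ⨾
     ra 4 ≔ reg 4 ⊕ lit 1)) ⨾
  lit 0 ≔ cell (Compile.cellE K (slot bool ok) (lit 0) (lit 0)) ⨾
  lit 2 ≔ cell (Compile.cellE K (slot bool w) (lit 0) (lit 1))

postCost : ℕ → ℕ
postCost n = 1 + (suc (n * suc (suc (1 + 1) + 1)) + (1 + 1))

module Postlude (C : Context) (K B : ℕ) (3≤B : 3 ≤ B) (I≤B : Context.cI C ≤ B) (6≤K : 6 ≤ K)
                (2≤M : 2 ≤ Context.cM C) (n≤M : Context.cn C ≤ Context.cM C) (n<B : suc (Context.cn C) ≤ B) where
  open Context C using (cn) renaming (cM to M)
  open Correct C K B 3≤B I≤B (≤-trans (≤ᵇ⇒≤ 4 6 tt) 6≤K)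
  open Static

  module _ {st σ₀} (S : Static σ₀) (A : Arr st σ₀) (ok w : ℕ) where

    -- `High` omits cell 0: the verdict is written there before the entry for vertex 1 is read, and
    -- `n` is lost by then.
    High Outside : Memory → Set
    High σ    = σ 2 ≡ B × (∀ x → B ≤ x → x ≢ B + 4 → σ x ≡ σ₀ x)
    Outside σ = σ 0 ≡ cn × High σ

    getR : ∀ {σ} → Outside σ → ∀ r → ⟦ reg r ⟧ σ ≡ σ (B + r)
    getR {σ} (_ , o , _) r = cong (λ b → σ (b + r)) o

    getCell : ∀ {σ t a je j} → High σ → j < M → ⟦ je ⟧ σ ≡ j →
              ⟦ cell (Compile.cellE K (slot t a) (lit 0) je) ⟧ σ ≡ enc (st t a 0 j)
    getCell {σ} {t} {a} {je} {j} (o2 , o) j< q = trans (cong σ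
      (eval-cell₀ {s = slot t a} {lit 0} {je} o2 (trans (o _ (m≤m+n B 1) (λ q → contradiction (+-cancelˡ-≡ B 1 4 q) λ ())) (r1 S))
        (trans (o _ (m≤m+n B _) (λ q → n≮n K (≤-trans (s≤s (≤-trans (m≤m+n K 0) (≤-reflexive (+-cancelˡ-≡ B _ _ q)))) (≤-trans (≤ᵇ⇒≤ 5 6 tt) 6≤K))))
          (rows S 0<M)) refl q))
      (trans (o _ (≤-trans (m≤m+n B K) (BK≤addr (slot t a) 0 j)) (λ q → n≮n _ (≤-trans (+-monoʳ-< B (≤-trans (≤ᵇ⇒≤ 5 6 tt) 6≤K)) (≤-trans (BK≤addr (slot t a) 0 j) (≤-reflexive q))))) (A t a 0<M j<))
      where
      0<M : 0 < M
      0<M = ≤-trans (s≤s z≤n) 2≤M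

    Done : ℕ → Memory → Set
    Done i σ = ∀ {x} → x < i → x ≢ 1 → σ (suc x) ≡ enc (st bool w 0 x)

    Inv : ℕ → Memory → Set
    Inv i σ = Outside σ × σ (B + 4) ≡ i × Done i σ

    setCounter : ∀ {σ f i} → ⟦ f ⟧ σ ≡ i → Outside σ → i ≤ cn → Done i σ → Run (ra 4 ≔ f) σ 1 (Inv i)
    setCounter {σ} {f} {i} q (o0 , o2 , o) i≤ d = asgR (subst (λ y → Inv i (σ [ y + 4 ↦ ⟦ f ⟧ σ ])) (sym o2)
      ((trans (oth 0 (≤-trans (s≤s z≤n) n<B)) o0 , trans (oth 2 3≤B) o2 , λ x h ne → trans (↦-other σ (B + 4) _ ne) (o x h ne)) ,
       trans (↦-same σ (B + 4) _) q , λ {x} x< ne → trans (oth (suc x) (≤-trans (s≤s (≤-trans x< i≤)) n<B)) (d x< ne)))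
      where
      oth : ∀ x → x < B → (σ [ B + 4 ↦ ⟦ f ⟧ σ ]) x ≡ σ x
      oth x h = ↦-other σ (B + 4) _ λ { refl → n≮n _ (≤-trans h (m≤m+n B 4)) }

    setOutput : ∀ {σ e f i} → ⟦ e ⟧ σ ≡ suc i → ⟦ f ⟧ σ ≡ enc (st bool w 0 i) → i ≢ 1 → i < cn → Inv i σ →
                Run (e ≔ f) σ 1 (λ σ′ → Outside σ′ × σ′ (B + 4) ≡ i × Done (suc i) σ′)
    setOutput {σ} {e} {f} {i} p q ne i< ((o0 , o2 , o) , r , d) =
      asgR (subst (λ y → Outside (σ [ y ↦ ⟦ f ⟧ σ ]) × (σ [ y ↦ ⟦ f ⟧ σ ]) (B + 4) ≡ i × Done (suc i) (σ [ y ↦ ⟦ f ⟧ σ ])) (sym p)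
      ((o0 , trans (↦-other σ (suc i) _ (λ u → ne (suc-injective (sym u)))) o2 , λ x h ne → trans (hi x h) (o x h ne)) ,
       trans (hi _ (m≤m+n B 4)) r ,
       λ {x} x< x≢ → [ (λ l → trans (↦-other σ (suc i) _ (λ u → <⇒≢ l (suc-injective u))) (d l x≢)) , (λ { refl → trans (↦-same σ (suc i) _) q }) ]′ (m≤n⇒m<n∨m≡n (≤-pred x<))))
      where
      hi : ∀ x → B ≤ x → (σ [ suc i ↦ ⟦ f ⟧ σ ]) x ≡ σ x
      hi x h = ↦-other σ (suc i) _ λ { refl → n≮n _ (≤-trans (s≤s i<) (≤-trans n<B h)) }

    one : ∀ i → (i ∸ 1) + (1 ∸ i) ≡ 0 → i ≡ 1
    one (suc zero) _ = refl

    postlude-ok : Run (postlude K ok w) σ₀ (postCost cn)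
        (λ σ′ → σ′ 0 ≡ enc (st bool ok 0 0) × (∀ {x} → x < cn → σ′ (suc x) ≡ enc (st bool w 0 x)))
    postlude-ok =
      seqR (setCounter refl (s0 S , s2 S , λ _ _ _ → refl) z≤n (λ ())) λ inv →
      seqR (whileR Inv (λ (o , q , _) → cong₂ _∸_ (proj₁ o) (trans (getR o 4) q))
        (λ {i} {σ} i< (o , q , d) → seqR
          (ifR {b = 1} {c = 1} {Post = λ σ′ → Outside σ′ × σ′ (B + 4) ≡ i × Done (suc i) σ′}
            (λ ne → setOutput {e = reg 4 ⊕ lit 1} {f = cell (Compile.cellE K (slot bool w) (lit 0) (reg 4))}
                (trans (cong (_+ 1) (trans (getR o 4) q)) (+-comm i 1))
                (getCell {a = w} {je = reg 4} (proj₂ o) (≤-trans i< n≤M) (trans (getR o 4) q))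
                (λ u → ne (trans (cong (λ y → (y ∸ 1) + (1 ∸ y)) (trans (getR o 4) q)) (cong (λ y → (y ∸ 1) + (1 ∸ y)) u))) i< (o , q , d))
            (λ eq → mkRun skip ≤-refl (o , q , λ x< ne → [ (λ l → d l ne) ,
                (λ { refl → ⊥-elim (ne (one i (trans (sym (cong (λ y → (y ∸ 1) + (1 ∸ y)) (trans (getR o 4) q))) eq))) }) ]′ (m≤n⇒m<n∨m≡n (≤-pred x<)))))
          λ (o , q , d) → setCounter (trans (cong (_+ 1) (trans (getR o 4) q)) (+-comm i 1)) o i< d)
        inv)
      λ {σ} (o , q , d) →
      seqR (asgR {Post = λ σ′ → σ′ 0 ≡ enc (st bool ok 0 0) × (∀ x → x ≢ 0 → σ′ x ≡ σ x)}
        (getCell {a = ok} {je = lit 0} (proj₂ o) (≤-trans (s≤s z≤n) 2≤M) refl , λ x ne → ↦-other σ 0 _ ne)) λ {σ₁} (p , e) →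
      asgR (p , λ {x} x< → last {σ₁} {σ} (proj₂ o) e d x (x ≟ 1) x<)
      where
      last : ∀ {σ₁ σ} → High σ → (∀ x → x ≢ 0 → σ₁ x ≡ σ x) → Done cn σ → ∀ x → Dec (x ≡ 1) → x < cn →
             (σ₁ [ 2 ↦ ⟦ cell (Compile.cellE K (slot bool w) (lit 0) (lit 1)) ⟧ σ₁ ]) (suc x) ≡ enc (st bool w 0 x)
      last {σ₁} (o2 , o) e d _ (yes refl) x< = getCell {σ₁} {a = w} {je = lit 1}
        (trans (e 2 λ ()) o2 , λ x h ne → trans (e x λ { refl → contradiction (≤-trans 3≤B h) λ () }) (o x h ne)) 2≤M refl
      last {σ₁} o e d x (no ne) x< = trans (↦-other σ₁ 2 _ (λ u → ne (suc-injective u))) (trans (e _ λ ()) (d x< ne))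

-- The encoded instance in memory

load-beyond : ∀ xs x → length xs ≤ x → load xs x ≡ 0
load-beyond []       x       h       = refl
load-beyond (m ∷ xs) (suc x) (s≤s h) = load-beyond xs x h

load-++ˡ : ∀ xs ys {x} → x < length xs → load (xs ++ ys) x ≡ load xs x
load-++ˡ (m ∷ xs) ys {zero}  h       = refl
load-++ˡ (m ∷ xs) ys {suc x} (s≤s h) = load-++ˡ xs ys h

load-++ʳ : ∀ xs ys x → load (xs ++ ys) (length xs + x) ≡ load ys x
load-++ʳ []       ys x = refl
load-++ʳ (m ∷ xs) ys x = load-++ʳ xs ys x

module _ {n : ℕ} (A : Pairs n) where

  private
    row : Fin n → List ℕ
    row u = map (λ w → if A u w then 1 else 0) (allFin n)
    rows : ∀ {m} → (Fin m → Fin n) → List ℕ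
    rows g = concatMap row (List.tabulate g)

  length-row : ∀ u → length (row u) ≡ n
  length-row u = trans (length-map _ (allFin n)) (length-tabulate id)

  length-rows : ∀ {m} (g : Fin m → Fin n) → length (rows g) ≡ m * n
  length-rows {zero}  g = refl
  length-rows {suc m} g = trans (length-++ (row (g zero))) (cong₂ _+_ (length-row (g zero)) (length-rows (g ∘ suc)))

  load-map : ∀ {m} (f : Fin n → ℕ) (g : Fin m → Fin n) w → load (map f (List.tabulate g)) (toℕ w) ≡ f (g w)
  load-map f g zero    = refl
  load-map f g (suc w) = load-map f (g ∘ suc) w

  load-rows : ∀ {m} (g : Fin m → Fin n) (u : Fin m) (w : Fin n) →
              load (rows g) (toℕ u * n + toℕ w) ≡ (if A (g u) w then 1 else 0)
  load-rows g zero    w = trans (load-++ˡ (row (g zero)) (rows (g ∘ suc)) (subst (toℕ w <_) (sym (length-row (g zero))) (toℕ<n w))) (load-map _ id w)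
  load-rows g (suc u) w = trans (cong (load (rows g)) (trans (+-assoc n _ _) (cong (_+ _) (sym (length-row (g zero))))))
    (trans (load-++ʳ (row (g zero)) (rows (g ∘ suc)) _) (load-rows (g ∘ suc) u w))

  length-matrix : length (matrix A) ≡ n * n
  length-matrix = length-rows id

  load-matrix : ∀ u w → load (matrix A) (toℕ u * n + toℕ w) ≡ (if A u w then 1 else 0)
  load-matrix = load-rows id

square≢0 : ∀ {m} → Fin m → m * m ≢ 0
square≢0 {suc m} _ ()

-- For `m` at least 2 the requests start at cell `2 + m * m`, beyond the counter cell `m + 3`. For
-- `m` equal to 1 the only request is in cell 3.
request≢counter : ∀ {m} (u w : Fin m) → 2 + (m * m + (toℕ u * m + toℕ w)) ≢ m + 3
request≢counter {suc zero}    zero zero ()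
request≢counter {suc (suc m)} u w q = n≮n (2 + (2 + m) * (2 + m))
  (≤-trans (s≤s (m≤m+n (2 + (2 + m) * (2 + m)) _)) (≤-trans (≤-reflexive (cong suc q))
    (≤-trans (≤-reflexive (+-comm (3 + m) 3)) (s≤s (s≤s bound)))))
  where
  open +-*-Solver
  bound : 4 + m ≤ (2 + m) * (2 + m)
  bound = ≤-trans (+-monoʳ-≤ 4 (m≤m+n m (3 * m + m * m)))
    (≤-reflexive (solve 1 (λ m → con 4 :+ (m :+ (con 3 :* m :+ m :* m)) := (con 2 :+ m) :* (con 2 :+ m)) refl m))

module _ (I : Instance) where
  open Instance I

  -- Nothing is promised about diagonal arcs, as some may be overwritten. This is harmless, for no
  -- path uses a loop.
  record InputOK (C : Context) : Set where
    open Context C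
    field
      room : 2 + (n * n + n * n) ≤ cI
      arcs : ∀ u w → toℕ u ≢ toℕ w → input (2 + (toℕ u * n + toℕ w)) ≡ (if arc u w then 1 else 0)
      reqs : ∀ u w → input (2 + (n * n + (toℕ u * n + toℕ w))) ≡ (if request u w then 1 else 0)

  encode-beyond : ∀ x → 2 + (n * n + n * n) ≤ x → encode I x ≡ 0
  encode-beyond x h = load-beyond (n ∷ k ∷ matrix arc ++ matrix request) x
    (≤-trans (≤-reflexive (cong (2 +_) (trans (length-++ (matrix arc)) (cong₂ _+_ (length-matrix arc) (length-matrix request))))) h)

  input-ok : ∀ {σ} → Based n k (encode I) σ → ∀ E → InputOK (context n k (σ 2) E σ)
  input-ok b E = record
    { room = Based.len b
    ; arcs = λ u w ne → trans (Based.keep b _ (λ q → ne (first u w (suc-injective (suc-injective q))))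
          (λ q → ne (second u w (trans (suc-injective (suc-injective (trans q (+-comm n 3)))) refl))))
        (trans (load-++ˡ (matrix arc) (matrix request) (subst (toℕ u * n + toℕ w <_) (sym (length-matrix arc)) (combine< n (toℕ<n u) (toℕ<n w)))) (load-matrix arc u w))
    ; reqs = λ u w → trans (Based.keep b _ (λ q → square≢0 u (m+n≡0⇒m≡0 (n * n) (suc-injective (suc-injective q)))) (request≢counter u w))
        (trans (cong (λ y → load (matrix arc ++ matrix request) (y + (toℕ u * n + toℕ w))) (sym (length-matrix arc)))
          (trans (load-++ʳ (matrix arc) (matrix request) (toℕ u * n + toℕ w)) (load-matrix request u w))) }
    where
    first : ∀ (u w : Fin n) → toℕ u * n + toℕ w ≡ 0 → toℕ u ≡ toℕ w
    first u w q = trans (proj₁ (digits-unique n (toℕ u) (toℕ w) 0 0 (toℕ<n w) (≤-trans (s≤s z≤n) (toℕ<n w)) q))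
                        (sym (proj₂ (digits-unique n (toℕ u) (toℕ w) 0 0 (toℕ<n w) (≤-trans (s≤s z≤n) (toℕ<n w)) q)))
    second : ∀ (u w : Fin n) → toℕ u * n + toℕ w ≡ suc n → toℕ u ≡ toℕ w
    second u w q with 1 <? n
    ... | yes 1<n = trans (proj₁ e) (sym (proj₂ e))
      where
      e = digits-unique n (toℕ u) (toℕ w) 1 1 (toℕ<n w) 1<n (trans q (trans (+-comm 1 n) (cong (_+ 1) (sym (+-identityʳ n)))))
    ... | no  1≮n = trans (below1 u) (sym (below1 w))
      where
      below1 : ∀ (u : Fin n) → toℕ u ≡ 0
      below1 u = n<1⇒n≡0 (≤-trans (toℕ<n u) (≮⇒≥ 1≮n))

-- The complete machine program

registers : Stm → Stm → ℕ
registers s₁ s₂ = 6 + (needS s₁ + needS s₂)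

-- Two stages, because the repetition count of the second has to be computed: `s₁` leaves it in
-- array `aE`, from where it is copied to register 3.
mainProgram : Stm → Stm → ℕ → ℕ → ℕ → Program
mainProgram s₁ s₂ aE ok w =
  program (registers s₁ s₂)
  where
  program : ℕ → Program
  program K = prelude K ⨾ Compile.comp K 4 s₁ ⨾ ra 3 ≔ cell (Compile.cellE K (slot nat aE) (lit 0) (lit 0)) ⨾
              Compile.comp K 4 s₂ ⨾ postlude K ok w

module _ (s₁ s₂ : Stm) (aE ok w : ℕ) (I : Instance) where
  open Instance I
  private
    M = memSize n k

  module Stages (B : ℕ) (input : Memory) where
    C₁ C₂ : Context
    st₁ st₂ : State
    E : ℕ
    C₁  = context n k B 0 input
    st₁ = Semantics.run C₁ s₁ empty
    E   = st₁ nat aE 0 0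
    C₂  = context n k B E input
    st₂ = Semantics.run C₂ s₂ st₁

  record Simulated : Set where
    field
      {B}     : ℕ
      {input} : Memory
    open Stages B input public
    field
      inputOK : ∀ E → InputOK I (context n k B E input)
      {σ} : Memory
      {t} : ℕ
      exec : mainProgram s₁ s₂ aE ok w ⊢ encode I ⇓ σ in-time t
      bound : t ≤ preCost n M + (costS s₁ M 0 + (1 + (costS s₂ M E + postCost n)))
      answer : decode n σ ≡ (if st₂ bool ok 0 0 then just (tabulate (λ (u : Fin n) → st₂ bool w 0 (toℕ u))) else nothing)

  private
    8≤M : 8 ≤ M
    8≤M = m≤n+m 8 (2 * n + 8 * k)
    n≤M : n ≤ M
    n≤M = ≤-trans (m≤m+n n (n + 0)) (≤-trans (m≤m+n (2 * n) (8 * k)) (m≤m+n _ 8))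

    Goal : ℕ → Memory → Memory → Set
    Goal B input σ = let open Stages B input in
      decode n σ ≡ (if st₂ bool ok 0 0 then just (tabulate (λ (u : Fin n) → st₂ bool w 0 (toℕ u))) else nothing)

    decode-ok : ∀ σ (o : Bool) (f : Fin n → Bool) → σ 0 ≡ enc {bool} o → (∀ u → σ (suc (toℕ u)) ≡ enc {bool} (f u)) →
                decode n σ ≡ (if o then just (tabulate f) else nothing)
    decode-ok σ true f p q rewrite p = cong just (tabulate-cong λ u → trans (cong (λ y → not (y ≡ᵇ 0)) (q u)) (back (f u)))
      where
      back : ∀ c → not (enc {bool} c ≡ᵇ 0) ≡ c
      back true  = refl
      back false = refl
    decode-ok σ false f p q rewrite p = refl

  module _ (K : ℕ) (6≤K : 6 ≤ K) (a≤K : 4 + needS s₁ ≤ K) (b≤K : 4 + needS s₂ ≤ K) where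
   private
    4≤K : 4 ≤ K
    4≤K = ≤-trans (≤ᵇ⇒≤ 4 6 tt) 6≤K

   run₂ : ∀ {σ₀} (bs : Based n k (encode I) σ₀) {σ} → Prelude.Rest.Static K 6≤K n k (encode I) refl refl (encode-beyond I) bs σ → Prelude.Rest.Arr K 6≤K n k (encode I) refl refl (encode-beyond I) bs empty σ →
          let open Stages (σ₀ 2) σ₀ in
          Run (Compile.comp K 4 s₁ ⨾ ra 3 ≔ cell (Compile.cellE K (slot nat aE) (lit 0) (lit 0)) ⨾
               Compile.comp K 4 s₂ ⨾ postlude K ok w) σ (costS s₁ M 0 + (1 + (costS s₂ M E + postCost n))) (Goal (σ₀ 2) σ₀)
   run₂ {σ₀} bs {σ} S A =
     seqR (X₁.comp-ok s₁ {4} {empty} M>0 ≤-refl a≤K S A) λ {σ₁} (S₁ , A₁ , _) →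
     seqR (X₁.setReg 3 _ S₁) λ {σ₂} (p , o) →
     let e3 : σ₂ (B + 3) ≡ E
         e3 = trans p (trans (cong σ₁ (X₁.eval-cell {s = slot nat aE} {lit 0} {lit 0} S₁ M>0 refl refl)) (A₁ nat aE M>0 M>0))
         lo : ∀ {x} → x < B → σ₂ x ≡ σ₁ x
         lo h = o _ λ { refl → n≮n _ (≤-trans h (m≤m+n B 3)) }
         rg : ∀ r → r ≢ 3 → σ₂ (B + r) ≡ σ₁ (B + r)
         rg r ne = o _ λ q → ne (+-cancelˡ-≡ B _ _ q)
         S₂ : X₂.Static σ₂
         S₂ = record
           { s0 = trans (lo (≤-trans (s≤s z≤n) 3≤B)) (X₁.Static.s0 S₁)
           ; s1 = trans (lo (≤-trans (s≤s (s≤s z≤n)) 3≤B)) (X₁.Static.s1 S₁)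
           ; s2 = trans (lo 3≤B) (X₁.Static.s2 S₁)
           ; r0 = trans (rg 0 λ ()) (X₁.Static.r0 S₁)
           ; r1 = trans (rg 1 λ ()) (X₁.Static.r1 S₁)
           ; r2 = trans (rg 2 λ ()) (X₁.Static.r2 S₁)
           ; r3 = e3
           ; rows = λ {i} h → trans (rg (K + i) λ q → n≮n 3 (≤-trans 4≤K (≤-trans (m≤m+n K i) (≤-reflexive q)))) (X₁.Static.rows S₁ h)
           ; inps = λ h → trans (lo h) (X₁.Static.inps S₁ h) }
         A₂ : X₂.Arr st₁ σ₂
         A₂ t a {i} {j} i< j< = trans (o _ λ q → n≮n _ (≤-trans (+-monoʳ-< B 4≤K) (≤-trans (X₁.BK≤addr (slot t a) i j) (≤-reflexive q)))) (A₁ t a i< j<)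
     in
     seqR (X₂.comp-ok s₂ {4} {st₁} M>0 ≤-refl b≤K S₂ A₂) λ (S₃ , A₃ , _) →
     mono ≤-refl (λ {σ′} (p , q) → decode-ok σ′ _ _ p (λ u → q (toℕ<n u)))
       (Postlude.postlude-ok C₂ K B 3≤B ≤-refl 6≤K (≤-trans (≤ᵇ⇒≤ 2 8 tt) 8≤M) n≤M n<B {st₂} S₃ A₃ ok w)
     where
     B = σ₀ 2
     open Stages B σ₀
     open Based bs
     3≤B : 3 ≤ B
     3≤B = ≤-trans (≤ᵇ⇒≤ 3 10 tt) big
     M>0 : 0 < M
     M>0 = ≤-trans (s≤s z≤n) 8≤M
     n<B : suc n ≤ B
     n<B = ≤-trans (s≤s (≤-trans (square n) (≤-trans (m≤m+n (n * n) (n * n)) (n≤1+n _)))) len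
       where
       square : ∀ m → m ≤ m * m
       square zero    = z≤n
       square (suc m) = m≤m*n (suc m) (suc m)
     module X₁ = Correct C₁ K B 3≤B ≤-refl 4≤K
     module X₂ = Correct C₂ K B 3≤B ≤-refl 4≤K

  private
    K : ℕ
    K = registers s₁ s₂
    6≤K : 6 ≤ K
    6≤K = m≤m+n 6 _
    a≤K : 4 + needS s₁ ≤ K
    a≤K = +-mono-≤ (≤ᵇ⇒≤ 4 6 tt) (m≤m+n (needS s₁) (needS s₂))
    b≤K : 4 + needS s₂ ≤ K
    b≤K = +-mono-≤ (≤ᵇ⇒≤ 4 6 tt) (m≤n+m (needS s₂) (needS s₁))

  simulate : Simulated
  simulate = go (Prelude.prelude-ok K 6≤K n k (encode I) refl refl (encode-beyond I))
    where
    go : Run (prelude K) (encode I) (preCost n M) (Prelude.Ready K 6≤K n k (encode I) refl refl (encode-beyond I)) → Simulated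
    go (mkRun ex tb record { σ₁ = σ₁ ; based = bs ; static = S ; arr = A }) =
      finish (run₂ K 6≤K a≤K b≤K bs S A)
      where
      finish : Run _ _ _ (Goal (σ₁ 2) σ₁) → Simulated
      finish (mkRun ex′ tb′ g) = record { B = σ₁ 2 ; input = σ₁ ; inputOK = input-ok I bs ; exec = seq ex ex′ ; bound = +-mono-≤ tb tb′ ; answer = g }

-- Bounds on the running time

PolyBounded : (ℕ → ℕ → ℕ) → Set
PolyBounded f = ∃[ c ] ∃[ d ] ∃[ e ] (∀ M E → f M E ≤ c * (suc M ^ d * suc E ^ e))

bd-const : ∀ c → PolyBounded (λ _ _ → c)
bd-const c = c , 0 , 0 , λ M E → ≤-reflexive (sym (*-identityʳ c))

bd-M : PolyBounded (λ M _ → M)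
bd-M = 1 , 1 , 0 , λ M E → ≤-trans (n≤1+n M) (≤-reflexive (sym (trans (+-identityʳ _) (trans (*-identityʳ _) (*-identityʳ _)))))

bd-E : PolyBounded (λ _ E → E)
bd-E = 1 , 0 , 1 , λ M E → ≤-trans (n≤1+n E) (≤-reflexive (sym (trans (+-identityʳ _) (trans (+-identityʳ _) (*-identityʳ _)))))

-- Adding the exponents is a crude common bound for both monomials; it is valid because the bases
-- `suc M` and `suc E` are at least 1.
bd-+ : ∀ {f g} → PolyBounded f → PolyBounded g → PolyBounded (λ M E → f M E + g M E)
bd-+ (c , d , e , p) (c′ , d′ , e′ , p′) = c + c′ , d + d′ , e + e′ , λ M E →
  ≤-trans (+-mono-≤ (≤-trans (p M E) (*-monoʳ-≤ c (*-mono-≤ (^-monoʳ-≤ (suc M) (m≤m+n d d′)) (^-monoʳ-≤ (suc E) (m≤m+n e e′)))))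
                    (≤-trans (p′ M E) (*-monoʳ-≤ c′ (*-mono-≤ (^-monoʳ-≤ (suc M) (m≤n+m d′ d)) (^-monoʳ-≤ (suc E) (m≤n+m e′ e))))))
          (≤-reflexive (sym (*-distribʳ-+ _ c c′)))

bd-* : ∀ {f g} → PolyBounded f → PolyBounded g → PolyBounded (λ M E → f M E * g M E)
bd-* (c , d , e , p) (c′ , d′ , e′ , p′) = c * c′ , d + d′ , e + e′ , λ M E →
  ≤-trans (*-mono-≤ (p M E) (p′ M E)) (≤-reflexive
    (trans (re c c′ (suc M ^ d) (suc E ^ e) (suc M ^ d′) (suc E ^ e′))
      (cong₂ (λ x y → c * c′ * (x * y)) (sym (^-distribˡ-+-* (suc M) d d′)) (sym (^-distribˡ-+-* (suc E) e e′)))))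
  where
  open +-*-Solver
  re : ∀ c c′ a b a′ b′ → c * (a * b) * (c′ * (a′ * b′)) ≡ c * c′ * (a * a′ * (b * b′))
  re = solve 6 (λ c c′ a b a′ b′ → c :* (a :* b) :* (c′ :* (a′ :* b′)) := c :* c′ :* (a :* a′ :* (b :* b′))) refl

bd-suc : ∀ {f} → PolyBounded f → PolyBounded (λ M E → suc (f M E))
bd-suc = bd-+ (bd-const 1)

bd-loop : ∀ {f g} → PolyBounded f → PolyBounded g → PolyBounded (λ M E → loopCost (f M E) (g M E))
bd-loop f g = bd-suc (bd-suc (bd-* f (bd-suc (bd-+ g (bd-const 1)))))

bd-cost : ∀ {t g} (e : Ex t g) → PolyBounded (λ M _ → cost e M)
bd-cost (lit′ _)     = bd-const 1
bd-cost #n           = bd-const 1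
bd-cost #k           = bd-const 1
bd-cost #M           = bd-const 1
bd-cost (inp e)      = bd-+ (bd-cost e) (bd-const 3)
bd-cost (ix _)       = bd-const 1
bd-cost (rd _ _ _ _) = bd-const 1
bd-cost (e ⊞ f)      = bd-+ (bd-cost e) (bd-+ (bd-cost f) (bd-const 1))
bd-cost (e ⊟ f)      = bd-+ (bd-cost e) (bd-+ (bd-cost f) (bd-const 1))
bd-cost (ite b e f)  = bd-+ (bd-cost b) (bd-suc (bd-+ (bd-cost e) (bd-cost f)))
bd-cost (e ⊲ f)      = bd-+ (bd-cost e) (bd-+ (bd-cost f) (bd-const 3))
bd-cost (e ≐ f)      = bd-+ (bd-cost e) (bd-+ (bd-cost f) (bd-const 3))
bd-cost (e && f)     = bd-+ (bd-cost e) (bd-suc (bd-+ (bd-cost f) (bd-const 1)))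
bd-cost (e || f)     = bd-+ (bd-cost e) (bd-suc (bd-suc (bd-cost f)))
bd-cost (neg e)      = bd-+ (bd-cost e) (bd-const 1)
bd-cost (Σ̂ e)        = bd-suc (bd-suc (bd-suc (bd-* bd-M (bd-suc (bd-+ (bd-cost e) (bd-const 2))))))
bd-cost (∃̂ e)        = bd-suc (bd-suc (bd-suc (bd-* bd-M (bd-suc (bd-+ (bd-cost e) (bd-const 4))))))

bd-costS : ∀ s → PolyBounded (costS s)
bd-costS (assign t a e) = bd-+ (bd-loop bd-M (bd-loop bd-M (bd-+ (bd-cost e) (bd-const 1))))
                               (bd-loop bd-M (bd-loop bd-M (bd-const 1)))
bd-costS (s ⍮ s′)       = bd-+ (bd-costS s) (bd-costS s′)
bd-costS (loop s)       = bd-loop bd-M (bd-costS s)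
bd-costS (rep s)        = bd-loop bd-E (bd-costS s)

-- The number of advice strings: base 2k + 4, length 8k + 6.
strings : ℕ → ℕ
strings k = (2 * k + 4) ^ (8 * k + 6)

timeBound : ℕ → ℕ → Stm → Stm → ℕ → ℕ
timeBound n M s₁ s₂ E = preCost n M + (costS s₁ M 0 + (1 + (costS s₂ M E + postCost n)))

preCost-mono : ∀ {n m} M → n ≤ m → preCost n M ≤ preCost m M
preCost-mono M h = +-monoˡ-≤ (1 + (1 + (1 + (1 + (1 + (suc (M * 4) + 1))))))
  (s≤s (+-monoˡ-≤ 1 (+-monoʳ-≤ 2 (+-monoˡ-≤ 1 (s≤s (*-monoˡ-≤ 3 h))))))

postCost-mono : ∀ {n m} → n ≤ m → postCost n ≤ postCost m
postCost-mono h = +-monoʳ-≤ 1 (+-monoˡ-≤ 2 (s≤s (*-monoˡ-≤ 5 h)))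

bd-time : ∀ s₁ s₂ → PolyBounded (λ M E → timeBound M M s₁ s₂ E)
bd-time s₁ s₂ = bd-+ bound₁ (bd-+ bound₀ (bd-suc (bd-+ (bd-costS s₂) bound₂)))
  where
  bound₁ : PolyBounded (λ M _ → preCost M M)
  bound₁ = bd-+ (bd-suc (bd-+ (bd-suc (bd-suc (bd-+ (bd-suc (bd-* bd-M (bd-const 3))) (bd-const 1)))) (bd-const 1)))
                (bd-suc (bd-suc (bd-suc (bd-suc (bd-suc (bd-+ (bd-suc (bd-* bd-M (bd-const 4))) (bd-const 1)))))))
  bound₂ : PolyBounded (λ M _ → postCost M)
  bound₂ = bd-suc (bd-+ (bd-suc (bd-* bd-M (bd-const 5))) (bd-const 2))
  bound₀ : PolyBounded (λ M _ → costS s₁ M 0)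
  bound₀ = let (c , d , e , p) = bd-costS s₁ in
    c , d , 0 , λ M E → ≤-trans (p M 0) (≤-reflexive (cong (λ x → c * (suc M ^ d * x)) (^-zeroˡ e)))

-- 2k + 4 ≤ k³ for k ≥ 2, and only finitely many values of k remain.
power-bound : ∀ d e → ∃[ a ] ∃[ b ] (∀ k → (2 * k + 4) ^ ((8 * k + 7) * e + d) ≤ a * k ^ (b * k))
-- The constant is the left-hand side at `k = 1`, where the base is 6 and the exponent `15 * e + d`.
-- It also covers `k = 0`, where the power of `k` is `0 ^ 0 = 1`. The factor 3 comes from the cube
-- that bounds the base.
power-bound d e = 6 ^ (15 * e + d) , 3 * (15 * e + d) , bound
  where
  open +-*-Solver
  bound : ∀ k → (2 * k + 4) ^ ((8 * k + 7) * e + d) ≤ 6 ^ (15 * e + d) * k ^ (3 * (15 * e + d) * k)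
  bound zero = ≤-trans (≤-trans (^-monoˡ-≤ (7 * e + d) (≤ᵇ⇒≤ 4 6 tt)) (^-monoʳ-≤ 6 (+-monoˡ-≤ d (*-monoˡ-≤ e (≤ᵇ⇒≤ 7 15 tt)))))
    (≤-reflexive (trans (sym (*-identityʳ _)) (cong (λ x → 6 ^ (15 * e + d) * 0 ^ x) (sym (*-zeroʳ (3 * (15 * e + d)))))))
  bound (suc zero) = ≤-reflexive (trans (sym (*-identityʳ _)) (cong (6 ^ (15 * e + d) *_) (sym (^-zeroˡ (3 * (15 * e + d) * 1)))))
  bound k@(suc (suc j)) = ≤-trans (^-monoˡ-≤ ((8 * k + 7) * e + d) cube)
    (≤-trans (≤-reflexive (^-*-assoc k 3 ((8 * k + 7) * e + d)))
    (≤-trans (^-monoʳ-≤ k (≤-trans (*-monoʳ-≤ 3 exponent) (≤-reflexive (sym (*-assoc 3 (15 * e + d) k)))))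
      (m≤n*m (k ^ (3 * (15 * e + d) * k)) (6 ^ (15 * e + d)) {{>-nonZero (m^n>0 6 (15 * e + d))}})))
    where
    cube : 2 * k + 4 ≤ k ^ 3
    cube = ≤-trans (m≤m+n (2 * k + 4) (10 * j + 6 * (j * j) + j * (j * j)))
      (≤-reflexive (solve 1 (λ j → con 2 :* (con 2 :+ j) :+ con 4 :+ (con 10 :* j :+ con 6 :* (j :* j) :+ j :* (j :* j))
                                := (con 2 :+ j) :* ((con 2 :+ j) :* ((con 2 :+ j) :* con 1))) refl j))
    exponent : (8 * k + 7) * e + d ≤ (15 * e + d) * k
    exponent = ≤-trans (m≤m+n _ (7 * (suc j * e) + suc j * d))
      (≤-reflexive (solve 3 (λ j d e → (con 8 :* (con 2 :+ j) :+ con 7) :* e :+ d :+ (con 7 :* ((con 1 :+ j) :* e) :+ (con 1 :+ j) :* d)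
                                := (con 15 :* e :+ d) :* (con 2 :+ j)) refl j d e))

^-distrib-* : ∀ d m n → (m * n) ^ d ≡ m ^ d * n ^ d
^-distrib-* zero    m n = refl
^-distrib-* (suc d) m n = trans (cong (m * n *_) (^-distrib-* d m n))
  (solve 4 (λ m n x y → m :* n :* (x :* y) := m :* x :* (n :* y)) refl m n (m ^ d) (n ^ d))
  where open +-*-Solver

final-bound : ∀ s₁ s₂ → ∃[ a ] ∃[ b ] ∃[ c ] (∀ n k E → E ≤ strings k →
              timeBound n (memSize n k) s₁ s₂ E ≤ a * k ^ (b * k) * suc n ^ c)
final-bound s₁ s₂ = combine (bd-time s₁ s₂)
  where
  open +-*-Solver
  combine : PolyBounded (λ M E → timeBound M M s₁ s₂ E) → ∃[ a ] ∃[ b ] ∃[ c ] (∀ n k E → E ≤ strings k →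
              timeBound n (memSize n k) s₁ s₂ E ≤ a * k ^ (b * k) * suc n ^ c)
  combine (c , d , e , p) = c * 9 ^ d * a , b , d , bound
    where
    a b : ℕ
    a = proj₁ (power-bound d e)
    b = proj₁ (proj₂ (power-bound d e))
    bound : ∀ n k E → E ≤ strings k → timeBound n (memSize n k) s₁ s₂ E ≤ c * 9 ^ d * a * k ^ (b * k) * suc n ^ d
    bound n k E h = begin
      timeBound n M s₁ s₂ E                              ≤⟨ +-mono-≤ (preCost-mono M n≤M) (+-monoʳ-≤ (costS s₁ M 0) (+-monoʳ-≤ 1 (+-monoʳ-≤ (costS s₂ M E) (postCost-mono n≤M)))) ⟩
      timeBound M M s₁ s₂ E                              ≤⟨ p M E ⟩
      c * (suc M ^ d * suc E ^ e)                        ≤⟨ *-monoʳ-≤ c (*-mono-≤ (^-monoˡ-≤ d sucM) (^-monoˡ-≤ e sucE)) ⟩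
      c * ((9 * (suc n * X)) ^ d * (X ^ (8 * k + 7)) ^ e) ≡⟨ cong (c *_) (cong₂ _*_ (trans (^-distrib-* d 9 (suc n * X)) (cong (9 ^ d *_) (^-distrib-* d (suc n) X))) (^-*-assoc X (8 * k + 7) e)) ⟩
      c * (9 ^ d * (suc n ^ d * X ^ d) * X ^ ((8 * k + 7) * e)) ≡⟨ re c (9 ^ d) (suc n ^ d) (X ^ d) (X ^ ((8 * k + 7) * e)) ⟩
      c * 9 ^ d * (X ^ ((8 * k + 7) * e) * X ^ d) * suc n ^ d   ≡⟨ cong (λ x → c * 9 ^ d * x * suc n ^ d) (^-distribˡ-+-* X ((8 * k + 7) * e) d) ⟨
      c * 9 ^ d * X ^ ((8 * k + 7) * e + d) * suc n ^ d  ≤⟨ *-monoˡ-≤ (suc n ^ d) (*-monoʳ-≤ (c * 9 ^ d) (proj₂ (proj₂ (power-bound d e)) k)) ⟩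
      c * 9 ^ d * (a * k ^ (b * k)) * suc n ^ d          ≡⟨ cong (_* suc n ^ d) (*-assoc (c * 9 ^ d) a (k ^ (b * k))) ⟨
      c * 9 ^ d * a * k ^ (b * k) * suc n ^ d            ∎
      where
      open ≤-Reasoning
      M X : ℕ
      M = memSize n k
      X = 2 * k + 4
      1≤X : 1 ≤ X
      1≤X = ≤-trans (s≤s z≤n) (m≤n+m 4 (2 * k))
      re : ∀ c p s x y → c * (p * (s * x) * y) ≡ c * p * (y * x) * s
      re = solve 5 (λ c p s x y → c :* (p :* (s :* x) :* y) := c :* p :* (y :* x) :* s) refl
      -- `M` is linear in `n` and `k`; as `suc n` and `X` are positive, their product dominates
      -- both.
      sucM : suc M ≤ 9 * (suc n * X)
      sucM = ≤-trans (m≤m+n (suc M) (34 * n + 10 * k + 27 + 18 * (n * k))) (≤-reflexive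
        (solve 2 (λ n k → con 1 :+ (con 2 :* n :+ con 8 :* k :+ con 8) :+ (con 34 :* n :+ con 10 :* k :+ con 27 :+ con 18 :* (n :* k))
                   := con 9 :* ((con 1 :+ n) :* (con 2 :* k :+ con 4))) refl n k))
      -- The successor at most doubles the number of strings, and one further factor `X` absorbs
      -- this.
      sucE : suc E ≤ X ^ (8 * k + 7)
      sucE = begin
        suc E                     ≤⟨ +-mono-≤ (m^n>0 X {{>-nonZero 1≤X}} (8 * k + 6)) h ⟩
        strings k + strings k     ≡⟨ cong (strings k +_) (+-identityʳ (strings k)) ⟨
        2 * strings k             ≤⟨ *-monoˡ-≤ (strings k) (≤-trans (s≤s (s≤s z≤n)) (m≤n+m 4 (2 * k))) ⟩
        X ^ suc (8 * k + 6)       ≡⟨ cong (X ^_) (+-suc (8 * k) 6) ⟨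
        X ^ (8 * k + 7)           ∎
      n≤M : n ≤ M
      n≤M = ≤-trans (m≤m+n n (n + 0)) (≤-trans (m≤m+n (2 * n) (8 * k)) (m≤m+n _ 8))

-- Booleans as propositions

∧ˡ : ∀ a {b} → T (a ∧ b) → T a
∧ˡ true _ = tt

∧ʳ : ∀ a {b} → T (a ∧ b) → T b
∧ʳ true h = h

∧ⁱ : ∀ {a b} → T a → T b → T (a ∧ b)
∧ⁱ {true} _ h = h

∨ˡ : ∀ {a b} → T a → T (a ∨ b)
∨ˡ {true} _ = tt

∨ʳ : ∀ a {b} → T b → T (a ∨ b)
∨ʳ true  _ = tt
∨ʳ false h = h

∨ᵉ : ∀ a {b} → T (a ∨ b) → T a ⊎ T b
∨ᵉ true  _ = inj₁ tt
∨ᵉ false h = inj₂ h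

notⁱ : ∀ {a} → ¬ T a → T (not a)
notⁱ {true}  h = h tt
notⁱ {false} h = tt

notᵉ : ∀ {a} → T (not a) → ¬ T a
notᵉ {false} _ ()

T→≡ : ∀ {b} → T b → b ≡ true
T→≡ {true} _ = refl

if-T : ∀ {A : Set} {b} {x y : A} → T b → (if b then x else y) ≡ x
if-T {b = true} _ = refl

if-F : ∀ {A : Set} {b} {x y : A} → ¬ T b → (if b then x else y) ≡ y
if-F {b = false} _ = refl
if-F {b = true}  h = ⊥-elim (h tt)

-- Finite quantifiers and sums

anyⁱ : ∀ n {p} x → x < n → T (p x) → T (any n p)
anyⁱ (suc n) {p} x x< h with m≤n⇒m<n∨m≡n (≤-pred x<)
... | inj₁ l    = ∨ˡ (anyⁱ n x l h)
... | inj₂ refl = ∨ʳ (any n p) h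

anyᵉ : ∀ n {p} → T (any n p) → ∃[ x ] x < n × T (p x)
anyᵉ (suc n) {p} h with ∨ᵉ (any n p) h
... | inj₁ l = let (x , x< , q) = anyᵉ n l in x , ≤-trans x< (n≤1+n n) , q
... | inj₂ r = n , ≤-refl , r

b2n : Bool → ℕ
b2n b = if b then 1 else 0

b2n-mono : ∀ {a b} → (T a → T b) → b2n a ≤ b2n b
b2n-mono {false} h = z≤n
b2n-mono {true} {true}  h = ≤-refl
b2n-mono {true} {false} h = ⊥-elim (h tt)

b2n≤1 : ∀ b → b2n b ≤ 1
b2n≤1 true  = ≤-refl
b2n≤1 false = z≤n

sum-mono : ∀ n {f g} → (∀ {x} → x < n → f x ≤ g x) → sum n f ≤ sum n g
sum-mono zero    h = z≤n
sum-mono (suc n) h = +-mono-≤ (sum-mono n (λ l → h (≤-trans l (n≤1+n n)))) (h ≤-refl)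

sum-cong : ∀ n {f g} → (∀ {x} → x < n → f x ≡ g x) → sum n f ≡ sum n g
sum-cong n h = ≤-antisym (sum-mono n (λ l → ≤-reflexive (h l))) (sum-mono n (λ l → ≤-reflexive (sym (h l))))

sum-+ : ∀ n f g → sum n (λ x → f x + g x) ≡ sum n f + sum n g
sum-+ zero    f g = refl
sum-+ (suc n) f g = trans (cong (_+ (f n + g n)) (sum-+ n f g)) (re (sum n f) (sum n g) (f n) (g n))
  where
  open +-*-Solver
  re : ∀ a b c d → a + b + (c + d) ≡ a + c + (b + d)
  re = solve 4 (λ a b c d → a :+ b :+ (c :+ d) := a :+ c :+ (b :+ d)) refl

sum-zero : ∀ n {f} → (∀ {x} → x < n → f x ≡ 0) → sum n f ≡ 0
sum-zero zero    h = refl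
sum-zero (suc n) h = cong₂ _+_ (sum-zero n (λ l → h (≤-trans l (n≤1+n n)))) (h ≤-refl)

sum-const : ∀ n c → sum n (λ _ → c) ≡ n * c
sum-const zero    c = refl
sum-const (suc n) c = trans (cong (_+ c) (sum-const n c)) (+-comm (n * c) c)

term≤sum : ∀ n {f} x → x < n → f x ≤ sum n f
term≤sum (suc n) {f} x x< with m≤n⇒m<n∨m≡n (≤-pred x<)
... | inj₁ l    = ≤-trans (term≤sum n x l) (m≤m+n _ _)
... | inj₂ refl = m≤n+m _ _

sum-strict : ∀ n {f g} x → x < n → (∀ {y} → y < n → f y ≤ g y) → f x < g x → sum n f < sum n g
sum-strict (suc n) x x< h l with m≤n⇒m<n∨m≡n (≤-pred x<)
... | inj₁ x<n  = +-mono-<-≤ (sum-strict n x x<n (λ y< → h (≤-trans y< (n≤1+n n))) l) (h ≤-refl)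
... | inj₂ refl = +-mono-≤-< (sum-mono n (λ y< → h (≤-trans y< (n≤1+n n)))) l

sum-delta : ∀ n {f} x → x < n → (∀ {y} → y < n → y ≢ x → f y ≡ 0) → sum n f ≡ f x
sum-delta (suc n) {f} x x< h with m≤n⇒m<n∨m≡n (≤-pred x<)
... | inj₁ l    = trans (cong₂ _+_ (sum-delta n x l (λ y< → h (≤-trans y< (n≤1+n n)))) (h ≤-refl λ { refl → n≮n _ l })) (+-identityʳ _)
... | inj₂ refl = cong (_+ f n) (sum-zero n (λ y< → h (≤-trans y< (n≤1+n n)) (<⇒≢ y<)))

count : ℕ → (ℕ → Bool) → ℕ
count n p = sum n (λ x → b2n (p x))

count-mono : ∀ n {p q} → (∀ {x} → x < n → T (p x) → T (q x)) → count n p ≤ count n q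
count-mono n h = sum-mono n (λ l → b2n-mono (h l))

count-cong : ∀ n {p q} → (∀ {x} → x < n → p x ≡ q x) → count n p ≡ count n q
count-cong n h = sum-cong n (λ l → cong b2n (h l))

b2n-T : ∀ {b} → T b → b2n b ≡ 1
b2n-T {true} _ = refl

b2n-F : ∀ {b} → ¬ T b → b2n b ≡ 0
b2n-F {false} _ = refl
b2n-F {true}  h = ⊥-elim (h tt)

count-strict : ∀ n {p q} x → x < n → (∀ {y} → y < n → T (p y) → T (q y)) → ¬ T (p x) → T (q x) → count n p < count n q
count-strict n {p} {q} x x< h np qx = sum-strict n x x< (λ l → b2n-mono (h l)) (subst₂ _<_ (sym (b2n-F np)) (sym (b2n-T qx)) (s≤s z≤n))

count-zero : ∀ n {p} → count n p ≡ 0 → ∀ {x} → x < n → ¬ T (p x)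
count-zero n e {x} l h = contradiction (≤-trans (≤-reflexive (sym (b2n-T h))) (≤-trans (term≤sum n x l) (≤-reflexive e))) λ ()

count-full : ∀ n {p} → n ≤ count n p → ∀ {x} → x < n → T (p x)
count-full n {p} h {x} l with p x in q
... | true  = tt
... | false = contradiction (≤-trans (count-strict n {p} {λ _ → true} x l (λ _ _ → tt) (subst T q) tt) (≤-reflexive (trans (sum-const n 1) (*-identityʳ n)))) (≤⇒≯ h)

count-insert : ∀ n p x → count n (λ y → p y ∨ (y ≡ᵇ x)) ≤ suc (count n p)
count-insert n p x = ≤-trans (sum-mono n {g = λ y → b2n (p y) + b2n (y ≡ᵇ x)} (λ {y} _ → or (p y) (y ≡ᵇ x)))
  (≤-trans (≤-reflexive (sum-+ n _ _)) (≤-trans (+-monoʳ-≤ (count n p) (single n)) (≤-reflexive (+-comm (count n p) 1))))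
  where
  or : ∀ a b → b2n (a ∨ b) ≤ b2n a + b2n b
  or true  b = s≤s z≤n
  or false b = ≤-refl
  single : ∀ n → sum n (λ y → b2n (y ≡ᵇ x)) ≤ 1
  single n with x <? n
  ... | yes l = ≤-trans (≤-reflexive (sum-delta n x l (λ {y} _ ne → b2n-F (λ h → ne (≡ᵇ⇒≡ y x h))))) (b2n≤1 (x ≡ᵇ x))
  ... | no  l = ≤-trans (≤-reflexive (sum-zero n (λ {y} y< → b2n-F (λ h → l (subst (_< n) (≡ᵇ⇒≡ y x h) y<))))) z≤n

-- The least number with property `p`. It is written as a sum with at most one nonzero term because
-- this is what the expression `firstE` evaluates to.
first : ℕ → (ℕ → Bool) → ℕ
first n p = sum n (λ x → if p x ∧ not (any n (λ y → (y <ᵇ x) ∧ p y)) then x else 0)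

first-ok : ∀ n {p} → T (any n p) → first n p < n × T (p (first n p))
first-ok n {p} h = least n ≤-refl h
  where
  least : ∀ m → m ≤ n → T (any m p) → first n p < n × T (p (first n p))
  least (suc m) m< h with T? (any m p)
  ... | yes q = least m (≤-trans (n≤1+n m) m<) q
  ... | no  q = subst (λ y → y < n × T (p y)) (sym e) (m< , pm)
    where
    pm : T (p m)
    pm = [ (λ u → ⊥-elim (q u)) , id ]′ (∨ᵉ (any m p) h)
    is : T (p m ∧ not (any n (λ y → (y <ᵇ m) ∧ p y)))
    is = ∧ⁱ pm (notⁱ λ u → let (y , _ , w) = anyᵉ n {λ y → (y <ᵇ m) ∧ p y} u in q (anyⁱ m y (<ᵇ⇒< y m (∧ˡ (y <ᵇ m) w)) (∧ʳ (y <ᵇ m) w)))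
    isn't : ∀ {y} → y < n → y ≢ m → ¬ T (p y ∧ not (any n (λ x → (x <ᵇ y) ∧ p x)))
    isn't {y} y< ne u with <-cmp y m
    ... | tri< l _ _ = q (anyⁱ m y l (∧ˡ (p y) u))
    ... | tri≈ _ e _ = ne e
    ... | tri> _ _ l = notᵉ (∧ʳ (p y) u) (anyⁱ n m m< (∧ⁱ (<⇒<ᵇ l) pm))
    e : first n p ≡ m
    e = trans (sum-delta n m m< (λ {y} y< ne → if-F (isn't y< ne))) (if-T is)

iter-ind : ∀ {A : Set} (P : ℕ → A → Set) {f : A → A} n {x} → P 0 x → (∀ {i y} → i < n → P i y → P (suc i) (f y)) → P n (iter n f x)
iter-ind P zero    p s = p
iter-ind P (suc n) p s = s ≤-refl (iter-ind P n p (λ l → s (≤-trans l (n≤1+n n))))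

-- Which arrays a program reads and writes

sameArray : Ty → ℕ → Ty → ℕ → Bool
sameArray nat  a nat  b = a ≡ᵇ b
sameArray bool a bool b = a ≡ᵇ b
sameArray nat  a bool b = false
sameArray bool a nat  b = false

reads : ∀ {t g} → Ty → ℕ → Ex t g → Bool
reads t a (lit′ _)     = false
reads t a #n           = false
reads t a #k           = false
reads t a #M           = false
reads t a (inp e)      = reads t a e
reads t a (ix _)       = false
reads t a (rd t′ b _ _) = sameArray t′ b t a
reads t a (e ⊞ f)      = reads t a e ∨ reads t a f
reads t a (e ⊟ f)      = reads t a e ∨ reads t a f
reads t a (ite b e f)  = reads t a b ∨ (reads t a e ∨ reads t a f)
reads t a (e ⊲ f)      = reads t a e ∨ reads t a f
reads t a (e ≐ f)      = reads t a e ∨ reads t a f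
reads t a (e && f)     = reads t a e ∨ reads t a f
reads t a (e || f)     = reads t a e ∨ reads t a f
reads t a (neg e)      = reads t a e
reads t a (Σ̂ e)        = reads t a e
reads t a (∃̂ e)        = reads t a e

readsS : Ty → ℕ → Stm → Bool
readsS t a (assign _ _ e) = reads t a e
readsS t a (s ⍮ s′)       = readsS t a s ∨ readsS t a s′
readsS t a (loop s)       = readsS t a s
readsS t a (rep s)        = readsS t a s

writes : Ty → ℕ → Stm → Bool
writes t a (assign t′ b _) = sameArray t′ b t a
writes t a (s ⍮ s′)        = writes t a s ∨ writes t a s′
writes t a (loop s)        = writes t a s
writes t a (rep s)         = writes t a s

any-cong : ∀ n {p q : ℕ → Bool} → (∀ x → p x ≡ q x) → any n p ≡ any n q
any-cong zero    h = refl
any-cong (suc n) h = cong₂ _∨_ (any-cong n h) (h n)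

if-cong : ∀ {A : Set} {b b′ : Bool} {x x′ y y′ : A} → b ≡ b′ → x ≡ x′ → y ≡ y′ →
          (if b then x else y) ≡ (if b′ then x′ else y′)
if-cong refl refl refl = refl

upd-frame : ∀ st t a f t′ b → ¬ T (sameArray t a t′ b) → upd st t a f t′ b ≡ st t′ b
upd-frame st nat  a f bool b h = refl
upd-frame st bool a f nat  b h = refl
upd-frame st nat  a f nat  b h with b ≡ᵇ a in q
... | false = refl
... | true  = ⊥-elim (h (subst T (sym (cong (a ≡ᵇ_) (≡ᵇ⇒≡ b a (subst T (sym q) tt)))) (≡⇒≡ᵇ a a refl)))
upd-frame st bool a f bool b h with b ≡ᵇ a in q
... | false = refl
... | true  = ⊥-elim (h (subst T (sym (cong (a ≡ᵇ_) (≡ᵇ⇒≡ b a (subst T (sym q) tt)))) (≡⇒≡ᵇ a a refl)))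

-- Agreement outside a single array. It is used for the advice, whose strings are to be exchanged,
-- and for the digit read last.
Agree : Ty → ℕ → State → State → Set
Agree t a st st′ = ∀ t′ b → ¬ T (sameArray t′ b t a) → ∀ i j → st t′ b i j ≡ st′ t′ b i j

upd-agree : ∀ {t a st st′} t′ b f f′ → Agree t a st st′ → (∀ i j → f i j ≡ f′ i j) →
            Agree t a (upd st t′ b f) (upd st′ t′ b f′)
upd-agree nat  b f f′ A h bool c n = A bool c n
upd-agree bool b f f′ A h nat  c n = A nat c n
upd-agree nat  b f f′ A h nat  c n with c ≡ᵇ b
... | true  = h
... | false = A nat c n
upd-agree bool b f f′ A h bool c n with c ≡ᵇ b
... | true  = h
... | false = A bool c n

module Logic (C : Context) where
  open Context C
  open Semantics C

  -- The propositional reading of a Boolean expression: facts about a program are extracted from its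
  -- text by `to` and established by `from`.
  Holds : ∀ {g} → State → Vec ℕ g → Ex bool g → Set
  Holds st ρ (rd _ a i j) = T (st bool a (ixv ρ i) (ixv ρ j))
  Holds st ρ (ite b e f)  = Holds st ρ b × Holds st ρ e ⊎ (¬ Holds st ρ b) × Holds st ρ f
  Holds st ρ (e ⊲ f)      = eval st ρ e < eval st ρ f
  Holds st ρ (e ≐ f)      = eval st ρ e ≡ eval st ρ f
  Holds st ρ (e && f)     = Holds st ρ e × Holds st ρ f
  Holds st ρ (e || f)     = Holds st ρ e ⊎ Holds st ρ f
  Holds st ρ (neg e)      = ¬ Holds st ρ e
  Holds st ρ (∃̂ e)        = ∃[ x ] x < cM × Holds st (x ∷ ρ) e

  to   : ∀ {g} st (ρ : Vec ℕ g) e → T (eval st ρ e) → Holds st ρ e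
  from : ∀ {g} st (ρ : Vec ℕ g) e → Holds st ρ e → T (eval st ρ e)

  to st ρ (rd _ a i j) h = h
  to st ρ (ite b e f) h with eval st ρ b in q
  ... | true  = inj₁ (to st ρ b (subst T (sym q) tt) , to st ρ e h)
  ... | false = inj₂ ((λ u → subst T q (from st ρ b u)) , to st ρ f h)
  to st ρ (e ⊲ f)  h = <ᵇ⇒< _ _ h
  to st ρ (e ≐ f)  h = ≡ᵇ⇒≡ _ _ h
  to st ρ (e && f) h = to st ρ e (∧ˡ (eval st ρ e) h) , to st ρ f (∧ʳ (eval st ρ e) h)
  to st ρ (e || f) h with ∨ᵉ (eval st ρ e) h
  ... | inj₁ u = inj₁ (to st ρ e u)
  ... | inj₂ u = inj₂ (to st ρ f u)
  to st ρ (neg e)  h = λ u → notᵉ h (from st ρ e u)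
  to st ρ (∃̂ e)    h with anyᵉ cM {λ x → eval st (x ∷ ρ) e} h
  ... | x , x< , u = x , x< , to st (x ∷ ρ) e u

  from st ρ (rd _ a i j) h = h
  from st ρ (ite b e f) h with eval st ρ b in q | h
  ... | true  | inj₁ (_ , u) = from st ρ e u
  ... | true  | inj₂ (n , _) = ⊥-elim (n (to st ρ b (subst T (sym q) tt)))
  ... | false | inj₁ (u , _) = ⊥-elim (subst T q (from st ρ b u))
  ... | false | inj₂ (_ , u) = from st ρ f u
  from st ρ (e ⊲ f)  h = <⇒<ᵇ h
  from st ρ (e ≐ f)  h = ≡⇒≡ᵇ _ _ h
  from st ρ (e && f) (h , u) = ∧ⁱ (from st ρ e h) (from st ρ f u)
  from st ρ (e || f) (inj₁ h) = ∨ˡ (from st ρ e h)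
  from st ρ (e || f) (inj₂ h) = ∨ʳ (eval st ρ e) (from st ρ f h)
  from st ρ (neg e)  h = notⁱ λ u → h (to st ρ e u)
  from st ρ (∃̂ e)    (x , x< , u) = anyⁱ cM {λ x → eval st (x ∷ ρ) e} x x< (from st (x ∷ ρ) e u)

  frame : ∀ s st t a → ¬ T (writes t a s) → run s st t a ≡ st t a
  frame (assign t′ b e) st t a h = upd-frame st t′ b _ t a h
  frame (s ⍮ s′) st t a h = trans (frame s′ (run s st) t a (λ u → h (∨ʳ (writes t a s) u))) (frame s st t a (λ u → h (∨ˡ u)))
  frame (loop s) st t a h = iter-ind (λ _ st′ → st′ t a ≡ st t a) cM refl (λ {_} {st′} _ p → trans (frame s st′ t a h) p)
  frame (rep s)  st t a h = iter-ind (λ _ st′ → st′ t a ≡ st t a) cE refl (λ {_} {st′} _ p → trans (frame s st′ t a h) p)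

  eval-agree : ∀ {t a st st′} → Agree t a st st′ → ∀ {t′ g} (e : Ex t′ g) (ρ : Vec ℕ g) → ¬ T (reads t a e) → eval st ρ e ≡ eval st′ ρ e
  eval-agree A (lit′ _) ρ h = refl
  eval-agree A #n ρ h = refl
  eval-agree A #k ρ h = refl
  eval-agree A #M ρ h = refl
  eval-agree A (inp e) ρ h = cong (λ x → if x <ᵇ cI then input x else 0) (eval-agree A e ρ h)
  eval-agree A (ix _) ρ h = refl
  eval-agree A (rd t b i j) ρ h = A t b h _ _
  eval-agree A (e ⊞ f) ρ h = cong₂ _+_ (eval-agree A e ρ (h ∘ ∨ˡ)) (eval-agree A f ρ (h ∘ ∨ʳ _))
  eval-agree A (e ⊟ f) ρ h = cong₂ _∸_ (eval-agree A e ρ (h ∘ ∨ˡ)) (eval-agree A f ρ (h ∘ ∨ʳ _))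
  eval-agree {t} {a} A (ite b e f) ρ h = if-cong (eval-agree A b ρ (h ∘ ∨ˡ))
    (eval-agree A e ρ (h ∘ ∨ʳ (reads t a b) ∘ ∨ˡ)) (eval-agree A f ρ (h ∘ ∨ʳ (reads t a b) ∘ ∨ʳ (reads t a e)))
  eval-agree A (e ⊲ f) ρ h = cong₂ _<ᵇ_ (eval-agree A e ρ (h ∘ ∨ˡ)) (eval-agree A f ρ (h ∘ ∨ʳ _))
  eval-agree A (e ≐ f) ρ h = cong₂ _≡ᵇ_ (eval-agree A e ρ (h ∘ ∨ˡ)) (eval-agree A f ρ (h ∘ ∨ʳ _))
  eval-agree A (e && f) ρ h = cong₂ _∧_ (eval-agree A e ρ (h ∘ ∨ˡ)) (eval-agree A f ρ (h ∘ ∨ʳ _))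
  eval-agree A (e || f) ρ h = cong₂ _∨_ (eval-agree A e ρ (h ∘ ∨ˡ)) (eval-agree A f ρ (h ∘ ∨ʳ _))
  eval-agree A (neg e) ρ h = cong not (eval-agree A e ρ h)
  eval-agree A (Σ̂ e) ρ h = sum-cong cM (λ {x} _ → eval-agree A e (x ∷ ρ) h)
  eval-agree A (∃̂ e) ρ h = any-cong cM (λ x → eval-agree A e (x ∷ ρ) h)

  run-agree : ∀ {t a st st′} → Agree t a st st′ → ∀ s → ¬ T (readsS t a s) → Agree t a (run s st) (run s st′)
  run-agree A (assign t b e) h = upd-agree t b _ _ A (λ i j → eval-agree A e (j ∷ i ∷ []) h)
  run-agree {t} {a} A (s ⍮ s′) h = run-agree (run-agree A s (h ∘ ∨ˡ)) s′ (h ∘ ∨ʳ (readsS t a s))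
  run-agree {t} {a} {st} {st′} A (loop s) h = go cM
    where
    go : ∀ m → Agree t a (iter m (run s) st) (iter m (run s) st′)
    go zero    = A
    go (suc m) = run-agree (go m) s h
  run-agree {t} {a} {st} {st′} A (rep s) h = go cE
    where
    go : ∀ m → Agree t a (iter m (run s) st) (iter m (run s) st′)
    go zero    = A
    go (suc m) = run-agree (go m) s h

-- Arrays of the algorithm. Compression: W is the solution to be replaced, DEL the
-- candidate under construction, BEST the last verified candidate. Advice: LAB
-- holds the labels of W (0: delete), DG the digit read at position PT < LIM.
-- Cuts: in GR, from SS to AA, avoiding UU; AX and DS are the sinks added by
-- former digits. VS and VT are the endpoints of an unsolved request.

ARC REQ W BEST FOUND OK DEL AX GC TC GR SS AA UU SRC SNK RCH GO YS HAS HH G2 DIR DS VI VIO MV FB : ℕ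
ARC = 0
REQ = 1
W = 2
BEST = 3
FOUND = 4
OK = 5
DEL = 6
AX = 7
GC = 8
TC = 9
GR = 10
SS = 11
AA = 12
UU = 13
SRC = 14
SNK = 15
RCH = 16
GO = 17
YS = 18
HAS = 19
HH = 20
G2 = 21
DIR = 22
DS = 23
VI = 24
VIO = 25
MV = 26
FB = 27

ADV LAB LEV PT ROW CAP DIST CU NX PK CNT DG EE VS VT : ℕ
ADV = 0
LAB = 1
LEV = 2
PT = 3
ROW = 4
CAP = 5
DIST = 6
CU = 7
NX = 8
PK = 9
CNT = 10
DG = 11
EE = 12
VS = 13
VT = 14

-- De Bruijn indices: in an assigned expression, 0 is the column and 1 the row.

x₀ : ∀ {g} → Ix (suc g)
x₀ = v zero
x₁ : ∀ {g} → Ix (suc (suc g))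
x₁ = v (suc zero)
x₂ : ∀ {g} → Ix (suc (suc (suc g)))
x₂ = v (suc (suc zero))
n₀ : ∀ {g} → Ex nat (suc g)
n₀ = ix zero
n₁ : ∀ {g} → Ex nat (suc (suc g))
n₁ = ix (suc zero)
n₂ : ∀ {g} → Ex nat (suc (suc (suc g)))
n₂ = ix (suc (suc zero))

bm : ∀ {g} → ℕ → Ix g → Ix g → Ex bool g
bm a i j = rd bool a i j
br : ∀ {g} → ℕ → Ix g → Ex bool g
br a j = rd bool a z j
bs : ∀ {g} → ℕ → Ex bool g
bs a = rd bool a z z
nm : ∀ {g} → ℕ → Ix g → Ix g → Ex nat g
nm a i j = rd nat a i j
nr : ∀ {g} → ℕ → Ix g → Ex nat g
nr a j = rd nat a z j
ns : ∀ {g} → ℕ → Ex nat g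
ns a = rd nat a z z

Reach : (ℕ → ℕ → Bool) → ℕ → ℕ → Set
Reach g = Star (λ u w → T (g u w))

-- Transitive closure by Warshall's algorithm

closeInit closeStep : Ex bool 2
closeInit = n₁ ≐ n₀ || bm GC x₁ x₀
closeStep = bm TC x₁ x₀ || ∃̂ (n₀ ≐ ns CNT && bm TC x₂ x₀ && bm TC x₀ x₁)

closeBody CLOSE : Stm
closeBody = assign bool TC closeStep ⍮ assign nat CNT (ns CNT ⊞ lit′ 1)
CLOSE = assign bool TC closeInit ⍮ assign nat CNT (lit′ 0) ⍮ loop closeBody

module Closure (C : Context) where
  open Context C renaming (cM to M)
  open Semantics C
  open Logic C

  record Closed (g t : ℕ → ℕ → Bool) : Set where
    field
      sound    : ∀ {u w} → T (t u w) → Reach g u w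
      complete : (∀ {u w} → T (g u w) → u < M × w < M) → ∀ {u w} → Reach g u w → T (t u w)

  close-ok : ∀ st → Closed (st bool GC) (run CLOSE st bool TC)
  close-ok st = record { sound = Inv.s final ; complete = complete }
    where
    g = st bool GC
    init = run (assign bool TC closeInit ⍮ assign nat CNT (lit′ 0)) st
    record Inv (k : ℕ) (st′ : State) : Set where
      pattern
      constructor inv
      field
        counter : st′ nat CNT 0 0 ≡ k
        s : ∀ {u w} → T (st′ bool TC u w) → Reach g u w
        b : ∀ {u w} → u ≡ w ⊎ T (g u w) → T (st′ bool TC u w)
        -- Instead of walks with inner vertices below `k`, the invariant has transitivity through
        -- the vertices below `k`. At `k = M` this joins any walk whose arcs are bounded by `M`.
        t : ∀ {u x w} → x < k → T (st′ bool TC u x) → T (st′ bool TC x w) → T (st′ bool TC u w)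
    step : ∀ {k y} → k < M → Inv k y → Inv (suc k) (run closeBody y)
    step {k} {y} k< (inv c s b t) = inv (trans (cong (_+ 1) c) (+-comm k 1)) s′ (λ h → old (b h)) t′
      where
      old : ∀ {u w} → T (y bool TC u w) → T (run closeBody y bool TC u w)
      old {u} {w} h = from y (w ∷ u ∷ []) closeStep (inj₁ h)
      via : ∀ {u w} → T (y bool TC u k) → T (y bool TC k w) → T (run closeBody y bool TC u w)
      via {u} {w} h h′ = from y (w ∷ u ∷ []) closeStep (inj₂ (k , k< , sym c , h , h′))
      cases : ∀ {u w} → T (run closeBody y bool TC u w) → T (y bool TC u w) ⊎ T (y bool TC u k) × T (y bool TC k w)
      cases {u} {w} h with to y (w ∷ u ∷ []) closeStep h
      ... | inj₁ p = inj₁ p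
      ... | inj₂ (x , _ , e , p , q) with trans e c
      ...   | refl = inj₂ (p , q)
      s′ : ∀ {u w} → T (run closeBody y bool TC u w) → Reach g u w
      s′ {u} {w} h with cases {u} {w} h
      ... | inj₁ p       = s p
      ... | inj₂ (p , q) = s p ◅◅ s q
      -- Round `k` changes neither column `k` nor row `k`, so the new closure is expressed by the
      -- old one.
      toK : ∀ {u} → T (run closeBody y bool TC u k) → T (y bool TC u k)
      toK {u} h = [ id , proj₁ ]′ (cases {u} {k} h)
      fromK : ∀ {w} → T (run closeBody y bool TC k w) → T (y bool TC k w)
      fromK {w} h = [ id , proj₂ ]′ (cases {k} {w} h)
      t′ : ∀ {u x w} → x < suc k → T (run closeBody y bool TC u x) → T (run closeBody y bool TC x w) → T (run closeBody y bool TC u w)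
      t′ {u} {x} {w} x< h h′ with m≤n⇒m<n∨m≡n (≤-pred x<)
      ... | inj₂ refl = via {u} {w} (toK {u} h) (fromK {w} h′)
      ... | inj₁ x<k with cases {u} {x} h | cases {x} {w} h′
      ...   | inj₁ p       | inj₁ q       = old {u} {w} (t x<k p q)
      ...   | inj₁ p       | inj₂ (q , r) = via {u} {w} (t x<k p q) r
      ...   | inj₂ (p , q) | inj₁ r       = via {u} {w} p (t x<k q r)
      ...   | inj₂ (p , q) | inj₂ (r , o) = via {u} {w} p o
    final : Inv M (run CLOSE st)
    final = iter-ind Inv M {init} (inv refl
      (λ {u} {w} h → [ (λ { refl → ε }) , (λ p → p ◅ ε) ]′ (to st (w ∷ u ∷ []) closeInit h))
      (λ {u} {w} h → from st (w ∷ u ∷ []) closeInit h) (λ ())) (λ {i} {y} → step)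
    complete : (∀ {u w} → T (g u w) → u < M × w < M) → ∀ {u w} → Reach g u w → T (run CLOSE st bool TC u w)
    complete bd ε = Inv.b final (inj₁ refl)
    complete bd {u} {w} (_◅_ {j = x} e p) = Inv.t final {u} {x} {w} (proj₂ (bd e)) (Inv.b final {u} {x} (inj₂ e)) (complete bd p)

-- Minimum cuts by augmenting paths

firstE : ∀ {g} → (∀ {h} → Fin h → Ex bool h) → Ex nat g
firstE p = Σ̂ (ite (p zero && neg (∃̂ (n₀ ⊲ n₁ && p zero))) n₀ (lit′ 0))

isTarget isPred : ∀ {h} → Fin h → Ex bool h
isTarget x = br RCH (v x) && br SNK (v x)
isPred   x = br RCH (v x) && ∃̂ (n₀ ≐ ns CU && lit′ 0 ⊲ nm CAP (v (suc x)) x₀ && nr DIST (v (suc x)) ⊲ nr DIST x₀)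

bfsStep moveE goE : Ex bool 2
bfsStep = br RCH x₀ || ∃̂ (br RCH x₀ && lit′ 0 ⊲ nm CAP x₀ x₁)
goE     = ∃̂ (isTarget zero)
moveE   = bs GO && neg (∃̂ (n₀ ≐ ns CU && br SRC x₀))

pushE : Ex nat 2
pushE = ite (bs MV)
  ((nm CAP x₁ x₀ ⊞ ite (n₁ ≐ ns CU && n₀ ≐ ns NX) (lit′ 1) (lit′ 0)) ⊟ ite (n₁ ≐ ns NX && n₀ ≐ ns CU) (lit′ 1) (lit′ 0))
  (nm CAP x₁ x₀)

-- `DIST` counts the rounds in which a vertex was still unreached. `TRACE` goes back from a sink
-- along strictly decreasing `DIST` and shifts one unit of residual capacity on each arc. When there
-- is nothing to do, the remaining rounds of a loop leave the state as it is.
bfsBody BFS traceBody TRACE FLOW : Stm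
bfsBody = assign nat DIST (nr DIST x₀ ⊞ ite (br RCH x₀) (lit′ 0) (lit′ 1)) ⍮ assign bool RCH bfsStep
BFS     = assign bool RCH (br SRC x₀) ⍮ assign nat DIST (lit′ 0) ⍮ loop bfsBody
traceBody = assign nat NX (firstE isPred) ⍮ assign bool MV moveE ⍮ assign nat CAP pushE ⍮
            assign nat CU (ite (bs MV) (ns NX) (ns CU))
TRACE   = assign bool GO goE ⍮ assign nat CU (firstE isTarget) ⍮ loop traceBody
FLOW    = loop (BFS ⍮ TRACE) ⍮ BFS

-- Capacities of cuts

module Cut (M : ℕ) where

  cut : (ℕ → ℕ → ℕ) → (ℕ → Bool) → ℕ
  cut c R = sum M λ x → sum M λ y → if R x ∧ not (R y) then c x y else 0

  unit : ℕ → ℕ → ℕ → ℕ → ℕ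
  unit p q x y = if (x ≡ᵇ p) ∧ (y ≡ᵇ q) then 1 else 0

  cut-cong : ∀ {c c′} R → (∀ {x y} → x < M → y < M → c x y ≡ c′ x y) → cut c R ≡ cut c′ R
  cut-cong R h = sum-cong M λ x< → sum-cong M λ y< → cong (λ m → if _ then m else 0) (h x< y<)

  cut-+ : ∀ c d R → cut (λ x y → c x y + d x y) R ≡ cut c R + cut d R
  cut-+ c d R = trans (sum-cong M λ {x} _ → trans (sum-cong M λ {y} _ → if-+ (R x ∧ not (R y))) (sum-+ M _ _)) (sum-+ M _ _)
    where
    if-+ : ∀ b {m n} → (if b then m + n else 0) ≡ (if b then m else 0) + (if b then n else 0)
    if-+ true  = refl
    if-+ false = refl

  if-zero′ : ∀ b {m} → m ≡ 0 → (if b then m else 0) ≡ 0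
  if-zero′ true  e = e
  if-zero′ false e = refl

  cut-unit : ∀ {p q} R → p < M → q < M → cut (unit p q) R ≡ b2n (R p ∧ not (R q))
  cut-unit {p} {q} R p< q< = trans
    (sum-delta M p p< λ {x} _ ne → sum-zero M λ {y} _ → if-zero′ (R x ∧ not (R y)) (if-F λ h → ne (≡ᵇ⇒≡ x p (∧ˡ (x ≡ᵇ p) h))))
    (trans (sum-delta M q q< λ {y} _ ne → if-zero′ (R p ∧ not (R y)) (if-F λ h → ne (≡ᵇ⇒≡ y q (∧ʳ (p ≡ᵇ p) h))))
      (cong (λ m → if R p ∧ not (R q) then m else 0) (if-T (∧ⁱ (≡⇒≡ᵇ p p refl) (≡⇒≡ᵇ q q refl)))))

  -- Moving one unit of flow from q to p along a residual arc.
  cut-push : ∀ {p q} c R → p < M → q < M → p ≢ q → 0 < c q p →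
             cut (λ x y → (c x y + unit p q x y) ∸ unit q p x y) R + b2n (R q) ≡ cut c R + b2n (R p)
  cut-push {p} {q} c R p< q< p≢q pos = finish (R p) (R q) (trans
      (trans (cong (cut c′ R +_) (sym (cut-unit R q< p<))) (sym (cut-+ c′ (unit q p) R)))
      (trans (cut-cong R (λ {x} {y} _ _ → m∸n+n≡m (enough x y)))
        (trans (cut-+ c (unit p q) R) (cong (cut c R +_) (cut-unit R p< q<)))))
    where
    c′ : ℕ → ℕ → ℕ
    c′ x y = (c x y + unit p q x y) ∸ unit q p x y
    enough : ∀ x y → unit q p x y ≤ c x y + unit p q x y
    enough x y with T? ((x ≡ᵇ q) ∧ (y ≡ᵇ p))
    ... | no  h = ≤-trans (≤-reflexive (if-F h)) z≤n
    ... | yes h with ≡ᵇ⇒≡ x q (∧ˡ (x ≡ᵇ q) h) | ≡ᵇ⇒≡ y p (∧ʳ (x ≡ᵇ q) h)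
    ...   | refl | refl = ≤-trans (≤-trans (≤-reflexive (if-T h)) pos) (m≤m+n _ _)
    finish : ∀ a b → cut c′ R + b2n (b ∧ not a) ≡ cut c R + b2n (a ∧ not b) → cut c′ R + b2n b ≡ cut c R + b2n a
    finish true  true  e = cong (_+ 1) (trans (sym (+-identityʳ _)) (trans e (+-identityʳ _)))
    finish true  false e = e
    finish false true  e = e
    finish false false e = e

module Flow (C : Context) where
  open Context C renaming (cM to M)
  open Semantics C
  open Logic C
  open Cut M

  record Bfs (c : ℕ → ℕ → ℕ) (S R : ℕ → Bool) (d : ℕ → ℕ) : Set where
    field
      start  : ∀ {x} → T (S x) → T (R x)
      prev   : ∀ {x} → T (R x) → T (S x) ⊎ (∃[ y ] y < M × T (R y) × 0 < c y x × d y < d x)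
      closed : ∀ {x y} → x < M → y < M → T (R x) → 0 < c x y → T (R y)
      least  : ∀ {R′ : ℕ → Bool} → (∀ {x} → x < M → T (S x) → T (R′ x)) →
               (∀ {x y} → x < M → y < M → T (R′ x) → 0 < c x y → T (R′ y)) → ∀ {x} → x < M → T (R x) → T (R′ x)
      short  : ∀ {x} → d x ≤ M

  bfs-ok : ∀ st → Bfs (st nat CAP) (st bool SRC 0) (run BFS st bool RCH 0) (run BFS st nat DIST 0)
  bfs-ok st = record
    { start = Inv.start fin ; prev = Inv.prev fin
    ; closed = λ {x} {y} → [ (λ h → h {x} {y}) , (λ full x< y< _ _ → count-full M {run BFS st bool RCH 0} full y<) ]′ (Inv.grown fin)
    ; least = λ s c → Inv.least fin s c
    ; short = λ {x} → case T? (run BFS st bool RCH 0 x) of λ { (yes h) → Inv.near fin h ; (no h) → ≤-reflexive (Inv.far fin h) } }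
    where
    c = st nat CAP
    S = st bool SRC 0
    Closed′ : (ℕ → Bool) → Set
    Closed′ R = ∀ {x y} → x < M → y < M → T (R x) → 0 < c x y → T (R y)
    record Inv (i : ℕ) (y : State) : Set where
      field
        cap   : y nat CAP ≡ c
        start : ∀ {x} → T (S x) → T (y bool RCH 0 x)
        prev   : ∀ {x} → T (y bool RCH 0 x) → T (S x) ⊎ (∃[ u ] u < M × T (y bool RCH 0 u) × 0 < c u x × y nat DIST 0 u < y nat DIST 0 x)
        -- As long as the set is not closed, each round adds a vertex. After `M` rounds it is closed
        -- or contains everything.
        grown : Closed′ (y bool RCH 0) ⊎ i ≤ count M (y bool RCH 0)
        least : ∀ {R′ : ℕ → Bool} → (∀ {x} → x < M → T (S x) → T (R′ x)) → Closed′ R′ → ∀ {x} → x < M → T (y bool RCH 0 x) → T (R′ x)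
        far   : ∀ {x} → ¬ T (y bool RCH 0 x) → y nat DIST 0 x ≡ i
        near  : ∀ {x} → T (y bool RCH 0 x) → y nat DIST 0 x ≤ i
    step : ∀ {i y} → i < M → Inv i y → Inv (suc i) (run bfsBody y)
    step {i} {y} i< I = record
      { cap = Inv.cap I
      ; start = λ h → grow (Inv.start I h)
      ; prev = λ {x} h → case T? (R x) of λ
          { (yes p) → case Inv.prev I p of λ
              { (inj₁ s) → inj₁ s
              ; (inj₂ (u , u< , q , a , l)) → inj₂ (u , u< , grow q , a , subst₂ _<_ (sym (dist-in q)) (sym (dist-in p)) l) }
          ; (no p)  → case to y (x ∷ 0 ∷ []) bfsStep h of λ
              { (inj₁ q) → ⊥-elim (p q)
              ; (inj₂ (u , u< , q , a)) → inj₂ (u , u< , grow q , subst (λ c → 0 < c u x) (Inv.cap I) a ,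
                    subst₂ _<_ (sym (dist-in q)) (sym (dist-out p)) (s≤s (Inv.near I q))) } }
      ; grown = grown
      ; least = λ {R′} s cl {x} x< h → case to y (x ∷ 0 ∷ []) bfsStep h of λ
          { (inj₁ q) → Inv.least I s cl x< q
          ; (inj₂ (u , u< , q , a)) → cl u< x< (Inv.least I s cl u< q) (subst (λ c → 0 < c u x) (Inv.cap I) a) }
      ; far = λ {x} h → dist-out (λ q → h (grow q))
      ; near = λ {x} h → case T? (R x) of λ
          { (yes p) → ≤-trans (≤-reflexive (dist-in p)) (≤-trans (Inv.near I p) (n≤1+n i))
          ; (no p)  → ≤-reflexive (dist-out p) } }
      where
      R = y bool RCH 0
      R′ = run bfsBody y bool RCH 0
      grow : ∀ {x} → T (R x) → T (R′ x)
      grow {x} h = from y (x ∷ 0 ∷ []) bfsStep (inj₁ h)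
      dist-in : ∀ {x} → T (R x) → run bfsBody y nat DIST 0 x ≡ y nat DIST 0 x
      dist-in {x} h = trans (cong (y nat DIST 0 x +_) (if-T h)) (+-identityʳ _)
      dist-out : ∀ {x} → ¬ T (R x) → run bfsBody y nat DIST 0 x ≡ suc i
      dist-out {x} h = trans (cong₂ _+_ (Inv.far I h) (if-F h)) (+-comm i 1)
      grown : Closed′ R′ ⊎ suc i ≤ count M R′
      grown with count M R <? count M R′ | Inv.grown I
      ... | yes l | inj₂ g = inj₂ (≤-trans (s≤s g) l)
      ... | _     | inj₁ cl = inj₁ λ {x} {z} x< z< h a → grow (cl x< z< (same cl x< h) a)
        where
        same : Closed′ R → ∀ {x} → x < M → T (R′ x) → T (R x)
        same cl {x} x< h with to y (x ∷ 0 ∷ []) bfsStep h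
        ... | inj₁ q = q
        ... | inj₂ (u , u< , q , a) = cl u< x< q (subst (λ c → 0 < c u x) (Inv.cap I) a)
      ... | no l  | inj₂ _ = inj₁ λ {x} {z} x< z< h a → from y (z ∷ 0 ∷ []) bfsStep
              (inj₂ (x , x< , back x< h , subst (λ c → 0 < c x z) (sym (Inv.cap I)) a))
        where
        back : ∀ {x} → x < M → T (R′ x) → T (R x)
        back {x} x< h with T? (R x)
        ... | yes p = p
        ... | no p  = ⊥-elim (l (count-strict M {R} {R′} x x< (λ {u} _ → grow {u}) p h))
    fin : Inv M (run BFS st)
    fin = iter-ind Inv M record { cap = refl ; start = id ; prev = inj₁ ; grown = inj₂ z≤n
      ; least = λ s _ x< h → s x< h ; far = λ _ → refl ; near = λ _ → z≤n } step

  Side : (S K R : ℕ → Bool) → Set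
  Side S K R = (∀ {x} → x < M → T (S x) → T (R x)) × (∀ {x} → x < M → T (K x) → ¬ T (R x))

  trace-idle : ∀ st → ¬ T (run (assign bool GO goE) st bool GO 0 0) → ∀ i j → run TRACE st nat CAP i j ≡ st nat CAP i j
  trace-idle st h i j = proj₁ (iter-ind (λ _ y → y nat CAP i j ≡ st nat CAP i j × ¬ T (y bool GO 0 0)) M {init} (refl , h)
    λ {_} {y} _ (e , g) → trans (if-F (λ m → g (proj₁ (to y (0 ∷ 0 ∷ []) moveE m)))) e , g)
    where
    init = run (assign bool GO goE ⍮ assign nat CU (firstE isTarget)) st

  -- The invariant counts the unit of flow that is on its way back to S.
  trace-push : ∀ st → let S = st bool SRC 0; K = st bool SNK 0; R = st bool RCH 0; c = st nat CAP in
    Bfs c S R (st nat DIST 0) → T (run (assign bool GO goE) st bool GO 0 0) →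
    ∀ R′ → Side S K R′ → suc (cut (run TRACE st nat CAP) R′) ≡ cut c R′
  trace-push st B g R′ (s , k) = trans (+-comm 1 _) (trans (cong (cut (run TRACE st nat CAP) R′ +_) (sym (b2n-T at-source))) (Inv.flow fin R′ (s , k)))
    where
    S = st bool SRC 0
    K = st bool SNK 0
    R = st bool RCH 0
    c = st nat CAP
    d = st nat DIST 0
    module B = Bfs B
    record Inv (j : ℕ) (y : State) : Set where
      field
        go    : T (y bool GO 0 0)
        src   : y bool SRC ≡ st bool SRC
        rch   : y bool RCH ≡ st bool RCH
        dist  : y nat DIST ≡ st nat DIST
        cu<   : y nat CU 0 0 < M
        here  : T (R (y nat CU 0 0))
        flow  : ∀ R′ → Side S K R′ → cut (y nat CAP) R′ + b2n (R′ (y nat CU 0 0)) ≡ cut c R′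
        -- Only arcs into vertices already left behind, which are farther away, can have lost
        -- capacity. So the predecessor found by the search is still available.
        fresh : ∀ {u x} → d x ≤ d (y nat CU 0 0) → c u x ≤ y nat CAP u x
        -- The distance starts at most at `M` and drops in every step until a source is met.
        near  : T (S (y nat CU 0 0)) ⊎ d (y nat CU 0 0) + j ≤ M
    init = run (assign bool GO goE ⍮ assign nat CU (firstE isTarget)) st
    target : first M (λ x → R x ∧ K x) < M × T (R (first M (λ x → R x ∧ K x)) ∧ K (first M (λ x → R x ∧ K x)))
    target = first-ok M {λ x → R x ∧ K x} g
    init-inv : Inv 0 init
    init-inv = record { go = g ; src = refl ; rch = refl ; dist = refl ; cu< = proj₁ target
      ; here = ∧ˡ (R (first M (λ x → R x ∧ K x))) (proj₂ target)
      ; flow = λ R′ (_ , k) → trans (cong (cut c R′ +_) (b2n-F (k (proj₁ target) (∧ʳ (R (first M (λ x → R x ∧ K x))) (proj₂ target))))) (+-identityʳ _)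
      ; fresh = λ _ → ≤-refl ; near = inj₂ (≤-trans (≤-reflexive (+-identityʳ _)) B.short) }
    step : ∀ {j y} → j < M → Inv j y → Inv (suc j) (run traceBody y)
    step {j} {y} j< I with T? (S (y nat CU 0 0))
    ... | yes sc = record { go = I.go ; src = I.src ; rch = I.rch ; dist = I.dist
      ; cu< = subst (_< M) (sym cu) I.cu< ; here = subst (T ∘ R) (sym cu) I.here
      ; flow = λ R′ sd → trans (cong₂ _+_ (cut-cong R′ (λ {x} {w} _ _ → if-F no-move)) (cong (b2n ∘ R′) cu)) (I.flow R′ sd)
      ; fresh = λ {u} {x} h → ≤-trans (I.fresh (subst (λ q → d x ≤ d q) cu h)) (≤-reflexive (sym (if-F no-move)))
      ; near = inj₁ (subst (T ∘ S) (sym cu) sc) }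
      where
      module I = Inv I
      no-move : ¬ T (run (assign nat NX (firstE isPred) ⍮ assign bool MV moveE) y bool MV 0 0)
      no-move m = proj₂ (to y (0 ∷ 0 ∷ []) moveE m) (y nat CU 0 0 , I.cu< , refl , subst (λ f → T (f 0 (y nat CU 0 0))) (sym I.src) sc)
      cu : run traceBody y nat CU 0 0 ≡ y nat CU 0 0
      cu = if-F no-move
    ... | no ¬sc = record { go = I.go ; src = I.src ; rch = I.rch ; dist = I.dist
      ; cu< = subst (_< M) (sym cu) q< ; here = subst (T ∘ R) (sym cu) (subst (λ f → T (f 0 q)) I.rch (proj₁ q-ok))
      ; flow = λ R′ sd → trans (cong₂ _+_ (cut-cong R′ (λ {x} {w} _ _ → if-T move)) (cong (b2n ∘ R′) cu))
                 (trans (cut-push (y nat CAP) R′ I.cu< q< p≢q q-cap) (I.flow R′ sd))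
      ; fresh = fresh
      ; near = inj₂ (≤-trans (≤-reflexive (trans (cong (λ w → d w + suc j) cu) (+-suc (d q) j)))
                 (≤-trans (+-monoˡ-≤ j q-near) ([ (λ sc → ⊥-elim (¬sc sc)) , id ]′ I.near))) }
      where
      module I = Inv I
      p q : ℕ
      p = y nat CU 0 0
      q = run (assign nat NX (firstE isPred)) y nat NX 0 0
      move : T (run (assign nat NX (firstE isPred) ⍮ assign bool MV moveE) y bool MV 0 0)
      move = from y (0 ∷ 0 ∷ []) moveE (I.go , λ { (x , _ , refl , h) → ¬sc (subst (λ f → T (f 0 p)) I.src h) })
      cu : run traceBody y nat CU 0 0 ≡ q
      cu = if-T move
      exists : T (any M (λ x → eval y (x ∷ []) (isPred zero)))
      exists with B.prev I.here
      ... | inj₁ sc = ⊥-elim (¬sc sc)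
      ... | inj₂ (u , u< , r , a , l) = anyⁱ M u u< (from y (u ∷ []) (isPred zero)
            (subst (λ f → T (f 0 u)) (sym I.rch) r , p , I.cu< , refl , ≤-trans a (I.fresh ≤-refl) ,
             subst (λ f → f 0 u < f 0 p) (sym I.dist) l))
      q< : q < M
      q< = proj₁ (first-ok M {λ x → eval y (x ∷ []) (isPred zero)} exists)
      q-ok : T (y bool RCH 0 q) × (∃[ x ] x < M × x ≡ p × 0 < y nat CAP q x × y nat DIST 0 q < y nat DIST 0 x)
      q-ok = to y (q ∷ []) (isPred zero) (proj₂ (first-ok M {λ x → eval y (x ∷ []) (isPred zero)} exists))
      q-cap : 0 < y nat CAP q p
      q-cap with proj₂ q-ok
      ... | _ , _ , refl , a , _ = a
      q-near : d q < d p
      q-near with proj₂ q-ok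
      ... | _ , _ , refl , _ , l = subst (λ f → f 0 q < f 0 p) I.dist l
      p≢q : p ≢ q
      p≢q e = <⇒≢ q-near (cong d (sym e))
      fresh : ∀ {u x} → d x ≤ d (run traceBody y nat CU 0 0) → c u x ≤ run traceBody y nat CAP u x
      fresh {u} {x} h = ≤-trans (I.fresh (<⇒≤ l)) (≤-trans (m≤m+n _ (unit p q u x))
          (≤-reflexive (sym (trans (if-T move) (cong (y nat CAP u x + unit p q u x ∸_) (if-F {b = (u ≡ᵇ q) ∧ (x ≡ᵇ p)} (λ e → <⇒≢ l (cong d (≡ᵇ⇒≡ x p (∧ʳ (u ≡ᵇ q) e))))))))))
        where
        l : d x < d p
        l = ≤-trans (s≤s (subst (λ w → d x ≤ d w) cu h)) q-near
    fin : Inv M (run TRACE st)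
    fin = iter-ind Inv M init-inv step
    at-source : T (R′ (run TRACE st nat CU 0 0))
    at-source with Inv.near fin
    ... | inj₁ sc = s (Inv.cu< fin) sc
    ... | inj₂ l with B.prev (Inv.here fin)
    ...   | inj₁ sc = s (Inv.cu< fin) sc
    ...   | inj₂ (_ , _ , _ , _ , l′) = contradiction (≤-trans (+-monoˡ-≤ M (≤-trans (s≤s z≤n) l′)) l) (n≮n M)

  record MinCut (c : ℕ → ℕ → ℕ) (S K R : ℕ → Bool) : Set where
    field
      side    : Side S K R
      minimum : ∀ R′ → Side S K R′ → cut c R ≤ cut c R′
      nearest : ∀ R′ → Side S K R′ → cut c R′ ≤ cut c R → ∀ {x} → x < M → T (R x) → T (R′ x)

  cut-zero : ∀ c R → (∀ {x y} → x < M → y < M → T (R x) → 0 < c x y → T (R y)) → cut c R ≡ 0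
  cut-zero c R cl = sum-zero M λ {x} x< → sum-zero M λ {y} y< → zero-if x< y<
    where
    zero-if : ∀ {x y} → x < M → y < M → (if R x ∧ not (R y) then c x y else 0) ≡ 0
    zero-if {x} {y} x< y< with T? (R x ∧ not (R y))
    ... | no h = if-F h
    ... | yes h with c x y in e
    ...   | zero  = if-T h
    ...   | suc m = ⊥-elim (notᵉ (∧ʳ (R x) h) (cl x< y< (∧ˡ (R x) h) (subst (0 <_) (sym e) (s≤s z≤n))))

  zero-cut : ∀ c R → cut c R ≡ 0 → ∀ {x y} → x < M → y < M → T (R x) → 0 < c x y → T (R y)
  zero-cut c R e {x} {y} x< y< h pos with T? (R y)
  ... | yes p = p
  ... | no  p = contradiction (≤-trans pos (≤-trans (≤-reflexive (sym (if-T (∧ⁱ h (notⁱ p)))))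
                  (≤-trans (term≤sum M y y<) (≤-trans (term≤sum M x x<) (≤-reflexive e))))) λ ()

  -- No flow is stored: having sent `value` units means that every side has lost exactly `value` of
  -- its capacity. The side `R₀` of capacity below `M` forces one of the `M` rounds to find no
  -- augmenting path.
  flow-ok : ∀ st → let S = st bool SRC 0; K = st bool SNK 0; c = st nat CAP in
    ∀ R₀ → Side S K R₀ → cut c R₀ < M → MinCut c S K (run FLOW st bool RCH 0)
  flow-ok st R₀ v₀ l₀ = record
    { side = side
    ; minimum = λ R′ sd → ≤-trans (≤-reflexive value) (≤-trans (m≤n+m f _) (≤-reflexive (Inv.flow inv R′ sd)))
    -- No residual capacity leaves a side that attains the minimum. So it is closed under the search
    -- and contains everything that the search reaches.
    ; nearest = λ R′ sd h x< r → B.least (λ x< s → proj₁ sd x< (subst (λ g → T (g 0 _)) (Inv.src inv) s))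
        (zero-cut (y nat CAP) R′ (n≤0⇒n≡0 (+-cancelʳ-≤ f _ _ (≤-trans (≤-reflexive (Inv.flow inv R′ sd)) (≤-trans h (≤-reflexive value)))))) x< r }
    where
    S = st bool SRC 0
    K = st bool SNK 0
    c = st nat CAP
    record Inv (i : ℕ) (y : State) : Set where
      field
        src   : y bool SRC ≡ st bool SRC
        snk   : y bool SNK ≡ st bool SNK
        value : ℕ
        flow  : ∀ R′ → Side S K R′ → cut (y nat CAP) R′ + value ≡ cut c R′
        full  : value ≡ i ⊎ (∃[ R ] Side S K R × cut (y nat CAP) R ≡ 0)
    step : ∀ {i y} → i < M → Inv i y → Inv (suc i) (run (BFS ⍮ TRACE) y)
    step {i} {y} _ I with T? (run (assign bool GO goE) (run BFS y) bool GO 0 0)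
    ... | yes g = record
      { src = trans (frame (BFS ⍮ TRACE) y bool SRC λ ()) I.src ; snk = trans (frame (BFS ⍮ TRACE) y bool SNK λ ()) I.snk
      ; value = suc I.value
      ; flow = λ R′ sd → trans (+-suc _ I.value) (trans (cong (_+ I.value) (push R′ sd)) (I.flow R′ sd))
      ; full = inj₁ (cong suc ([ id , (λ (R , sd , e) → contradiction (trans (push R sd) e) λ ()) ]′ I.full)) }
      where
      module I = Inv I
      y₁ = run BFS y
      c₁ : y₁ nat CAP ≡ y nat CAP
      c₁ = frame BFS y nat CAP λ ()
      s₁ : y₁ bool SRC ≡ y bool SRC
      s₁ = frame BFS y bool SRC λ ()
      bfs : Bfs (y₁ nat CAP) (y₁ bool SRC 0) (y₁ bool RCH 0) (y₁ nat DIST 0)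
      bfs = subst₂ (λ c s → Bfs c (s 0) (y₁ bool RCH 0) (y₁ nat DIST 0)) (sym c₁) (sym s₁) (bfs-ok y)
      push : ∀ R′ → Side S K R′ → suc (cut (run (BFS ⍮ TRACE) y nat CAP) R′) ≡ cut (y nat CAP) R′
      push R′ sd = trans (trace-push y₁ bfs g R′ (subst₂ (λ s k → Side (s 0) (k 0) R′) (sym (trans s₁ I.src))
                    (sym (trans (frame BFS y bool SNK λ ()) I.snk)) sd)) (cong (λ c → cut c R′) c₁)
    ... | no ¬g = record
      { src = trans (frame (BFS ⍮ TRACE) y bool SRC λ ()) I.src ; snk = trans (frame (BFS ⍮ TRACE) y bool SNK λ ()) I.snk
      ; value = I.value ; flow = λ R′ sd → trans (cong (_+ I.value) (same R′)) (I.flow R′ sd)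
      ; full = inj₂ (R , ((λ x< s → B.start (subst (λ g → T (g 0 _)) (sym I.src) s)) ,
          λ {x} x< k r → ¬g (from y₁ (0 ∷ 0 ∷ []) goE (x , x< , r , subst (λ g → T (g 0 x)) (sym (trans (frame BFS y bool SNK λ ()) I.snk)) k))) ,
          trans (same R) (cut-zero (y nat CAP) R B.closed)) }
      where
      module I = Inv I
      y₁ = run BFS y
      R = y₁ bool RCH 0
      module B = Bfs (bfs-ok y)
      same : ∀ R′ → cut (run (BFS ⍮ TRACE) y nat CAP) R′ ≡ cut (y nat CAP) R′
      same R′ = cut-cong R′ λ {i} {j} _ _ → trans (trace-idle y₁ ¬g i j) (cong (λ c → c i j) (frame BFS y nat CAP λ ()))
    y = run (loop (BFS ⍮ TRACE)) st
    inv : Inv M y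
    inv = iter-ind Inv M record { src = refl ; snk = refl ; value = 0 ; flow = λ _ _ → +-identityʳ _ ; full = inj₁ refl } step
    f = Inv.value inv
    R = run FLOW st bool RCH 0
    module B = Bfs (bfs-ok y)
    blocked : ∃[ R ] Side S K R × cut (y nat CAP) R ≡ 0
    blocked with Inv.full inv
    ... | inj₂ b = b
    ... | inj₁ e = contradiction (≤-trans (s≤s (≤-trans (m≤n+m f _) (≤-reflexive (Inv.flow inv R₀ v₀)))) (≤-trans l₀ (≤-reflexive (sym e)))) (n≮n f)
    side : Side S K R
    side = let (R₁ , (s₁ , k₁) , e₁) = blocked in
      (λ x< s → B.start (subst (λ g → T (g 0 _)) (sym (Inv.src inv)) s)) ,
      λ x< k r → k₁ x< k (B.least (λ x< s → s₁ x< (subst (λ g → T (g 0 _)) (Inv.src inv) s)) (zero-cut (y nat CAP) R₁ e₁) x< r)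
    value : cut c R ≡ f
    value = trans (sym (Inv.flow inv R side)) (cong (_+ f) (cut-zero (y nat CAP) R B.closed))

-- Vertex u is split into an entry u and an exit u + n.

capE : Ex nat 2
capE = ite (n₁ ⊲ #n && n₀ ≐ n₁ ⊞ #n) (ite (br UU x₁) #M (lit′ 1))
           (ite (∃̂ (n₂ ≐ n₀ ⊞ #n && bm GR x₀ x₁)) #M (lit′ 0))

exitE : ℕ → Ex bool 2
exitE a = ∃̂ (n₁ ≐ n₀ ⊞ #n && br a x₀)

sideE : Ex bool 2
sideE = ∃̂ (n₀ ≐ n₁ ⊞ #n && br RCH x₀)

isBoundary : ∀ {h} → Fin h → Ex bool h
isBoundary w = neg (br YS (v w)) && ∃̂ (br YS x₀ && bm GR x₀ (v (suc w)))

SEP : Stm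
SEP = assign nat CAP capE ⍮ assign bool SRC (exitE SS) ⍮ assign bool SNK (exitE AA) ⍮ FLOW ⍮
      assign bool YS sideE ⍮ assign bool HAS (∃̂ (isBoundary zero)) ⍮ assign nat PK (firstE isBoundary)

-- Vertex separators as cuts of the split graph

module Vertex (M : ℕ) where

  N : (ℕ → ℕ → Bool) → (ℕ → Bool) → ℕ → Bool
  N g Y w = not (Y w) ∧ any M (λ u → Y u ∧ g u w)

  Nⁱ : ∀ g Y {u w} → u < M → ¬ T (Y w) → T (Y u) → T (g u w) → T (N g Y w)
  Nⁱ g Y {u} {w} u< nw yu e = ∧ⁱ (notⁱ nw) (anyⁱ M {λ u → Y u ∧ g u w} u u< (∧ⁱ yu e))

  Nᵉ : ∀ g Y {w} → T (N g Y w) → ¬ T (Y w) × ∃[ u ] u < M × T (Y u) × T (g u w)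
  Nᵉ g Y {w} h = let (u , u< , k) = anyᵉ M {λ u → Y u ∧ g u w} (∧ʳ (not (Y w)) h) in
    notᵉ (∧ˡ (not (Y w)) h) , u , u< , ∧ˡ (Y u) k , ∧ʳ (Y u) k

  -- N g Y is a set of deletable vertices cutting all paths from S to A.
  record Sep (g : ℕ → ℕ → Bool) (S A U Y : ℕ → Bool) : Set where
    constructor sep
    field
      source : ∀ {u} → T (S u) → T (Y u)
      sink   : ∀ {u} → T (A u) → ¬ T (Y u)
      free   : ∀ {w} → T (N g Y w) → ¬ T (U w)

  size : (ℕ → ℕ → Bool) → (ℕ → Bool) → ℕ
  size g Y = count M (N g Y)

  record MinSep (g : ℕ → ℕ → Bool) (S A U Y : ℕ → Bool) : Set where
    field
      isSep   : Sep g S A U Y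
      minimum : ∀ {Y′} → Sep g S A U Y′ → size g Y ≤ size g Y′
      nearest : ∀ {Y′} → Sep g S A U Y′ → size g Y′ ≤ size g Y → ∀ {u} → T (Y u) → T (Y′ u)

module Separator (C : Context) (n+n≤M : Context.cn C + Context.cn C ≤ Context.cM C) where
  open Context C renaming (cM to M; cn to n)
  open Semantics C
  open Logic C
  open Cut M
  open Flow C
  open Vertex M

  module _ (g : ℕ → ℕ → Bool) (S A U : ℕ → Bool)
           (gn : ∀ {u w} → T (g u w) → u < n × w < n) (Sn : ∀ {u} → T (S u) → u < n) where

    -- The value of `capE`. The capacity `M` stands for infinity, since only cuts of capacity below
    -- `M` will matter; arcs and undeletable vertices get it.
    cap : ℕ → ℕ → ℕ
    cap x y = if (x <ᵇ n) ∧ (y ≡ᵇ x + n) then (if U x then M else 1)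
              else (if any M (λ u → (x ≡ᵇ u + n) ∧ g u y) then M else 0)

    exits : (ℕ → Bool) → ℕ → Bool
    exits B x = any M (λ u → (x ≡ᵇ u + n) ∧ B u)

    inside : (ℕ → Bool) → ℕ → Bool
    inside R w = any M (λ x → (x ≡ᵇ w + n) ∧ R x)

    exits-i : ∀ B {u} → u < M → T (B u) → T (exits B (u + n))
    exits-i B {u} u< b = anyⁱ M {λ w → (u + n ≡ᵇ w + n) ∧ B w} u u< (∧ⁱ (≡⇒≡ᵇ (u + n) (u + n) refl) b)

    exits-e : ∀ B {x} → T (exits B x) → ∃[ u ] x ≡ u + n × T (B u)
    exits-e B {x} h = let (u , _ , k) = anyᵉ M {λ u → (x ≡ᵇ u + n) ∧ B u} h in
      u , ≡ᵇ⇒≡ x (u + n) (∧ˡ (x ≡ᵇ u + n) k) , ∧ʳ (x ≡ᵇ u + n) k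

    inside-i : ∀ R {w} → w + n < M → T (R (w + n)) → T (inside R w)
    inside-i R {w} l r = anyⁱ M {λ x → (x ≡ᵇ w + n) ∧ R x} (w + n) l (∧ⁱ (≡⇒≡ᵇ (w + n) (w + n) refl) r)

    inside-e : ∀ R {w} → T (inside R w) → w + n < M × T (R (w + n))
    inside-e R {w} h with anyᵉ M {λ x → (x ≡ᵇ w + n) ∧ R x} h
    ... | x , x< , k with ≡ᵇ⇒≡ x (w + n) (∧ˡ (x ≡ᵇ w + n) k)
    ...   | refl = x< , ∧ʳ (w + n ≡ᵇ w + n) k

    n→M : ∀ {u} → u < n → u < M
    n→M h = ≤-trans h (≤-trans (m≤m+n n n) n+n≤M)

    exit<M : ∀ {u} → u < n → u + n < M
    exit<M h = ≤-trans (+-monoˡ-< n h) n+n≤M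

    cap-arc : ∀ {u y} → T (g u y) → cap (u + n) y ≡ M
    cap-arc {u} {y} e = trans (if-F {b = (u + n <ᵇ n) ∧ (y ≡ᵇ (u + n) + n)} λ h → n≮n n (≤-trans (s≤s (m≤n+m n u)) (<ᵇ⇒< (u + n) n (∧ˡ (u + n <ᵇ n) h))))
      (if-T (anyⁱ M {λ w → (u + n ≡ᵇ w + n) ∧ g w y} u (n→M (proj₁ (gn e))) (∧ⁱ (≡⇒≡ᵇ (u + n) (u + n) refl) e)))

    cap-vertex : ∀ {w} → w < n → cap w (w + n) ≡ (if U w then M else 1)
    cap-vertex {w} h = if-T (∧ⁱ (<⇒<ᵇ h) (≡⇒≡ᵇ (w + n) (w + n) refl))

    module _ {Y : ℕ → Bool} (V : Sep g S A U Y) where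
      open Sep V

      -- Turns a separator into a cut through its vertex arcs: the side has the entries of `Y` and
      -- of its boundary, but only the exits of `Y`.
      nodes : ℕ → Bool
      nodes x = if x <ᵇ n then Y x ∨ N g Y x else Y (x ∸ n)

      nodes-entry : ∀ {x} → x < n → nodes x ≡ Y x ∨ N g Y x
      nodes-entry h = if-T (<⇒<ᵇ h)

      nodes-exit : ∀ u → nodes (u + n) ≡ Y u
      nodes-exit u = trans (if-F (λ h → n≮n n (≤-trans (s≤s (m≤n+m n u)) (<ᵇ⇒< (u + n) n h)))) (cong Y (m+n∸n≡m u n))

      nodes-side : Side (exits S) (exits A) nodes
      nodes-side = (λ {x} _ h → let (u , e , s) = exits-e S {x} h in subst T (sym (trans (cong nodes e) (nodes-exit u))) (source s)) ,
        λ {x} _ h r → let (u , e , a) = exits-e A {x} h in sink a (subst T (trans (cong nodes e) (nodes-exit u)) r)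

      nodes-cut : cut cap nodes ≤ size g Y
      nodes-cut = sum-mono M λ {x} x< → row x<
        where
        row : ∀ {x} → x < M → sum M (λ y → if nodes x ∧ not (nodes y) then cap x y else 0) ≤ b2n (N g Y x)
        row {x} x< with x <? n
        ... | yes x<n = ≤-trans (≤-reflexive (sum-delta M (x + n) (exit<M x<n) off)) on
          where
          off : ∀ {y} → y < M → y ≢ x + n → (if nodes x ∧ not (nodes y) then cap x y else 0) ≡ 0
          off {y} _ ne = if-zero′ (nodes x ∧ not (nodes y)) (trans
            (if-F {b = (x <ᵇ n) ∧ (y ≡ᵇ x + n)} (λ h → ne (≡ᵇ⇒≡ y (x + n) (∧ʳ (x <ᵇ n) h))))
            (if-F (λ h → let (u , _ , k) = anyᵉ M {λ u → (x ≡ᵇ u + n) ∧ g u y} h in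
               n≮n x (≤-trans x<n (≤-trans (m≤n+m n u) (≤-reflexive (sym (≡ᵇ⇒≡ x (u + n) (∧ˡ (x ≡ᵇ u + n) k)))))))))
          on : (if nodes x ∧ not (nodes (x + n)) then cap x (x + n) else 0) ≤ b2n (N g Y x)
          on with T? (nodes x ∧ not (nodes (x + n)))
          ... | no h  = ≤-trans (≤-reflexive (if-F h)) z≤n
          ... | yes h = ≤-reflexive (trans (if-T h) (trans (cap-vertex x<n) (trans (if-F (free b)) (sym (b2n-T b)))))
            where
            b : T (N g Y x)
            b = [ (λ q → ⊥-elim (notᵉ (∧ʳ (nodes x) h) (subst T (sym (nodes-exit x)) q))) , id ]′
                (∨ᵉ (Y x) (subst T (nodes-entry x<n) (∧ˡ (nodes x) h)))
        ... | no x≮n = ≤-trans (≤-reflexive (sum-zero M λ {y} _ → zero-term y)) z≤n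
          where
          zero-term : ∀ y → (if nodes x ∧ not (nodes y) then cap x y else 0) ≡ 0
          zero-term y with T? (nodes x ∧ not (nodes y))
          ... | no h  = if-F h
          ... | yes h = trans (if-T h) (trans (if-F {b = (x <ᵇ n) ∧ (y ≡ᵇ x + n)} (λ k → x≮n (<ᵇ⇒< x n (∧ˡ (x <ᵇ n) k))))
              (if-F λ k → let (u , _ , k′) = anyᵉ M {λ u → (x ≡ᵇ u + n) ∧ g u y} k
                              e = ≡ᵇ⇒≡ x (u + n) (∧ˡ (x ≡ᵇ u + n) k′)
                              a = ∧ʳ (x ≡ᵇ u + n) k′
                              yu = subst T (trans (cong nodes e) (nodes-exit u)) (∧ˡ (nodes x) h)
                          in notᵉ (∧ʳ (nodes x) h) (subst T (sym (nodes-entry (proj₂ (gn a))))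
                             (case T? (Y y) of λ { (yes p) → ∨ˡ p ; (no p) → ∨ʳ (Y y) (Nⁱ g Y (n→M (proj₁ (gn a))) p yu a) }))))

    module _ {R : ℕ → Bool} (sd : Side (exits S) (exits A) R) (small : cut cap R < M) where

      private
        Y = inside R

        crossing : ∀ {x y} → x < M → y < M → T (R x) → ¬ T (R y) → cap x y ≤ cut cap R
        crossing x< y< r r′ = ≤-trans (≤-reflexive (sym (if-T (∧ⁱ r (notⁱ r′))))) (≤-trans (term≤sum M _ y<) (term≤sum M _ x<))

        -- An arc of capacity `M` cannot cross a cut below `M`. Hence the entry of a boundary vertex
        -- lies on the source side while its exit does not, and the cut pays for this vertex.
        entry : ∀ {w} → T (N g Y w) → w < n × T (R w) × ¬ T (R (w + n))
        entry {w} h with Nᵉ g Y h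
        ... | nw , u , _ , yu , e with T? (R w)
        ...   | yes r = proj₂ (gn e) , r , λ r′ → nw (inside-i R (exit<M (proj₂ (gn e))) r′)
        ...   | no  r = contradiction (≤-trans small (≤-trans (≤-reflexive (sym (cap-arc e)))
                          (crossing (proj₁ (inside-e R {u} yu)) (n→M (proj₂ (gn e))) (proj₂ (inside-e R {u} yu)) r))) (n≮n _)

        vertex≤ : ∀ {w} → T (N g Y w) → (if U w then M else 1) ≤ cut cap R
        vertex≤ h = let (w< , r , r′) = entry h in ≤-trans (≤-reflexive (sym (cap-vertex w<))) (crossing (n→M w<) (exit<M w<) r r′)

      inside-sep : Sep g S A U Y
      inside-sep = sep
        (λ {u} s → inside-i R (exit<M (Sn s)) (proj₁ sd (exit<M (Sn s)) (exits-i S (n→M (Sn s)) s)))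
        (λ {u} a y → let (l , r) = inside-e R {u} y in proj₂ sd l (exits-i A (≤-trans (s≤s (m≤m+n u n)) l) a) r)
        (λ {w} h uw → n≮n _ (≤-trans small (≤-trans (≤-reflexive (sym (if-T uw))) (vertex≤ h))))

      inside-size : size g Y ≤ cut cap R
      inside-size = sum-mono M λ {w} w< → row w<
        where
        row : ∀ {w} → w < M → b2n (N g Y w) ≤ sum M (λ y → if R w ∧ not (R y) then cap w y else 0)
        row {w} w< with T? (N g Y w)
        ... | no h  = ≤-trans (≤-reflexive (b2n-F h)) z≤n
        ... | yes h = let (w<n , r , r′) = entry h in
          ≤-trans (≤-trans (b2n≤1 (N g Y w)) (≤-trans (one (U w)) (≤-reflexive (sym (trans (if-T (∧ⁱ r (notⁱ r′))) (cap-vertex w<n))))))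
                  (term≤sum M (w + n) (exit<M w<n))
          where
          one : ∀ b → 1 ≤ (if b then M else 1)
          one true  = ≤-trans (s≤s z≤n) small
          one false = ≤-refl

  sep-ok : ∀ st → let g = st bool GR; S = st bool SS 0; A = st bool AA 0; U = st bool UU 0; st′ = run SEP st in
    (∀ {u w} → T (g u w) → u < n × w < n) → (∀ {u} → T (S u) → u < n) →
    ∀ {Y₀} → Sep g S A U Y₀ → size g Y₀ < M →
    ∃[ Y ] MinSep g S A U Y ×
      (T (st′ bool HAS 0 0) × st′ nat PK 0 0 < M × T (N g Y (st′ nat PK 0 0)) ⊎
       ¬ T (st′ bool HAS 0 0) × (∀ {w} → w < M → ¬ T (N g Y w)))
  sep-ok st gn Sn {Y₀} V₀ small = Y , min , pick
    where
    g = st bool GR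
    S = st bool SS 0
    A = st bool AA 0
    U = st bool UU 0
    init = run (assign nat CAP capE ⍮ assign bool SRC (exitE SS) ⍮ assign bool SNK (exitE AA)) st
    R = run FLOW init bool RCH 0
    Y = inside g S A U gn Sn R
    mc : MinCut (cap g S A U gn Sn) (exits g S A U gn Sn S) (exits g S A U gn Sn A) R
    mc = flow-ok init (nodes g S A U gn Sn V₀) (nodes-side g S A U gn Sn V₀) (≤-trans (s≤s (nodes-cut g S A U gn Sn V₀)) small)
    module MC = MinCut mc
    cut<M : cut (cap g S A U gn Sn) R < M
    cut<M = ≤-trans (s≤s (≤-trans (MC.minimum _ (nodes-side g S A U gn Sn V₀)) (nodes-cut g S A U gn Sn V₀))) small
    min : MinSep g S A U Y
    min = record
      { isSep = inside-sep g S A U gn Sn MC.side cut<M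
      ; minimum = λ V → ≤-trans (inside-size g S A U gn Sn MC.side cut<M) (≤-trans (MC.minimum _ (nodes-side g S A U gn Sn V)) (nodes-cut g S A U gn Sn V))
      ; nearest = λ V h {u} y → let (l , r) = inside-e g S A U gn Sn R {u} y in
          subst T (nodes-exit g S A U gn Sn V u) (MC.nearest _ (nodes-side g S A U gn Sn V)
            (≤-trans (nodes-cut g S A U gn Sn V) (≤-trans h (inside-size g S A U gn Sn MC.side cut<M))) l r) }
    gr : run (FLOW ⍮ assign bool YS sideE) init bool GR ≡ g
    gr = frame (FLOW ⍮ assign bool YS sideE) init bool GR λ ()
    boundary : ∀ w → eval (run (FLOW ⍮ assign bool YS sideE) init) (w ∷ []) (isBoundary zero) ≡ N g Y w
    boundary w = cong (λ f → not (Y w) ∧ any M (λ u → Y u ∧ f u w)) gr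
    pick : _
    pick with T? (run SEP st bool HAS 0 0)
    ... | no h  = inj₂ (h , λ {w} w< k → h (anyⁱ M w w< (subst T (sym (boundary w)) k)))
    ... | yes h = inj₁ (h , proj₁ p , subst T (boundary _) (proj₂ p))
      where
      p = first-ok M {λ w → eval (run (FLOW ⍮ assign bool YS sideE) init) (w ∷ []) (isBoundary zero)} h

-- Deletion of vertices and reachability

infixl 5 _∖_

_∖_ : (ℕ → ℕ → Bool) → (ℕ → Bool) → ℕ → ℕ → Bool
(g ∖ X) u w = g u w ∧ (not (X u) ∧ not (X w))

∖ⁱ : ∀ g X {u w} → T (g u w) → ¬ T (X u) → ¬ T (X w) → T ((g ∖ X) u w)
∖ⁱ g X e a b = ∧ⁱ e (∧ⁱ (notⁱ a) (notⁱ b))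

∖ᵉ : ∀ g X {u w} → T ((g ∖ X) u w) → T (g u w) × ¬ T (X u) × ¬ T (X w)
∖ᵉ g X {u} {w} h = ∧ˡ (g u w) h , notᵉ (∧ˡ (not (X u)) (∧ʳ (g u w) h)) , notᵉ (∧ʳ (not (X u)) (∧ʳ (g u w) h))

reach-map : ∀ g g′ → (∀ {u w} → T (g u w) → T (g′ u w)) → ∀ {u w} → Reach g u w → Reach g′ u w
reach-map g g′ f = RT.map f

reach-∖ : ∀ g X {u w} → Reach (g ∖ X) u w → Reach g u w
reach-∖ g X = reach-map (g ∖ X) g λ h → proj₁ (∖ᵉ g X h)

reach-avoids : ∀ g X {u w} → ¬ T (X u) → Reach (g ∖ X) u w → ¬ T (X w)
reach-avoids g X n ε       = n
reach-avoids g X n (e ◅ p) = reach-avoids g X (proj₂ (proj₂ (∖ᵉ g X e))) p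

reach-closed : ∀ g (Y : ℕ → Bool) → (∀ {u w} → T (Y u) → T (g u w) → T (Y w)) → ∀ {u w} → T (Y u) → Reach g u w → T (Y w)
reach-closed g Y c y ε       = y
reach-closed g Y c y (e ◅ p) = reach-closed g Y c (c y e) p

-- Submodularity and pushing of solutions

module Pushing (C : Context) where
  open Context C renaming (cM to M)
  open Semantics C
  open Vertex M
  open Closure C

  withGraph : (ℕ → ℕ → Bool) → State
  withGraph g nat  _ _ _ = 0
  withGraph g bool _ u w = g u w

  -- Reachability is made decidable by evaluating `CLOSE` on an artificial state, so that hulls are
  -- Boolean sets to which `size` applies.
  reachable : (ℕ → ℕ → Bool) → ℕ → ℕ → Bool
  reachable g = run CLOSE (withGraph g) bool TC

  reachableⁱ : ∀ g → (∀ {u w} → T (g u w) → u < M × w < M) → ∀ {u w} → Reach g u w → T (reachable g u w)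
  reachableⁱ g b = Closed.complete (close-ok (withGraph g)) b

  reachableᵉ : ∀ g {u w} → T (reachable g u w) → Reach g u w
  reachableᵉ g = Closed.sound (close-ok (withGraph g))

  hull : (ℕ → ℕ → Bool) → (ℕ → Bool) → ℕ → Bool
  hull g S w = any M (λ s → S s ∧ reachable g s w)

  hullᵉ : ∀ g S {w} → T (hull g S w) → ∃[ s ] T (S s) × Reach g s w
  hullᵉ g S {w} h = let (s , _ , k) = anyᵉ M {λ s → S s ∧ reachable g s w} h in
    s , ∧ˡ (S s) k , reachableᵉ g (∧ʳ (S s) k)

  hullⁱ : ∀ g S → (∀ {u w} → T (g u w) → u < M × w < M) → ∀ {s w} → s < M → T (S s) → Reach g s w → T (hull g S w)
  hullⁱ g S b {s} {w} s< h p = anyⁱ M {λ s → S s ∧ reachable g s w} s s< (∧ⁱ h (reachableⁱ g b p))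

  -- Holds at each vertex: one on the boundary of the intersection or of the union is on the
  -- boundary of `Y` or of `Z`, and one on both of the former is on both of the latter.
  submodular : ∀ g Y Z → size g (λ u → Y u ∧ Z u) + size g (λ u → Y u ∨ Z u) ≤ size g Y + size g Z
  submodular g Y Z = ≤-trans (≤-reflexive (sym (sum-+ M _ _))) (≤-trans (sum-mono M λ {w} _ → point w) (≤-reflexive (sum-+ M _ _)))
    where
    Y∩Z Y∪Z : ℕ → Bool
    Y∩Z u = Y u ∧ Z u
    Y∪Z u = Y u ∨ Z u
    point : ∀ w → b2n (N g Y∩Z w) + b2n (N g Y∪Z w) ≤ b2n (N g Y w) + b2n (N g Z w)
    point w with T? (N g Y∩Z w) | T? (N g Y∪Z w)
    ... | no p  | no q  = ≤-trans (≤-reflexive (cong₂ _+_ (b2n-F p) (b2n-F q))) z≤n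
    ... | yes p | no q  = ≤-trans (≤-reflexive (cong₂ _+_ (b2n-T p) (b2n-F q))) (one (Nᵉ g Y∩Z p))
      where
      one : ¬ T (Y w ∧ Z w) × (∃[ u ] u < M × T (Y u ∧ Z u) × T (g u w)) → 1 ≤ b2n (N g Y w) + b2n (N g Z w)
      one (np , u , u< , yz , e) with T? (Y w)
      ... | no ny = ≤-trans (≤-reflexive (sym (b2n-T (Nⁱ g Y u< ny (∧ˡ (Y u) yz) e)))) (m≤m+n _ _)
      ... | yes y = ≤-trans (≤-reflexive (sym (b2n-T (Nⁱ g Z u< (λ zw → np (∧ⁱ y zw)) (∧ʳ (Y u) yz) e)))) (m≤n+m _ _)
    ... | no p  | yes q = ≤-trans (≤-reflexive (cong₂ _+_ (b2n-F p) (b2n-T q))) (one (Nᵉ g Y∪Z q))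
      where
      one : ¬ T (Y w ∨ Z w) × (∃[ u ] u < M × T (Y u ∨ Z u) × T (g u w)) → 1 ≤ b2n (N g Y w) + b2n (N g Z w)
      one (np , u , u< , yz , e) with ∨ᵉ (Y u) yz
      ... | inj₁ y  = ≤-trans (≤-reflexive (sym (b2n-T (Nⁱ g Y u< (λ yw → np (∨ˡ yw)) y e)))) (m≤m+n _ _)
      ... | inj₂ zu = ≤-trans (≤-reflexive (sym (b2n-T (Nⁱ g Z u< (λ zw → np (∨ʳ (Y w) zw)) zu e)))) (m≤n+m _ _)
    ... | yes p | yes q with Nᵉ g Y∩Z p | Nᵉ g Y∪Z q
    ...   | (_ , u , u< , yz , e) | (np , _) = ≤-reflexive (trans (cong₂ _+_ (b2n-T p) (b2n-T q)) (sym (cong₂ _+_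
              (b2n-T (Nⁱ g Y u< (λ yw → np (∨ˡ yw)) (∧ˡ (Y u) yz) e)) (b2n-T (Nⁱ g Z u< (λ zw → np (∨ʳ (Y w) zw)) (∧ʳ (Y u) yz) e)))))

  -- X is a solution of size at most κ of the separation problem; every
  -- solution has size at least ℓ.
  record Hidden (g : ℕ → ℕ → Bool) (S A U X : ℕ → Bool) (κ ℓ : ℕ) : Set where
    field
      kept   : ∀ {u} → T (U u) → ¬ T (X u)
      apart  : ∀ {s a} → T (S s) → Reach (g ∖ X) s a → ¬ T (A a)
      budget : count M X ≤ κ
      lower  : ∀ {Y} → Sep g S A U Y → ℓ ≤ size g Y

  -- One direction of the dominance: walks leaving what S reaches in g ∖ X′
  -- are walks of g ∖ X.
  Dominates : (g : ℕ → ℕ → Bool) (S : ℕ → Bool) (X : ℕ → Bool) (g′ : ℕ → ℕ → Bool) (X′ : ℕ → Bool) → Set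
  Dominates g S X g′ X′ = ∀ {s u w} → T (S s) → Reach (g′ ∖ X′) s u → Reach (g′ ∖ X′) u w → Reach (g ∖ X) u w

  Deleted : ℕ → (g g′ : ℕ → ℕ → Bool) → Set
  Deleted p g g′ = ∀ {u w} → (T (g′ u w) → T (g u w) × u ≢ p × w ≢ p) × (T (g u w) → u ≢ p → w ≢ p → T (g′ u w))

  module _ {g S A U X κ ℓ} (bounded : ∀ {u w} → T (g u w) → u < M × w < M) (S< : ∀ {s} → T (S s) → s < M)
           (S⊆U : ∀ {s} → T (S s) → T (U s)) (H : Hidden g S A U X κ ℓ) where
    open Hidden H

    private
      Y : ℕ → Bool
      Y = hull (g ∖ X) S

      bounded′ : ∀ {u w} → T ((g ∖ X) u w) → u < M × w < M
      bounded′ h = bounded (proj₁ (∖ᵉ g X h))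

      source : ∀ {s} → T (S s) → T (Y s)
      source h = hullⁱ (g ∖ X) S bounded′ (S< h) h ε

      N⊆X : ∀ {w} → T (N g Y w) → T (X w)
      N⊆X {w} h with T? (X w)
      ... | yes x = x
      ... | no nx = let (ny , u , _ , yu , e) = Nᵉ g Y h
                        (s , hs , p) = hullᵉ (g ∖ X) S yu
                        nu = reach-avoids g X (kept (S⊆U hs)) p in
          ⊥-elim (ny (hullⁱ (g ∖ X) S bounded′ (S< hs) hs (p ◅◅ (∖ⁱ g X e nu nx ◅ ε))))

    hidden-sep : Sep g S A U Y
    hidden-sep = sep source (λ a y → let (s , hs , p) = hullᵉ (g ∖ X) S y in apart hs p a) (λ h u → kept u (N⊆X h))

    hidden-size : size g Y ≤ κ
    hidden-size = ≤-trans (count-mono M (λ _ → N⊆X)) budget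

    lower≤budget : ℓ ≤ κ
    lower≤budget = ≤-trans (lower hidden-sep) hidden-size

    module _ {Z} (min : MinSep g S A U Z) where
      open MinSep min
      open Sep isSep using () renaming (source to sourceZ; sink to sinkZ; free to freeZ)

      -- An empty minimum separator means that the present problem is solved. Then `ℓ` is 0 as well,
      -- so no potential is lost when the next problem begins with a fresh lower bound.
      no-boundary : (∀ {w} → w < M → ¬ T (N g Z w)) → (∀ {s a} → T (S s) → T (A a) → ¬ Reach g s a) × ℓ ≡ 0
      no-boundary none = (λ hs ha p → sinkZ ha (reach-closed g Z (λ {u} {w} zu e → case T? (Z w) of λ
            { (yes zw) → zw ; (no nz) → ⊥-elim (none (proj₂ (bounded e)) (Nⁱ g Z (proj₁ (bounded e)) nz zu e)) }) (sourceZ hs) p)) ,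
        n≤0⇒n≡0 (≤-trans (lower isSep) (≤-reflexive (sum-zero M (λ w< → b2n-F (none w<)))))

      private
        I : ℕ → Bool
        I u = Y u ∧ Z u

      -- The pushed solution: the boundary of `Y ∩ Z`, where `Y` is what `S` reaches without `X` and
      -- `Z` is the nearest minimum side. Its point is `pushed-outside`: a boundary vertex of `Z`
      -- outside `X′` is cut off from `S` and can be declared a sink.
      X′ : ℕ → Bool
      X′ = N g I

      private
        N∩⊆ : ∀ {w} → T (X′ w) → T (N g Y w) ⊎ T (N g Z w)
        N∩⊆ {w} h with Nᵉ g I h
        ... | (np , u , u< , yz , e) with T? (Y w)
        ...   | no ny = inj₁ (Nⁱ g Y u< ny (∧ˡ (Y u) yz) e)
        ...   | yes y = inj₂ (Nⁱ g Z u< (λ zw → np (∧ⁱ y zw)) (∧ʳ (Y u) yz) e)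

        N∪⊆ : ∀ {w} → T (N g (λ u → Y u ∨ Z u) w) → T (N g Y w) ⊎ T (N g Z w)
        N∪⊆ {w} h with Nᵉ g (λ u → Y u ∨ Z u) h
        ... | (np , u , u< , yz , e) with ∨ᵉ (Y u) yz
        ...   | inj₁ y  = inj₁ (Nⁱ g Y u< (λ yw → np (∨ˡ yw)) y e)
        ...   | inj₂ zu = inj₂ (Nⁱ g Z u< (λ zw → np (∨ʳ (Y w) zw)) zu e)

        union : Sep g S A U (λ u → Y u ∨ Z u)
        union = sep (λ h → ∨ˡ (source h))
          (λ {u} a h → [ Sep.sink hidden-sep a , sinkZ a ]′ (∨ᵉ (Y u) h))
          (λ h u → [ (λ k → Sep.free hidden-sep k u) , (λ k → freeZ k u) ]′ (N∪⊆ h))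

      pushed-kept : ∀ {u} → T (U u) → ¬ T (X′ u)
      pushed-kept u h = [ (λ k → Sep.free hidden-sep k u) , (λ k → freeZ k u) ]′ (N∩⊆ h)

      -- The union `Y ∪ Z` separates too, so its boundary is at least as large as that of `Z`.
      -- Submodularity then bounds the boundary of the intersection by that of `Y`, which lies in
      -- `X`.
      pushed-size : count M X′ ≤ κ
      pushed-size = ≤-trans (+-cancelʳ-≤ (size g Z) _ _ (≤-trans (+-monoʳ-≤ (size g I) (minimum union)) (submodular g Y Z))) hidden-size

      private
        stays : ∀ {u w} → T (I u) → Reach (g ∖ X′) u w → T (I w)
        stays = reach-closed (g ∖ X′) I (λ {u} {w} h e → let (e′ , _ , nx) = ∖ᵉ g X′ e in
          case T? (I w) of λ { (yes i) → i ; (no ni) → ⊥-elim (nx (Nⁱ g I (proj₁ (bounded e′)) ni h e′)) })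

        I⇒¬X : ∀ {u} → T (I u) → ¬ T (X u)
        I⇒¬X {u} h = let (s , hs , p) = hullᵉ (g ∖ X) S (∧ˡ (Y u) h) in reach-avoids g X (kept (S⊆U hs)) p

        follow : ∀ {u w} → T (I u) → Reach (g ∖ X′) u w → Reach (g ∖ X) u w
        follow h ε = ε
        follow h (e ◅ p) = let h′ = stays h (e ◅ ε) in ∖ⁱ g X (proj₁ (∖ᵉ g X′ e)) (I⇒¬X h) (I⇒¬X h′) ◅ follow h′ p

        source∩ : ∀ {s} → T (S s) → T (I s)
        source∩ h = ∧ⁱ (source h) (sourceZ h)

      -- Without `X′`, no walk from `S` leaves `Y ∩ Z`, and this set avoids `X`.
      pushed-dominates : Dominates g S X g X′
      pushed-dominates hs p q = follow (stays (source∩ hs) p) q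

      pushed-outside : ∀ {s p} → T (N g Z p) → T (S s) → ¬ Reach (g ∖ X′) s p
      pushed-outside {s} {p} b hs q = proj₁ (Nᵉ g Z b) (∧ʳ (Y p) (stays (source∩ hs) q))

      -- The chosen boundary vertex p belongs to X′ and is deleted.
      delete : ∀ {p g′} → p < M → T (N g Z p) → T (X′ p) → Deleted p g g′ →
               ∃[ X″ ] ∃[ κ′ ] κ ≡ suc κ′ × Hidden g′ S A U X″ κ′ (ℓ ∸ 1) × Dominates g S X g′ X″
      delete {p} {g′} p< b x del = X″ , κ ∸ 1 , sym (m+[n∸m]≡n (≤-trans (s≤s z≤n) smaller)) , record
        { kept = λ u h → pushed-kept u (∧ˡ (X′ _) h)
        ; apart = λ hs r a → apart hs (pushed-dominates hs ε (lift r)) a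
        ; budget = ≤-pred (≤-trans smaller (≤-reflexive (sym (m+[n∸m]≡n (≤-trans (s≤s z≤n) smaller)))))
        ; lower = lower′ } , λ hs r q → pushed-dominates hs (lift r) (lift q)
        where
        X″ : ℕ → Bool
        X″ u = X′ u ∧ not (u ≡ᵇ p)
        smaller : count M X″ < κ
        smaller = ≤-trans (count-strict M {X″} {X′} p p< (λ {u} _ h → ∧ˡ (X′ u) h) (λ h → notᵉ (∧ʳ (X′ p) h) (≡⇒≡ᵇ p p refl)) x) pushed-size
        lift : ∀ {u w} → Reach (g′ ∖ X″) u w → Reach (g ∖ X′) u w
        lift = reach-map (g′ ∖ X″) (g ∖ X′) λ {u} {w} h → let (e , nu , nw) = ∖ᵉ g′ X″ h ; (e′ , u≢ , w≢) = proj₁ del e in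
          ∖ⁱ g X′ e′ (λ k → nu (∧ⁱ k (notⁱ λ q → u≢ (≡ᵇ⇒≡ u p q)))) (λ k → nw (∧ⁱ k (notⁱ λ q → w≢ (≡ᵇ⇒≡ w p q))))
        -- Together with `p`, a separator of the smaller graph separates in `g`. Hence the lower
        -- bound drops by at most one.
        lower′ : ∀ {V} → Sep g′ S A U V → ℓ ∸ 1 ≤ size g′ V
        lower′ {V} sV = ∸-monoˡ-≤ 1 (≤-trans (lower sep′) size′)
          where
          V′ : ℕ → Bool
          V′ u = V u ∧ not (u ≡ᵇ p)
          N⊆ : ∀ {w} → T (N g V′ w) → T (N g′ V w) ⊎ w ≡ p
          N⊆ {w} h with w ≟ p | Nᵉ g V′ h
          ... | yes e | _ = inj₂ e
          ... | no ne | (np , u , u< , vu , e) = inj₁ (Nⁱ g′ V u< (λ vw → np (∧ⁱ vw (notⁱ λ q → ne (≡ᵇ⇒≡ w p q)))) (∧ˡ (V u) vu)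
                (proj₂ del e (λ { refl → notᵉ (∧ʳ (V p) vu) (≡⇒≡ᵇ p p refl) }) ne))
          sep′ : Sep g S A U V′
          sep′ = sep (λ {s} hs → ∧ⁱ (Sep.source sV hs) (notⁱ λ q → proj₁ (Nᵉ g Z b) (subst (T ∘ Z) (≡ᵇ⇒≡ s p q) (sourceZ hs))))
                     (λ {u} a h → Sep.sink sV a (∧ˡ (V u) h))
                     (λ h u → [ (λ k → Sep.free sV k u) , (λ { refl → freeZ b u }) ]′ (N⊆ h))
          size′ : size g V′ ≤ suc (size g′ V)
          size′ = ≤-trans (count-mono M {q = λ w → N g′ V w ∨ (w ≡ᵇ p)} λ {w} _ h → [ ∨ˡ , (λ e → ∨ʳ (N g′ V w) (≡⇒≡ᵇ w p e)) ]′ (N⊆ h)) (count-insert M (N g′ V) p)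

      -- The chosen boundary vertex p is not in X′: it becomes an undeletable sink.
      mark : ∀ {p A′ U′} → T (N g Z p) → ¬ T (X′ p) → (∀ {u} → T (A u) → T (A′ u)) → (∀ {u} → T (U u) → T (U′ u)) →
             (∀ {u} → T (A′ u) → T (A u) ⊎ u ≡ p) → (∀ {u} → T (U′ u) → T (U u) ⊎ u ≡ p) → T (A′ p) → T (U′ p) →
             Hidden g S A′ U′ X′ κ (suc ℓ)
      mark {p} {A′} {U′} b nx A⊆ U⊆ ⊆A ⊆U Ap Up = record
        { kept = λ u h → [ (λ u′ → pushed-kept u′ h) , (λ { refl → nx h }) ]′ (⊆U u)
        ; apart = λ hs r a → [ (λ a′ → apart hs (pushed-dominates hs ε r) a′) , (λ { refl → pushed-outside b hs r }) ]′ (⊆A a)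
        ; budget = pushed-size
        -- If `V` were no larger than the old minimum, it would contain the nearest side `Z`. The
        -- sink `p`, which has an arc from `Z`, would then lie on the boundary of `V` although it is
        -- undeletable.
        ; lower = λ {V} sV → let sV′ = sep (Sep.source sV) (λ a → Sep.sink sV (A⊆ a)) (λ h u → Sep.free sV h (U⊆ u)) in
            ≤-trans (s≤s (lower isSep)) (≰⇒> λ le →
              let (nz , u , u< , zu , e) = Nᵉ g Z b in
              Sep.free sV (Nⁱ g V u< (Sep.sink sV Ap) (nearest sV′ le zu) e) Up) }

  hidden-cong : ∀ {g g′ S S′ A A′ U U′ X κ ℓ} →
    (∀ {u w} → T (g u w) → T (g′ u w)) → (∀ {u w} → T (g′ u w) → T (g u w)) →
    (∀ {u} → T (S u) → T (S′ u)) → (∀ {u} → T (S′ u) → T (S u)) →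
    (∀ {u} → T (A u) → T (A′ u)) → (∀ {u} → T (A′ u) → T (A u)) →
    (∀ {u} → T (U u) → T (U′ u)) → (∀ {u} → T (U′ u) → T (U u)) →
    Hidden g S A U X κ ℓ → Hidden g′ S′ A′ U′ X κ ℓ
  hidden-cong {g} {g′} {X = X} g→ g← S→ S← A→ A← U→ U← H = record
    { kept = λ u → kept (U← u)
    ; apart = λ s r a → apart (S← s) (reach-map (g′ ∖ X) (g ∖ X) (λ h → let (e , p , q) = ∖ᵉ g′ X h in ∖ⁱ g X (g← e) p q) r) (A← a)
    ; budget = budget
    ; lower = λ {Y} V → ≤-trans (lower (sep (λ s → Sep.source V (S→ s)) (λ a → Sep.sink V (A→ a))
        (λ h u → Sep.free V (N→ h) (U→ u)))) (count-mono M λ {w} _ → N→ {Y} {w}) }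
    where
    open Hidden H
    N→ : ∀ {Y w} → T (N g Y w) → T (N g′ Y w)
    N→ {Y} h = let (n , u , u< , y , e) = Nᵉ g Y h in Nⁱ g′ Y u< n y (g→ e)

-- Steering a loop by advice

LIM : ℕ
LIM = 15

falseE : ∀ {g} → Ex bool g
falseE = lit′ 1 ⊲ lit′ 0

digitE : Ex nat 2
digitE = Σ̂ (ite (n₀ ≐ ns PT && n₀ ⊲ ns LIM) (nr ADV x₀) (lit′ 0))

DIGIT APPLY : Stm
DIGIT = assign nat DG digitE
APPLY = assign bool DEL (br DEL x₀ || (bs HAS && (ns DG ≐ lit′ 0 && n₀ ≐ ns PK))) ⍮
        assign bool AX (br AX x₀ || (bs HAS && (neg (ns DG ≐ lit′ 0) && n₀ ≐ ns PK)))

advance : Stm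
advance = assign nat PT (ns PT ⊞ lit′ 1)

module Advice (C : Context) where
  open Context C renaming (cM to M)
  open Semantics C
  open Logic C

  _≈_ : State → State → Set
  _≈_ = Agree nat ADV

  digitAt : State → ℕ → ℕ → ℕ
  digitAt st lim p = sum M (λ x → if (x ≡ᵇ p) ∧ (x <ᵇ lim) then st nat ADV 0 x else 0)

  withDigit : State → ℕ → State
  withDigit st d = upd st nat DG (λ _ _ → d)

  -- If every step from a state satisfying I can be steered by a digit, a whole
  -- loop can be steered by an advice string.
  module _ (b : ℕ) (body : Stm) (blind : ¬ T (readsS nat ADV body)) (keeps : ¬ T (writes nat ADV body))
           (keepsLim : ¬ T (writes nat LIM body))
           (moves : ∀ st → run body st nat PT 0 0 ≡ suc (st nat PT 0 0))
           (I : ℕ → State → Set)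
           (step : ∀ {r st} → I r st → ∃[ d ] d < b × (r ≡ 0 → d ≡ 0) × I (r ∸ 1) (run body (withDigit st d))) where

    -- `end` is reached by writing each chosen digit directly to `DG`, after inspecting the state
    -- met so far. `follow` transfers the result to any state whose advice supplies the same digits.
    record Steered (m r : ℕ) (st : State) : Set where
      field
        digit  : ℕ → ℕ
        small  : ∀ j → digit j < b
        -- The loop runs `M` rounds, but only `r` places of the advice belong to it. Positions from
        -- `LIM` on read as 0, so later digits must be 0.
        past   : ∀ {j} → r ≤ j → digit j ≡ 0
        end    : State
        end-ok : I (r ∸ m) end
        end-pt : end nat PT 0 0 ≡ m + st nat PT 0 0
        end-lim : end nat LIM 0 0 ≡ st nat LIM 0 0
        follow : ∀ {st₀} → st ≈ st₀ →
                 (∀ {j} → j < m → digitAt st₀ (st nat LIM 0 0) (j + st nat PT 0 0) ≡ digit j) →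
                 end ≈ iter m (run (DIGIT ⍮ body)) st₀

    steer : 0 < b → ∀ m {r st} → I r st → Steered m r st
    steer b>0 zero    i = record { digit = λ _ → 0 ; small = λ _ → b>0 ; past = λ _ → refl ; end = _ ; end-ok = i
      ; end-pt = refl ; end-lim = refl ; follow = λ A _ → A }
    steer b>0 (suc m) {r} {st} i with steer b>0 m i
    ... | s with step (Steered.end-ok s)
    ...   | d , d< , d0 , i′ = record
      { digit = digit′ ; small = small′ ; past = past′ ; end = y
      ; end-ok = subst (λ x → I x y) (trans (∸-+-assoc r m 1) (cong (r ∸_) (+-comm m 1))) i′
      ; end-pt = trans (moves (withDigit S.end d)) (cong suc S.end-pt)
      ; end-lim = trans (cong (λ f → f 0 0) (frame body (withDigit S.end d) nat LIM keepsLim)) S.end-lim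
      ; follow = λ {st₀} A h → let B = S.follow A (λ {j} j< → trans (h (≤-trans j< (n≤1+n m))) (digit-old j<)) in
          run-agree {nat} {ADV} (digits {st₀} B (trans (h ≤-refl) digit-new)) body blind }
      where
      module S = Steered s
      y = run body (withDigit S.end d)
      digit′ : ℕ → ℕ
      digit′ j = if j ≡ᵇ m then d else S.digit j
      digit-new : digit′ m ≡ d
      digit-new = if-T (≡⇒≡ᵇ m m refl)
      digit-old : ∀ {j} → j < m → digit′ j ≡ S.digit j
      digit-old {j} j< = if-F λ h → <⇒≢ j< (≡ᵇ⇒≡ j m h)
      small′ : ∀ j → digit′ j < b
      small′ j with j ≡ᵇ m
      ... | true  = d<
      ... | false = S.small j
      past′ : ∀ {j} → r ≤ j → digit′ j ≡ 0
      past′ {j} h with j ≟ m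
      ... | yes refl = trans digit-new (d0 (m≤n⇒m∸n≡0 h))
      ... | no ne    = trans (if-F λ q → ne (≡ᵇ⇒≡ j m q)) (S.past h)
      digits : ∀ {st₀} → S.end ≈ iter m (run (DIGIT ⍮ body)) st₀ →
               digitAt st₀ (st nat LIM 0 0) (m + st nat PT 0 0) ≡ d →
               withDigit S.end d ≈ run DIGIT (iter m (run (DIGIT ⍮ body)) st₀)
      digits {st₀} B e = upd-agree nat DG _ _ B λ i j → trans (sym e) (sum-cong M λ {x} _ →
          trans (cong₂ (λ p l → if (x ≡ᵇ p) ∧ (x <ᵇ l) then st₀ nat ADV 0 x else 0)
                  (trans (sym S.end-pt) (B nat PT (λ ()) 0 0)) (trans (sym S.end-lim) (B nat LIM (λ ()) 0 0)))
                (cong (λ f → if (x ≡ᵇ st₁ nat PT 0 0) ∧ (x <ᵇ st₁ nat LIM 0 0) then f 0 x else 0) (sym (unread m))))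
        where
        st₁ = iter m (run (DIGIT ⍮ body)) st₀
        unread : ∀ m → iter m (run (DIGIT ⍮ body)) st₀ nat ADV ≡ st₀ nat ADV
        unread zero    = refl
        unread (suc m) = trans (frame body (run DIGIT (iter m (run (DIGIT ⍮ body)) st₀)) nat ADV keeps) (unread m)

record Updated (D A D′ A′ : ℕ → Bool) (has : Bool) (p d : ℕ) : Set where
  field
    del-old : ∀ {x} → T (D x) → T (D′ x)
    ax-old  : ∀ {x} → T (A x) → T (A′ x)
    del-new : ∀ {x} → T (D′ x) → T (D x) ⊎ T has × d ≡ 0 × x ≡ p
    ax-new  : ∀ {x} → T (A′ x) → T (A x) ⊎ T has × d ≢ 0 × x ≡ p
    del-add : T has → d ≡ 0 → T (D′ p)
    ax-add  : T has → d ≢ 0 → T (A′ p)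

-- The block `P` does not read the digit. So the vertex that it offers is known before the digit is
-- chosen, although in the program the digit is read first.
module Applied (C : Context) (P : Stm) (blind : ¬ T (readsS nat DG P)) (kDG : ¬ T (writes nat DG P))
               (kDEL : ¬ T (writes bool DEL P)) (kAX : ¬ T (writes bool AX P)) (st : State) (d : ℕ) where
  open Semantics C
  open Logic C
  open Advice C

  agree : Agree nat DG (run P st) (run P (withDigit st d))
  agree = run-agree (λ t b h i j → sym (cong (λ f → f i j) (upd-frame st nat DG (λ _ _ → d) t b (λ q → h (flip t b q))))) P blind
    where
    flip : ∀ t b → T (sameArray nat DG t b) → T (sameArray t b nat DG)
    flip nat b q = ≡⇒≡ᵇ b DG (sym (≡ᵇ⇒≡ DG b q))

  digit : run P (withDigit st d) nat DG 0 0 ≡ d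
  digit = cong (λ f → f 0 0) (frame P (withDigit st d) nat DG kDG)

  has-eq : run APPLY (run P (withDigit st d)) bool HAS 0 0 ≡ run P st bool HAS 0 0
  has-eq = sym (agree bool HAS (λ ()) 0 0)

  del-eq : ∀ x → run APPLY (run P (withDigit st d)) bool DEL 0 x ≡ st bool DEL 0 x ∨ (run P st bool HAS 0 0 ∧ ((d ≡ᵇ 0) ∧ (x ≡ᵇ run P st nat PK 0 0)))
  del-eq x = cong₂ _∨_ (cong (λ f → f 0 x) (frame P (withDigit st d) bool DEL kDEL))
    (cong₂ _∧_ has-eq (cong₂ (λ a b → (a ≡ᵇ 0) ∧ (x ≡ᵇ b)) digit (sym (agree nat PK (λ ()) 0 0))))

  ax-eq : ∀ x → run APPLY (run P (withDigit st d)) bool AX 0 x ≡ st bool AX 0 x ∨ (run P st bool HAS 0 0 ∧ (not (d ≡ᵇ 0) ∧ (x ≡ᵇ run P st nat PK 0 0)))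
  ax-eq x = cong₂ _∨_ (cong (λ f → f 0 x) (frame P (withDigit st d) bool AX kAX))
    (cong₂ _∧_ has-eq (cong₂ (λ a b → not (a ≡ᵇ 0) ∧ (x ≡ᵇ b)) digit (sym (agree nat PK (λ ()) 0 0))))

  updated : Updated (st bool DEL 0) (st bool AX 0) (run APPLY (run P (withDigit st d)) bool DEL 0) (run APPLY (run P (withDigit st d)) bool AX 0) (run P st bool HAS 0 0) (run P st nat PK 0 0) d
  updated = record
    { del-old = λ {x} h → subst T (sym (del-eq x)) (∨ˡ h)
    ; ax-old  = λ {x} h → subst T (sym (ax-eq x)) (∨ˡ h)
    ; del-new = λ {x} h → [ inj₁ , (λ q → inj₂ (∧ˡ has q , ≡ᵇ⇒≡ d 0 (∧ˡ (d ≡ᵇ 0) (∧ʳ has q)) , ≡ᵇ⇒≡ x p (∧ʳ (d ≡ᵇ 0) (∧ʳ has q)))) ]′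
        (∨ᵉ (st bool DEL 0 x) (subst T (del-eq x) h))
    ; ax-new  = λ {x} h → [ inj₁ , (λ q → inj₂ (∧ˡ has q , (λ e → notᵉ (∧ˡ (not (d ≡ᵇ 0)) (∧ʳ has q)) (≡⇒≡ᵇ d 0 e)) , ≡ᵇ⇒≡ x p (∧ʳ (not (d ≡ᵇ 0)) (∧ʳ has q)))) ]′
        (∨ᵉ (st bool AX 0 x) (subst T (ax-eq x) h))
    ; del-add = λ { h refl → subst T (sym (del-eq p)) (∨ʳ (st bool DEL 0 p) (∧ⁱ h (≡⇒≡ᵇ p p refl))) }
    ; ax-add  = λ h ne → subst T (sym (ax-eq p)) (∨ʳ (st bool AX 0 p) (∧ⁱ h (∧ⁱ (notⁱ λ q → ne (≡ᵇ⇒≡ d 0 q)) (≡⇒≡ᵇ p p refl)))) }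
    where
    has = run P st bool HAS 0 0
    p = run P st nat PK 0 0

-- Phase one: separating the components in topological order

protE lowE srcE : Ex bool 2
protE = br W x₀ && lit′ 0 ⊲ nr LAB x₀
lowE  = n₀ ⊲ #n && (br W x₀ && (lit′ 0 ⊲ nr LAB x₀ && nr LAB x₀ ⊲ ns LEV))
srcE  = n₀ ⊲ #n && (br W x₀ && neg (nr LAB x₀ ⊲ ns LEV))

SETUP₁ BODY₁ : Stm
SETUP₁ = assign bool GR (bm ARC x₁ x₀ && (neg (br DEL x₁) && neg (br DEL x₀))) ⍮
         assign bool SS srcE ⍮ assign bool AA (br AX x₀ || lowE) ⍮ assign bool UU (br AX x₀ || protE)
BODY₁  = SETUP₁ ⍮ SEP ⍮ APPLY ⍮ assign nat LEV (ns LEV ⊞ ite (bs HAS) (lit′ 0) (lit′ 1)) ⍮ advance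

-- A deletion lowers `2 * κ` by 2. This pays for the digit and for the possible loss of 1 in `ℓ`.
shift-fuel : ∀ {κ c ℓ r} → 2 * suc κ + c ≤ ℓ + suc r → 2 * κ + c ≤ (ℓ ∸ 1) + r
shift-fuel {κ} {c} {zero} {r} h = ≤-trans (≤-pred (≤-trans (s≤s (n≤1+n _)) (≤-trans (≤-reflexive (solve 2 (λ κ c → con 2 :+ (con 2 :* κ :+ c) := con 2 :* (con 1 :+ κ) :+ c) refl κ c)) h))) ≤-refl
  where open +-*-Solver
shift-fuel {κ} {c} {suc ℓ} {r} h = ≤-pred (≤-pred (≤-trans (≤-reflexive (solve 2 (λ κ c → con 2 :+ (con 2 :* κ :+ c) := con 2 :* (con 1 :+ κ) :+ c) refl κ c)) (≤-trans h (≤-reflexive (cong suc (+-suc ℓ r))))))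
  where open +-*-Solver

module Phase₁ (C : Context) (n+n≤M : Context.cn C + Context.cn C ≤ Context.cM C) (k<M : Context.ck C < Context.cM C) where
  open Context C renaming (cM to M; cn to n; ck to k)
  open Semantics C
  open Logic C
  open Vertex M
  open Separator C n+n≤M using (sep-ok)
  open Pushing C
  open Advice C using (withDigit)

  -- Exceeds all labels, which are bounded by the size of `W`, at most `2 * k + 1`. From level `top`
  -- on there are no sources.
  top : ℕ
  top = 2 * k + 3

  src low : (ℕ → Bool) → (ℕ → ℕ) → ℕ → ℕ → Bool
  src w l j x = (x <ᵇ n) ∧ (w x ∧ not (l x <ᵇ j))
  low w l j x = (x <ᵇ n) ∧ (w x ∧ ((0 <ᵇ l x) ∧ (l x <ᵇ j)))

  prot : (ℕ → Bool) → (ℕ → ℕ) → ℕ → Bool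
  prot w l x = w x ∧ (0 <ᵇ l x)

  src-e : ∀ w l j {x} → T (src w l j x) → x < n × T (w x) × j ≤ l x
  src-e w l j {x} h = <ᵇ⇒< x n (∧ˡ (x <ᵇ n) h) , ∧ˡ (w x) (∧ʳ (x <ᵇ n) h) , ≮⇒≥ λ q → notᵉ (∧ʳ (w x) (∧ʳ (x <ᵇ n) h)) (<⇒<ᵇ q)

  src-i : ∀ w l j {x} → x < n → T (w x) → j ≤ l x → T (src w l j x)
  src-i w l j {x} x< h q = ∧ⁱ (<⇒<ᵇ x<) (∧ⁱ h (notⁱ λ u → ≤⇒≯ q (<ᵇ⇒< (l x) j u)))

  low-e : ∀ w l j {x} → T (low w l j x) → x < n × T (w x) × 0 < l x × l x < j
  low-e w l j {x} h = let a = ∧ʳ (w x) (∧ʳ (x <ᵇ n) h) in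
    <ᵇ⇒< x n (∧ˡ (x <ᵇ n) h) , ∧ˡ (w x) (∧ʳ (x <ᵇ n) h) , <ᵇ⇒< 0 (l x) (∧ˡ (0 <ᵇ l x) a) , <ᵇ⇒< (l x) j (∧ʳ (0 <ᵇ l x) a)

  low-i : ∀ w l j {x} → x < n → T (w x) → 0 < l x → l x < j → T (low w l j x)
  low-i w l j x< h p q = ∧ⁱ (<⇒<ᵇ x<) (∧ⁱ h (∧ⁱ (<⇒<ᵇ p) (<⇒<ᵇ q)))

  src-anti : ∀ w l {i j x} → i ≤ j → T (src w l j x) → T (src w l i x)
  src-anti w l {i} {j} h s = let (a , b , c) = src-e w l j s in src-i w l i a b (≤-trans h c)

  src⊆prot : ∀ w l {j x} → 1 ≤ j → T (src w l j x) → T (prot w l x)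
  src⊆prot w l {j} h s = let (a , b , c) = src-e w l j s in ∧ⁱ b (<⇒<ᵇ (≤-trans h c))

  record Fixed (g : ℕ → ℕ → Bool) (w : ℕ → Bool) (l : ℕ → ℕ) : Set where
    field
      arcs  : ∀ {u w} → T (g u w) → u < n × w < n
      below : ∀ {x} → T (w x) → l x < top

  -- Higher labels must not reach lower positive ones. Below level `lev` the deletions alone ensure
  -- this (`below`); the other levels are still owed to the hidden set, by `hid` with the added
  -- sinks for the present level and by `above` for all from there on.
  record Inv₁ (g : ℕ → ℕ → Bool) (W₀ : ℕ → ℕ → Bool) (L₀ : ℕ → ℕ → ℕ) (r : ℕ) (st : State) : Set where
    w = W₀ 0
    l = L₀ 0
    D = st bool DEL 0
    A = st bool AX 0
    lev = st nat LEV 0 0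
    G = g ∖ D
    field
      arc≡ : st bool ARC ≡ g
      w≡   : st bool W ≡ W₀
      l≡   : st nat LAB ≡ L₀
      lev>0 : 1 ≤ lev
      {X}  : ℕ → Bool
      {κ ℓ} : ℕ
      hid  : Hidden G (src w l lev) (λ x → A x ∨ low w l lev x) (λ x → A x ∨ prot w l x) X κ ℓ
      above : ∀ {j s t} → lev ≤ j → T (src w l j s) → T (low w l j t) → ¬ Reach (G ∖ X) s t
      below : ∀ {j s t} → j < lev → T (src w l j s) → T (low w l j t) → ¬ Reach G s t
      spent : κ + count M D ≤ k
      -- The potential, including the levels left, is at most the number `r` of digits left. A
      -- deletion, a new sink and a finished level each lower it by at least 1.
      fuel  : 2 * κ + (top ∸ lev) ≤ ℓ + r

  module Step {g W₀ L₀ r st} (F : Fixed g (W₀ 0) (L₀ 0)) (I : Inv₁ g W₀ L₀ r st) where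
    open Fixed F using (arcs) renaming (below to labels)
    open Inv₁ I
    private
      S A′ U : ℕ → Bool
      S = src w l lev
      A′ x = A x ∨ low w l lev x
      U x = A x ∨ prot w l x
      arcsG : ∀ {u v} → T (G u v) → u < n × v < n
      arcsG h = arcs (proj₁ (∖ᵉ g D h))
      n<M : ∀ {x} → x < n → x < M
      n<M h = ≤-trans h (≤-trans (m≤m+n n n) n+n≤M)
      boundedG : ∀ {u v} → T (G u v) → u < M × v < M
      boundedG h = let (a , b) = arcsG h in n<M a , n<M b
      S<n : ∀ {s} → T (S s) → s < n
      S<n h = proj₁ (src-e w l lev h)
      S⊆U : ∀ {s} → T (S s) → T (U s)
      S⊆U {s} h = ∨ʳ (A s) (src⊆prot w l lev>0 h)
      κ≤k : κ ≤ k
      κ≤k = ≤-trans (m≤m+n κ _) spent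
      st₁ = run SETUP₁ st
      st₂ = run SEP st₁

    outcome : ∃[ Z ] MinSep G S A′ U Z ×
      (T (st₂ bool HAS 0 0) × st₂ nat PK 0 0 < M × T (N G Z (st₂ nat PK 0 0)) ⊎
       ¬ T (st₂ bool HAS 0 0) × (∀ {w} → w < M → ¬ T (N G Z w)))
    outcome with arc≡ | w≡ | l≡
    ... | refl | refl | refl = sep-ok st₁ arcsG S<n (hidden-sep boundedG (n<M ∘ S<n) S⊆U hid)
                 (≤-trans (s≤s (≤-trans (hidden-size boundedG (n<M ∘ S<n) S⊆U hid) κ≤k)) k<M)

    record After (has : Bool) (p d : ℕ) (st′ : State) : Set where
      field
        effect : Updated D A (st′ bool DEL 0) (st′ bool AX 0) has p d
        lev-eq : st′ nat LEV 0 0 ≡ lev + (if has then 0 else 1)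
        arc′   : st′ bool ARC ≡ g
        w′     : st′ bool W ≡ W₀
        l′     : st′ nat LAB ≡ L₀

    after : ∀ d → After (st₂ bool HAS 0 0) (st₂ nat PK 0 0) d (run BODY₁ (withDigit st d))
    after d = record
      { effect = Applied.updated C (SETUP₁ ⍮ SEP) (λ ()) (λ ()) (λ ()) (λ ()) st d
      ; lev-eq = cong₂ _+_ (cong (λ f → f 0 0) (frame (SETUP₁ ⍮ SEP ⍮ APPLY) (withDigit st d) nat LEV λ ()))
          (cong (λ b → if b then 0 else 1) (Applied.has-eq C (SETUP₁ ⍮ SEP) (λ ()) (λ ()) (λ ()) (λ ()) st d))
      ; arc′ = trans (frame BODY₁ (withDigit st d) bool ARC λ ()) arc≡
      ; w′ = trans (frame BODY₁ (withDigit st d) bool W λ ()) w≡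
      ; l′ = trans (frame BODY₁ (withDigit st d) nat LAB λ ()) l≡ }

    module Move (has : Bool) (p : ℕ) {Z : ℕ → Bool} (min : MinSep G S A′ U Z)
                (next-state : ℕ → State) (result : ∀ d → After has p d (next-state d)) where
     private
      n<M′ : ∀ {s} → T (S s) → s < M
      n<M′ = n<M ∘ S<n

     module Digit (d : ℕ) where
      open After (result d) public
      open Updated effect public
      st′ = next-state d
      D′ A″ : ℕ → Bool
      D′ = st′ bool DEL 0
      A″ = st′ bool AX 0
      lev′ = st′ nat LEV 0 0
      G′ = g ∖ D′
      G′⊆ : ∀ {u v} → T (G′ u v) → T (G u v)
      G′⊆ h = let (e , a , b) = ∖ᵉ g D′ h in ∖ⁱ g D e (a ∘ del-old) (b ∘ del-old)
      reach⊆ : ∀ {u v} → Reach G′ u v → Reach G u v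
      reach⊆ = reach-map G′ G G′⊆

     choose : T has × p < M × T (N G Z p) ⊎ ¬ T has × (∀ {w} → w < M → ¬ T (N G Z w)) →
            ∃[ d ] d < 2 × (r ≡ 0 → d ≡ 0) × Inv₁ g W₀ L₀ (r ∸ 1) (next-state d)
     choose (inj₂ (¬has , none)) = 0 , s≤s z≤n , (λ _ → refl) , next
       where
       open Digit 0
       blocked = no-boundary boundedG n<M′ S⊆U hid min none
       same : ∀ {u v} → T (G u v) → T (G′ u v)
       same h = let (e , a , b) = ∖ᵉ g D h in ∖ⁱ g D′ e
         (λ q → [ a , ¬has ∘ proj₁ ]′ (del-new q)) (λ q → [ b , ¬has ∘ proj₁ ]′ (del-new q))
       lev-suc : lev′ ≡ suc lev
       lev-suc = trans lev-eq (trans (cong (lev +_) (if-F ¬has)) (+-comm lev 1))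
       ax-same : ∀ {x} → T (A″ x) → T (A x)
       ax-same h = [ id , (λ q → ⊥-elim (¬has (proj₁ q))) ]′ (ax-new h)
       next : Inv₁ g W₀ L₀ (r ∸ 1) st′
       next with top ≤? lev
       ... | no lt = record
         { arc≡ = arc′ ; w≡ = w′ ; l≡ = l′ ; lev>0 = subst (1 ≤_) (sym lev-suc) (s≤s z≤n)
         ; X = X ; κ = κ ; ℓ = 0
         ; hid = record
           { kept = λ {u} h → Hidden.kept hid ([ (λ q → ∨ˡ (ax-same q)) , ∨ʳ (A u) ]′ (∨ᵉ (A″ u) h))
           ; apart = λ {s} {a} hs q h → [ (λ ha → proj₁ blocked (src-anti w l (n≤1+n lev) (subst (λ j → T (src w l j s)) lev-suc hs)) (∨ˡ (ax-same ha)) (reach⊆ (reach-∖ G′ X q))) ,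
               (λ ha → above (n≤1+n lev) (subst (λ j → T (src w l j s)) lev-suc hs) (subst (λ j → T (low w l j a)) lev-suc ha) (reach-map (G′ ∖ X) (G ∖ X) shrink q)) ]′ (∨ᵉ (A″ a) h)
           ; budget = Hidden.budget hid ; lower = λ _ → z≤n }
         ; above = λ {j} h hs ht q → above (≤-trans (n≤1+n lev) (≤-trans (≤-reflexive (sym lev-suc)) h)) hs ht (reach-map (G′ ∖ X) (G ∖ X) shrink q)
         ; below = below′
         ; spent = ≤-trans (+-monoʳ-≤ κ (count-mono M λ _ q → [ id , (λ q → ⊥-elim (¬has (proj₁ q))) ]′ (del-new q))) spent
         ; fuel = subst (λ m → 2 * κ + (top ∸ m) ≤ r ∸ 1) (sym lev-suc) (fuel′ r (subst (λ m → 2 * κ + (top ∸ lev) ≤ m + r) (proj₂ blocked) fuel)) }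
         where
         shrink : ∀ {u v} → T ((G′ ∖ X) u v) → T ((G ∖ X) u v)
         shrink h = let (e , a , b) = ∖ᵉ G′ X h in ∖ⁱ G X (G′⊆ e) a b
         below′ : ∀ {j s t} → j < lev′ → T (src w l j s) → T (low w l j t) → ¬ Reach G′ s t
         below′ {j} {s} {t} h hs ht q with m≤n⇒m<n∨m≡n (≤-pred (≤-trans h (≤-reflexive lev-suc)))
         ... | inj₁ j<  = below j< hs ht (reach⊆ q)
         ... | inj₂ refl = proj₁ blocked hs (∨ʳ (A t) ht) (reach⊆ q)
         fuel′ : ∀ r → 2 * κ + (top ∸ lev) ≤ r → 2 * κ + (top ∸ suc lev) ≤ r ∸ 1
         fuel′ r h = ≤-trans (≤-reflexive (sym (trans (cong (_∸ 1) (cong (2 * κ +_) (sym (suc-pred-∸)))) (cong (_∸ 1) (+-suc (2 * κ) (top ∸ suc lev)))))) (∸-monoˡ-≤ 1 h)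
           where
           suc-pred-∸ : suc (top ∸ suc lev) ≡ top ∸ lev
           suc-pred-∸ = sym (+-∸-assoc 1 (≰⇒> lt))
       -- There are no sources any more, so the empty set with budget 0 is a hidden solution and the
       -- remaining rounds are idle.
       ... | yes ge = record
         { arc≡ = arc′ ; w≡ = w′ ; l≡ = l′ ; lev>0 = subst (1 ≤_) (sym lev-suc) (s≤s z≤n)
         ; X = λ _ → false ; κ = 0 ; ℓ = 0
         ; hid = record { kept = λ _ () ; apart = λ {s} hs _ _ → void (subst (λ j → T (src w l j s)) lev-suc hs)
                        ; budget = ≤-reflexive (sum-zero M (λ _ → refl)) ; lower = λ _ → z≤n }
         ; above = λ {j} {s} h hs _ _ → void (src-anti w l {x = s} (≤-trans (≤-reflexive (sym lev-suc)) h) hs)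
         ; below = below′
         ; spent = ≤-trans (≤-trans (count-mono M λ _ q → [ id , (λ q → ⊥-elim (¬has (proj₁ q))) ]′ (del-new q)) (m≤n+m _ κ)) spent
         ; fuel = subst (λ m → top ∸ m ≤ r ∸ 1) (sym lev-suc) (≤-trans (≤-reflexive (m≤n⇒m∸n≡0 (≤-trans ge (n≤1+n lev)))) z≤n) }
         where
         void : ∀ {s} → ¬ T (src w l (suc lev) s)
         void hs = let (_ , a , b) = src-e w l (suc lev) hs in n≮n _ (≤-trans (labels a) (≤-trans ge (≤-trans (n≤1+n lev) b)))
         below′ : ∀ {j s t} → j < lev′ → T (src w l j s) → T (low w l j t) → ¬ Reach G′ s t
         below′ {j} {s} {t} h hs ht q with m≤n⇒m<n∨m≡n (≤-pred (≤-trans h (≤-reflexive lev-suc)))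
         ... | inj₁ j<  = below j< hs ht (reach⊆ q)
         ... | inj₂ refl = proj₁ blocked hs (∨ʳ (A t) ht) (reach⊆ q)
     choose (inj₁ (h , p< , b)) = go r refl
       where
       go : ∀ r′ → r ≡ r′ → ∃[ d ] d < 2 × (r ≡ 0 → d ≡ 0) × Inv₁ g W₀ L₀ (r ∸ 1) (next-state d)
       -- Without digits left, `2 * κ ≤ ℓ ≤ κ` makes `κ` zero. Then the minimum separator is empty,
       -- but `p` lies on it.
       go zero refl = ⊥-elim (contradiction (≤-trans (≤-reflexive (sym (b2n-T b))) (≤-trans (term≤sum M p p<)
           (≤-trans (MinSep.minimum min (hidden-sep boundedG n<M′ S⊆U hid)) (≤-trans (hidden-size boundedG n<M′ S⊆U hid) κ≤0)))) λ ())
         where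
         κ≤0 : κ ≤ 0
         κ≤0 = +-cancelˡ-≤ κ κ 0 (≤-trans (≤-trans (+-monoʳ-≤ κ (m≤m+n κ 0)) (≤-trans (m≤m+n _ _) fuel)) (+-monoˡ-≤ 0 (lower≤budget boundedG n<M′ S⊆U hid)))
       go (suc r′) refl with T? (X′ boundedG n<M′ S⊆U hid min p)
       ... | yes x = 0 , s≤s z≤n , (λ ()) , next
         where
         open Digit 0
         del : Deleted p G G′
         del = (λ e → G′⊆ e , (λ { refl → proj₁ (proj₂ (∖ᵉ g D′ e)) (del-add h refl) }) , (λ { refl → proj₂ (proj₂ (∖ᵉ g D′ e)) (del-add h refl) })) ,
           λ e nu nv → let (e′ , a , c) = ∖ᵉ g D e in ∖ⁱ g D′ e′ (λ q → [ a , (λ (_ , _ , e″) → nu e″) ]′ (del-new q)) (λ q → [ c , (λ (_ , _ , e″) → nv e″) ]′ (del-new q))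
         lev-same : lev′ ≡ lev
         lev-same = trans lev-eq (trans (cong (lev +_) (if-T h)) (+-identityʳ lev))
         ax-same : ∀ {x} → T (A″ x) → T (A x)
         ax-same q = [ id , (λ (_ , ne , _) → ⊥-elim (ne refl)) ]′ (ax-new q)
         next : Inv₁ g W₀ L₀ r′ st′
         next with delete boundedG n<M′ S⊆U hid min p< b x del
         ... | X″ , κ′ , refl , hid′ , dom = record
           { arc≡ = arc′ ; w≡ = w′ ; l≡ = l′ ; lev>0 = subst (1 ≤_) (sym lev-same) lev>0
           ; X = X″ ; κ = κ′ ; ℓ = ℓ ∸ 1
           ; hid = subst (λ m → Hidden G′ (src w l m) (λ x → A″ x ∨ low w l m x) (λ x → A″ x ∨ prot w l x) X″ κ′ (ℓ ∸ 1)) (sym lev-same)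
               (hidden-cong id id id id
                 (λ {u} q → [ (λ a → ∨ˡ (ax-old a)) , ∨ʳ (A″ u) ]′ (∨ᵉ (A u) q)) (λ {u} q → [ (λ a → ∨ˡ (ax-same a)) , ∨ʳ (A u) ]′ (∨ᵉ (A″ u) q))
                 (λ {u} q → [ (λ a → ∨ˡ (ax-old a)) , ∨ʳ (A″ u) ]′ (∨ᵉ (A u) q)) (λ {u} q → [ (λ a → ∨ˡ (ax-same a)) , ∨ʳ (A u) ]′ (∨ᵉ (A″ u) q)) hid′)
           -- The sources of later levels are sources now, so dominance carries these levels over to
           -- the new hidden set.
           ; above = λ {j} {s} {t} q hs ht c → above (≤-trans (≤-reflexive (sym lev-same)) q) hs ht (dom (src-anti w l (≤-trans (≤-reflexive (sym lev-same)) q) hs) ε c)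
           ; below = λ q hs ht c → below (≤-trans q (≤-reflexive lev-same)) hs ht (reach⊆ c)
           ; spent = ≤-trans (+-monoʳ-≤ κ′ (≤-trans (count-mono M {q = λ x → D x ∨ (x ≡ᵇ p)} λ {x} _ q → [ ∨ˡ , (λ (_ , _ , e) → ∨ʳ (D x) (≡⇒≡ᵇ x p e)) ]′ (del-new q)) (count-insert M D p)))
                       (≤-trans (≤-reflexive (+-suc κ′ _)) spent)
           ; fuel = subst (λ m → 2 * κ′ + (top ∸ m) ≤ ℓ ∸ 1 + r′) (sym lev-same) (shift-fuel {κ′} {top ∸ lev} {ℓ} fuel) }
       ... | no nx = 1 , s≤s (s≤s z≤n) , (λ ()) , next
         where
         open Digit 1
         same : ∀ {u v} → T (G u v) → T (G′ u v)
         same q = let (e , a , c) = ∖ᵉ g D q in ∖ⁱ g D′ e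
           (λ q → [ a , (λ ()) ]′ (del-new q)) (λ q → [ c , (λ ()) ]′ (del-new q))
         lev-same : lev′ ≡ lev
         lev-same = trans lev-eq (trans (cong (lev +_) (if-T h)) (+-identityʳ lev))
         P = X′ boundedG n<M′ S⊆U hid min
         old : ∀ {B : ℕ → Bool} {u} → T (A u ∨ B u) → T (A″ u ∨ B u)
         old {u = u} q = [ (λ a → ∨ˡ (ax-old a)) , ∨ʳ (A″ u) ]′ (∨ᵉ (A u) q)
         new : ∀ {B : ℕ → Bool} {u} → T (A″ u ∨ B u) → T (A u ∨ B u) ⊎ u ≡ p
         new {u = u} q = [ (λ a → [ (λ a → inj₁ (∨ˡ a)) , (λ (_ , _ , e) → inj₂ e) ]′ (ax-new a)) , (λ c → inj₁ (∨ʳ (A u) c)) ]′ (∨ᵉ (A″ u) q)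
         hid′ : Hidden G S (λ x → A″ x ∨ low w l lev x) (λ x → A″ x ∨ prot w l x) P κ (suc ℓ)
         hid′ = mark boundedG n<M′ S⊆U hid min b nx (λ {u} → old {low w l lev} {u}) (λ {u} → old {prot w l} {u})
                  (λ {u} → new {low w l lev} {u}) (λ {u} → new {prot w l} {u}) (∨ˡ (ax-add h λ ())) (∨ˡ (ax-add h λ ()))
         next : Inv₁ g W₀ L₀ r′ st′
         next = record
           { arc≡ = arc′ ; w≡ = w′ ; l≡ = l′ ; lev>0 = subst (1 ≤_) (sym lev-same) lev>0
           ; X = P ; κ = κ ; ℓ = suc ℓ
           ; hid = subst (λ m → Hidden G′ (src w l m) (λ x → A″ x ∨ low w l m x) (λ x → A″ x ∨ prot w l x) P κ (suc ℓ)) (sym lev-same)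
               (hidden-cong same G′⊆ id id id id id id hid′)
           ; above = λ {j} {s} {t} q hs ht c → above (≤-trans (≤-reflexive (sym lev-same)) q) hs ht
               (pushed-dominates boundedG n<M′ S⊆U hid min (src-anti w l (≤-trans (≤-reflexive (sym lev-same)) q) hs) ε
                 (reach-map (G′ ∖ P) (G ∖ P) (λ e → let (e′ , a , c) = ∖ᵉ G′ P e in ∖ⁱ G P (G′⊆ e′) a c) c))
           ; below = λ q hs ht c → below (≤-trans q (≤-reflexive lev-same)) hs ht (reach⊆ c)
           ; spent = ≤-trans (+-monoʳ-≤ κ (count-mono M λ _ q → [ id , (λ ()) ]′ (del-new q))) spent
           ; fuel = subst (λ m → 2 * κ + (top ∸ m) ≤ suc ℓ + r′) (sym lev-same) (≤-trans fuel (≤-reflexive (+-suc ℓ r′))) }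

    step : ∀ {B} → B ≡ BODY₁ → ∃[ d ] d < 2 × (r ≡ 0 → d ≡ 0) × Inv₁ g W₀ L₀ (r ∸ 1) (run B (withDigit st d))
    step refl = Move.choose (st₂ bool HAS 0 0) (st₂ nat PK 0 0) (proj₁ (proj₂ outcome))
      (λ d → run BODY₁ (withDigit st d)) after (proj₂ (proj₂ outcome))

-- Phase two: solving the requests inside the components

isBadSource isBadTarget : ∀ {h} → Fin h → Ex bool h
isBadSource s = ∃̂ (bm VI (v (suc s)) x₀)
isBadTarget t = ∃̂ (n₀ ≐ ns VS && bm VI x₀ (v (suc t)))

coreE badE : Ex bool 2
coreE = ∃̂ (br SS x₀ && bm TC x₀ x₁) && ∃̂ (br SS x₀ && bm TC x₁ x₀)
badE  = bm REQ x₁ x₀ && (neg (ns ROW ⊲ n₁) && (bm HH x₁ x₀ && (br FB x₁ && br FB x₀)))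

-- When the present separation is done, the digit selects the next one in `RESET`: 0 and 1 name the
-- endpoint `VS`, 2 and 3 name `VT`, and odd digits reverse the arcs. The sinks added by earlier
-- digits belong to the former separation and are dropped.
SETUP₂ FIND RESET BODY₂ : Stm
SETUP₂ = assign bool GR (ite (bs DIR) (bm G2 x₀ x₁) (bm G2 x₁ x₀) && (neg (br DEL x₁) && neg (br DEL x₀))) ⍮
         assign bool SS (n₀ ⊲ #n && protE) ⍮ assign bool AA (br AX x₀ || br DS x₀) ⍮ assign bool UU (br AX x₀ || protE)
FIND   = assign bool GC (bm G2 x₁ x₀ && (neg (br DEL x₁) && neg (br DEL x₀))) ⍮ CLOSE ⍮
         assign bool FB coreE ⍮ assign bool VI badE ⍮ assign bool VIO (∃̂ (isBadSource zero)) ⍮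
         assign nat VS (firstE isBadSource) ⍮ assign nat VT (firstE isBadTarget)
RESET  = assign bool DS (ite (bs HAS) (br DS x₀) (bs VIO && n₀ ≐ ite (ns DG ⊲ lit′ 2) (ns VS) (ns VT))) ⍮
         assign bool AX (bs HAS && br AX x₀) ⍮
         assign bool DIR (ite (bs HAS) (bs DIR) (ns DG ≐ lit′ 1 || ns DG ≐ lit′ 3))
BODY₂  = SETUP₂ ⍮ SEP ⍮ FIND ⍮ APPLY ⍮ RESET ⍮ advance

reach-reverse : ∀ g g′ → (∀ {u w} → T (g u w) → T (g′ w u)) → ∀ {u w} → Reach g u w → Reach g′ w u
reach-reverse g g′ f ε       = ε
reach-reverse g g′ f (e ◅ p) = reach-reverse g g′ f p ◅◅ (f e ◅ ε)

module Phase₂ (C : Context) (n+n≤M : Context.cn C + Context.cn C ≤ Context.cM C) (k<M : 2 * Context.ck C < Context.cM C) where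
  open Context C renaming (cM to M; cn to n; ck to k)
  open Semantics C
  open Logic C
  open Vertex M
  open Closure C
  open Separator C n+n≤M using (sep-ok)
  open Pushing C
  open Advice C using (withDigit)
  open Phase₁ C n+n≤M (≤-trans (s≤s (m≤m+n k _)) k<M) using (prot)

  terminals : (ℕ → Bool) → (ℕ → ℕ) → ℕ → Bool
  terminals w l x = (x <ᵇ n) ∧ prot w l x

  Core : (ℕ → ℕ → Bool) → (ℕ → Bool) → ℕ → Set
  Core g S x = (∃[ s ] T (S s) × Reach g s x) × (∃[ s ] T (S s) × Reach g x s)

  directed : Bool → (ℕ → ℕ → Bool) → ℕ → ℕ → Bool
  directed dir g u w = if dir then g w u else g u w

  record Fixed₂ (g h q : ℕ → ℕ → Bool) : Set where
    field
      arcs : ∀ {u w} → T (g u w) → u < n × w < n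
      reqs : ∀ {u w} → T (q u w) → u < n × w < n

  -- Stronger than solving the requests: two endpoints related by `h` must not both be connected
  -- from and to the terminals, not even to different ones. An endpoint that fails this is separated
  -- from all terminals at once in one direction, so a single cut problem describes the choice.
  Solved : (g h q : ℕ → ℕ → Bool) (m : ℕ) (S : ℕ → Bool) → Set
  Solved g h q m S = ∀ {s t} → T (q s t) → s ≤ m → T (h s t) → Core g S s → Core g S t → ⊥

  record Static₂ (g h q W₀ : ℕ → ℕ → Bool) (L₀ : ℕ → ℕ → ℕ) (m : ℕ) (st : State) : Set where
    field
      g≡ : st bool G2 ≡ g
      h≡ : st bool HH ≡ h
      q≡ : st bool REQ ≡ q
      w≡ : st bool W ≡ W₀
      l≡ : st nat LAB ≡ L₀
      m≡ : st nat ROW 0 0 ≡ m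

  record Found (g h q : ℕ → ℕ → Bool) (m : ℕ) (S : ℕ → Bool) (vio : Bool) (vs vt : ℕ) : Set where
    field
      some : T vio → T (q vs vt) × vs ≤ m × T (h vs vt) × Core g S vs × Core g S vt
      none : ¬ T vio → Solved g h q m S

  find-ok : ∀ {q m} y → (∀ {u w} → T (y bool G2 u w) → u < n × w < n) → (∀ {u w} → T (q u w) → u < n × w < n) →
            (∀ {s} → T (y bool SS 0 s) → s < n) → y bool REQ ≡ q → y nat ROW 0 0 ≡ m → let y′ = run FIND y in
            Found (y bool G2 ∖ y bool DEL 0) (y bool HH) q m (y bool SS 0) (y′ bool VIO 0 0) (y′ nat VS 0 0) (y′ nat VT 0 0)
  find-ok y gn qn Sn refl refl = record { some = some ; none = none }
    where
    g = y bool G2 ∖ y bool DEL 0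
    S = y bool SS 0
    y₀ = run (assign bool GC (bm G2 x₁ x₀ && (neg (br DEL x₁) && neg (br DEL x₀)))) y
    y₁ = run CLOSE y₀
    y₂ = run (assign bool FB coreE) y₁
    y₃ = run (assign bool VI badE) y₂
    n<M : ∀ {x} → x < n → x < M
    n<M h = ≤-trans h (≤-trans (m≤m+n n n) n+n≤M)
    bounded : ∀ {u w} → T (g u w) → u < M × w < M
    bounded h = let (a , b) = gn (proj₁ (∖ᵉ (y bool G2) (y bool DEL 0) h)) in n<M a , n<M b
    cl : Closed g (y₁ bool TC)
    cl = close-ok y₀
    ss : y₁ bool SS ≡ y bool SS
    ss = frame CLOSE y₀ bool SS λ ()
    hh : y₂ bool HH ≡ y bool HH
    hh = frame CLOSE y₀ bool HH λ ()
    rq : y₂ bool REQ ≡ y bool REQ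
    rq = frame CLOSE y₀ bool REQ λ ()
    rw′ : y₂ nat ROW ≡ y nat ROW
    rw′ = frame CLOSE y₀ nat ROW λ ()
    core-e : ∀ x → T (y₂ bool FB 0 x) → Core g S x
    core-e x h with to y₁ (x ∷ 0 ∷ []) coreE h
    ... | (s , _ , hs , p) , (t , _ , ht , q) =
      (s , subst (λ f → T (f 0 s)) ss hs , Closed.sound cl p) , (t , subst (λ f → T (f 0 t)) ss ht , Closed.sound cl q)
    core-i : ∀ x → Core g S x → T (y₂ bool FB 0 x)
    core-i x ((s , hs , p) , (t , ht , q)) = from y₁ (x ∷ 0 ∷ []) coreE
      ((s , n<M (Sn hs) , subst (λ f → T (f 0 s)) (sym ss) hs , Closed.complete cl bounded p) ,
       (t , n<M (Sn ht) , subst (λ f → T (f 0 t)) (sym ss) ht , Closed.complete cl bounded q))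
    y′ = run FIND y
    VIs = λ s → eval y₃ (s ∷ []) (isBadSource zero)
    vs = first M VIs
    y₄ = run (assign bool VIO (∃̂ (isBadSource zero)) ⍮ assign nat VS (firstE isBadSource)) y₃
    VIt = λ t → eval y₄ (t ∷ []) (isBadTarget zero)
    vt = first M VIt
    some : T (any M VIs) → T (y bool REQ vs vt) × vs ≤ y nat ROW 0 0 × T (y bool HH vs vt) × Core g S vs × Core g S vt
    some h =
      let (vs< , bad) = first-ok M {VIs} h
          (t₀ , t₀< , vi) = to y₃ (vs ∷ []) (isBadSource zero) bad
          (_ , bad′) = first-ok M {VIt} (anyⁱ M {VIt} t₀ t₀< (from y₄ (t₀ ∷ []) (isBadTarget zero) (vs , vs< , refl , vi)))
          (s′ , _ , e , vi′) = to y₄ (vt ∷ []) (isBadTarget zero) bad′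
          (r , le , hv , a , b) = to y₂ (vt ∷ vs ∷ []) badE (subst (λ s → T (y₃ bool VI s vt)) e vi′)
      in subst (λ f → T (f vs vt)) rq r , subst (λ f → vs ≤ f 0 0) rw′ (≮⇒≥ le) , subst (λ f → T (f vs vt)) hh hv , core-e vs a , core-e vt b
    none : ¬ T (y′ bool VIO 0 0) → Solved g (y bool HH) (y bool REQ) (y nat ROW 0 0) S
    none h {s} {t} r le hv a b = h (from y₃ (0 ∷ 0 ∷ []) (∃̂ (isBadSource zero)) (s , n<M (proj₁ (qn r)) , t , n<M (proj₂ (qn r)) ,
      from y₂ (t ∷ s ∷ []) badE (subst (λ f → T (f s t)) (sym rq) r ,
        (λ lt → ≤⇒≯ le (subst (λ f → f 0 0 < s) rw′ lt)) , subst (λ f → T (f s t)) (sym hh) hv , core-i s a , core-i t b)))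

  found-in : ∀ y {g D h q m S} → y bool G2 ≡ g → y bool DEL 0 ≡ D → y bool HH ≡ h → y bool SS 0 ≡ S → y bool REQ ≡ q → y nat ROW 0 0 ≡ m →
             Fixed₂ g h q → (∀ {s} → T (S s) → s < n) →
             Found (g ∖ D) h q m S (run FIND y bool VIO 0 0) (run FIND y nat VS 0 0) (run FIND y nat VT 0 0)
  found-in y refl refl refl refl q≡ m≡ F Sn = find-ok y (Fixed₂.arcs F) (Fixed₂.reqs F) Sn q≡ m≡

  found-after : ∀ y {g D h q m S} → y bool G2 ≡ g → y bool DEL 0 ≡ D → y bool HH ≡ h → y bool SS 0 ≡ S → y bool REQ ≡ q → y nat ROW 0 0 ≡ m →
                Fixed₂ g h q → (∀ {s} → T (S s) → s < n) → let y′ = run FIND (run SEP y) in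
                Found (g ∖ D) h q m S (y′ bool VIO 0 0) (y′ nat VS 0 0) (y′ nat VT 0 0)
  found-after y g≡ D≡ h≡ S≡ q≡ m≡ = found-in (run SEP y) (trans (frame SEP y bool G2 λ ()) g≡) (trans (cong (λ f → f 0) (frame SEP y bool DEL λ ())) D≡)
    (trans (frame SEP y bool HH λ ()) h≡) (trans (cong (λ f → f 0) (frame SEP y bool SS λ ())) S≡)
    (trans (frame SEP y bool REQ λ ()) q≡) (trans (cong (λ f → f 0 0) (frame SEP y nat ROW λ ())) m≡)

  -- The potential has no levels here. A new separation starts with `ℓ = 1`, and this pays for the
  -- digit that selects it.
  record Inv₂ (g h q W₀ : ℕ → ℕ → Bool) (L₀ : ℕ → ℕ → ℕ) (m r : ℕ) (st : State) : Set where
    w = W₀ 0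
    l = L₀ 0
    D = st bool DEL 0
    A = st bool AX 0
    B = st bool DS 0
    dir = st bool DIR 0 0
    field
      static : Static₂ g h q W₀ L₀ m st
      {X}    : ℕ → Bool
      {κ ℓ}  : ℕ
      hid    : Hidden (directed dir g ∖ D) (terminals w l) (λ x → A x ∨ B x) (λ x → A x ∨ prot w l x) X κ ℓ
      good   : Solved (g ∖ D ∖ X) h q m (terminals w l)
      spent  : κ + count M D ≤ 2 * k
      fuel   : 2 * κ ≤ ℓ + r

  directed-arcs : ∀ dir {g} → (∀ {u w} → T (g u w) → u < n × w < n) → ∀ {u w} → T (directed dir g u w) → u < n × w < n
  directed-arcs true  gn e = let (a , b) = gn e in b , a
  directed-arcs false gn e = gn e

  solved-⊆ : ∀ g g′ {h q m S} → (∀ {u w} → T (g′ u w) → T (g u w)) → Solved g h q m S → Solved g′ h q m S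
  solved-⊆ g g′ sub sol r le hv a b = sol r le hv (core a) (core b)
    where
    core : ∀ {x} → Core g′ _ x → Core g _ x
    core ((s , hs , p) , (t , ht , q)) = (s , hs , reach-map g′ g sub p) , (t , ht , reach-map g′ g sub q)

  -- A core vertex is reached from `S`, and its walk back to `S` starts there; this is why
  -- `Dominates` speaks of walks continuing from a reached vertex. For reversed arcs the two walks
  -- exchange their roles.
  solved-dominates : ∀ dir {g D D′ S X X′ h q m} → Dominates (directed dir g ∖ D) S X (directed dir g ∖ D′) X′ →
                     Solved (g ∖ D ∖ X) h q m S → Solved (g ∖ D′ ∖ X′) h q m S
  solved-dominates dir {g} {D} {D′} {S} {X} {X′} dom sol r le hv a b = sol r le hv (core dir dom a) (core dir dom b)
    where
    flip₁ : ∀ {u w} → T ((g ∖ D′ ∖ X′) u w) → T ((directed true g ∖ D′ ∖ X′) w u)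
    flip₁ e = let (e₁ , a , b) = ∖ᵉ (g ∖ D′) X′ e ; (e₂ , c , d) = ∖ᵉ g D′ e₁ in
      ∖ⁱ (directed true g ∖ D′) X′ (∖ⁱ (directed true g) D′ e₂ d c) b a
    flip₂ : ∀ {u w} → T ((directed true g ∖ D ∖ X) u w) → T ((g ∖ D ∖ X) w u)
    flip₂ e = let (e₁ , a , b) = ∖ᵉ (directed true g ∖ D) X e ; (e₂ , c , d) = ∖ᵉ (directed true g) D e₁ in
      ∖ⁱ (g ∖ D) X (∖ⁱ g D e₂ d c) b a
    core : ∀ dir → Dominates (directed dir g ∖ D) S X (directed dir g ∖ D′) X′ → ∀ {x} → Core (g ∖ D′ ∖ X′) S x → Core (g ∖ D ∖ X) S x
    core false dom ((s , hs , p) , (t , ht , q)) = (s , hs , dom hs ε p) , (t , ht , dom hs p q)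
    core true  dom ((s , hs , p) , (t , ht , q)) =
      (s , hs , reach-reverse (directed true g ∖ D ∖ X) (g ∖ D ∖ X) flip₂ (dom ht (rev q) (rev p))) ,
      (t , ht , reach-reverse (directed true g ∖ D ∖ X) (g ∖ D ∖ X) flip₂ (dom ht ε (rev q)))
      where
      rev : ∀ {u w} → Reach (g ∖ D′ ∖ X′) u w → Reach (directed true g ∖ D′ ∖ X′) w u
      rev = reach-reverse (g ∖ D′ ∖ X′) (directed true g ∖ D′ ∖ X′) flip₁

  record After₂ (g h q W₀ : ℕ → ℕ → Bool) (L₀ : ℕ → ℕ → ℕ) (m : ℕ) (st : State)
                (has : Bool) (p : ℕ) (vio : Bool) (vs vt d : ℕ) (st′ : State) : Set where
    field
      static′ : Static₂ g h q W₀ L₀ m st′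
      {A′}    : ℕ → Bool
      effect  : Updated (st bool DEL 0) (st bool AX 0) (st′ bool DEL 0) A′ has p d
      ax-e    : ∀ {x} → T (st′ bool AX 0 x) → T has × T (A′ x)
      ax-i    : ∀ {x} → T has → T (A′ x) → T (st′ bool AX 0 x)
      ds-eq   : ∀ x → st′ bool DS 0 x ≡ (if has then st bool DS 0 x else vio ∧ (x ≡ᵇ (if d <ᵇ 2 then vs else vt)))
      dir-eq  : st′ bool DIR 0 0 ≡ (if has then st bool DIR 0 0 else (d ≡ᵇ 1) ∨ (d ≡ᵇ 3))

  after-reset : ∀ {g h q W₀ L₀ m st has p vio vs vt d} y → Static₂ g h q W₀ L₀ m y →
    Updated (st bool DEL 0) (st bool AX 0) (y bool DEL 0) (y bool AX 0) has p d →
    y bool HAS 0 0 ≡ has → y bool VIO 0 0 ≡ vio → y nat VS 0 0 ≡ vs → y nat VT 0 0 ≡ vt → y nat DG 0 0 ≡ d →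
    y bool DS ≡ st bool DS → y bool DIR ≡ st bool DIR →
    After₂ g h q W₀ L₀ m st has p vio vs vt d (run (RESET ⍮ advance) y)
  after-reset y S u refl refl refl refl refl ds dir = record
    { static′ = record { g≡ = g≡ ; h≡ = h≡ ; q≡ = q≡ ; w≡ = w≡ ; l≡ = l≡ ; m≡ = m≡ }
    ; A′ = y bool AX 0 ; effect = u
    ; ax-e = λ {x} q → ∧ˡ (y bool HAS 0 0) q , ∧ʳ (y bool HAS 0 0) q
    ; ax-i = λ hh a → ∧ⁱ hh a
    ; ds-eq = λ x → cong (λ b → if y bool HAS 0 0 then b else _) (cong (λ f → f 0 x) ds)
    ; dir-eq = cong (λ b → if y bool HAS 0 0 then b else _) (cong (λ f → f 0 0) dir) }
    where open Static₂ S

  -- Stated for an abstract block P, so that its program is not unfolded.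
  after-block : ∀ {g h q W₀ L₀ m st} P d → ¬ T (readsS nat DG P) → ¬ T (writes nat DG P) → ¬ T (writes bool DEL P) → ¬ T (writes bool AX P) →
    ¬ T (writes bool G2 P) → ¬ T (writes bool HH P) → ¬ T (writes bool REQ P) → ¬ T (writes bool W P) → ¬ T (writes nat LAB P) →
    ¬ T (writes nat ROW P) → ¬ T (writes bool DS P) → ¬ T (writes bool DIR P) → Static₂ g h q W₀ L₀ m st → let s = run P st in
    After₂ g h q W₀ L₀ m st (s bool HAS 0 0) (s nat PK 0 0) (s bool VIO 0 0) (s nat VS 0 0) (s nat VT 0 0) d
      (run (RESET ⍮ advance) (run APPLY (run P (withDigit st d))))
  after-block {g} {h} {q} {W₀} {L₀} {m} {st} P d blind kDG kDEL kAX kG kH kQ kW kL kR kDS kDIR S =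
    after-reset (run APPLY (run P y)) record
      { g≡ = trans (frame P y bool G2 kG) g≡ ; h≡ = trans (frame P y bool HH kH) h≡ ; q≡ = trans (frame P y bool REQ kQ) q≡
      ; w≡ = trans (frame P y bool W kW) w≡ ; l≡ = trans (frame P y nat LAB kL) l≡
      ; m≡ = trans (cong (λ f → f 0 0) (frame P y nat ROW kR)) m≡ }
      A.updated A.has-eq (sym (A.agree bool VIO (λ ()) 0 0)) (sym (A.agree nat VS (λ ()) 0 0)) (sym (A.agree nat VT (λ ()) 0 0)) A.digit
      (frame P y bool DS kDS) (frame P y bool DIR kDIR)
    where
    open Static₂ S
    y = withDigit st d
    module A = Applied C P blind kDG kDEL kAX st d

  after-blocks : ∀ {g h q W₀ L₀ m st} a b c d → let P = a ⍮ b ⍮ c in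
    ¬ T (readsS nat DG P) → ¬ T (writes nat DG P) → ¬ T (writes bool DEL P) → ¬ T (writes bool AX P) →
    ¬ T (writes bool G2 P) → ¬ T (writes bool HH P) → ¬ T (writes bool REQ P) → ¬ T (writes bool W P) → ¬ T (writes nat LAB P) →
    ¬ T (writes nat ROW P) → ¬ T (writes bool DS P) → ¬ T (writes bool DIR P) → Static₂ g h q W₀ L₀ m st →
    ∀ {B s₁ s₂ s} → B ≡ (a ⍮ b ⍮ c ⍮ APPLY ⍮ RESET ⍮ advance) → s₁ ≡ run a st → s₂ ≡ run b s₁ → s ≡ run c s₂ →
    After₂ g h q W₀ L₀ m st (s bool HAS 0 0) (s nat PK 0 0) (s bool VIO 0 0) (s nat VS 0 0) (s nat VT 0 0) d (run B (withDigit st d))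
  after-blocks a b c d h₁ h₂ h₃ h₄ h₅ h₆ h₇ h₈ h₉ h₁₀ h₁₁ h₁₂ S refl refl refl refl =
    after-block (a ⍮ b ⍮ c) d h₁ h₂ h₃ h₄ h₅ h₆ h₇ h₈ h₉ h₁₀ h₁₁ h₁₂ S

  module Step₂ {g h q W₀ L₀ m r st} (F : Fixed₂ g h q) (J : Inv₂ g h q W₀ L₀ m r st) where
    open Fixed₂ F
    open Inv₂ J
    S A′ U : ℕ → Bool
    S = terminals w l
    A′ x = A x ∨ B x
    U x = A x ∨ prot w l x
    G : ℕ → ℕ → Bool
    G = directed dir g ∖ D
    S<n : ∀ {s} → T (S s) → s < n
    S<n {s} hs = <ᵇ⇒< s n (∧ˡ (s <ᵇ n) hs)
    n<M : ∀ {x} → x < n → x < M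
    n<M h = ≤-trans h (≤-trans (m≤m+n n n) n+n≤M)
    S<M : ∀ {s} → T (S s) → s < M
    S<M = n<M ∘ S<n
    S⊆U : ∀ {s} → T (S s) → T (U s)
    S⊆U {s} hs = ∨ʳ (A s) (∧ʳ (s <ᵇ n) hs)
    arcsG : ∀ {u w} → T (G u w) → u < n × w < n
    arcsG e = directed-arcs dir {g} arcs (proj₁ (∖ᵉ (directed dir g) D e))
    boundedG : ∀ {u w} → T (G u w) → u < M × w < M
    boundedG e = let (a , b) = arcsG e in n<M a , n<M b
    κ≤2k : κ ≤ 2 * k
    κ≤2k = ≤-trans (m≤m+n κ _) spent

    module Move (has : Bool) (p : ℕ) {Z : ℕ → Bool} (min : MinSep G S A′ U Z) (vio : Bool) (vs vt : ℕ)
                (found : Found (g ∖ D) h q m S vio vs vt) (next-state : ℕ → State)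
                (result : ∀ d → After₂ g h q W₀ L₀ m st has p vio vs vt d (next-state d)) where

     module Digit (d : ℕ) where
      open After₂ (result d) public renaming (A′ to A⁺)
      open Updated effect public
      st′ = next-state d
      D′ A″ B″ : ℕ → Bool
      D′ = st′ bool DEL 0
      A″ = st′ bool AX 0
      B″ = st′ bool DS 0
      dir′ = st′ bool DIR 0 0
      shrink : ∀ g → ∀ {u v} → T ((g ∖ D′) u v) → T ((g ∖ D) u v)
      shrink g e = let (e , a , b) = ∖ᵉ g D′ e in ∖ⁱ g D e (a ∘ del-old) (b ∘ del-old)
      shrinkX : ∀ g X → ∀ {u v} → T ((g ∖ D′ ∖ X) u v) → T ((g ∖ D ∖ X) u v)
      shrinkX g X e = let (e , a , b) = ∖ᵉ (g ∖ D′) X e in ∖ⁱ (g ∖ D) X (shrink g e) a b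

     -- An endpoint of an unsolved request is cut off by X in one direction.
     record Choice : Set where
      field
        d     : ℕ
        d<4   : d < 4
        way   : Bool
        x     : ℕ
        way-eq : ((d ≡ᵇ 1) ∨ (d ≡ᵇ 3)) ≡ way
        x-eq  : (if d <ᵇ 2 then vs else vt) ≡ x
        cut   : ∀ {s} → T (S s) → ¬ Reach (directed way g ∖ D ∖ X) s x
        near  : ∃[ s ] T (S s) × Reach (directed way g ∖ D) s x

     private
      reverse : ∀ {u w} → Reach (g ∖ D) u w → Reach (directed true g ∖ D) w u
      reverse = reach-reverse (g ∖ D) (directed true g ∖ D) λ e → let (e , a , b) = ∖ᵉ g D e in ∖ⁱ (directed true g) D e b a

      reverseX : ∀ {u w} → Reach (directed true g ∖ D ∖ X) u w → Reach (g ∖ D ∖ X) w u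
      reverseX = reach-reverse (directed true g ∖ D ∖ X) (g ∖ D ∖ X) λ e →
        let (e , a , b) = ∖ᵉ (directed true g ∖ D) X e ; (e , c , f) = ∖ᵉ (directed true g) D e in ∖ⁱ (g ∖ D) X (∖ⁱ g D e f c) b a

      boundX : ∀ way {u w} → T ((directed way g ∖ D ∖ X) u w) → u < M × w < M
      boundX way e = let (a , b) = directed-arcs way {g} arcs (proj₁ (∖ᵉ (directed way g) D (proj₁ (∖ᵉ (directed way g ∖ D) X e)))) in n<M a , n<M b

      out in′ : ℕ → Bool
      out x = hull (directed false g ∖ D ∖ X) S x
      in′ x = hull (directed true g ∖ D ∖ X) S x

      uncut : ∀ way {x} → ¬ T (hull (directed way g ∖ D ∖ X) S x) → ∀ {s} → T (S s) → ¬ Reach (directed way g ∖ D ∖ X) s x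
      uncut way nh hs r = nh (hullⁱ (directed way g ∖ D ∖ X) S (boundX way) (S<M hs) hs r)

      core : ∀ {x} → T (out x) → T (in′ x) → Core (g ∖ D ∖ X) S x
      core {x} o i = let (s , hs , a) = hullᵉ (directed false g ∖ D ∖ X) S o
                         (t , ht , b) = hullᵉ (directed true g ∖ D ∖ X) S i in (s , hs , a) , (t , ht , reverseX b)

     choice : T vio → Choice
     choice hv′ with Found.some found hv′
     ... | r , le , hv , ((s , hs , a) , (s′ , hs′ , a′)) , ((t , ht , b) , (t′ , ht′ , b′)) with T? (out vs) | T? (in′ vs) | T? (out vt) | T? (in′ vt)
     ... | no nh | _ | _ | _ = record { d = 0 ; d<4 = s≤s z≤n ; way = false ; x = vs ; way-eq = refl ; x-eq = refl ; cut = uncut false nh ; near = s , hs , a }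
     ... | yes _ | no nh | _ | _ = record { d = 1 ; d<4 = s≤s (s≤s z≤n) ; way = true ; x = vs ; way-eq = refl ; x-eq = refl ; cut = uncut true nh ; near = s′ , hs′ , reverse a′ }
     ... | yes _ | yes _ | no nh | _ = record { d = 2 ; d<4 = s≤s (s≤s (s≤s z≤n)) ; way = false ; x = vt ; way-eq = refl ; x-eq = refl ; cut = uncut false nh ; near = t , ht , b }
     ... | yes _ | yes _ | yes _ | no nh = record { d = 3 ; d<4 = ≤-refl ; way = true ; x = vt ; way-eq = refl ; x-eq = refl ; cut = uncut true nh ; near = t′ , ht′ , reverse b′ }
     ... | yes o | yes i | yes o′ | yes i′ = ⊥-elim (good r le hv (core o i) (core o′ i′))

     -- The requests are solved by the deletions alone, so the hidden set may become empty and
     -- further rounds change nothing.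
     idle : ¬ T has → ¬ T vio → Inv₂ g h q W₀ L₀ m (r ∸ 1) (next-state 0)
     idle ¬has ¬vio = record
       { static = static′ ; X = λ _ → false ; κ = 0 ; ℓ = 0
       ; hid = record
         { kept = λ _ ()
         ; apart = λ {s} {a} _ _ hA → [ (λ q → ¬has (proj₁ (ax-e q))) , (λ q → ¬vio (∧ˡ vio (subst T (trans (ds-eq a) (if-F ¬has)) q))) ]′ (∨ᵉ (A″ a) hA)
         ; budget = ≤-reflexive (sum-zero M (λ _ → refl)) ; lower = λ _ → z≤n }
       ; good = solved-⊆ (g ∖ D) (g ∖ D′ ∖ (λ _ → false)) (λ e → shrink g (proj₁ (∖ᵉ (g ∖ D′) (λ _ → false) e))) (Found.none found ¬vio)
       ; spent = ≤-trans (≤-trans (count-mono M λ _ q → [ id , (λ q → ⊥-elim (¬has (proj₁ q))) ]′ (del-new q)) (m≤n+m _ κ)) spent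
       ; fuel = z≤n }
       where open Digit 0

     begin : ¬ T has → ℓ ≡ 0 → (c : Choice) → T vio → let d = Choice.d c in
             (r ≡ 0 → d ≡ 0) × Inv₂ g h q W₀ L₀ m (r ∸ 1) (next-state d)
     begin ¬has ℓ0 c hv = (λ { refl → ⊥-elim (contradiction positive (≤⇒≯ (≤-trans (m≤m+n κ _) (subst (λ m → 2 * κ ≤ m + 0) ℓ0 fuel)))) }) , record
       { static = static′ ; X = X ; κ = κ ; ℓ = 1 ; hid = hid′
       ; good = solved-⊆ (g ∖ D ∖ X) (g ∖ D′ ∖ X) (shrinkX g X) good
       ; spent = ≤-trans (+-monoʳ-≤ κ (count-mono M λ _ q → [ id , (λ q → ⊥-elim (¬has (proj₁ q))) ]′ (del-new q))) spent
       ; fuel = ≤-trans (subst (λ m → 2 * κ ≤ m + r) ℓ0 fuel) (m≤n+m∸n r 1) }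
       where
       open Choice c
       open Digit d
       G′ : ℕ → ℕ → Bool
       G′ = directed dir′ g ∖ D′
       dir-way : dir′ ≡ way
       dir-way = trans dir-eq (trans (if-F ¬has) way-eq)
       sink : T (B″ x)
       sink = subst T (sym (trans (ds-eq x) (if-F ¬has))) (∧ⁱ hv (subst (λ y → T (x ≡ᵇ y)) (sym x-eq) (≡⇒≡ᵇ x x refl)))
       only : ∀ {a} → T (A″ a ∨ B″ a) → a ≡ x
       only {a} hA = [ (λ q → ⊥-elim (¬has (proj₁ (ax-e q)))) ,
         (λ q → trans (≡ᵇ⇒≡ a _ (∧ʳ vio (subst T (trans (ds-eq a) (if-F ¬has)) q))) x-eq) ]′ (∨ᵉ (A″ a) hA)
       grow : ∀ {u v} → T ((directed way g ∖ D) u v) → T ((directed way g ∖ D′) u v)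
       grow e = let (e , a , b) = ∖ᵉ (directed way g) D e in ∖ⁱ (directed way g) D′ e
         (λ q → [ a , ¬has ∘ proj₁ ]′ (del-new q)) (λ q → [ b , ¬has ∘ proj₁ ]′ (del-new q))
       bounded′ : ∀ {u v} → T (G′ u v) → u < M × v < M
       bounded′ e = let (a , b) = directed-arcs dir′ {g} arcs (proj₁ (∖ᵉ (directed dir′ g) D′ e)) in n<M a , n<M b
       reaches : ∃[ s ] T (S s) × Reach G′ s x
       reaches = let (s , hs , a) = near in
         s , hs , subst (λ y → Reach (directed y g ∖ D′) s x) (sym dir-way) (reach-map (directed way g ∖ D) (directed way g ∖ D′) grow a)
       -- The new sink is still reachable from a terminal, so no separator is empty.
       lower′ : ∀ {Y} → Sep G′ S (λ x → A″ x ∨ B″ x) (λ x → A″ x ∨ prot w l x) Y → 1 ≤ size G′ Y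
       lower′ {Y} V = n≢0⇒n>0 λ e → Sep.sink V (∨ʳ (A″ x) sink)
         (let (s , hs , a) = reaches in reach-closed G′ Y (λ {u} {y} yu e′ → case T? (Y y) of λ
             { (yes q) → q ; (no nq) → ⊥-elim (count-zero M e (proj₂ (bounded′ e′)) (Nⁱ G′ Y (proj₁ (bounded′ e′)) nq yu e′)) }) (Sep.source V hs) a)
       hid′ : Hidden G′ S (λ x → A″ x ∨ B″ x) (λ x → A″ x ∨ prot w l x) X κ 1
       hid′ = record
         { kept = λ {u} hU → [ (λ q → ⊥-elim (¬has (proj₁ (ax-e q)))) , (λ q → Hidden.kept hid (∨ʳ (A u) q)) ]′ (∨ᵉ (A″ u) hU)
         ; apart = λ {s} hs a hA → cut hs (reach-map (directed way g ∖ D′ ∖ X) (directed way g ∖ D ∖ X) (shrinkX (directed way g) X)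
             (subst₂ (λ y a → Reach (directed y g ∖ D′ ∖ X) s a) dir-way (only hA) a))
         ; budget = Hidden.budget hid ; lower = lower′ }
       -- The nonempty separator lies within the budget. So some digit is left, and the digit chosen
       -- here may be nonzero.
       positive : 0 < κ
       positive = lower≤budget bounded′ S<M (λ {s} hs → ∨ʳ (A″ s) (∧ʳ (s <ᵇ n) hs)) hid′

     choose : T has × p < M × T (N G Z p) ⊎ ¬ T has × (∀ {w} → w < M → ¬ T (N G Z w)) →
              ∃[ d ] d < 4 × (r ≡ 0 → d ≡ 0) × Inv₂ g h q W₀ L₀ m (r ∸ 1) (next-state d)
     choose (inj₂ (¬has , none)) with T? vio
     ... | no ¬vio = 0 , s≤s z≤n , (λ _ → refl) , idle ¬has ¬vio
     ... | yes hv  = let c = choice hv in Choice.d c , Choice.d<4 c , begin ¬has (proj₂ (no-boundary boundedG S<M S⊆U hid min none)) c hv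
     choose (inj₁ (hh , p< , b)) = go r refl
      where
      go : ∀ r′ → r ≡ r′ → ∃[ d ] d < 4 × (r ≡ 0 → d ≡ 0) × Inv₂ g h q W₀ L₀ m (r ∸ 1) (next-state d)
      go zero refl = ⊥-elim (contradiction (≤-trans (≤-reflexive (sym (b2n-T b))) (≤-trans (term≤sum M p p<)
          (≤-trans (MinSep.minimum min (hidden-sep boundedG S<M S⊆U hid)) (≤-trans (hidden-size boundedG S<M S⊆U hid) κ≤0)))) λ ())
        where
        κ≤0 : κ ≤ 0
        κ≤0 = +-cancelˡ-≤ κ κ 0 (≤-trans (≤-trans (+-monoʳ-≤ κ (m≤m+n κ 0)) fuel) (+-monoˡ-≤ 0 (lower≤budget boundedG S<M S⊆U hid)))
      go (suc r′) refl with T? (X′ boundedG S<M S⊆U hid min p)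
      ... | yes x = 0 , s≤s z≤n , (λ ()) , next
        where
        open Digit 0
        dir-same : dir′ ≡ dir
        dir-same = trans dir-eq (if-T hh)
        B-same : ∀ {x} → T (B″ x) → T (B x)
        B-same {x} = subst T (trans (ds-eq x) (if-T hh))
        B-same′ : ∀ {x} → T (B x) → T (B″ x)
        B-same′ {x} = subst T (sym (trans (ds-eq x) (if-T hh)))
        A→ : ∀ {x} → T (A x) → T (A″ x)
        A→ q = ax-i hh (ax-old q)
        A← : ∀ {x} → T (A″ x) → T (A x)
        A← q = [ id , (λ (_ , ne , _) → ⊥-elim (ne refl)) ]′ (ax-new (proj₂ (ax-e q)))
        G′ : ℕ → ℕ → Bool
        G′ = directed dir g ∖ D′
        del : Deleted p G G′
        del = (λ e → shrink (directed dir g) e , (λ { refl → proj₁ (proj₂ (∖ᵉ (directed dir g) D′ e)) (del-add hh refl) }) , (λ { refl → proj₂ (proj₂ (∖ᵉ (directed dir g) D′ e)) (del-add hh refl) })) ,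
          λ e nu nv → let (e′ , a , c) = ∖ᵉ (directed dir g) D e in ∖ⁱ (directed dir g) D′ e′
            (λ q → [ a , (λ (_ , _ , e″) → nu e″) ]′ (del-new q)) (λ q → [ c , (λ (_ , _ , e″) → nv e″) ]′ (del-new q))
        next : Inv₂ g h q W₀ L₀ m r′ st′
        next with delete boundedG S<M S⊆U hid min p< b x del
        ... | X″ , κ′ , refl , hid′ , dom = record
          { static = static′ ; X = X″ ; κ = κ′ ; ℓ = ℓ ∸ 1
          ; hid = subst (λ y → Hidden (directed y g ∖ D′) S (λ x → A″ x ∨ B″ x) (λ x → A″ x ∨ prot w l x) X″ κ′ (ℓ ∸ 1)) (sym dir-same)
              (hidden-cong id id id id
                (λ {u} q → [ (λ a → ∨ˡ (A→ a)) , (λ a → ∨ʳ (A″ u) (B-same′ {u} a)) ]′ (∨ᵉ (A u) q)) (λ {u} q → [ (λ a → ∨ˡ (A← a)) , (λ a → ∨ʳ (A u) (B-same {u} a)) ]′ (∨ᵉ (A″ u) q))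
                (λ {u} q → [ (λ a → ∨ˡ (A→ a)) , ∨ʳ (A″ u) ]′ (∨ᵉ (A u) q)) (λ {u} q → [ (λ a → ∨ˡ (A← a)) , ∨ʳ (A u) ]′ (∨ᵉ (A″ u) q)) hid′)
          ; good = solved-dominates dir {g} {D} {D′} {S} {X} {X″} dom good
          ; spent = ≤-trans (+-monoʳ-≤ κ′ (≤-trans (count-mono M {q = λ x → D x ∨ (x ≡ᵇ p)} λ {x} _ q → [ ∨ˡ , (λ (_ , _ , e) → ∨ʳ (D x) (≡⇒≡ᵇ x p e)) ]′ (del-new q)) (count-insert M D p)))
                      (≤-trans (≤-reflexive (+-suc κ′ _)) spent)
          ; fuel = ≤-trans (m≤m+n _ 0) (shift-fuel {κ′} {0} {ℓ} (≤-trans (≤-reflexive (+-identityʳ _)) fuel)) }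
      ... | no nx = 1 , s≤s (s≤s z≤n) , (λ ()) , next
        where
        open Digit 1
        P = X′ boundedG S<M S⊆U hid min
        dir-same : dir′ ≡ dir
        dir-same = trans dir-eq (if-T hh)
        B-same : ∀ {x} → T (B″ x) → T (B x)
        B-same {x} = subst T (trans (ds-eq x) (if-T hh))
        B-same′ : ∀ {x} → T (B x) → T (B″ x)
        B-same′ {x} = subst T (sym (trans (ds-eq x) (if-T hh)))
        A→ : ∀ {x} → T (A x) → T (A″ x)
        A→ q = ax-i hh (ax-old q)
        A← : ∀ {x} → T (A″ x) → T (A x) ⊎ x ≡ p
        A← q = [ inj₁ , (λ (_ , _ , e) → inj₂ e) ]′ (ax-new (proj₂ (ax-e q)))
        same : ∀ {u v} → T (G u v) → T ((directed dir g ∖ D′) u v)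
        same e = let (e , a , c) = ∖ᵉ (directed dir g) D e in ∖ⁱ (directed dir g) D′ e
          (λ q → [ a , (λ ()) ]′ (del-new q)) (λ q → [ c , (λ ()) ]′ (del-new q))
        hid′ : Hidden G S (λ x → A″ x ∨ B″ x) (λ x → A″ x ∨ prot w l x) P κ (suc ℓ)
        hid′ = mark boundedG S<M S⊆U hid min b nx
          (λ {u} q → [ (λ a → ∨ˡ (A→ a)) , (λ a → ∨ʳ (A″ u) (B-same′ {u} a)) ]′ (∨ᵉ (A u) q))
          (λ {u} q → [ (λ a → ∨ˡ (A→ a)) , ∨ʳ (A″ u) ]′ (∨ᵉ (A u) q))
          (λ {u} q → [ (λ a → [ (λ a → inj₁ (∨ˡ a)) , inj₂ ]′ (A← a)) , (λ a → inj₁ (∨ʳ (A u) (B-same {u} a))) ]′ (∨ᵉ (A″ u) q))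
          (λ {u} q → [ (λ a → [ (λ a → inj₁ (∨ˡ a)) , inj₂ ]′ (A← a)) , (λ a → inj₁ (∨ʳ (A u) a)) ]′ (∨ᵉ (A″ u) q))
          (∨ˡ (ax-i hh (ax-add hh λ ()))) (∨ˡ (ax-i hh (ax-add hh λ ())))
        dom : Dominates G S X (directed dir g ∖ D′) P
        dom hs a c = pushed-dominates boundedG S<M S⊆U hid min hs (thin a) (thin c)
          where
          thin : ∀ {u v} → Reach (directed dir g ∖ D′ ∖ P) u v → Reach (G ∖ P) u v
          thin = reach-map (directed dir g ∖ D′ ∖ P) (G ∖ P) (shrinkX (directed dir g) P)
        next : Inv₂ g h q W₀ L₀ m r′ st′
        next = record
          { static = static′ ; X = P ; κ = κ ; ℓ = suc ℓ
          ; hid = subst (λ y → Hidden (directed y g ∖ D′) S (λ x → A″ x ∨ B″ x) (λ x → A″ x ∨ prot w l x) P κ (suc ℓ)) (sym dir-same)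
              (hidden-cong same (shrink (directed dir g)) id id id id id id hid′)
          ; good = solved-dominates dir {g} {D} {D′} {S} {X} {P} dom good
          ; spent = ≤-trans (+-monoʳ-≤ κ (count-mono M λ _ q → [ id , (λ ()) ]′ (del-new q))) spent
          ; fuel = ≤-trans fuel (≤-reflexive (+-suc ℓ r′)) }

    private
      st₁ = run SETUP₂ st
      st₂ = run SEP st₁
      st₃ = run FIND st₂

    Outcome FoundIn : State → Set
    Outcome s = ∃[ Z ] MinSep G S A′ U Z × (T (s bool HAS 0 0) × s nat PK 0 0 < M × T (N G Z (s nat PK 0 0)) ⊎ ¬ T (s bool HAS 0 0) × (∀ {w} → w < M → ¬ T (N G Z w)))
    FoundIn s = Found (g ∖ D) h q m S (s bool VIO 0 0) (s nat VS 0 0) (s nat VT 0 0)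

    AfterFrom : State → ℕ → State → Set
    AfterFrom s d st′ = After₂ g h q W₀ L₀ m st (s bool HAS 0 0) (s nat PK 0 0) (s bool VIO 0 0) (s nat VS 0 0) (s nat VT 0 0) d st′

    outcome : Outcome st₃
    outcome = subst₂ (λ b p → ∃[ Z ] MinSep G S A′ U Z × (T b × p < M × T (N G Z p) ⊎ ¬ T b × (∀ {w} → w < M → ¬ T (N G Z w))))
                (sym (cong (λ f → f 0 0) (frame FIND st₂ bool HAS λ ()))) (sym (cong (λ f → f 0 0) (frame FIND st₂ nat PK λ ()))) (separate static)
      where
      separate : Static₂ g h q W₀ L₀ m st → ∃[ Z ] MinSep G S A′ U Z ×
        (T (st₂ bool HAS 0 0) × st₂ nat PK 0 0 < M × T (N G Z (st₂ nat PK 0 0)) ⊎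
         ¬ T (st₂ bool HAS 0 0) × (∀ {w} → w < M → ¬ T (N G Z w)))
      separate record { g≡ = refl ; w≡ = refl ; l≡ = refl } = sep-ok st₁ arcsG S<n (hidden-sep boundedG S<M S⊆U hid)
        (≤-trans (s≤s (≤-trans (hidden-size boundedG S<M S⊆U hid) κ≤2k)) k<M)

    found : FoundIn st₃
    found = found-after st₁ g≡ refl h≡ (terminals-cong w≡ l≡) q≡ m≡ F S<n
      where
      open Static₂ static
      terminals-cong : ∀ {w₁ l₁} → w₁ ≡ W₀ → l₁ ≡ L₀ → terminals (w₁ 0) (l₁ 0) ≡ S
      terminals-cong refl refl = refl

    after : ∀ d → AfterFrom st₃ d (run BODY₂ (withDigit st d))
    after d = after-blocks SETUP₂ SEP FIND d (λ ()) (λ ()) (λ ()) (λ ()) (λ ()) (λ ()) (λ ()) (λ ()) (λ ()) (λ ()) (λ ()) (λ ()) static {BODY₂} {st₁} {st₂} {st₃} refl refl refl refl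

    private
      decide : ∀ s B → Outcome s → FoundIn s → (∀ d → AfterFrom s d (run B (withDigit st d))) →
        ∃[ d ] d < 4 × (r ≡ 0 → d ≡ 0) × Inv₂ g h q W₀ L₀ m (r ∸ 1) (run B (withDigit st d))
      decide s B (_ , min , o) f a = Move.choose (s bool HAS 0 0) (s nat PK 0 0) min (s bool VIO 0 0) (s nat VS 0 0) (s nat VT 0 0) f (λ d → run B (withDigit st d)) a o

    step : ∀ {B} → B ≡ BODY₂ → ∃[ d ] d < 4 × (r ≡ 0 → d ≡ 0) × Inv₂ g h q W₀ L₀ m (r ∸ 1) (run B (withDigit st d))
    step refl = decide st₃ BODY₂ outcome found after

-- Topological ranks of strong components

code : ℕ → (ℕ → Bool) → ℕ
code zero    p = 0
code (suc n) p = b2n (p n) + 2 * code n p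

code-mono : ∀ n {p q} → (∀ {x} → x < n → T (p x) → T (q x)) → code n p ≤ code n q
code-mono zero    h = z≤n
code-mono (suc n) h = +-mono-≤ (b2n-mono (h ≤-refl)) (*-monoʳ-≤ 2 (code-mono n λ l → h (≤-trans l (n≤1+n n))))

code-injective : ∀ n {p q} → code n p ≡ code n q → ∀ {x} → x < n → p x ≡ q x
code-injective (suc n) {p} {q} e {x} x< with digits (p n) (q n) (code n p) (code n q) e
  where
  digits : ∀ a b c d → b2n a + 2 * c ≡ b2n b + 2 * d → a ≡ b × c ≡ d
  digits true  true  c d e = refl , *-cancelˡ-≡ c d 2 (suc-injective e)
  digits false false c d e = refl , *-cancelˡ-≡ c d 2 e
  digits true  false c d e = ⊥-elim (odd≢even c d e)
    where
    odd≢even : ∀ c d → suc (2 * c) ≢ 2 * d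
    odd≢even c       zero    ()
    odd≢even zero    (suc d) e = contradiction (trans e (cong suc (+-suc d _))) λ ()
    odd≢even (suc c) (suc d) e = odd≢even c d (suc-injective (suc-injective (trans (cong (λ m → suc (suc m)) (sym (+-suc c _))) (trans e (cong suc (+-suc d _))))))
  digits false true  c d e = let (e₁ , e₂) = digits true false d c (sym e) in sym e₁ , sym e₂
... | e₁ , e₂ with m≤n⇒m<n∨m≡n (≤-pred x<)
...   | inj₁ l    = code-injective n e₂ l
...   | inj₂ refl = e₁

-- Ranks of the vertices of w ∖ X, given a preorder r: related vertices have
-- increasing ranks, and only equivalent vertices have equal ranks.
module Ranking (M : ℕ) (w X : ℕ → Bool) (r : ℕ → ℕ → Bool) (r-refl : ∀ u → T (r u u))
               (r-trans : ∀ {u x y} → T (r u x) → T (r x y) → T (r u y)) where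

  Live : ℕ → Set
  Live x = x < M × T (w x) × ¬ T (X x)

  live : ℕ → Bool
  live x = w x ∧ not (X x)

  -- The key is the binary code of the set of live vertices from which `x` is reached. This set
  -- grows along the preorder and is the same only for equivalent live vertices, so comparing codes
  -- yields a linear extension. Rank 0 is reserved for the vertices of `X`.
  key rank : ℕ → ℕ
  key x  = code M (λ u → live u ∧ r u x)
  rank x = if X x then 0 else suc (count M (λ u → live u ∧ (key u <ᵇ key x)))

  rank-dead : ∀ {x} → T (X x) → rank x ≡ 0
  rank-dead h = if-T h

  rank-live : ∀ {x} → ¬ T (X x) → rank x ≡ suc (count M (λ u → live u ∧ (key u <ᵇ key x)))
  rank-live h = if-F h

  rank≤ : ∀ {x} → x < M → T (w x) → rank x ≤ count M w
  rank≤ {x} x< h with T? (X x)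
  ... | yes d = ≤-trans (≤-reflexive (rank-dead d)) z≤n
  ... | no n  = ≤-trans (≤-reflexive (rank-live n)) (count-strict M x x< (λ {y} _ q → ∧ˡ (w y) (∧ˡ (live y) q))
                  (λ q → n≮n _ (<ᵇ⇒< (key x) (key x) (∧ʳ (live x) q))) h)

  private
    below-mono : ∀ {s t} → key s ≤ key t → count M (λ u → live u ∧ (key u <ᵇ key s)) ≤ count M (λ u → live u ∧ (key u <ᵇ key t))
    below-mono {s} {t} le = count-mono M λ {y} _ q → ∧ⁱ (∧ˡ (live y) q) (<⇒<ᵇ (≤-trans (<ᵇ⇒< (key y) (key s) (∧ʳ (live y) q)) le))

  rank-mono : ∀ {s t} → Live s → Live t → T (r s t) → rank s ≤ rank t
  rank-mono {s} {t} (_ , _ , ns) (_ , _ , nt) h = ≤-trans (≤-reflexive (rank-live ns)) (≤-trans (s≤s (below-mono {s} {t}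
    (code-mono M λ {u} _ q → ∧ⁱ (∧ˡ (live u) q) (r-trans (∧ʳ (live u) q) h)))) (≤-reflexive (sym (rank-live nt))))

  rank-< : ∀ {s t} → Live s → Live t → key s < key t → rank s < rank t
  rank-< {s} {t} (s< , ws , ns) (_ , _ , nt) h = subst₂ _<_ (sym (rank-live ns)) (sym (rank-live nt))
    (s≤s (count-strict M s s< (λ {y} _ q → ∧ⁱ (∧ˡ (live y) q) (<⇒<ᵇ (<-trans (<ᵇ⇒< (key y) (key s) (∧ʳ (live y) q)) h)))
      (λ q → n≮n _ (<ᵇ⇒< (key s) (key s) (∧ʳ (live s) q))) (∧ⁱ (∧ⁱ ws (notⁱ ns)) (<⇒<ᵇ h))))

  rank-≡ : ∀ {s t} → Live s → Live t → rank s ≡ rank t → T (r s t)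
  rank-≡ {s} {t} ls@(s< , ws , ns) lt e with <-cmp (key s) (key t)
  ... | tri< l _ _ = ⊥-elim (<⇒≢ (rank-< ls lt l) e)
  ... | tri> _ _ l = ⊥-elim (<⇒≢ (rank-< lt ls l) (sym e))
  ... | tri≈ _ q _ = ∧ʳ (live s) (subst T (code-injective M q s<) (∧ⁱ (∧ⁱ ws (notⁱ ns)) (r-refl s)))

-- One attempt to replace the solution W by a small one, steered by the advice

k+k : ∀ {g} → Ex nat g
k+k = #k ⊞ #k

-- The advice has one label for each vertex of `W`, not for each vertex of the graph: a vertex reads
-- the digit at its position within `W`.
posE : Ex nat 3
posE = Σ̂ (ite (n₀ ⊲ n₂ && br W x₀) (lit′ 1) (lit′ 0))

labelE : Ex nat 2
labelE = Σ̂ (ite (n₀ ≐ posE) (nr ADV x₀) (lit′ 0))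

liveE violatedE tooBigE : Ex bool 2
liveE     = bm ARC x₁ x₀ && (neg (br DEL x₁) && neg (br DEL x₀))
violatedE = bm REQ x₁ x₀ && (neg (ns ROW ⊲ n₁) && (neg (br DEL x₁) && (neg (br DEL x₀) && (bm TC x₁ x₀ && bm TC x₀ x₁))))
tooBigE   = k+k ⊲ Σ̂ (ite (br DEL x₀) (lit′ 1) (lit′ 0))

LABELS INIT₁ MID GUESS CHECK TRY : Stm
LABELS = assign nat LAB labelE
INIT₁  = assign bool DEL (br W x₀ && nr LAB x₀ ≐ lit′ 0) ⍮ assign bool AX falseE ⍮ assign nat LEV (lit′ 1) ⍮
         assign nat PT (k+k ⊞ lit′ 2) ⍮ assign nat LIM (k+k ⊞ k+k ⊞ k+k ⊞ lit′ 5)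
MID    = assign bool GC liveE ⍮ CLOSE ⍮ assign bool HH (bm TC x₁ x₀ && bm TC x₀ x₁) ⍮ assign bool G2 (liveE && bm HH x₁ x₀) ⍮
         assign bool AX falseE ⍮ assign bool DS falseE ⍮ assign bool DIR falseE ⍮
         assign nat PT (k+k ⊞ k+k ⊞ k+k ⊞ lit′ 5) ⍮ assign nat LIM (k+k ⊞ k+k ⊞ k+k ⊞ k+k ⊞ lit′ 6)
GUESS  = LABELS ⍮ INIT₁ ⍮ loop (DIGIT ⍮ BODY₁) ⍮ MID ⍮ loop (DIGIT ⍮ BODY₂)
CHECK  = assign bool GC liveE ⍮ CLOSE ⍮ assign bool VI violatedE ⍮ assign bool VIO (∃̂ (∃̂ (bm VI x₁ x₀)) || tooBigE) ⍮
         assign bool BEST (ite (bs VIO) (br BEST x₀) (br DEL x₀)) ⍮ assign bool FOUND (bs FOUND || neg (bs VIO))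
TRY    = GUESS ⍮ CHECK

-- The result of a program depends only on the arrays that it does not define
-- before reading them. E holds the undefined arrays.

Arrays : Set
Arrays = Ty → ℕ → Bool

avoids : ∀ {t g} → Arrays → Ex t g → Bool
avoids E (lit′ _)     = true
avoids E #n           = true
avoids E #k           = true
avoids E #M           = true
avoids E (inp e)      = avoids E e
avoids E (ix _)       = true
avoids E (rd t a _ _) = not (E t a)
avoids E (e ⊞ f)      = avoids E e ∧ avoids E f
avoids E (e ⊟ f)      = avoids E e ∧ avoids E f
avoids E (ite b e f)  = avoids E b ∧ (avoids E e ∧ avoids E f)
avoids E (e ⊲ f)      = avoids E e ∧ avoids E f
avoids E (e ≐ f)      = avoids E e ∧ avoids E f
avoids E (e && f)     = avoids E e ∧ avoids E f
avoids E (e || f)     = avoids E e ∧ avoids E f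
avoids E (neg e)      = avoids E e
avoids E (Σ̂ e)        = avoids E e
avoids E (∃̂ e)        = avoids E e

undefined : Arrays → Stm → Arrays
undefined E (assign t a e) t′ b = E t′ b ∧ not (sameArray t a t′ b)
undefined E (s ⍮ s′)            = undefined (undefined E s) s′
-- A loop may take no round at all, so it is not counted as defining anything.
undefined E (loop s)            = E
undefined E (rep s)             = E

legal : Arrays → Stm → Bool
legal E (assign t a e) = avoids E e
legal E (s ⍮ s′)       = legal E s ∧ legal (undefined E s) s′
legal E (loop s)       = legal E s
legal E (rep s)        = legal E s

undefined-⊆ : ∀ E s t b → T (undefined E s t b) → T (E t b)
undefined-⊆ E (assign t′ a e) t b h = ∧ˡ (E t b) h
undefined-⊆ E (s ⍮ s′)        t b h = undefined-⊆ E s t b (undefined-⊆ (undefined E s) s′ t b h)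
undefined-⊆ E (loop s)        t b h = h
undefined-⊆ E (rep s)         t b h = h

AgreeOff : Arrays → State → State → Set
AgreeOff E st st′ = ∀ t b → ¬ T (E t b) → ∀ i j → st t b i j ≡ st′ t b i j

-- All arrays except the graph, the requests, `W`, the advice and the row. An attempt must not
-- depend on what former attempts left in them.
scratch : Arrays
scratch bool a = not ((a ≡ᵇ ARC) ∨ ((a ≡ᵇ REQ) ∨ (a ≡ᵇ W)))
scratch nat  a = not ((a ≡ᵇ ADV) ∨ (a ≡ᵇ ROW))

guess-legal : T (legal scratch GUESS)
guess-legal = tt

guess-defines : ¬ T (undefined scratch GUESS bool DEL)
guess-defines ()

module Independence (C : Context) where
  open Context C
  open Semantics C

  eval-off : ∀ E {st st′} → AgreeOff E st st′ → ∀ {t g} (e : Ex t g) (ρ : Vec ℕ g) → T (avoids E e) → eval st ρ e ≡ eval st′ ρ e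
  eval-off E A (lit′ _) ρ h = refl
  eval-off E A #n ρ h = refl
  eval-off E A #k ρ h = refl
  eval-off E A #M ρ h = refl
  eval-off E A (inp e) ρ h = cong (λ x → if x <ᵇ cI then input x else 0) (eval-off E A e ρ h)
  eval-off E A (ix _) ρ h = refl
  eval-off E A (rd t b i j) ρ h = A t b (notᵉ h) _ _
  eval-off E A (e ⊞ f) ρ h = cong₂ _+_ (eval-off E A e ρ (∧ˡ (avoids E e) h)) (eval-off E A f ρ (∧ʳ (avoids E e) h))
  eval-off E A (e ⊟ f) ρ h = cong₂ _∸_ (eval-off E A e ρ (∧ˡ (avoids E e) h)) (eval-off E A f ρ (∧ʳ (avoids E e) h))
  eval-off E A (ite b e f) ρ h = let h′ = ∧ʳ (avoids E b) h in if-cong (eval-off E A b ρ (∧ˡ (avoids E b) h))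
    (eval-off E A e ρ (∧ˡ (avoids E e) h′)) (eval-off E A f ρ (∧ʳ (avoids E e) h′))
  eval-off E A (e ⊲ f) ρ h = cong₂ _<ᵇ_ (eval-off E A e ρ (∧ˡ (avoids E e) h)) (eval-off E A f ρ (∧ʳ (avoids E e) h))
  eval-off E A (e ≐ f) ρ h = cong₂ _≡ᵇ_ (eval-off E A e ρ (∧ˡ (avoids E e) h)) (eval-off E A f ρ (∧ʳ (avoids E e) h))
  eval-off E A (e && f) ρ h = cong₂ _∧_ (eval-off E A e ρ (∧ˡ (avoids E e) h)) (eval-off E A f ρ (∧ʳ (avoids E e) h))
  eval-off E A (e || f) ρ h = cong₂ _∨_ (eval-off E A e ρ (∧ˡ (avoids E e) h)) (eval-off E A f ρ (∧ʳ (avoids E e) h))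
  eval-off E A (neg e) ρ h = cong not (eval-off E A e ρ h)
  eval-off E A (Σ̂ e) ρ h = sum-cong cM (λ {x} _ → eval-off E A e (x ∷ ρ) h)
  eval-off E A (∃̂ e) ρ h = any-cong cM (λ x → eval-off E A e (x ∷ ρ) h)

  upd-off : ∀ E {st st′} t a f f′ → AgreeOff E st st′ → (∀ i j → f i j ≡ f′ i j) →
            AgreeOff (λ t′ b → E t′ b ∧ not (sameArray t a t′ b)) (upd st t a f) (upd st′ t a f′)
  upd-off E nat  a f f′ A h bool b n = A bool b λ e → n (∧ⁱ e tt)
  upd-off E bool a f f′ A h nat  b n = A nat b λ e → n (∧ⁱ e tt)
  upd-off E nat  a f f′ A h nat  b n with b ≡ᵇ a in q
  ... | true  = h
  ... | false = A nat b λ e → n (∧ⁱ e (notⁱ λ s → subst T q (≡⇒≡ᵇ b a (sym (≡ᵇ⇒≡ a b s)))))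
  upd-off E bool a f f′ A h bool b n with b ≡ᵇ a in q
  ... | true  = h
  ... | false = A bool b λ e → n (∧ⁱ e (notⁱ λ s → subst T q (≡⇒≡ᵇ b a (sym (≡ᵇ⇒≡ a b s)))))

  run-off : ∀ E {st st′} → AgreeOff E st st′ → ∀ s → T (legal E s) → AgreeOff (undefined E s) (run s st) (run s st′)
  run-off E A (assign t a e) h = upd-off E t a _ _ A (λ i j → eval-off E A e (j ∷ i ∷ []) h)
  run-off E A (s ⍮ s′) h = run-off (undefined E s) (run-off E A s (∧ˡ (legal E s) h)) s′ (∧ʳ (legal E s) h)
  run-off E {st} {st′} A (loop s) h = go cM
    where
    go : ∀ m → AgreeOff E (iter m (run s) st) (iter m (run s) st′)
    go zero    = A
    go (suc m) t b n = run-off E (go m) s h t b (n ∘ undefined-⊆ E s t b)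
  run-off E {st} {st′} A (rep s) h = go cE
    where
    go : ∀ m → AgreeOff E (iter m (run s) st) (iter m (run s) st′)
    go zero    = A
    go (suc m) t b n = run-off E (go m) s h t b (n ∘ undefined-⊆ E s t b)

-- Verification of candidates

module Checking (C : Context) (n≤M : Context.cn C ≤ Context.cM C) where
  open Context C renaming (cM to M; cn to n; ck to k)
  open Semantics C
  open Logic C
  open Closure C

  Solves : (g q : ℕ → ℕ → Bool) (m : ℕ) (D : ℕ → Bool) → Set
  Solves g q m D = ∀ {s t} → T (q s t) → s ≤ m → ¬ T (D s) → ¬ T (D t) → Reach (g ∖ D) s t → ¬ Reach (g ∖ D) t s

  record Verified (g q : ℕ → ℕ → Bool) (m : ℕ) (D : ℕ → Bool) : Set where
    field
      solves : Solves g q m D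
      small  : count M D ≤ 2 * k

  Bounded : (ℕ → ℕ → Bool) → Set
  Bounded g = ∀ {u w} → T (g u w) → u < n × w < n

  record Setting (g q : ℕ → ℕ → Bool) (m : ℕ) (st : State) : Set where
    field
      arc≡ : st bool ARC ≡ g
      req≡ : st bool REQ ≡ q
      row≡ : st nat ROW 0 0 ≡ m

  GoodBest : (ℕ → ℕ → Bool) → (ℕ → ℕ → Bool) → ℕ → State → Set
  GoodBest g q m st = T (st bool FOUND 0 0) → Verified g q m (st bool BEST 0)

  Success : State → Set
  Success st = T (st bool FOUND 0 0)

  record Checked (g q : ℕ → ℕ → Bool) (m : ℕ) (y y′ : State) : Set where
    D = y bool DEL 0
    field
      vio      : Bool
      found-eq : y′ bool FOUND 0 0 ≡ y bool FOUND 0 0 ∨ not vio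
      best-eq  : ∀ x → y′ bool BEST 0 x ≡ (if vio then y bool BEST 0 x else D x)
      vio-e    : ¬ T vio → Verified g q m D
      vio-i    : Verified g q m D → ¬ T vio

  check-ok : ∀ {g q m} y → Setting g q m y → Bounded g → Bounded q → Checked g q m y (run CHECK y)
  check-ok y record { arc≡ = refl ; req≡ = refl ; row≡ = refl } gn qn = record
    { vio = vio
    ; found-eq = cong (λ f → f 0 0 ∨ not vio) (frame CLOSE y₀ bool FOUND λ ())
    ; best-eq = λ x → cong₂ (λ a b → if vio then a else b) (cong (λ f → f 0 x) (frame CLOSE y₀ bool BEST λ ())) (cong (λ f → f 0 x) del)
    ; vio-e = λ nv → record
      { solves = λ {s} {t} r le ns nt p p′ → nv (from y₂ (0 ∷ 0 ∷ []) (∃̂ (∃̂ (bm VI x₁ x₀)) || tooBigE)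
          (inj₁ (s , n<M (proj₁ (qn r)) , t , n<M (proj₂ (qn r)) , from y₁ (t ∷ s ∷ []) violatedE
            (subst (λ f → T (f s t)) (sym rq) r , (λ lt → ≤⇒≯ le (subst (λ f → f 0 0 < s) rw′ lt)) ,
             (λ h → ns (subst (λ f → T (f 0 s)) del h)) , (λ h → nt (subst (λ f → T (f 0 t)) del h)) ,
             Closed.complete cl bounded p , Closed.complete cl bounded p′))))
      ; small = ≤-trans (≮⇒≥ λ l → nv (from y₂ (0 ∷ 0 ∷ []) (∃̂ (∃̂ (bm VI x₁ x₀)) || tooBigE)
          (inj₂ (subst (k + k <_) (sym size) l)))) (≤-reflexive (cong (k +_) (sym (+-identityʳ k)))) }
    ; vio-i = λ V h → case to y₂ (0 ∷ 0 ∷ []) (∃̂ (∃̂ (bm VI x₁ x₀)) || tooBigE) h of λ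
      { (inj₁ (s , _ , t , _ , b)) → let (r , le , ns , nt , p , p′) = to y₁ (t ∷ s ∷ []) violatedE b in
          Verified.solves V (subst (λ f → T (f s t)) rq r) (≮⇒≥ λ l → le (subst (λ f → f 0 0 < s) (sym rw′) l))
            (λ h → ns (subst (λ f → T (f 0 s)) (sym del) h)) (λ h → nt (subst (λ f → T (f 0 t)) (sym del) h))
            (Closed.sound cl p) (Closed.sound cl p′)
      ; (inj₂ l) → ≤⇒≯ (Verified.small V) (subst₂ _<_ (cong (k +_) (sym (+-identityʳ k))) size l) } }
    where
    g = y bool ARC ∖ y bool DEL 0
    y₀ = run (assign bool GC liveE) y
    y₁ = run CLOSE y₀
    y₂ = run (assign bool VI violatedE) y₁
    vio = eval y₂ (0 ∷ 0 ∷ []) (∃̂ (∃̂ (bm VI x₁ x₀)) || tooBigE)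
    n<M : ∀ {x} → x < n → x < M
    n<M h = ≤-trans h n≤M
    bounded : ∀ {u w} → T (g u w) → u < M × w < M
    bounded h = let (a , b) = gn (proj₁ (∖ᵉ (y bool ARC) (y bool DEL 0) h)) in n<M a , n<M b
    cl : Closed g (y₁ bool TC)
    cl = close-ok y₀
    del : y₁ bool DEL ≡ y bool DEL
    del = frame CLOSE y₀ bool DEL λ ()
    rq : y₁ bool REQ ≡ y bool REQ
    rq = frame CLOSE y₀ bool REQ λ ()
    rw′ : y₁ nat ROW ≡ y nat ROW
    rw′ = frame CLOSE y₀ nat ROW λ ()
    size : count M (y₁ bool DEL 0) ≡ count M (y bool DEL 0)
    size = cong (λ f → count M (f 0)) del

  reach-cong : ∀ g {D D′} → (∀ x → D x ≡ D′ x) → ∀ {u w} → Reach (g ∖ D′) u w → Reach (g ∖ D) u w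
  reach-cong g {D} {D′} e = reach-map (g ∖ D′) (g ∖ D) λ {u} {w} h → let (a , b , c) = ∖ᵉ g D′ h in
    ∖ⁱ g D a (b ∘ subst T (e u)) (c ∘ subst T (e w))

  verified-cong : ∀ {g q m D D′} → (∀ x → D x ≡ D′ x) → Verified g q m D → Verified g q m D′
  verified-cong {g} e V = record
    { solves = λ {s} {t} r le ns nt p p′ → Verified.solves V r le (ns ∘ subst T (e s)) (nt ∘ subst T (e t)) (reach-cong g e p) (reach-cong g e p′)
    ; small = ≤-trans (≤-reflexive (count-cong M λ {x} _ → sym (e x))) (Verified.small V) }

  check-sound : ∀ {g q m} y → Setting g q m y → Bounded g → Bounded q → GoodBest g q m y →
                ∀ {P} → P ≡ CHECK → GoodBest g q m (run P y)
  check-sound {g} {q} {m} y S gn qn good refl = goal (check-ok y S gn qn)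
    where
    goal : ∀ {y′} → Checked g q m y y′ → GoodBest g q m y′
    goal record { vio = true ; found-eq = f ; best-eq = b } h =
      verified-cong (λ x → sym (b x)) (good ([ id , (λ ()) ]′ (∨ᵉ (y bool FOUND 0 0) (subst T f h))))
    goal record { vio = false ; best-eq = b ; vio-e = passed } h = verified-cong (λ x → sym (b x)) (passed id)

  check-found : ∀ {g q m} y → Setting g q m y → Bounded g → Bounded q → Success y ⊎ Verified g q m (y bool DEL 0) →
                ∀ {P} → P ≡ CHECK → Success (run P y)
  check-found {g} {q} {m} y S gn qn h refl = goal (check-ok y S gn qn) h
    where
    goal : ∀ {y′} → Checked g q m y y′ → Success y ⊎ Verified g q m (y bool DEL 0) → Success y′
    goal c (inj₁ f) = subst T (sym (Checked.found-eq c)) (∨ˡ f)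
    goal c (inj₂ V) = subst T (sym (Checked.found-eq c)) (∨ʳ (y bool FOUND 0 0) (notⁱ (Checked.vio-i c V)))

-- Every vertex of a walk that closes up at `s` lies in the strong component of `s`. So `g′` has to
-- provide only the arcs inside this component.
within-component : ∀ g g′ {s} → (∀ {u w} → Reach g s u → T (g u w) → Reach g w s → T (g′ u w)) →
                   ∀ {u w} → Reach g s u → Reach g u w → Reach g w s → Reach g′ u w
within-component g g′ f a ε       b = ε
within-component g g′ f a (e ◅ p) b = f a e (p ◅◅ b) ◅ within-component g g′ f (a ◅◅ (e ◅ ε)) p b

-- What the two phases achieve for a hidden solution

module Attempt (C : Context) (n+n≤M : Context.cn C + Context.cn C ≤ Context.cM C) (2k<M : 2 * Context.ck C < Context.cM C) where
  open Context C renaming (cM to M; cn to n; ck to k)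
  open Semantics C
  open Logic C
  open Closure C
  open Pushing C
  private
    k<M : k < M
    k<M = ≤-trans (s≤s (m≤m+n k _)) 2k<M
    n≤M : n ≤ M
    n≤M = ≤-trans (m≤m+n n n) n+n≤M
  open Phase₁ C n+n≤M k<M
  open Phase₂ C n+n≤M 2k<M
  open Checking C n≤M

  n<M : ∀ {x} → x < n → x < M
  n<M h = ≤-trans h n≤M

  bounded-∖ : ∀ g X → Bounded g → ∀ {u w} → T ((g ∖ X) u w) → u < M × w < M
  bounded-∖ g X gn e = let (a , b) = gn (proj₁ (∖ᵉ g X e)) in n<M a , n<M b

  -- The labelled vertices lie in different components, in topological order.
  record Split (g : ℕ → ℕ → Bool) (w : ℕ → Bool) (l : ℕ → ℕ) (D : ℕ → Bool) : Set where
    field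
      zero-deleted : ∀ {x} → T (w x) → l x ≡ 0 → T (D x)
      separated    : ∀ {s t} → s < n → t < n → T (w s) → T (w t) → 0 < l t → l t < l s → ¬ Reach (g ∖ D) s t
      cheap        : count M D ≤ k

  split-ok : ∀ {g W₀ L₀ st} → Fixed g (W₀ 0) (L₀ 0) → Inv₁ g W₀ L₀ 0 st →
             (∀ {x} → T (W₀ 0 x) → L₀ 0 x ≡ 0 → T (st bool DEL 0 x)) → Split g (W₀ 0) (L₀ 0) (st bool DEL 0)
  split-ok {g} F I zd = record
    { zero-deleted = zd
    ; separated = λ {s} {t} s< t< ws wt l>0 l< → Inv₁.below I (≤-trans (Fixed.below F ws) (m∸n≡0⇒m≤n (n≤0⇒n≡0 done)))
        (src-i w l (l s) {s} s< ws ≤-refl) (low-i w l (l s) {t} t< wt l>0 l<)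
    ; cheap = ≤-trans (m≤n+m _ κ) spent }
    where
    open Inv₁ I
    ℓ≤κ : ℓ ≤ κ
    ℓ≤κ = lower≤budget (bounded-∖ g D (Fixed.arcs F)) (λ {s} hs → n<M (proj₁ (src-e w l lev hs)))
            (λ {s} hs → ∨ʳ (A s) (src⊆prot w l lev>0 hs)) hid
    -- With no digit left, `2 * κ + (top ∸ lev) ≤ ℓ ≤ κ`.
    done : top ∸ lev ≤ 0
    done = +-cancelˡ-≤ κ _ _ (≤-trans (+-monoˡ-≤ (top ∸ lev) (m≤m+n κ (κ + 0))) (≤-trans fuel (+-monoˡ-≤ 0 ℓ≤κ)))

  -- h relates the vertices of a component of g ∖ D, and g₂ consists of the
  -- arcs inside the components.
  record Components (g : ℕ → ℕ → Bool) (D : ℕ → Bool) (g₂ h : ℕ → ℕ → Bool) : Set where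
    field
      arc-e : ∀ {u w} → T (g₂ u w) → T ((g ∖ D) u w) × Reach (g ∖ D) w u
      arc-i : ∀ {u w} → T ((g ∖ D) u w) → Reach (g ∖ D) w u → T (g₂ u w)
      rel-e : ∀ {u w} → T (h u w) → Reach (g ∖ D) u w × Reach (g ∖ D) w u
      rel-i : ∀ {u w} → Reach (g ∖ D) u w → Reach (g ∖ D) w u → T (h u w)

    back : ∀ {u w} → Reach g₂ u w → Reach (g ∖ D) u w × Reach (g ∖ D) w u
    back ε       = ε , ε
    back (e ◅ p) = let (a , b) = back p ; (c , d) = arc-e e in (c ◅ a) , (b ◅◅ d)

  terminals-e : ∀ w l {x} → T (terminals w l x) → x < n × T (w x) × 0 < l x
  terminals-e w l {x} h = <ᵇ⇒< x n (∧ˡ (x <ᵇ n) h) , ∧ˡ (w x) (∧ʳ (x <ᵇ n) h) , <ᵇ⇒< 0 (l x) (∧ʳ (w x) (∧ʳ (x <ᵇ n) h))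

  terminals-i : ∀ w l {x} → x < n → T (w x) → 0 < l x → T (terminals w l x)
  terminals-i w l x< h p = ∧ⁱ (<⇒<ᵇ x<) (∧ⁱ h (<⇒<ᵇ p))

  module Hiding {g q w X m} (gn : Bounded g) (qn : Bounded q) (w<n : ∀ {x} → T (w x) → x < n)
                (wsol : Solves g q m w) (xsol : Solves g q m X) where

    r : ℕ → ℕ → Bool
    r = reachable (g ∖ X)

    private
      rⁱ : ∀ {u x} → Reach (g ∖ X) u x → T (r u x)
      rⁱ = reachableⁱ (g ∖ X) (bounded-∖ g X gn)
      rᵉ : ∀ {u x} → T (r u x) → Reach (g ∖ X) u x
      rᵉ = reachableᵉ (g ∖ X)

    open Ranking M w X r (λ u → rⁱ ε) (λ a b → rⁱ (rᵉ a ◅◅ rᵉ b)) public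

    live-of : ∀ {x} → T (w x) → 0 < rank x → Live x
    live-of {x} h p = n<M (w<n h) , h , λ hx → contradiction (≤-trans p (≤-reflexive (rank-dead hx))) λ ()

    module _ {l : ℕ → ℕ} (labels : ∀ {x} → T (w x) → l x ≡ rank x) where

      labelled : ∀ {x} → T (w x) → 0 < l x → Live x
      labelled h p = live-of h (subst (0 <_) (labels h) p)

      -- Initially the topological order makes X ∖ w a solution of phase one.
      ordered : ∀ {D X₁ s t} → (∀ {x} → T (X x) → T (D x) ⊎ T (X₁ x)) → T (w s) → T (w t) → 0 < l t → l t < l s →
                ¬ Reach (g ∖ D ∖ X₁) s t
      ordered {D} {X₁} {s} {t} cover ws wt p lt a = <⇒≱ lt (subst₂ _≤_ (sym (labels ws)) (sym (labels wt))
        (rank-mono (labelled ws (≤-trans p (<⇒≤ lt))) (labelled wt p) (rⁱ (reach-map (g ∖ D ∖ X₁) (g ∖ X) thin a))))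
        where
        thin : ∀ {u x} → T ((g ∖ D ∖ X₁) u x) → T ((g ∖ X) u x)
        thin e = let (e , a , b) = ∖ᵉ (g ∖ D) X₁ e ; (e , c , d) = ∖ᵉ g D e in
          ∖ⁱ g X e (λ h → [ c , a ]′ (cover h)) (λ h → [ d , b ]′ (cover h))

      module _ {D₁ g₂ h} (S : Split g w l D₁) (comp : Components g D₁ g₂ h) where
        open Split S
        open Components comp

        -- Phase one separates different positive labels in one direction, whereas vertices of one
        -- component reach each other in both.
        same-label : ∀ {s t} → T (terminals w l s) → T (terminals w l t) → Reach (g ∖ D₁) s t → Reach (g ∖ D₁) t s → l s ≡ l t
        same-label {s} {t} hs ht a b with terminals-e w l hs | terminals-e w l ht | <-cmp (l s) (l t)
        ... | _ | _ | tri≈ _ e _ = e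
        ... | s< , ws , p | t< , wt , q | tri< lt _ _ = ⊥-elim (separated t< s< wt ws p lt b)
        ... | s< , ws , p | t< , wt , q | tri> _ _ lt = ⊥-elim (separated s< t< ws wt q lt a)

        joined : ∀ {s t} → T (terminals w l s) → T (terminals w l t) → Reach (g ∖ D₁) s t → Reach (g ∖ D₁) t s → Reach (g ∖ X) s t
        joined hs ht a b = let (_ , ws , p) = terminals-e w l hs ; (_ , wt , q) = terminals-e w l ht in
          rᵉ (rank-≡ (labelled ws p) (labelled wt q) (trans (sym (labels ws)) (trans (same-label hs ht a b) (labels wt))))

        -- X solves the second phase: the labels tell the components of g ∖ X apart.
        good-initial : Solved (g₂ ∖ D₁ ∖ X) h q m (terminals w l)
        good-initial {s} {t} hq le hh ((p , hp , a) , (p′ , hp′ , a′)) ((o , ho , b) , (o′ , ho′ , b′)) =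
          -- The terminals around `s` and `t` lie in one component after phase one, so they have
          -- equal labels and are strongly connected without `X`. Joining them to `s` and `t` gives
          -- walks in both directions that avoid `X`.
          xsol hq le (avoid hp a) (avoid ho b)
            (thin a′ ◅◅ (joined hp′ ho (proj₂ (out a′) ◅◅ (proj₁ st ◅◅ proj₂ (out b))) (proj₁ (out b) ◅◅ (proj₂ st ◅◅ proj₁ (out a′))) ◅◅ thin b))
            (thin b′ ◅◅ (joined ho′ hp (proj₂ (out b′) ◅◅ (proj₂ st ◅◅ proj₂ (out a))) (proj₁ (out a) ◅◅ (proj₁ st ◅◅ proj₁ (out b′))) ◅◅ thin a))
          where
          st = rel-e hh
          thin : ∀ {u x} → Reach (g₂ ∖ D₁ ∖ X) u x → Reach (g ∖ X) u x
          thin = reach-map (g₂ ∖ D₁ ∖ X) (g ∖ X) λ e → let (e , a , b) = ∖ᵉ (g₂ ∖ D₁) X e ; (e , _) = ∖ᵉ g₂ D₁ e in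
            ∖ⁱ g X (proj₁ (∖ᵉ g D₁ (proj₁ (arc-e e)))) a b
          out : ∀ {u x} → Reach (g₂ ∖ D₁ ∖ X) u x → Reach (g ∖ D₁) u x × Reach (g ∖ D₁) x u
          out p = back (reach-map (g₂ ∖ D₁ ∖ X) g₂ (λ e → proj₁ (∖ᵉ g₂ D₁ (proj₁ (∖ᵉ (g₂ ∖ D₁) X e)))) p)
          avoid : ∀ {p x} → T (terminals w l p) → Reach (g₂ ∖ D₁ ∖ X) p x → ¬ T (X x)
          avoid hp a = let (_ , wp , q) = terminals-e w l hp in reach-avoids g X (proj₂ (proj₂ (labelled wp q))) (thin a)

        -- As `W` is a solution, the component of an unsolved request contains a vertex of `W`. It
        -- is not deleted, so its label is positive and it is a terminal; both endpoints are then in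
        -- the core.
        solves-final : ∀ {D} → (∀ {x} → T (D₁ x) → T (D x)) → Solved (g₂ ∖ D) h q m (terminals w l) → Solves g q m D
        solves-final {D} D₁⊆D sol {s} {t} hq le ns nt p p′ = sol hq le (rel-i (loosen p) (loosen p′)) (core ε ε) (core p p′)
          where
          loosen : ∀ {u x} → Reach (g ∖ D) u x → Reach (g ∖ D₁) u x
          loosen = reach-map (g ∖ D) (g ∖ D₁) λ e → let (e , a , b) = ∖ᵉ g D e in ∖ⁱ g D₁ e (a ∘ D₁⊆D) (b ∘ D₁⊆D)
          s<n = proj₁ (qn hq)
          R : ℕ → ℕ → Bool
          R = reachable (g ∖ D)
          meets : ℕ → Bool
          meets x = w x ∧ (R s x ∧ R x s)
          inner : ∀ {u x} → Reach (g ∖ D) s u → T ((g ∖ D) u x) → Reach (g ∖ D) x s → T ((g₂ ∖ D) u x)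
          inner a e b = let (_ , c , d) = ∖ᵉ g D e in
            ∖ⁱ g₂ D (arc-i (∖ⁱ g D₁ (proj₁ (∖ᵉ g D e)) (c ∘ D₁⊆D) (d ∘ D₁⊆D)) (loosen (b ◅◅ a))) c d
          terminal : ∃[ x ] T (terminals w l x) × Reach (g ∖ D) s x × Reach (g ∖ D) x s
          terminal with T? (any M meets)
          ... | yes h = let (x , x< , hx) = anyᵉ M {meets} h
                            a = reachableᵉ (g ∖ D) (∧ˡ (R s x) (∧ʳ (w x) hx)) in
            x , terminals-i w l (w<n (∧ˡ (w x) hx)) (∧ˡ (w x) hx)
                  (n≢0⇒n>0 λ e → reach-avoids g D ns a (D₁⊆D (zero-deleted (∧ˡ (w x) hx) e))) ,
              a , reachableᵉ (g ∖ D) (∧ʳ (R s x) (∧ʳ (w x) hx))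
          -- A component without vertices of `W` would survive the deletion of `W` and violate the
          -- request there.
          ... | no none = ⊥-elim (wsol hq le (λ h → miss h ε ε) (λ h → miss h p p′)
                  (within-component (g ∖ D) (g ∖ w) off ε p p′) (within-component (g ∖ D) (g ∖ w) off p p′ ε))
            where
            miss : ∀ {x} → T (w x) → Reach (g ∖ D) s x → ¬ Reach (g ∖ D) x s
            miss {x} h a b = none (anyⁱ M {meets} x (n<M (w<n h)) (∧ⁱ h
              (∧ⁱ (reachableⁱ (g ∖ D) (bounded-∖ g D gn) a) (reachableⁱ (g ∖ D) (bounded-∖ g D gn) b))))
            off : ∀ {u x} → Reach (g ∖ D) s u → T ((g ∖ D) u x) → Reach (g ∖ D) x s → T ((g ∖ w) u x)
            off a e b = ∖ⁱ g w (proj₁ (∖ᵉ g D e)) (λ h → miss h a (e ◅ b)) (λ h → miss h (a ◅◅ (e ◅ ε)) b)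
          core : ∀ {y} → Reach (g ∖ D) s y → Reach (g ∖ D) y s → Core (g₂ ∖ D) (terminals w l) y
          core a b = let (x , hx , c , d) = terminal in
            (x , hx , within-component (g ∖ D) (g₂ ∖ D) inner c (d ◅◅ a) b) ,
            (x , hx , within-component (g ∖ D) (g₂ ∖ D) inner a (b ◅◅ c) d)

-- Loops driven by a part of the advice

module Driving (C : Context) where
  open Context C renaming (cM to M; cn to n; ck to k)
  open Semantics C
  open Logic C
  open Advice C
  open Independence C

  record Grows (s : Stm) : Set where
    constructor grows
    field at : ∀ y {x} → T (y bool DEL 0 x) → T (run s y bool DEL 0 x)

  record Moves (s : Stm) : Set where
    constructor moves
    field at : ∀ y → run s y nat PT 0 0 ≡ suc (y nat PT 0 0)

  grows-⍮ : ∀ {a b} → Grows a → Grows b → Grows (a ⍮ b)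
  grows-⍮ {a} (grows ga) (grows gb) = grows λ y h → gb (run a y) (ga y h)

  grows-frame : ∀ {a} → ¬ T (writes bool DEL a) → Grows a
  grows-frame {a} nw = grows λ y {x} h → subst (λ f → T (f 0 x)) (sym (frame a y bool DEL nw)) h

  grows₁ : Grows BODY₁
  grows₁ = grows-⍮ (grows-frame λ ()) (grows-⍮ (grows-frame λ ()) (grows-⍮ (grows λ y → ∨ˡ) (grows-frame λ ())))

  grows₂ : Grows BODY₂
  grows₂ = grows-⍮ (grows-frame λ ()) (grows-⍮ (grows-frame λ ()) (grows-⍮ (grows-frame λ ()) (grows-⍮ (grows λ y → ∨ˡ) (grows-frame λ ()))))

  moves-⍮ : ∀ {a b} → ¬ T (writes nat PT a) → Moves b → Moves (a ⍮ b)
  moves-⍮ {a} nw (moves mb) = moves λ y → trans (mb (run a y)) (cong (λ f → suc (f 0 0)) (frame a y nat PT nw))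

  moves-advance : Moves advance
  moves-advance = moves λ y → +-comm (y nat PT 0 0) 1

  moves₁ : Moves BODY₁
  moves₁ = moves-⍮ (λ ()) (moves-⍮ (λ ()) (moves-⍮ (λ ()) (moves-⍮ (λ ()) moves-advance)))

  moves₂ : Moves BODY₂
  moves₂ = moves-⍮ (λ ()) (moves-⍮ (λ ()) (moves-⍮ (λ ()) (moves-⍮ (λ ()) (moves-⍮ (λ ()) moves-advance))))

  agree-run : ∀ s → ¬ T (readsS nat ADV s) → ∀ {st st′} → st ≈ st′ → run s st ≈ run s st′
  agree-run s blind A = run-agree A s blind

  independent : ∀ {s st st′} → T (legal scratch s) → ¬ T (undefined scratch s bool DEL) → AgreeOff scratch st st′ →
                ∀ x → run s st bool DEL 0 x ≡ run s st′ bool DEL 0 x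
  independent {s} h d A x = run-off scratch A s h bool DEL d 0 x

  advice-kept : ∀ {s} → ¬ T (writes nat ADV s) → ∀ {st} → run s st nat ADV ≡ st nat ADV
  advice-kept {s} nw {st} = frame s st nat ADV nw

  digit-inside : ∀ st lim p {a : ℕ → ℕ} → (∀ j → st nat ADV 0 j ≡ a j) → p < lim → p < M → digitAt st lim p ≡ a p
  digit-inside st lim p {a} e p< p<M = trans (sum-delta M p p<M λ {y} _ ne → if-F λ h → ne (≡ᵇ⇒≡ y p (∧ˡ (y ≡ᵇ p) h)))
    (trans (if-T (∧ⁱ (≡⇒≡ᵇ p p refl) (<⇒<ᵇ p<))) (e p))

  digit-outside : ∀ st lim p → lim ≤ p → digitAt st lim p ≡ 0
  digit-outside st lim p le = sum-zero M λ {y} _ → if-F λ h →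
    ≤⇒≯ le (subst (_< lim) (≡ᵇ⇒≡ y p (∧ˡ (y ≡ᵇ p) h)) (<ᵇ⇒< y lim (∧ʳ (y ≡ᵇ p) h)))

  -- A loop driven by the part of the advice from position o to position lim.
  record Driven (body : Stm) (b r : ℕ) (I : ℕ → State → Set) (st : State) : Set where
    field
      digit   : ℕ → ℕ
      small   : ∀ j → digit j < b
      end     : State
      end-ok  : I 0 end
      end-del : ∀ {x} → T (st bool DEL 0 x) → T (end bool DEL 0 x)
      follow  : ∀ {st₀ o lim} {a : ℕ → ℕ} → st ≈ st₀ → st nat PT 0 0 ≡ o → st nat LIM 0 0 ≡ lim → r + o ≤ lim → lim ≤ M →
                (∀ j → st₀ nat ADV 0 j ≡ a j) → (∀ {j} → o ≤ j → j < lim → a j ≡ digit (j ∸ o)) →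
                end ≈ run (loop (DIGIT ⍮ body)) st₀

  drive : ∀ {body b r} I → ¬ T (readsS nat ADV body) → ¬ T (writes nat ADV body) → ¬ T (writes nat LIM body) → Moves body → Grows body →
          (∀ {r st} → I r st → ∃[ d ] d < b × (r ≡ 0 → d ≡ 0) × I (r ∸ 1) (run body (withDigit st d))) →
          0 < b → r ≤ M → ∀ {st} → I r st → Driven body b r I st
  drive {body} {b} {r} I blind keeps keepsLim mv gr step b>0 r≤M {st} i = record
    { digit = S.digit ; small = S.small ; end = S.end ; end-ok = subst (λ r → I r S.end) (m≤n⇒m∸n≡0 r≤M) (proj₁ S.end-ok)
    ; end-del = proj₂ S.end-ok ; follow = follow }
    where
    I′ : ℕ → State → Set
    I′ r y = I r y × (∀ {x} → T (st bool DEL 0 x) → T (y bool DEL 0 x))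
    step′ : ∀ {r y} → I′ r y → ∃[ d ] d < b × (r ≡ 0 → d ≡ 0) × I′ (r ∸ 1) (run body (withDigit y d))
    step′ {y = y} (i , sub) = let (d , d< , d0 , i′) = step i in d , d< , d0 , i′ , λ h → Grows.at gr (withDigit y d) (sub h)
    module S = Steered (steer b body blind keeps keepsLim (Moves.at mv) I′ step′ b>0 M (i , id))
    follow : ∀ {st₀ o lim} {a : ℕ → ℕ} → st ≈ st₀ → st nat PT 0 0 ≡ o → st nat LIM 0 0 ≡ lim → r + o ≤ lim → lim ≤ M →
             (∀ j → st₀ nat ADV 0 j ≡ a j) → (∀ {j} → o ≤ j → j < lim → a j ≡ S.digit (j ∸ o)) →
             S.end ≈ run (loop (DIGIT ⍮ body)) st₀
    follow {st₀} {a = a} A refl refl fits lim≤M e h = S.follow A digits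
      where
      o = st nat PT 0 0
      lim = st nat LIM 0 0
      digits : ∀ {j} → j < M → digitAt st₀ lim (j + o) ≡ S.digit j
      digits {j} j< with (j + o) <? lim
      ... | yes l = trans (digit-inside st₀ lim (j + o) e l (≤-trans l lim≤M)) (trans (h (m≤n+m o j) l) (cong S.digit (m+n∸n≡m j o)))
      ... | no ge = trans (digit-outside st₀ lim (j + o) (≮⇒≥ ge)) (sym (S.past (+-cancelʳ-≤ o _ _ (≤-trans fits (≮⇒≥ ge)))))

-- Layout of the advice: labels, digits of phase one, digits of phase two.

labelsEnd phase₁End adviceLength : ℕ → ℕ
labelsEnd k    = k + k + 2
phase₁End k    = k + k + (k + k) + (k + k) + 5
adviceLength k = k + k + (k + k) + (k + k) + (k + k) + 6

position : ℕ → (ℕ → Bool) → ℕ → ℕ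
position M w x = count M (λ y → (y <ᵇ x) ∧ w y)

position-strict : ∀ M w {x y} → x < M → T (w x) → x < y → position M w x < position M w y
position-strict M w {x} {y} x<M h x<y = count-strict M x x<M
  (λ {u} _ q → ∧ⁱ (<⇒<ᵇ (<-trans (<ᵇ⇒< u x (∧ˡ (u <ᵇ x) q)) x<y)) (∧ʳ (u <ᵇ x) q))
  (λ q → n≮n x (<ᵇ⇒< x x (∧ˡ (x <ᵇ x) q))) (∧ⁱ (<⇒<ᵇ x<y) h)

position-injective : ∀ M w {x y} → x < M → y < M → T (w x) → T (w y) → position M w x ≡ position M w y → x ≡ y
position-injective M w {x} {y} x< y< hx hy e with <-cmp x y
... | tri< l _ _ = ⊥-elim (<⇒≢ (position-strict M w x< hx l) e)
... | tri≈ _ q _ = q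
... | tri> _ _ l = ⊥-elim (<⇒≢ (position-strict M w y< hy l) (sym e))

position≤ : ∀ M w x → position M w x ≤ count M w
position≤ M w x = count-mono M λ {y} _ q → ∧ʳ (y <ᵇ x) q

-- Writes the value of each element of `w` to its position within `w`, which undoes the reading of
-- labels.
listed : ℕ → (ℕ → Bool) → (ℕ → ℕ) → ℕ → ℕ
listed M w f j = if any M (λ x → w x ∧ (position M w x ≡ᵇ j)) then f (first M (λ x → w x ∧ (position M w x ≡ᵇ j))) else 0

listed-at : ∀ M w f {x} → x < M → T (w x) → listed M w f (position M w x) ≡ f x
listed-at M w f {x} x< h = trans (if-T found) (cong f (position-injective M w p< x< (∧ˡ (w p) pw) h (≡ᵇ⇒≡ _ _ (∧ʳ (w p) pw))))
  where
  q : ℕ → Bool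
  q y = w y ∧ (position M w y ≡ᵇ position M w x)
  found : T (any M q)
  found = anyⁱ M {q} x x< (∧ⁱ h (≡⇒≡ᵇ (position M w x) _ refl))
  p = first M q
  p< = proj₁ (first-ok M {q} found)
  pw = proj₂ (first-ok M {q} found)

listed≤ : ∀ M w f b → (∀ {x} → x < M → T (w x) → f x ≤ b) → ∀ j → listed M w f j ≤ b
listed≤ M w f b h j with any M (λ x → w x ∧ (position M w x ≡ᵇ j)) in e
... | false = z≤n
... | true  = let q = λ x → w x ∧ (position M w x ≡ᵇ j) ; (p< , pw) = first-ok M {q} (subst T (sym e) tt) in h p< (∧ˡ (w (first M q)) pw)

-- An advice string that makes an attempt succeed

module Guessing (C : Context) (n+n≤M : Context.cn C + Context.cn C ≤ Context.cM C) (2k<M : 2 * Context.ck C < Context.cM C) where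
  open Context C renaming (cM to M; cn to n; ck to k)
  open Semantics C
  open Logic C
  open Closure C
  open Pushing C
  open Advice C
  open Independence C
  open Driving C
  k<M : k < M
  k<M = ≤-trans (s≤s (m≤m+n k _)) 2k<M
  n≤M : n ≤ M
  n≤M = ≤-trans (m≤m+n n n) n+n≤M
  open Phase₁ C n+n≤M k<M
  open Phase₂ C n+n≤M 2k<M
  open Checking C n≤M
  open Attempt C n+n≤M 2k<M

  labels-read : ∀ y i x → position M (y bool W 0) x < M → run LABELS y nat LAB i x ≡ y nat ADV 0 (position M (y bool W 0) x)
  labels-read y i x p< = trans (sum-delta M p p< λ {j} _ ne → if-F λ h → ne (≡ᵇ⇒≡ j p h)) (if-T (≡⇒≡ᵇ p p refl))
    where p = position M (y bool W 0) x

  -- The initial potentials for a budget of `k` and the trivial lower bound 0, in phase one with the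
  -- levels from 1 to `top`.
  r₁ r₂ : ℕ
  r₁ = 2 * k + (top ∸ 1)
  r₂ = 2 * k

  record Started (w : ℕ → Bool) (y y′ : State) : Set where
    l = y nat LAB 0
    field
      del≡ : ∀ x → y′ bool DEL 0 x ≡ w x ∧ (l x ≡ᵇ 0)
      ax≡  : ∀ x → y′ bool AX 0 x ≡ false
      lev≡ : y′ nat LEV 0 0 ≡ 1
      pt≡  : y′ nat PT 0 0 ≡ labelsEnd k
      lim≡ : y′ nat LIM 0 0 ≡ phase₁End k
      arc≡ : y′ bool ARC ≡ y bool ARC
      w≡   : y′ bool W ≡ y bool W
      lab≡ : y′ nat LAB ≡ y nat LAB

  init-ok : ∀ y → Started (y bool W 0) y (run INIT₁ y)
  init-ok y = record { del≡ = λ _ → refl ; ax≡ = λ _ → refl ; lev≡ = refl ; pt≡ = refl ; lim≡ = refl ; arc≡ = refl ; w≡ = refl ; lab≡ = refl }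

  record Mid (y y′ : State) : Set where
    field
      comp : Components (y bool ARC) (y bool DEL 0) (y′ bool G2) (y′ bool HH)
      del≡ : y′ bool DEL ≡ y bool DEL
      ax≡  : ∀ x → y′ bool AX 0 x ≡ false
      ds≡  : ∀ x → y′ bool DS 0 x ≡ false
      pt≡  : y′ nat PT 0 0 ≡ phase₁End k
      lim≡ : y′ nat LIM 0 0 ≡ adviceLength k
      req≡ : y′ bool REQ ≡ y bool REQ
      w≡   : y′ bool W ≡ y bool W
      lab≡ : y′ nat LAB ≡ y nat LAB
      row≡ : y′ nat ROW ≡ y nat ROW

  mid-ok : ∀ y → Bounded (y bool ARC) → Mid y (run MID y)
  mid-ok y gn = record
    { comp = record
      { arc-e = λ {u} {w} h → let (e , m) = to y₂ (w ∷ u ∷ []) (liveE && bm HH x₁ x₀) h in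
          subst T (live≡ u w) (from y₂ (w ∷ u ∷ []) liveE e) , Closed.sound cl (proj₂ (to y₁ (w ∷ u ∷ []) (bm TC x₁ x₀ && bm TC x₀ x₁) m))
      ; arc-i = λ {u} {w} e b → from y₂ (w ∷ u ∷ []) (liveE && bm HH x₁ x₀) (to y₂ (w ∷ u ∷ []) liveE (subst T (sym (live≡ u w)) e) ,
          from y₁ (w ∷ u ∷ []) (bm TC x₁ x₀ && bm TC x₀ x₁) (Closed.complete cl bounded (e ◅ ε) , Closed.complete cl bounded b))
      ; rel-e = λ {u} {w} h → let (a , b) = to y₁ (w ∷ u ∷ []) (bm TC x₁ x₀ && bm TC x₀ x₁) h in Closed.sound cl a , Closed.sound cl b
      ; rel-i = λ {u} {w} a b → from y₁ (w ∷ u ∷ []) (bm TC x₁ x₀ && bm TC x₀ x₁) (Closed.complete cl bounded a , Closed.complete cl bounded b) }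
    ; del≡ = frame CLOSE y₀ bool DEL λ () ; ax≡ = λ _ → refl ; ds≡ = λ _ → refl ; pt≡ = refl ; lim≡ = refl
    ; req≡ = frame CLOSE y₀ bool REQ λ () ; w≡ = frame CLOSE y₀ bool W λ () ; lab≡ = frame CLOSE y₀ nat LAB λ ()
    ; row≡ = frame CLOSE y₀ nat ROW λ () }
    where
    g = y bool ARC ∖ y bool DEL 0
    y₀ = run (assign bool GC liveE) y
    y₁ = run CLOSE y₀
    y₂ = run (assign bool HH (bm TC x₁ x₀ && bm TC x₀ x₁)) y₁
    bounded : ∀ {u w} → T (g u w) → u < M × w < M
    bounded = bounded-∖ (y bool ARC) (y bool DEL 0) gn
    cl : Closed g (y₁ bool TC)
    cl = close-ok y₀
    live≡ : ∀ u w → eval y₂ (w ∷ u ∷ []) liveE ≡ g u w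
    live≡ u w = cong₂ (λ a d → a u w ∧ (not (d 0 u) ∧ not (d 0 w))) (frame CLOSE y₀ bool ARC λ ()) (frame CLOSE y₀ bool DEL λ ())

  module Complete {g q : ℕ → ℕ → Bool} {W₀ : ℕ → ℕ → Bool} {m : ℕ} {X : ℕ → Bool} (gn : Bounded g) (qn : Bounded q) (w<n : ∀ {x} → T (W₀ 0 x) → x < n)
                  (wsol : Solves g q m (W₀ 0)) (xsol : Solves g q m X) (wsize : count M (W₀ 0) ≤ suc (2 * k)) (xsize : count M X ≤ k)
                  (L≤M : adviceLength k ≤ M) where
    w : ℕ → Bool
    w = W₀ 0
    open Hiding {g} {q} {w} {X} {m} gn qn w<n wsol xsol using (rank; rank≤; rank-dead; ordered; good-initial; solves-final)

    Labels : (ℕ → ℕ → ℕ) → Set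
    Labels L₀ = ∀ {x} → T (w x) → L₀ 0 x ≡ rank x

    fixed : ∀ {L₀} → Labels L₀ → Fixed g w (L₀ 0)
    fixed labels = record { arcs = gn ; below = λ h → ≤-trans (s≤s (≤-trans (≤-reflexive (labels h)) (≤-trans (rank≤ (n<M (w<n h)) h) wsize)))
      (≤-trans (≤-reflexive (+-comm 2 (2 * k))) (+-monoʳ-≤ (2 * k) (s≤s (s≤s z≤n)))) }

    record Scene (st : State) : Set where
      field
        req≡ : st bool REQ ≡ q
        row≡ : st nat ROW 0 0 ≡ m

    scene-run : ∀ s → ¬ T (writes bool REQ s) → ¬ T (writes nat ROW s) → ∀ {st} → Scene st → Scene (run s st)
    scene-run s nq nr {st} S = record { req≡ = trans (frame s st bool REQ nq) (Scene.req≡ S)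
                                      ; row≡ = trans (cong (λ f → f 0 0) (frame s st nat ROW nr)) (Scene.row≡ S) }

    I₁ : (ℕ → ℕ → ℕ) → ℕ → State → Set
    I₁ L₀ r st = Inv₁ g W₀ L₀ r st × Scene st

    record Ready₁ (L₀ : ℕ → ℕ → ℕ) (st : State) : Set where
      field
        inv  : I₁ L₀ r₁ st
        zero-deleted : ∀ {x} → T (w x) → L₀ 0 x ≡ 0 → T (st bool DEL 0 x)
        pt≡  : st nat PT 0 0 ≡ labelsEnd k
        lim≡ : st nat LIM 0 0 ≡ phase₁End k

    ready₁ : ∀ {L₀} y y′ → Labels L₀ → y bool ARC ≡ g → y bool W ≡ W₀ → y nat LAB ≡ L₀ → Scene y′ → Started (y bool W 0) y y′ → Ready₁ L₀ y′
    ready₁ {L₀} y y′ labels refl refl refl sc S = record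
      { inv = record
        { arc≡ = arc≡ ; w≡ = w≡ ; l≡ = lab≡ ; lev>0 = ≤-reflexive (sym lev≡)
        ; X = X₁ ; κ = count M X₁ ; ℓ = 0
        ; hid = record
          { kept = λ {u} h hx → [ (λ a → subst T (ax≡ u) a) , (λ p → notᵉ (∧ʳ (X u) hx) (∧ˡ (w u) p)) ]′ (∨ᵉ (y′ bool AX 0 u) h)
          ; apart = λ {s} {a} _ _ h → [ (λ q → subst T (ax≡ a) q) , (λ q → let (_ , _ , p , lt) = low-e w l _ q in
              n≮n 0 (≤-trans p (≤-pred (≤-trans lt (≤-reflexive lev≡))))) ]′ (∨ᵉ (y′ bool AX 0 a) h)
          ; budget = ≤-refl ; lower = λ _ → z≤n }
        ; above = λ {j} {s} {t} le hs ht → let (_ , ws , a) = src-e w l j hs ; (_ , wt , p , b) = low-e w l j ht in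
            ordered {L₀ 0} labels {y′ bool DEL 0} {X₁} cover ws wt p (≤-trans b a)
        ; below = λ {j} {s} {t} lt hs ht _ → let (_ , _ , _ , b) = low-e w l j ht in
            n≮n 0 (≤-trans (s≤s z≤n) (≤-trans b (≤-pred (≤-trans lt (≤-reflexive lev≡)))))
        ; spent = ≤-trans (≤-trans (≤-reflexive (sym (sum-+ M _ _))) (sum-mono M λ {x} _ → split x)) xsize
        ; fuel = ≤-trans (+-mono-≤ (*-monoʳ-≤ 2 (≤-trans (count-mono M λ {x} _ h → ∧ˡ (X x) h) xsize)) (≤-reflexive (cong (top ∸_) lev≡))) ≤-refl } , sc
      ; zero-deleted = λ {x} h e → subst T (sym (del≡ x)) (∧ⁱ h (≡⇒≡ᵇ (l x) 0 e))
      ; pt≡ = pt≡ ; lim≡ = lim≡ }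
      where
      open Started S
      -- The vertices of `X` in `W` have label 0 and are deleted at the start. Only the rest remains
      -- hidden.
      X₁ : ℕ → Bool
      X₁ x = X x ∧ not (w x)
      cover : ∀ {x} → T (X x) → T (y′ bool DEL 0 x) ⊎ T (X₁ x)
      cover {x} h with T? (w x)
      ... | yes p = inj₁ (subst T (sym (del≡ x)) (∧ⁱ p (≡⇒≡ᵇ (l x) 0 (trans (labels p) (rank-dead h)))))
      ... | no np = inj₂ (∧ⁱ h (notⁱ np))
      del⊆X : ∀ {x} → T (y′ bool DEL 0 x) → T (X x)
      del⊆X {x} h with T? (X x)
      ... | yes p = p
      ... | no np = contradiction (trans (sym (labels (∧ˡ (w x) d))) (≡ᵇ⇒≡ (l x) 0 (∧ʳ (w x) d))) (rank≢0 np)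
        where
        d = subst T (del≡ x) h
        rank≢0 : ¬ T (X x) → rank x ≢ 0
        rank≢0 np e = contradiction (trans (sym (if-F np)) e) λ ()
      split : ∀ x → b2n (X₁ x) + b2n (y′ bool DEL 0 x) ≤ b2n (X x)
      split x with T? (y′ bool DEL 0 x)
      ... | no nd = ≤-trans (≤-reflexive (trans (cong (b2n (X₁ x) +_) (b2n-F nd)) (+-identityʳ _))) (b2n-mono (∧ˡ (X x)))
      ... | yes d = ≤-reflexive (trans (cong₂ _+_ (b2n-F λ h → notᵉ (∧ʳ (X x) h) (∧ˡ (w x) (subst T (del≡ x) d))) (b2n-T d)) (sym (b2n-T (del⊆X d))))

    step₁ : ∀ {B} → B ≡ BODY₁ → ¬ T (writes bool REQ B) → ¬ T (writes nat ROW B) → ∀ {L₀} → Labels L₀ → ∀ {r st} → I₁ L₀ r st →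
            ∃[ d ] d < 2 × (r ≡ 0 → d ≡ 0) × I₁ L₀ (r ∸ 1) (run B (withDigit st d))
    step₁ {B} eq nq nr {L₀} labels {r} {st} (i , sc) = let (d , d< , d0 , i′) = Step.step (fixed {L₀} labels) i eq in
      d , d< , d0 , i′ , scene-run B nq nr {withDigit st d} record { req≡ = Scene.req≡ sc ; row≡ = Scene.row≡ sc }

    2k≤M : 2 * k ≤ M
    2k≤M = <⇒≤ 2k<M

    r₁-fits : r₁ + labelsEnd k ≤ phase₁End k
    r₁-fits = ≤-trans (+-monoˡ-≤ (labelsEnd k) (+-monoʳ-≤ (2 * k) (m∸n≤m top 1)))
      (≤-reflexive (solve 1 (λ k → con 2 :* k :+ (con 2 :* k :+ con 3) :+ (k :+ k :+ con 2) := k :+ k :+ (k :+ k) :+ (k :+ k) :+ con 5) refl k))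
      where open +-*-Solver

    r₂-fits : r₂ + phase₁End k ≤ adviceLength k
    r₂-fits = ≤-trans (n≤1+n _)
      (≤-reflexive (solve 1 (λ k → con 1 :+ (con 2 :* k :+ (k :+ k :+ (k :+ k) :+ (k :+ k) :+ con 5)) := k :+ k :+ (k :+ k) :+ (k :+ k) :+ (k :+ k) :+ con 6) refl k))
      where open +-*-Solver

    phase₁End≤M : phase₁End k ≤ M
    phase₁End≤M = ≤-trans (≤-trans (m≤n+m _ r₂) r₂-fits) L≤M

    driven₁ : ∀ {B} → B ≡ BODY₁ → ¬ T (writes bool REQ B) → ¬ T (writes nat ROW B) →
              ¬ T (readsS nat ADV B) → ¬ T (writes nat ADV B) → ¬ T (writes nat LIM B) → Moves B → Grows B →
              ∀ {L₀} → Labels L₀ → ∀ {st} → Ready₁ L₀ st → Driven B 2 r₁ (I₁ L₀) st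
    driven₁ eq nq nr blind keeps lim mv gr {L₀} labels R = drive (I₁ L₀) blind keeps lim mv gr (step₁ eq nq nr {L₀} labels) (s≤s z≤n)
      (≤-trans (m≤m+n r₁ _) (≤-trans r₁-fits phase₁End≤M)) (Ready₁.inv R)

    module _ {L₀ : ℕ → ℕ → ℕ} (labels : Labels L₀) {e : State} (end : I₁ L₀ 0 e) (zd : ∀ {x} → T (w x) → L₀ 0 x ≡ 0 → T (e bool DEL 0 x)) where
      split : Split g w (L₀ 0) (e bool DEL 0)
      split = split-ok (fixed {L₀} labels) (proj₁ end) zd

      module _ {y : State} (mid : Mid e y) where
        g₂ h : ℕ → ℕ → Bool
        g₂ = y bool G2
        h  = y bool HH

        comp : Components g (e bool DEL 0) g₂ h
        comp = subst (λ a → Components a (e bool DEL 0) g₂ h) (Inv₁.arc≡ (proj₁ end)) (Mid.comp mid)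

        fixed₂ : Fixed₂ g₂ h q
        fixed₂ = record { arcs = λ a → gn (proj₁ (∖ᵉ g (e bool DEL 0) (proj₁ (Components.arc-e comp a)))) ; reqs = qn }

        start₂ : Inv₂ g₂ h q W₀ L₀ m r₂ y
        start₂ = record
          { static = record { g≡ = refl ; h≡ = refl ; q≡ = trans req≡ (Scene.req≡ (proj₂ end)) ; w≡ = trans w≡ (Inv₁.w≡ (proj₁ end))
                            ; l≡ = trans lab≡ (Inv₁.l≡ (proj₁ end)) ; m≡ = trans (cong (λ f → f 0 0) row≡) (Scene.row≡ (proj₂ end)) }
          -- The original `X` again, with its full size as budget even if some of its vertices have
          -- been deleted. Together with the deletions of phase one this amounts to at most `2 * k`.
          ; X = X ; κ = count M X ; ℓ = 0
          ; hid = record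
            { kept = λ {u} hu hx → [ (λ a → subst T (ax≡ u) a) , (λ p → contradiction (≤-trans (<ᵇ⇒< 0 (L₀ 0 u) (∧ʳ (w u) p))
                (≤-reflexive (trans (labels (∧ˡ (w u) p)) (rank-dead hx)))) λ ()) ]′ (∨ᵉ (y bool AX 0 u) hu)
            ; apart = λ {s} {a} _ _ ha → [ (λ q → subst T (ax≡ a) q) , (λ q → subst T (ds≡ a) q) ]′ (∨ᵉ (y bool AX 0 a) ha)
            ; budget = ≤-refl ; lower = λ _ → z≤n }
          ; good = subst (λ D → Solved (g₂ ∖ D ∖ X) h q m (terminals w (L₀ 0))) (cong (λ f → f 0) (sym del≡)) (good-initial {L₀ 0} labels split comp)
          ; spent = ≤-trans (+-mono-≤ xsize (≤-trans (≤-reflexive (cong (λ f → count M (f 0)) del≡)) (Split.cheap split)))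
                            (≤-reflexive (cong (k +_) (sym (+-identityʳ k))))
          ; fuel = *-monoʳ-≤ 2 xsize }
          where open Mid mid hiding (comp)

        step₂ : ∀ {B} → B ≡ BODY₂ → ∀ {r st} → Inv₂ g₂ h q W₀ L₀ m r st →
                ∃[ d ] d < 4 × (r ≡ 0 → d ≡ 0) × Inv₂ g₂ h q W₀ L₀ m (r ∸ 1) (run B (withDigit st d))
        step₂ eq i = Step₂.step fixed₂ i eq

        driven₂ : ∀ {B} → B ≡ BODY₂ → ¬ T (readsS nat ADV B) → ¬ T (writes nat ADV B) → ¬ T (writes nat LIM B) → Moves B → Grows B →
                  Driven B 4 r₂ (Inv₂ g₂ h q W₀ L₀ m) y
        driven₂ {B} eq blind keeps lim mv gr = drive (Inv₂ g₂ h q W₀ L₀ m) blind keeps lim mv gr (step₂ eq) (s≤s z≤n) 2k≤M start₂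

        finish : ∀ {e₂} → Inv₂ g₂ h q W₀ L₀ m 0 e₂ → (∀ {x} → T (y bool DEL 0 x) → T (e₂ bool DEL 0 x)) → Verified g q m (e₂ bool DEL 0)
        finish {e₂} J grown = record
          { solves = solves-final {L₀ 0} labels split comp {e₂ bool DEL 0} (λ {x} d → grown (subst (λ f → T (f 0 x)) (sym (Mid.del≡ mid)) d))
              (solved-⊆ (g₂ ∖ D ∖ X⁺) (g₂ ∖ D) (λ {u} {x} a → let (b , c) = Fixed₂.arcs fixed₂ (proj₁ (∖ᵉ g₂ D a)) in
                ∖ⁱ (g₂ ∖ D) X⁺ a (count-zero M none (n<M b)) (count-zero M none (n<M c))) good)
          ; small = ≤-trans (m≤n+m _ κ) spent }
          where
          open Inv₂ J renaming (X to X⁺; w to w⁺)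
          ℓ≤κ : ℓ ≤ κ
          ℓ≤κ = lower≤budget (λ a → let (b , c) = directed-arcs dir {g₂} (Fixed₂.arcs fixed₂) (proj₁ (∖ᵉ (directed dir g₂) D a)) in n<M b , n<M c)
                  (λ hs → n<M (proj₁ (terminals-e w (L₀ 0) hs))) (λ {s} hs → ∨ʳ (A s) (∧ʳ (s <ᵇ n) hs)) hid
          -- With no digit left, `2 * κ ≤ ℓ ≤ κ`. So the hidden set is empty, and the deletions
          -- alone solve the requests.
          none : count M X⁺ ≡ 0
          none = n≤0⇒n≡0 (≤-trans (Hidden.budget hid) (+-cancelˡ-≤ κ κ 0 (≤-trans (+-monoʳ-≤ κ (m≤m+n κ 0)) (≤-trans fuel (+-monoˡ-≤ 0 ℓ≤κ)))))

    -- A reference state in which all scratch arrays are blank. The advice is constructed for it and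
    -- works for any actual state because an attempt does not depend on the scratch arrays.
    canon : (ℕ → ℕ) → State
    canon a nat  x i j = if x ≡ᵇ ADV then a j else (if x ≡ᵇ ROW then m else 0)
    canon a bool x     = if x ≡ᵇ ARC then g else (if x ≡ᵇ REQ then q else (if x ≡ᵇ W then W₀ else λ _ _ → false))

    canon-agree : ∀ a a′ → canon a ≈ canon a′
    canon-agree a a′ nat  b h i j = trans (if-F {b = b ≡ᵇ ADV} h) (sym (if-F {b = b ≡ᵇ ADV} h))
    canon-agree a a′ bool b h i j = refl

    module Spliced (α δ₁ δ₂ : ℕ → ℕ) where
      spliced : ℕ → ℕ
      spliced j = if j <ᵇ labelsEnd k then α j else (if j <ᵇ phase₁End k then δ₁ (j ∸ labelsEnd k)
                    else (if j <ᵇ adviceLength k then δ₂ (j ∸ phase₁End k) else 0))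

      labelsEnd≤ : labelsEnd k ≤ phase₁End k
      labelsEnd≤ = ≤-trans (m≤n+m _ r₁) r₁-fits

      phase₁End≤ : phase₁End k ≤ adviceLength k
      phase₁End≤ = ≤-trans (m≤n+m _ r₂) r₂-fits

      at-labels : ∀ {j} → j < labelsEnd k → spliced j ≡ α j
      at-labels h = if-T (<⇒<ᵇ h)

      at-phase₁ : ∀ {j} → labelsEnd k ≤ j → j < phase₁End k → spliced j ≡ δ₁ (j ∸ labelsEnd k)
      at-phase₁ {j} le h = trans (if-F {b = j <ᵇ labelsEnd k} λ q → ≤⇒≯ le (<ᵇ⇒< j _ q)) (if-T (<⇒<ᵇ h))

      at-phase₂ : ∀ {j} → phase₁End k ≤ j → j < adviceLength k → spliced j ≡ δ₂ (j ∸ phase₁End k)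
      at-phase₂ {j} le h = trans (if-F {b = j <ᵇ labelsEnd k} λ q → ≤⇒≯ (≤-trans labelsEnd≤ le) (<ᵇ⇒< j _ q))
        (trans (if-F {b = j <ᵇ phase₁End k} λ q → ≤⇒≯ le (<ᵇ⇒< j _ q)) (if-T (<⇒<ᵇ h)))

      at-end : ∀ {j} → adviceLength k ≤ j → spliced j ≡ 0
      at-end {j} le = trans (if-F {b = j <ᵇ labelsEnd k} λ q → ≤⇒≯ (≤-trans labelsEnd≤ (≤-trans phase₁End≤ le)) (<ᵇ⇒< j _ q))
        (trans (if-F {b = j <ᵇ phase₁End k} λ q → ≤⇒≯ (≤-trans phase₁End≤ le) (<ᵇ⇒< j _ q)) (if-F {b = j <ᵇ adviceLength k} λ q → ≤⇒≯ le (<ᵇ⇒< j _ q)))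

      spliced-small : ∀ b → 0 < b → (∀ j → α j < b) → (∀ j → δ₁ j < b) → (∀ j → δ₂ j < b) → ∀ j → spliced j < b
      spliced-small b b>0 hα h₁ h₂ j with j <? labelsEnd k | j <? phase₁End k | j <? adviceLength k
      ... | yes l | _ | _ = subst (_< b) (sym (at-labels l)) (hα _)
      ... | no l | yes l₁ | _ = subst (_< b) (sym (at-phase₁ (≮⇒≥ l) l₁)) (h₁ _)
      ... | no l | no l₁ | yes l₂ = subst (_< b) (sym (at-phase₂ (≮⇒≥ l₁) l₂)) (h₂ _)
      ... | no l | no l₁ | no l₂ = subst (_< b) (sym (at-end (≮⇒≥ l₂))) b>0

    -- The blocks are variables with equations, so that `complete` can be checked without unfolding
    -- them.
    record Parts (La In B₁ Mi B₂ : Stm) : Set where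
      program : Stm
      program = La ⍮ In ⍮ loop (DIGIT ⍮ B₁) ⍮ Mi ⍮ loop (DIGIT ⍮ B₂)
      field
        la≡ : La ≡ LABELS
        in≡ : In ≡ INIT₁
        b₁≡ : B₁ ≡ BODY₁
        mi≡ : Mi ≡ MID
        b₂≡ : B₂ ≡ BODY₂
        in-blind : ¬ T (readsS nat ADV In)
        mi-blind : ¬ T (readsS nat ADV Mi)
        in-keeps : ¬ T (writes nat ADV In)
        mi-keeps : ¬ T (writes nat ADV Mi)
        req₁   : ¬ T (writes bool REQ B₁)
        row₁   : ¬ T (writes nat ROW B₁)
        blind₁ : ¬ T (readsS nat ADV B₁)
        keeps₁ : ¬ T (writes nat ADV B₁)
        lim₁   : ¬ T (writes nat LIM B₁)
        mv₁    : Moves B₁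
        gr₁    : Grows B₁
        blind₂ : ¬ T (readsS nat ADV B₂)
        keeps₂ : ¬ T (writes nat ADV B₂)
        lim₂   : ¬ T (writes nat LIM B₂)
        mv₂    : Moves B₂
        gr₂    : Grows B₂
        legal′  : T (legal scratch program)
        defines : ¬ T (undefined scratch program bool DEL)

    α : ℕ → ℕ
    α = listed M w rank

    α≤ : ∀ j → α j ≤ suc (2 * k)
    α≤ = listed≤ M w rank (suc (2 * k)) λ x< h → ≤-trans (rank≤ x< h) wsize

    position-small : ∀ x → position M w x < labelsEnd k
    position-small x = ≤-trans (s≤s (≤-trans (position≤ M w x) wsize))
      (≤-reflexive (solve 1 (λ k → con 2 :+ con 2 :* k := k :+ k :+ con 2) refl k))
      where open +-*-Solver

    position<M : ∀ x → position M w x < M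
    position<M x = ≤-trans (position-small x) (≤-trans (≤-trans (m≤n+m _ r₁) r₁-fits) phase₁End≤M)

    labels-canon : ∀ {La} → La ≡ LABELS → ∀ a i x → run La (canon a) nat LAB i x ≡ a (position M w x)
    labels-canon refl a i x = labels-read (canon a) i x (position<M x)

    labels-agree : ∀ {La} → La ≡ LABELS → ∀ a → (∀ {j} → j < labelsEnd k → a j ≡ α j) → run La (canon α) ≈ run La (canon a)
    labels-agree refl a h = upd-agree nat LAB _ _ (canon-agree α a) λ i x →
      trans (labels-canon refl α i x) (trans (sym (h (position-small x))) (sym (labels-canon refl a i x)))

    record Labelled (y : State) : Set where
      field
        arc≡ : y bool ARC ≡ g
        w≡   : y bool W ≡ W₀
        scene : Scene y

    labelled-ok : ∀ {La} → La ≡ LABELS → ∀ a → Labelled (run La (canon a))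
    labelled-ok refl a = record { arc≡ = refl ; w≡ = refl ; scene = record { req≡ = refl ; row≡ = refl } }

    start₁ : ∀ {In} → In ≡ INIT₁ → ∀ {y} → Labelled y → Labels (y nat LAB) → Ready₁ (y nat LAB) (run In y)
    start₁ refl {y} L labels = ready₁ {y nat LAB} y (run INIT₁ y) labels (Labelled.arc≡ L) (Labelled.w≡ L) refl
      record { req≡ = Scene.req≡ (Labelled.scene L) ; row≡ = Scene.row≡ (Labelled.scene L) } (init-ok y)

    middle : ∀ {Mi} → Mi ≡ MID → ∀ {L₀ e} → I₁ L₀ 0 e → Mid e (run Mi e)
    middle refl {e = e} (i , _) = mid-ok e (subst Bounded (sym (Inv₁.arc≡ i)) gn)

    module _ {La In B₁ Mi B₂} (P : Parts La In B₁ Mi B₂) where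
      open Parts P

      complete : ∃[ a ] (∀ j → a j < 2 * k + 4) × (∀ {j} → adviceLength k ≤ j → a j ≡ 0) ×
                 (∀ {st} → AgreeOff scratch (canon a) st → Verified g q m (run program st bool DEL 0))
      complete = spliced , spliced-small (2 * k + 4) (≤-trans (s≤s z≤n) (m≤n+m 4 (2 * k)))
          (λ j → ≤-trans (s≤s (α≤ j)) (≤-trans (≤-reflexive (+-comm 2 (2 * k))) (+-monoʳ-≤ (2 * k) (s≤s (s≤s z≤n)))))
          (λ j → ≤-trans (D₁.small j) (≤-trans (s≤s (s≤s z≤n)) (m≤n+m 4 (2 * k)))) (λ j → ≤-trans (D₂.small j) (m≤n+m 4 (2 * k))) , at-end ,
          λ A → verified-cong (λ x → trans (A₂ bool DEL (λ ()) 0 x) (independent {program} legal′ defines A x)) verified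
        where
        -- Only the labels are present here. The digits of the phases arise along the run;
        -- afterwards `A₀`, `A₁` and `A₂` show that `spliced` leads to the same states up to the
        -- advice itself.
        y₀ = run La (canon α)
        labels : Labels (y₀ nat LAB)
        labels {x} h = trans (labels-canon la≡ α 0 x) (listed-at M w rank (n<M (w<n h)) h)
        R₁ : Ready₁ (y₀ nat LAB) (run In y₀)
        R₁ = start₁ in≡ (labelled-ok la≡ α) labels
        module D₁ = Driven (driven₁ b₁≡ req₁ row₁ blind₁ keeps₁ lim₁ mv₁ gr₁ {y₀ nat LAB} labels R₁)
        zd : ∀ {x} → T (w x) → y₀ nat LAB 0 x ≡ 0 → T (D₁.end bool DEL 0 x)
        zd h e = D₁.end-del (Ready₁.zero-deleted R₁ h e)
        mid : Mid D₁.end (run Mi D₁.end)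
        mid = middle mi≡ D₁.end-ok
        module D₂ = Driven (driven₂ {y₀ nat LAB} labels D₁.end-ok zd mid b₂≡ blind₂ keeps₂ lim₂ mv₂ gr₂)
        verified : Verified g q m (D₂.end bool DEL 0)
        verified = finish {y₀ nat LAB} labels D₁.end-ok zd mid D₂.end-ok D₂.end-del
        open Spliced α D₁.digit D₂.digit
        y₁ = run In (run La (canon spliced))
        A₀ : run In y₀ ≈ y₁
        A₀ = agree-run In in-blind (labels-agree la≡ spliced at-labels)
        la-keeps : ¬ T (writes nat ADV La)
        la-keeps = subst (λ s → ¬ T (writes nat ADV s)) (sym la≡) λ ()
        adv₁ : y₁ nat ADV ≡ canon spliced nat ADV
        adv₁ = trans (advice-kept {In} in-keeps) (advice-kept {La} la-keeps)
        A₁ : D₁.end ≈ run (loop (DIGIT ⍮ B₁)) y₁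
        A₁ = D₁.follow A₀ (Ready₁.pt≡ R₁) (Ready₁.lim≡ R₁) r₁-fits phase₁End≤M (λ j → cong (λ f → f 0 j) adv₁) at-phase₁
        y₂ = run Mi (run (loop (DIGIT ⍮ B₁)) y₁)
        adv₂ : y₂ nat ADV ≡ canon spliced nat ADV
        adv₂ = trans (advice-kept {Mi} mi-keeps) (trans (advice-kept {loop (DIGIT ⍮ B₁)} keeps₁) adv₁)
        A₂ : D₂.end ≈ run (loop (DIGIT ⍮ B₂)) y₂
        A₂ = D₂.follow (agree-run Mi mi-blind A₁) (Mid.pt≡ mid) (Mid.lim≡ mid) r₂-fits L≤M (λ j → cong (λ f → f 0 j) adv₂) at-phase₂

    guess-parts : Parts LABELS INIT₁ BODY₁ MID BODY₂
    guess-parts = record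
      { la≡ = refl ; in≡ = refl ; b₁≡ = refl ; mi≡ = refl ; b₂≡ = refl
      ; in-blind = λ () ; mi-blind = λ () ; in-keeps = λ () ; mi-keeps = λ ()
      ; req₁ = λ () ; row₁ = λ () ; blind₁ = λ () ; keeps₁ = λ () ; lim₁ = λ () ; mv₁ = moves₁ ; gr₁ = grows₁
      ; blind₂ = λ () ; keeps₂ = λ () ; lim₂ = λ () ; mv₂ = moves₂ ; gr₂ = grows₂ ; legal′ = guess-legal ; defines = guess-defines }

    guess-complete : ∀ {P} → P ≡ GUESS → ∃[ a ] (∀ j → a j < 2 * k + 4) × (∀ {j} → adviceLength k ≤ j → a j ≡ 0) ×
                     (∀ {st} → AgreeOff scratch (canon a) st → Verified g q m (run P st bool DEL 0))
    guess-complete eq = subst (λ P → ∃[ a ] (∀ j → a j < 2 * k + 4) × (∀ {j} → adviceLength k ≤ j → a j ≡ 0) ×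
                     (∀ {st} → AgreeOff scratch (canon a) st → Verified g q m (run P st bool DEL 0))) (sym eq) (complete guess-parts)

-- Counting in base suc c with L digits

module Odometer (M L c : ℕ) (L≤M : L ≤ M) where

  maximal : (ℕ → ℕ) → ℕ → Bool
  maximal a j = not (any M (λ i → (i <ᵇ j) ∧ not (a i ≡ᵇ c)))

  -- The increment as one bulk assignment, in the form of `nextE`: a digit changes exactly if all
  -- lower digits have their maximal value `c`.
  next : (ℕ → ℕ) → ℕ → ℕ
  next a j = if (j <ᵇ L) ∧ maximal a j then (if a j ≡ᵇ c then 0 else a j + 1) else a j

  value : ℕ → (ℕ → ℕ) → ℕ
  value zero    a = 0
  value (suc l) a = value l a + a l * suc c ^ l

  private
    maximal-e : ∀ a {j} → j ≤ M → T (maximal a j) → ∀ {i} → i < j → a i ≡ c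
    maximal-e a {j} j≤ h {i} i< with a i ≟ c
    ... | yes e = e
    ... | no ne = ⊥-elim (notᵉ h (anyⁱ M {λ i → (i <ᵇ j) ∧ not (a i ≡ᵇ c)} i (≤-trans i< j≤) (∧ⁱ (<⇒<ᵇ i<) (notⁱ λ q → ne (≡ᵇ⇒≡ (a i) c q)))))

    maximal-i : ∀ a {j} → (∀ {i} → i < j → a i ≡ c) → T (maximal a j)
    maximal-i a {j} h = notⁱ λ q → let (i , _ , p) = anyᵉ M {λ i → (i <ᵇ j) ∧ not (a i ≡ᵇ c)} q in
      notᵉ (∧ʳ (i <ᵇ j) p) (≡⇒≡ᵇ (a i) c (h (<ᵇ⇒< i j (∧ˡ (i <ᵇ j) p))))

    next-wrap : ∀ a {j} → j < L → T (maximal a j) → a j ≡ c → next a j ≡ 0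
    next-wrap a {j} j< h e = trans (if-T (∧ⁱ (<⇒<ᵇ j<) h)) (if-T (≡⇒≡ᵇ (a j) c e))

    next-up : ∀ a {j} → j < L → T (maximal a j) → a j ≢ c → next a j ≡ suc (a j)
    next-up a {j} j< h ne = trans (if-T (∧ⁱ (<⇒<ᵇ j<) h)) (trans (if-F λ q → ne (≡ᵇ⇒≡ (a j) c q)) (+-comm (a j) 1))

    next-same : ∀ a {j} → ¬ T (maximal a j) → next a j ≡ a j
    next-same a {j} h = if-F λ q → h (∧ʳ (j <ᵇ L) q)

  next-value : ∀ a l → l ≤ L → T (maximal a l) × value l (next a) ≡ 0 × suc (value l a) ≡ suc c ^ l ⊎
                                ¬ T (maximal a l) × value l (next a) ≡ suc (value l a)
  next-value a zero    l≤ = inj₁ (maximal-i a {0} (λ ()) , refl , refl)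
  next-value a (suc l) l≤ with next-value a l (≤-trans (n≤1+n l) l≤)
  ... | inj₂ (nm , e) = inj₂ ((λ h → nm (maximal-i a λ i< → maximal-e a (≤-trans l≤ L≤M) h (≤-trans i< (n≤1+n l)))) ,
          cong₂ _+_ e (cong (_* suc c ^ l) (next-same a nm)))
  ... | inj₁ (mx , e , full) with a l ≟ c
  ...   | yes q = inj₁ (maximal-i a below , cong₂ _+_ e (cong (_* suc c ^ l) (next-wrap a l≤ mx q)) ,
            cong₂ (λ x y → x + y * suc c ^ l) full q)
    where
    below : ∀ {i} → i < suc l → a i ≡ c
    below {i} i< with m≤n⇒m<n∨m≡n (≤-pred i<)
    ... | inj₁ i<l  = maximal-e a (≤-trans (≤-trans (n≤1+n l) l≤) L≤M) mx i<l
    ... | inj₂ refl = q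
  ...   | no ne = inj₂ ((λ h → ne (maximal-e a (≤-trans l≤ L≤M) h ≤-refl)) ,
            trans (cong₂ _+_ e (cong (_* suc c ^ l) (next-up a l≤ mx ne))) (cong (_+ a l * suc c ^ l) (sym full)))

  value-< : ∀ a → (∀ j → a j < suc c) → ∀ l → value l a < suc c ^ l
  value-< a h zero    = s≤s z≤n
  value-< a h (suc l) = ≤-trans (+-monoˡ-≤ _ (value-< a h l)) (+-monoʳ-≤ (suc c ^ l) (*-monoˡ-≤ (suc c ^ l) (≤-pred (h l))))

  value-injective : ∀ a a′ → (∀ j → a j < suc c) → (∀ j → a′ j < suc c) → ∀ l → value l a ≡ value l a′ → ∀ {j} → j < l → a j ≡ a′ j
  value-injective a a′ h h′ (suc l) e {j} j< with digit (a l) (a′ l) e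
    where
    B = suc c ^ l
    digit : ∀ q q′ → value l a + q * B ≡ value l a′ + q′ * B → q ≡ q′ × value l a ≡ value l a′
    digit q q′ e = digits-unique B q (value l a) q′ (value l a′) (value-< a h l) (value-< a′ h′ l)
      (trans (+-comm (q * B) _) (trans e (+-comm _ (q′ * B))))
  ... | e₁ , e₂ with m≤n⇒m<n∨m≡n (≤-pred j<)
  ...   | inj₁ l<   = value-injective a a′ h h′ l e₂ l<
  ...   | inj₂ refl = e₁

  next-small : ∀ a → (∀ j → a j < suc c) → ∀ j → next a j < suc c
  next-small a h j with T? ((j <ᵇ L) ∧ maximal a j)
  ... | no n = subst (_< suc c) (sym (if-F n)) (h j)
  ... | yes y with a j ≟ c
  ...   | yes e = subst (_< suc c) (sym (next-wrap a (<ᵇ⇒< j L (∧ˡ (j <ᵇ L) y)) (∧ʳ (j <ᵇ L) y) e)) (s≤s z≤n)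
  ...   | no ne = subst (_< suc c) (sym (next-up a (<ᵇ⇒< j L (∧ˡ (j <ᵇ L) y)) (∧ʳ (j <ᵇ L) y) ne)) (s≤s (≤∧≢⇒< (≤-pred (h j)) ne))

  next-end : ∀ a {j} → L ≤ j → next a j ≡ a j
  next-end a {j} le = if-F λ q → ≤⇒≯ le (<ᵇ⇒< j L (∧ˡ (j <ᵇ L) q))

  start : ℕ → ℕ
  start _ = 0

  private
    value-start : ∀ l → value l start ≡ 0
    value-start zero    = refl
    value-start (suc l) = cong (_+ 0) (value-start l)

  -- Each step before an overflow raises the value by one, and the value determines the digits. So
  -- the string `a` is met after `value L a` steps.
  reached : ∀ a → (∀ j → a j < suc c) → (∀ {j} → L ≤ j → a j ≡ 0) →
            value L a < suc c ^ L × (∀ j → iter (value L a) next start j ≡ a j)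
  reached a small end = value-< a small L , agrees
    where
    Reached : ℕ → (ℕ → ℕ) → Set
    Reached i s = value L s ≡ i × (∀ j → s j < suc c) × (∀ {j} → L ≤ j → s j ≡ 0)
    steps : Reached (value L a) (iter (value L a) next start)
    steps = iter-ind Reached {next} (value L a) {start} (value-start L , (λ _ → s≤s z≤n) , λ _ → refl) λ {i} {s} i< (e , sm , z′) →
      (case next-value s L ≤-refl of λ
        { (inj₁ (_ , _ , full)) → ⊥-elim (<⇒≢ (≤-trans (s≤s i<) (value-< a small L)) (trans (cong suc (sym e)) full))
        ; (inj₂ (_ , up)) → trans up (cong suc e) }) , next-small s sm , λ {j} le → trans (next-end s le) (z′ le)
    agrees : ∀ j → iter (value L a) next start j ≡ a j
    agrees j with j <? L
    ... | yes l = value-injective _ a (proj₁ (proj₂ steps)) small L (proj₁ steps) l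
    ... | no ge = trans (proj₂ (proj₂ steps) (≮⇒≥ ge)) (sym (end (≮⇒≥ ge)))

-- Iterative compression: row by row, the source of the requests is added to
-- the solution, which is then replaced by a small one.

lengthE : Ex nat 2
lengthE = k+k ⊞ k+k ⊞ k+k ⊞ k+k ⊞ lit′ 6

nextE : Ex nat 2
nextE = ite (n₀ ⊲ lengthE && neg (∃̂ (n₀ ⊲ n₁ && neg (nr ADV x₀ ≐ k+k ⊞ lit′ 3))))
            (ite (nr ADV x₀ ≐ k+k ⊞ lit′ 3) (lit′ 0) (nr ADV x₀ ⊞ lit′ 1)) (nr ADV x₀)

NEXT EXTEND REPLACE COMPRESS : Stm
NEXT     = assign nat ADV nextE
EXTEND   = assign bool W (n₀ ⊲ #n && (br W x₀ || n₀ ≐ ns ROW)) ⍮ assign bool FOUND falseE ⍮ assign nat ADV (lit′ 0)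
REPLACE  = assign bool OK (bs OK && bs FOUND) ⍮ assign bool W (br BEST x₀) ⍮ assign nat ROW (ns ROW ⊞ lit′ 1)
COMPRESS = EXTEND ⍮ rep (TRY ⍮ NEXT) ⍮ REPLACE

module Compression (C : Context) (n+n≤M : Context.cn C + Context.cn C ≤ Context.cM C) (2k<M : 2 * Context.ck C < Context.cM C)
                   (L≤M : adviceLength (Context.ck C) ≤ Context.cM C)
                   (all : Context.cE C ≡ suc (Context.ck C + Context.ck C + 3) ^ adviceLength (Context.ck C)) where
  open Context C renaming (cM to M; cn to n; ck to k; cE to E)
  open Semantics C
  open Logic C
  open Guessing C n+n≤M 2k<M using (n≤M; module Complete)
  open Checking C n≤M
  open Odometer M (adviceLength k) (k + k + 3) L≤M

  record Fix (g q W₀ : ℕ → ℕ → Bool) (m : ℕ) (y : State) : Set where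
    field
      arc≡ : y bool ARC ≡ g
      req≡ : y bool REQ ≡ q
      w≡   : y bool W ≡ W₀
      row≡ : ∀ i j → y nat ROW i j ≡ m

    setting : Setting g q m y
    setting = record { arc≡ = arc≡ ; req≡ = req≡ ; row≡ = row≡ 0 0 }

  record Keeps (s : Stm) : Set where
    field
      arc : ¬ T (writes bool ARC s)
      req : ¬ T (writes bool REQ s)
      w   : ¬ T (writes bool W s)
      ok  : ¬ T (writes bool OK s)
      row : ¬ T (writes nat ROW s)

  fix-run : ∀ {s} → Keeps s → ∀ {g q W₀ m y} → Fix g q W₀ m y → Fix g q W₀ m (run s y)
  fix-run {s} K {y = y} F = record
    { arc≡ = trans (frame s y bool ARC (Keeps.arc K)) (Fix.arc≡ F) ; req≡ = trans (frame s y bool REQ (Keeps.req K)) (Fix.req≡ F)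
    ; w≡ = trans (frame s y bool W (Keeps.w K)) (Fix.w≡ F)
    ; row≡ = λ i j → trans (cong (λ f → f i j) (frame s y nat ROW (Keeps.row K))) (Fix.row≡ F i j) }

  best-cong : ∀ {g q m y y′} → y′ bool FOUND ≡ y bool FOUND → y′ bool BEST ≡ y bool BEST → GoodBest g q m y → GoodBest g q m y′
  best-cong {g} {q} {m} e₁ e₂ good h = subst (λ f → Verified g q m (f 0)) (sym e₂) (good (subst (λ f → T (f 0 0)) e₁ h))

  success-cong : ∀ {y y′} → y′ bool FOUND ≡ y bool FOUND → Success y → Success y′
  success-cong e h = subst (λ f → T (f 0 0)) (sym e) h

  next-cong : ∀ {a a′} → (∀ j → a j ≡ a′ j) → ∀ j → next a j ≡ next a′ j
  next-cong {a} {a′} h j = if-cong (cong (λ p → (j <ᵇ adviceLength k) ∧ not p) (any-cong M λ i → cong (λ x → (i <ᵇ j) ∧ not (x ≡ᵇ k + k + 3)) (h i)))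
    (if-cong (cong (_≡ᵇ k + k + 3) (h j)) refl (cong (_+ 1) (h j))) (h j)

  -- Kept abstract, so that the programs are not unfolded.
  record Blocks (G K N : Stm) : Set where
    field
      g≡ : G ≡ GUESS
      k≡ : K ≡ CHECK
      n≡ : N ≡ NEXT
      gk : Keeps G
      kk : Keeps K
      nk : Keeps N
      gf : ¬ T (writes bool FOUND G)
      gb : ¬ T (writes bool BEST G)
      ga : ¬ T (writes nat ADV G)
      ka : ¬ T (writes nat ADV K)
      nf : ¬ T (writes bool FOUND N)
      nb : ¬ T (writes bool BEST N)

  blocks : Blocks GUESS CHECK NEXT
  blocks = record { g≡ = refl ; k≡ = refl ; n≡ = refl
    ; gk = record { arc = λ () ; req = λ () ; w = λ () ; ok = λ () ; row = λ () }
    ; kk = record { arc = λ () ; req = λ () ; w = λ () ; ok = λ () ; row = λ () }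
    ; nk = record { arc = λ () ; req = λ () ; w = λ () ; ok = λ () ; row = λ () }
    ; gf = λ () ; gb = λ () ; ga = λ () ; ka = λ () ; nf = λ () ; nb = λ () }

  module _ {G K N} (B : Blocks G K N) {g q W₀ : ℕ → ℕ → Bool} {m : ℕ} (gn : Bounded g) (qn : Bounded q) where
    open Blocks B

    private
      body : Stm
      body = (G ⍮ K) ⍮ N

    body-fix : ∀ {y} → Fix g q W₀ m y → Fix g q W₀ m (run body y)
    body-fix F = fix-run nk (fix-run kk (fix-run gk F))

    body-sound : ∀ {y} → Fix g q W₀ m y → GoodBest g q m y → GoodBest g q m (run body y)
    body-sound {y} F good = best-cong {g} {q} {m} {run K (run G y)} {run body y} (frame N (run K (run G y)) bool FOUND nf) (frame N (run K (run G y)) bool BEST nb)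
      (check-sound (run G y) (Fix.setting (fix-run gk F)) gn qn (best-cong {g} {q} {m} {y} {run G y} (frame G y bool FOUND gf) (frame G y bool BEST gb) good) k≡)

    body-found : ∀ {y} → Fix g q W₀ m y → Success y ⊎ Verified g q m (run G y bool DEL 0) → Success (run body y)
    body-found {y} F h = success-cong {run K (run G y)} {run body y} (frame N (run K (run G y)) bool FOUND nf)
      (check-found (run G y) (Fix.setting (fix-run gk F)) gn qn ([ (λ s → inj₁ (success-cong {y} {run G y} (frame G y bool FOUND gf) s)) , inj₂ ]′ h) k≡)

    body-next : ∀ {y a} → (∀ i j → y nat ADV i j ≡ a j) → ∀ i j → run body y nat ADV i j ≡ next a j
    body-next {y} {a} h i j = advance-by n≡ (λ j → trans (cong (λ f → f 0 j) (trans (frame K (run G y) nat ADV ka) (frame G y nat ADV ga))) (h 0 j)) j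
      where
      advance-by : ∀ {N y} → N ≡ NEXT → (∀ j → y nat ADV 0 j ≡ a j) → ∀ j → run N y nat ADV i j ≡ next a j
      advance-by refl e j = next-cong e j

    rep-fix : ∀ {y} → Fix g q W₀ m y → Fix g q W₀ m (run (rep body) y)
    rep-fix F = iter-ind (λ _ → Fix g q W₀ m) E F λ _ → body-fix

    rep-sound : ∀ {y} → Fix g q W₀ m y → GoodBest g q m y → GoodBest g q m (run (rep body) y)
    rep-sound {y} F good = proj₂ (iter-ind (λ _ y → Fix g q W₀ m y × GoodBest g q m y) E (F , good) λ {_} {y} _ (F , good) → body-fix F , body-sound {y} F good)

    module _ {X : ℕ → Bool} (w<n : ∀ {x} → T (W₀ 0 x) → x < n) (wsol : Solves g q m (W₀ 0)) (xsol : Solves g q m X)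
             (wsize : count M (W₀ 0) ≤ suc (2 * k)) (xsize : count M X ≤ k) where
      open Complete {g} {q} {W₀} {m} {X} gn qn w<n wsol xsol wsize xsize L≤M using (canon; guess-complete)

      rep-found : ∀ {y} → Fix g q W₀ m y → (∀ i j → y nat ADV i j ≡ 0) → Success (run (rep body) y)
      rep-found {y} F zero′ = proj₂ (proj₂ (iter-ind Inv E {y} (F , zero′ , λ ()) step)) hit
        where
        a = proj₁ (guess-complete g≡)
        small : ∀ j → a j < suc (k + k + 3)
        small j = ≤-trans (proj₁ (proj₂ (guess-complete g≡)) j) (≤-reflexive (solve 1 (λ k → con 2 :* k :+ con 4 := con 1 :+ (k :+ k :+ con 3)) refl k))
          where open +-*-Solver
        reaches = reached a small (proj₁ (proj₂ (proj₂ (guess-complete g≡))))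
        -- The number of the attempt that reads the good string. Success persists through the later
        -- attempts.
        N₀ = value (adviceLength k) a
        hit : N₀ < E
        hit = subst (N₀ <_) (sym all) (proj₁ reaches)
        string : ℕ → ℕ → ℕ
        string i = iter i next start
        Inv : ℕ → State → Set
        Inv i y = Fix g q W₀ m y × (∀ r j → y nat ADV r j ≡ string i j) × (N₀ < i → Success y)
        step : ∀ {i y} → i < E → Inv i y → Inv (suc i) (run body y)
        step {i} {y} _ (F , adv , found) = body-fix F , body-next {y} {string i} adv , λ le → body-found {y} F (now (m≤n⇒m<n∨m≡n (≤-pred le)))
          where
          agree : i ≡ N₀ → AgreeOff scratch (canon a) y
          agree e nat  0 _ r j = sym (trans (adv r j) (trans (cong (λ i → string i j) e) (proj₂ reaches j)))
          agree e nat  4 _ r j = sym (Fix.row≡ F r j)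
          agree e nat  1 h = ⊥-elim (h tt)
          agree e nat  2 h = ⊥-elim (h tt)
          agree e nat  3 h = ⊥-elim (h tt)
          agree e nat  (suc (suc (suc (suc (suc _))))) h = ⊥-elim (h tt)
          agree e bool 0 _ r j = cong (λ f → f r j) (sym (Fix.arc≡ F))
          agree e bool 1 _ r j = cong (λ f → f r j) (sym (Fix.req≡ F))
          agree e bool 2 _ r j = cong (λ f → f r j) (sym (Fix.w≡ F))
          agree e bool (suc (suc (suc _))) h = ⊥-elim (h tt)
          now : N₀ < i ⊎ N₀ ≡ i → Success y ⊎ Verified g q m (run G y bool DEL 0)
          now (inj₁ lt) = inj₁ (found lt)
          now (inj₂ e)  = inj₂ (proj₂ (proj₂ (proj₂ (guess-complete g≡))) {y} (agree (sym e)))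

  Below : (g q : ℕ → ℕ → Bool) (i : ℕ) (D : ℕ → Bool) → Set
  Below g q i D = ∀ {s t} → T (q s t) → s < i → ¬ T (D s) → ¬ T (D t) → Reach (g ∖ D) s t → ¬ Reach (g ∖ D) t s

  Solvable : (g q : ℕ → ℕ → Bool) → Set
  Solvable g q = ∃[ X ] count M X ≤ k × (∀ m → Solves g q m X)

  -- A failed replacement is decisive for the whole instance, since a solution of all requests also
  -- solves those of the rows considered so far.
  record Compressed (g q : ℕ → ℕ → Bool) (i : ℕ) (st : State) : Set where
    field
      arc≡   : st bool ARC ≡ g
      req≡   : st bool REQ ≡ q
      row≡   : ∀ r j → st nat ROW r j ≡ i
      sound  : T (st bool OK 0 0) → Below g q i (st bool W 0) × count M (st bool W 0) ≤ 2 * k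
      complete : Solvable g q → T (st bool OK 0 0)

  -- The guard allows the compression to run over all `M` rows: an index that is no vertex adds
  -- nothing.
  extended : State → ℕ → ℕ → Bool
  extended st _ x = (x <ᵇ n) ∧ (st bool W 0 x ∨ (x ≡ᵇ st nat ROW 0 0))

  record Extended (st y : State) : Set where
    field
      arc≡   : y bool ARC ≡ st bool ARC
      req≡   : y bool REQ ≡ st bool REQ
      w≡     : y bool W ≡ extended st
      row≡   : y nat ROW ≡ st nat ROW
      ok≡    : y bool OK ≡ st bool OK
      found≡ : y bool FOUND 0 0 ≡ false
      adv≡   : ∀ r j → y nat ADV r j ≡ 0

  extend-ok : ∀ st → Extended st (run EXTEND st)
  extend-ok st = record { arc≡ = refl ; req≡ = refl ; w≡ = refl ; row≡ = refl ; ok≡ = refl ; found≡ = refl ; adv≡ = λ _ _ → refl }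

  record Replaced (y₁ y : State) : Set where
    field
      arc≡ : y bool ARC ≡ y₁ bool ARC
      req≡ : y bool REQ ≡ y₁ bool REQ
      row≡ : ∀ r j → y nat ROW r j ≡ suc (y₁ nat ROW 0 0)
      ok≡  : y bool OK 0 0 ≡ y₁ bool OK 0 0 ∧ y₁ bool FOUND 0 0
      w≡   : ∀ x → y bool W 0 x ≡ y₁ bool BEST 0 x

  replace-ok : ∀ y₁ → Replaced y₁ (run REPLACE y₁)
  replace-ok y₁ = record { arc≡ = refl ; req≡ = refl ; row≡ = λ _ _ → +-comm (y₁ nat ROW 0 0) 1 ; ok≡ = refl ; w≡ = λ _ → refl }

  module _ {g q : ℕ → ℕ → Bool} (gn : Bounded g) (qn : Bounded q) where

    extended-sound : ∀ {i} st → st nat ROW 0 0 ≡ i → Below g q i (st bool W 0) → Solves g q i (extended st 0)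
    extended-sound st refl below {s} {t} r le ns nt p p′ with m≤n⇒m<n∨m≡n le
    -- The requests of the new row have their source in the extended set and are cut by it.
    ... | inj₂ refl = ns (∧ⁱ (<⇒<ᵇ (proj₁ (qn r))) (∨ʳ (st bool W 0 s) (≡⇒≡ᵇ s s refl)))
    ... | inj₁ lt = below r lt (λ h → ns (∧ⁱ (<⇒<ᵇ (proj₁ (qn r))) (∨ˡ h))) (λ h → nt (∧ⁱ (<⇒<ᵇ (proj₂ (qn r))) (∨ˡ h))) (thin p) (thin p′)
      where
      thin : ∀ {u w} → Reach (g ∖ extended st 0) u w → Reach (g ∖ st bool W 0) u w
      thin = reach-map (g ∖ extended st 0) (g ∖ st bool W 0) λ e → let (e , a , b) = ∖ᵉ g (extended st 0) e in
        ∖ⁱ g (st bool W 0) e (λ h → a (∧ⁱ (<⇒<ᵇ (proj₁ (gn e))) (∨ˡ h))) (λ h → b (∧ⁱ (<⇒<ᵇ (proj₂ (gn e))) (∨ˡ h)))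

    extended-size : ∀ st → count M (extended st 0) ≤ suc (count M (st bool W 0))
    extended-size st = ≤-trans (count-mono M λ {x} _ h → ∧ʳ (x <ᵇ n) h) (count-insert M (st bool W 0) (st nat ROW 0 0))

    module _ {G K N} (B : Blocks G K N) where
      private
        compressed : ∀ {i} st y y₁ → Compressed g q i st → Extended st y → y₁ ≡ run (rep ((G ⍮ K) ⍮ N)) y →
                     y₁ bool OK ≡ y bool OK → ∀ st′ → Replaced y₁ st′ → Compressed g q (suc i) st′
        compressed {i} st y y₁ S E refl ok st′ R = record
          { arc≡ = trans R.arc≡ (Fix.arc≡ F′) ; req≡ = trans R.req≡ (Fix.req≡ F′) ; row≡ = λ r j → trans (R.row≡ r j) (cong suc (Fix.row≡ F′ 0 0))
          ; sound = λ h → let V = best (∧ʳ (y₁ bool OK 0 0) (subst T R.ok≡ h)) in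
              (λ r lt → Verified.solves V r (≤-pred lt)) , Verified.small V
          ; complete = λ sol → subst T (sym R.ok≡) (∧ⁱ (subst (λ f → T (f 0 0)) (sym (trans ok E.ok≡)) (S.complete sol)) (found sol)) }
          where
          module S = Compressed S
          module E = Extended E
          module R = Replaced R
          F : Fix g q (extended st) i y
          F = record { arc≡ = trans E.arc≡ S.arc≡ ; req≡ = trans E.req≡ S.req≡ ; w≡ = E.w≡ ; row≡ = λ r j → trans (cong (λ f → f r j) E.row≡) (S.row≡ r j) }
          F′ : Fix g q (extended st) i y₁
          F′ = rep-fix B gn qn F
          best : T (y₁ bool FOUND 0 0) → Verified g q i (st′ bool W 0)
          best h = verified-cong (λ x → sym (R.w≡ x)) (rep-sound B gn qn {y = y} F (λ h → ⊥-elim (subst T E.found≡ h)) h)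
          found : Solvable g q → T (y₁ bool FOUND 0 0)
          found sol@(X , small , solves) = let (below , size) = S.sound (S.complete sol) in
            rep-found B gn qn {X = X} (λ {x} h → <ᵇ⇒< x n (∧ˡ (x <ᵇ n) h)) (extended-sound st (S.row≡ 0 0) below) (solves i)
              (≤-trans (extended-size st) (s≤s size)) small {y} F E.adv≡

      compress-step : ∀ {E R} → E ≡ EXTEND → R ≡ REPLACE → ∀ {i st} → Compressed g q i st →
                      Compressed g q (suc i) (run (E ⍮ rep ((G ⍮ K) ⍮ N) ⍮ R) st)
      compress-step refl refl {st = st} S = compressed st (run EXTEND st) _ S (extend-ok st) refl ok _ (replace-ok _)
        where
        ok : run (rep ((G ⍮ K) ⍮ N)) (run EXTEND st) bool OK ≡ run EXTEND st bool OK
        ok = frame (rep ((G ⍮ K) ⍮ N)) (run EXTEND st) bool OK λ h → [ (λ h → [ Keeps.ok gk , Keeps.ok kk ]′ (∨ᵉ (writes bool OK G) h)) , Keeps.ok nk ]′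
               (∨ᵉ (writes bool OK (G ⍮ K)) h)
          where open Blocks B

-- Loading the input and computing the number of strings

rowE squareE : Ex nat 2
rowE    = Σ̂ (ite (n₀ ⊲ n₂) #n (lit′ 0))
squareE = Σ̂ (ite (n₀ ⊲ #n) #n (lit′ 0))

arcE requestE : Ex bool 2
arcE     = n₁ ⊲ #n && (n₀ ⊲ #n && (neg (n₁ ≐ n₀) && lit′ 0 ⊲ inp (lit′ 2 ⊞ (rowE ⊞ n₀))))
requestE = n₁ ⊲ #n && (n₀ ⊲ #n && lit′ 0 ⊲ inp (lit′ 2 ⊞ (squareE ⊞ (rowE ⊞ n₀))))

LOAD SOLVE powerStep POWER : Stm
LOAD  = assign bool ARC arcE ⍮ assign bool REQ requestE ⍮ assign bool W falseE ⍮ assign bool OK (neg falseE) ⍮ assign nat ROW (lit′ 0)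
SOLVE = LOAD ⍮ loop COMPRESS
powerStep = assign nat EE (ite (ns CNT ⊲ lengthE) (Σ̂ (ite (n₀ ⊲ k+k ⊞ lit′ 4) (ns EE) (lit′ 0))) (ns EE)) ⍮ assign nat CNT (ns CNT ⊞ lit′ 1)
POWER = assign nat EE (lit′ 1) ⍮ assign nat CNT (lit′ 0) ⍮ loop powerStep

sum-initial : ∀ M u c → u ≤ M → sum M (λ x → if x <ᵇ u then c else 0) ≡ u * c
sum-initial zero    zero c h = refl
sum-initial (suc M) u    c h with m≤n⇒m<n∨m≡n h
... | inj₁ u<   = trans (cong₂ _+_ (sum-initial M u c (≤-pred u<)) (if-F {b = M <ᵇ u} λ q → ≤⇒≯ (≤-pred u<) (<ᵇ⇒< M u q))) (+-identityʳ (u * c))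
... | inj₂ refl = trans (cong₂ _+_ (trans (sum-cong M λ {x} x< → if-T (<⇒<ᵇ (≤-trans x< (n≤1+n M)))) (sum-const M c)) (if-T (<⇒<ᵇ {M} ≤-refl))) (+-comm (M * c) c)

module Powering (C : Context) (L≤M : adviceLength (Context.ck C) ≤ Context.cM C) (b≤M : Context.ck C + Context.ck C + 4 ≤ Context.cM C) where
  open Context C renaming (cM to M; cn to n; ck to k)
  open Semantics C

  radix : ℕ
  radix = k + k + 4

  record Power (i : ℕ) (st : State) : Set where
    field
      cnt : st nat CNT 0 0 ≡ i
      -- The loop takes `M` rounds, but multiplies only in as many as the advice has digits.
      val : st nat EE 0 0 ≡ radix ^ (i ⊓ adviceLength k)

  power-step : ∀ {i st} → Power i st → Power (suc i) (run powerStep st)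
  power-step {i} {st} record { cnt = refl ; val = e } = record { cnt = +-comm (st nat CNT 0 0) 1 ; val = value }
    where
    L = adviceLength k
    c = st nat CNT 0 0
    old = st nat EE 0 0
    value : (if c <ᵇ L then sum M (λ x → if x <ᵇ radix then old else 0) else old) ≡ radix ^ (suc c ⊓ L)
    value with c <? L
    ... | yes l = trans (if-T (<⇒<ᵇ l)) (trans (sum-initial M radix old b≤M) (trans (cong (radix *_) (trans e (cong (radix ^_) (m≤n⇒m⊓n≡m (<⇒≤ l)))))
                    (cong (radix ^_) (sym (m≤n⇒m⊓n≡m l)))))
    ... | no ge = trans (if-F {b = c <ᵇ L} λ q → ge (<ᵇ⇒< c L q)) (trans e (cong (radix ^_) (trans (m≥n⇒m⊓n≡n (≮⇒≥ ge)) (sym (m≥n⇒m⊓n≡n (≤-trans (≮⇒≥ ge) (n≤1+n c)))))))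

  power-ok : ∀ {P} → P ≡ POWER → ∀ st → run P st nat EE 0 0 ≡ radix ^ adviceLength k
  power-ok refl st = trans (Power.val (iter-ind Power M {run (assign nat EE (lit′ 1) ⍮ assign nat CNT (lit′ 0)) st} (record { cnt = refl ; val = refl }) λ {i} {y} _ → power-step {i} {y}))
    (cong (radix ^_) (m≥n⇒m⊓n≡n L≤M))

module Loading (I : Instance) (C : Context) (n≡ : Context.cn C ≡ Instance.n I) (n≤M : Context.cn C ≤ Context.cM C) (ok : InputOK I C) where
  open Instance I using (arc; request)
  open Context C renaming (cM to M; cn to n)
  open Semantics C
  open Logic C
  open InputOK ok

  record Loaded (st : State) : Set where
    field
      arc-e   : ∀ {u w} → T (st bool ARC (toℕ u) (toℕ w)) → T (arc u w)
      arc-i   : ∀ {u w} → toℕ u ≢ toℕ w → T (arc u w) → T (st bool ARC (toℕ u) (toℕ w))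
      req-e   : ∀ {u w} → T (st bool REQ (toℕ u) (toℕ w)) → T (request u w)
      req-i   : ∀ {u w} → T (request u w) → T (st bool REQ (toℕ u) (toℕ w))
      arc-<   : ∀ {u w} → T (st bool ARC u w) → u < n × w < n
      req-<   : ∀ {u w} → T (st bool REQ u w) → u < n × w < n
      row≡    : ∀ r j → st nat ROW r j ≡ 0
      empty-w : ∀ x → st bool W 0 x ≡ false
      ok≡     : st bool OK 0 0 ≡ true

  load-ok : ∀ st → Loaded (run LOAD st)
  load-ok st = record
    { arc-e = λ {u} {w} h → let (_ , _ , ne , lt) = to st (toℕ w ∷ toℕ u ∷ []) arcE h in bit-e (arc-cell u w ne) lt
    ; arc-i = λ {u} {w} ne h → from st (toℕ w ∷ toℕ u ∷ []) arcE (<n u , <n w , ne , bit-i (arc-cell u w ne) h)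
    ; req-e = λ {u} {w} h → let (_ , _ , lt) = to y (toℕ w ∷ toℕ u ∷ []) requestE h in bit-e (req-cell u w) lt
    ; req-i = λ {u} {w} h → from y (toℕ w ∷ toℕ u ∷ []) requestE (<n u , <n w , bit-i (req-cell u w) h)
    ; arc-< = λ {u} {w} h → let (a , b , _) = to st (w ∷ u ∷ []) arcE h in a , b
    ; req-< = λ {u} {w} h → let (a , b , _) = to y (w ∷ u ∷ []) requestE h in a , b
    ; row≡ = λ _ _ → refl ; empty-w = λ _ → refl ; ok≡ = refl }
    where
    y = run (assign bool ARC arcE) st
    <n : ∀ (u : Fin (Instance.n I)) → toℕ u < n
    <n u = subst (toℕ u <_) (sym n≡) (toℕ<n u)
    bit-e : ∀ {x b} → x ≡ (if b then 1 else 0) → 0 < x → T b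
    bit-e {b = true}  e h = tt
    bit-e {b = false} e h = contradiction (subst (0 <_) e h) λ ()
    bit-i : ∀ {x b} → x ≡ (if b then 1 else 0) → T b → 0 < x
    bit-i {b = true} e h = subst (0 <_) (sym e) (s≤s z≤n)
    inputAt : ℕ → ℕ
    inputAt x = if x <ᵇ cI then input x else 0
    N′ = Instance.n I
    row-sum : ∀ u → u ≤ n → sum M (λ x → if x <ᵇ u then n else 0) ≡ u * N′
    row-sum u h = trans (sum-initial M u n (≤-trans h n≤M)) (cong (u *_) n≡)
    cell< : ∀ (u w : Fin N′) → toℕ u * N′ + toℕ w < N′ * N′
    cell< u w = combine< N′ (toℕ<n u) (toℕ<n w)
    arc-cell : ∀ u w → toℕ u ≢ toℕ w → inputAt (2 + (sum M (λ x → if x <ᵇ toℕ u then n else 0) + toℕ w)) ≡ (if arc u w then 1 else 0)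
    arc-cell u w ne = trans (cong inputAt (cong (λ s → 2 + (s + toℕ w)) (row-sum (toℕ u) (<⇒≤ (<n u)))))
      (trans (if-T (<⇒<ᵇ (≤-trans (+-monoʳ-< 2 (cell< u w)) (≤-trans (+-monoʳ-≤ 2 (m≤m+n (N′ * N′) _)) room)))) (arcs u w ne))
    req-cell : ∀ u w → inputAt (2 + (sum M (λ x → if x <ᵇ n then n else 0) + (sum M (λ x → if x <ᵇ toℕ u then n else 0) + toℕ w))) ≡ (if request u w then 1 else 0)
    req-cell u w = trans (cong inputAt (cong₂ (λ q s → 2 + (q + (s + toℕ w))) (trans (row-sum n ≤-refl) (cong (_* N′) n≡)) (row-sum (toℕ u) (<⇒≤ (<n u)))))
      (trans (if-T (<⇒<ᵇ (≤-trans (+-monoʳ-< 2 (+-monoʳ-< (N′ * N′) (cell< u w))) room))) (reqs u w))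

-- Subsets, walks and paths of the given instance

member : ∀ {n} → Subset n → ℕ → Bool
member []      _       = false
member (b ∷ X) zero    = b
member (b ∷ X) (suc x) = member X x

member-lookup : ∀ {n} (X : Subset n) u → member X (toℕ u) ≡ lookup X u
member-lookup (b ∷ X) zero    = refl
member-lookup (b ∷ X) (suc u) = member-lookup X u

member-beyond : ∀ {n} (X : Subset n) {x} → n ≤ x → member X x ≡ false
member-beyond []      h       = refl
member-beyond (b ∷ X) (s≤s h) = member-beyond X h

sum-head : ∀ n f → sum (suc n) f ≡ f 0 + sum n (f ∘ suc)
sum-head zero    f = +-comm 0 (f 0)
sum-head (suc n) f = trans (cong (_+ f (suc n)) (sum-head n f)) (+-assoc (f 0) _ _)

count-member : ∀ {n} (X : Subset n) → ∣ X ∣ ≡ count n (member X)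
count-member []                = refl
count-member {suc n} (b ∷ X) = trans (head b) (sym (sum-head n (λ x → b2n (member (b ∷ X) x))))
  where
  head : ∀ b → ∣ b ∷ X ∣ ≡ b2n b + count n (member X)
  head true  = cong suc (count-member X)
  head false = count-member X

count-≤ : ∀ {n M} p → n ≤ M → count n p ≤ count M p
count-≤ {n} {zero}  p z≤n = z≤n
count-≤ {n} {suc M} p h with m≤n⇒m<n∨m≡n h
... | inj₁ lt   = ≤-trans (count-≤ p (≤-pred lt)) (m≤m+n _ _)
... | inj₂ refl = ≤-refl

count-beyond : ∀ {n M} p → (∀ {x} → n ≤ x → p x ≡ false) → count M p ≤ count n p
count-beyond {n} {zero}  p h = z≤n
count-beyond {n} {suc M} p h with n ≤? M
... | yes le = ≤-trans (+-mono-≤ (count-beyond {n} {M} p h) (≤-reflexive (cong b2n (h le)))) (≤-reflexive (+-identityʳ _))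
... | no gt  = count-≤ {suc M} {n} p (≰⇒> gt)

module Translation (I : Instance) (g q : ℕ → ℕ → Bool)
  (arc-e : ∀ {u w} → T (g (toℕ u) (toℕ w)) → T (Instance.arc I u w)) (arc-i : ∀ {u w} → toℕ u ≢ toℕ w → T (Instance.arc I u w) → T (g (toℕ u) (toℕ w)))
  (req-e : ∀ {u w} → T (q (toℕ u) (toℕ w)) → T (Instance.request I u w)) (req-i : ∀ {u w} → T (Instance.request I u w) → T (q (toℕ u) (toℕ w)))
  (arc-< : ∀ {u w} → T (g u w) → u < Instance.n I × w < Instance.n I) (req-< : ∀ {u w} → T (q u w) → u < Instance.n I × w < Instance.n I) where
  open Instance I

  Avoiding : (ℕ → Bool) → Vertex → Set
  Avoiding D u = ¬ T (D (toℕ u))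

  module _ {D : ℕ → Bool} {X : Subset n} (same : ∀ u → D (toℕ u) ≡ lookup X u) where

    ∈-e : ∀ {u} → u ∈ X → T (D (toℕ u))
    ∈-e {u} h = subst T (sym (trans (same u) ([]=⇒lookup h))) tt

    ∈-i : ∀ {u} → T (D (toℕ u)) → u ∈ X
    ∈-i {u} h = lookup⇒[]= u X (trans (sym (same u)) (T→≡ h))

    walk-reach : ∀ {s t} (p : Walk s t) → ¬ Any (_∈ X) (vertices p) → Reach (g ∖ D) (toℕ s) (toℕ t)
    walk-reach ε na = ε
    walk-reach {s} (_◅_ {j = u} e p) na with s Fin.≟ u
    -- A loop is skipped, because diagonal arcs are not loaded.
    ... | yes refl = walk-reach p (na ∘ Any.there)
    ... | no ne    = ∖ⁱ g D (arc-i (ne ∘ toℕ-injective) e) (na ∘ Any.here ∘ ∈-i) (na ∘ Any.there ∘ first-vertex p ∘ ∈-i) ◅ walk-reach p (na ∘ Any.there)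
      where
      first-vertex : ∀ {s t} (p : Walk s t) → s ∈ X → Any (_∈ X) (vertices p)
      first-vertex ε       h = Any.here h
      first-vertex (_ ◅ _) h = Any.here h

    unreachable : ∀ {s t} → ¬ Reach (g ∖ D) (toℕ s) (toℕ t) → CutsAllPaths X s t
    unreachable no-reach p _ with any? (_∈? X) (vertices p)
    ... | yes a = a
    ... | no na = ⊥-elim (no-reach (walk-reach p na))

    at-source : ∀ {s t} → T (D (toℕ s)) → CutsAllPaths X s t
    at-source h ε       _ = Any.here (∈-i h)
    at-source h (_ ◅ _) _ = Any.here (∈-i h)

    at-target : ∀ {s t} → T (D (toℕ t)) → CutsAllPaths X s t
    at-target h p _ = last p
      where
      last : ∀ {s} (p : Walk s _) → Any (_∈ X) (vertices p)
      last ε       = Any.here (∈-i h)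
      last (_ ◅ p) = Any.there (last p)

    Simple : Vertex → Vertex → Set
    Simple s t = Σ[ p ∈ Walk s t ] IsPath p × All (Avoiding D) (vertices p)

    suffix : ∀ {s u t} (p : Walk u t) → IsPath p → All (Avoiding D) (vertices p) → Any (s ≡_) (vertices p) → Simple s t
    suffix ε       un al (Any.here refl) = ε , un , al
    suffix (e ◅ p) un al (Any.here refl) = e ◅ p , un , al
    suffix (e ◅ p) (_ ∷ un) (_ ∷ al) (Any.there m) = suffix p un al m

    -- A walk is shortened to a path from its end: if the new first vertex already occurs, the path
    -- is cut back to that occurrence.
    simple : ∀ {a b} → Reach (g ∖ D) a b → ∀ s t → toℕ s ≡ a → toℕ t ≡ b → ¬ T (D a) → Simple s t
    simple ε s t refl e na with toℕ-injective e
    ... | refl = ε , ([] ∷ []) , (na ∷ [])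
    simple (_◅_ {j = c} e p) s t refl e′ na with ∖ᵉ g D e
    ... | arc-ac , _ , nc with proj₂ (arc-< arc-ac)
    ...   | c< with simple p (fromℕ< c<) t (toℕ-fromℕ< c<) e′ nc
    ...     | p′ , un , al with any? (s Fin.≟_) (vertices p′)
    ...       | yes m = suffix p′ un al m
    ...       | no nm = (arc-e (subst (T ∘ g (toℕ s)) (sym (toℕ-fromℕ< c<)) arc-ac) ◅ p′) , (¬Any⇒All¬ _ nm ∷ un) , (na ∷ al)

    uncut : ∀ {s t} → CutsAllPaths X s t → ¬ T (D (toℕ s)) → ¬ Reach (g ∖ D) (toℕ s) (toℕ t)
    uncut {s} {t} cuts ns r = let (p , un , al) = simple r s t refl refl ns in
      All¬⇒¬Any (All.map (λ na h → na (∈-e h)) al) (cuts p un)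

  module _ (C : Context) (n≡ : Context.cn C ≡ n) where
    open Context C using () renaming (cM to M)
    open Pushing C using (reachable; reachableⁱ; reachableᵉ)

    private
      tabulated : ∀ (D : ℕ → Bool) (u : Vertex) → D (toℕ u) ≡ lookup (tabulate {n = n} (D ∘ toℕ)) u
      tabulated D u = sym (lookup∘tabulate (D ∘ toℕ) u)
      bounded : n ≤ M → ∀ D {u w} → T ((g ∖ D) u w) → u < M × w < M
      bounded n≤M D e = let (a , b) = arc-< (proj₁ (∖ᵉ g D e)) in ≤-trans a n≤M , ≤-trans b n≤M

    is-solution : n ≤ M → ∀ D → (∀ {s t} → T (q s t) → ¬ T (D s) → ¬ T (D t) → Reach (g ∖ D) s t → ¬ Reach (g ∖ D) t s) →
                  IsSolution (tabulate (D ∘ toℕ))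
    is-solution n≤M D solves s t r with T? (D (toℕ s)) | T? (D (toℕ t)) | T? (reachable (g ∖ D) (toℕ s) (toℕ t)) | T? (reachable (g ∖ D) (toℕ t) (toℕ s))
    ... | yes h | _ | _ | _ = inj₁ (at-source {D} (tabulated D) h)
    ... | no _ | yes h | _ | _ = inj₁ (at-target {D} (tabulated D) h)
    ... | no _ | no _ | no h | _ = inj₁ (unreachable {D} (tabulated D) (h ∘ reachableⁱ (g ∖ D) (bounded n≤M D)))
    ... | no _ | no _ | yes _ | no h = inj₂ (unreachable {D} (tabulated D) (h ∘ reachableⁱ (g ∖ D) (bounded n≤M D)))
    ... | no ns | no nt | yes a | yes b = ⊥-elim (solves (req-i r) ns nt (reachableᵉ (g ∖ D) a) (reachableᵉ (g ∖ D) b))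

  solution-solves : ∀ {X} → IsSolution X → ∀ {s t} → T (q s t) → ¬ T (member X s) → ¬ T (member X t) →
                    Reach (g ∖ member X) s t → ¬ Reach (g ∖ member X) t s
  solution-solves {X} sol {s} {t} r ns nt p p′ with req-< r
  ... | s< , t< with fromℕ< s< | toℕ-fromℕ< s< | fromℕ< t< | toℕ-fromℕ< t<
  ...   | u | refl | w | refl = [ (λ c → uncut {member X} {X} (member-lookup X) c ns p) , (λ c → uncut {member X} {X} (member-lookup X) c nt p′) ]′ (sol u w (req-e r))

-- The algorithm on an encoded instance

module Solving (I : Instance) (B E : ℕ) (input : Memory) (ok : InputOK I (context (Instance.n I) (Instance.k I) B E input))
               (all : E ≡ suc (Instance.k I + Instance.k I + 3) ^ adviceLength (Instance.k I)) where
  open Instance I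
  C : Context
  C = context n k B E input
  M : ℕ
  M = memSize n k
  open Semantics C
  open Logic C

  n+n≤M : n + n ≤ M
  n+n≤M = ≤-trans (≤-reflexive (cong (n +_) (sym (+-identityʳ n)))) (≤-trans (m≤m+n (2 * n) (8 * k)) (m≤m+n _ 8))

  L≤M : adviceLength k ≤ M
  L≤M = ≤-trans (m≤m+n (adviceLength k) (2 * n + 2)) (≤-reflexive
    (solve 2 (λ n k → k :+ k :+ (k :+ k) :+ (k :+ k) :+ (k :+ k) :+ con 6 :+ (con 2 :* n :+ con 2) := (con 2 :* n :+ con 8 :* k) :+ con 8) refl n k))
    where open +-*-Solver

  2k<M : 2 * k < M
  2k<M = ≤-trans (m≤m+n (suc (2 * k)) (2 * n + 6 * k + 7)) (≤-reflexive
    (solve 2 (λ n k → con 1 :+ con 2 :* k :+ (con 2 :* n :+ con 6 :* k :+ con 7) := (con 2 :* n :+ con 8 :* k) :+ con 8) refl n k))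
    where open +-*-Solver

  n≤M : n ≤ M
  n≤M = ≤-trans (m≤m+n n n) n+n≤M

  open Compression C n+n≤M 2k<M L≤M all
  open Loading I C refl n≤M ok

  Outcome : State → Set
  Outcome y = (T (y bool OK 0 0) → IsSolution (tabulate (λ u → y bool W 0 (toℕ u))) × ∣ tabulate {n = n} (λ u → y bool W 0 (toℕ u)) ∣ ≤ 2 * k) ×
              (∀ X → IsSolution X → ∣ X ∣ ≤ k → T (y bool OK 0 0))

  loaded-compressed : ∀ {y} → Loaded y → Compressed (y bool ARC) (y bool REQ) 0 y
  loaded-compressed {y} L = record
    { arc≡ = refl ; req≡ = refl ; row≡ = Loaded.row≡ L
    ; sound = λ _ → (λ _ ()) , ≤-trans (≤-reflexive (sum-zero M λ {x} _ → cong b2n (Loaded.empty-w L x))) z≤n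
    ; complete = λ _ → subst T (sym (Loaded.ok≡ L)) tt }

  outcome : ∀ {y z′} → Loaded y → Compressed (y bool ARC) (y bool REQ) M z′ → Outcome z′
  outcome {y} {z′} L S = sound , complete
    where
    open Loaded L
    open Translation I (y bool ARC) (y bool REQ) arc-e arc-i req-e req-i arc-< req-<
    D : ℕ → Bool
    D = z′ bool W 0
    sound : T (z′ bool OK 0 0) → IsSolution (tabulate (λ u → D (toℕ u))) × ∣ tabulate {n = n} (λ u → D (toℕ u)) ∣ ≤ 2 * k
    sound h = let (below , small) = Compressed.sound S h in
      is-solution C refl n≤M D (λ r → below r (≤-trans (proj₁ (req-< r)) n≤M)) ,
      ≤-trans (≤-reflexive (trans (count-member {n} (tabulate (λ u → D (toℕ u)))) (count-cong n same))) (≤-trans (count-≤ {n} {M} D n≤M) small)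
      where
      same : ∀ {x} → x < n → member (tabulate {n = n} (λ u → D (toℕ u))) x ≡ D x
      same x< = subst (λ x → member (tabulate {n = n} (λ u → D (toℕ u))) x ≡ D x) (toℕ-fromℕ< x<)
        (trans (member-lookup (tabulate (λ u → D (toℕ u))) (fromℕ< x<)) (lookup∘tabulate (λ u → D (toℕ u)) (fromℕ< x<)))
    complete : ∀ X → IsSolution X → ∣ X ∣ ≤ k → T (z′ bool OK 0 0)
    complete X sol small = Compressed.complete S (member X ,
      ≤-trans (count-beyond {n} {M} (member X) (member-beyond X)) (≤-trans (≤-reflexive (sym (count-member X))) small) ,
      λ m r _ → solution-solves sol r)

  compressed-loop : ∀ {P} → P ≡ COMPRESS → ∀ {y} → Loaded y → Compressed (y bool ARC) (y bool REQ) M (run (loop P) y)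
  compressed-loop {P} eq {y} L = iter-ind (Compressed (y bool ARC) (y bool REQ)) M (loaded-compressed L) λ _ → step eq
    where
    step : ∀ {P} → P ≡ COMPRESS → ∀ {i st} → Compressed (y bool ARC) (y bool REQ) i st → Compressed (y bool ARC) (y bool REQ) (suc i) (run P st)
    step refl = compress-step (Loaded.arc-< L) (Loaded.req-< L) blocks refl refl

  solve-ok : ∀ {P} → P ≡ SOLVE → ∀ st → Outcome (run P st)
  solve-ok refl st = outcome (load-ok st) (compressed-loop refl (load-ok st))

module _ (I : Instance) where
  open Instance I

  correct : ∀ {σ b} {f : Fin n → Bool} → decode n σ ≡ (if b then just (tabulate f) else nothing) →
            (T b → IsSolution (tabulate f) × ∣ tabulate f ∣ ≤ 2 * k) × (∀ X → IsSolution X → ∣ X ∣ ≤ k → T b) → Correct (decode n σ)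
  correct {b = true}  e (sound , _)    = subst Correct (sym e) (sound tt)
  correct {b = false} e (_ , complete) = subst Correct (sym e) λ (X , sol , small) → complete X sol small

  strings-≡ : (k + k + 4) ^ adviceLength k ≡ strings k
  strings-≡ = cong₂ _^_ (solve 1 (λ k → k :+ k :+ con 4 := con 2 :* k :+ con 4) refl k)
    (solve 1 (λ k → k :+ k :+ (k :+ k) :+ (k :+ k) :+ (k :+ k) :+ con 6 := con 8 :* k :+ con 6) refl k)
    where open +-*-Solver

  outcome-of : ∀ {s₁ s₂} → s₁ ≡ POWER → s₂ ≡ SOLVE → (S : Simulated s₁ s₂ EE OK W I) → let open Simulated S in
               Correct (decode n σ) × E ≡ strings k
  outcome-of eq₁ eq₂ S = correct {σ} {st₂ bool OK 0 0} answer (Sol.solve-ok eq₂ st₁) , trans power strings-≡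
    where
    open Simulated S
    L≤ : adviceLength k ≤ memSize n k
    L≤ = ≤-trans (m≤m+n (adviceLength k) (2 * n + 2)) (≤-reflexive
      (solve 2 (λ n k → k :+ k :+ (k :+ k) :+ (k :+ k) :+ (k :+ k) :+ con 6 :+ (con 2 :* n :+ con 2) := (con 2 :* n :+ con 8 :* k) :+ con 8) refl n k))
      where open +-*-Solver
    b≤ : k + k + 4 ≤ memSize n k
    b≤ = ≤-trans (m≤m+n (k + k + 4) (2 * n + 6 * k + 4)) (≤-reflexive
      (solve 2 (λ n k → k :+ k :+ con 4 :+ (con 2 :* n :+ con 6 :* k :+ con 4) := (con 2 :* n :+ con 8 :* k) :+ con 8) refl n k))
      where open +-*-Solver
    power : E ≡ (k + k + 4) ^ adviceLength k
    power = Powering.power-ok C₁ L≤ b≤ eq₁ empty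
    module Sol = Solving I B E input (inputOK E) (trans power (cong (_^ adviceLength k) (+-suc (k + k) 3)))

algorithm : ∀ {s₁ s₂} → s₁ ≡ POWER → s₂ ≡ SOLVE → ∃[ a ] ∃[ b ] ∃[ c ] (∀ n k E → E ≤ strings k → timeBound n (memSize n k) s₁ s₂ E ≤ a * k ^ (b * k) * suc n ^ c) →
  ∃[ P ] ∃[ a ] ∃[ b ] ∃[ c ] ((I : Instance) → let open Instance I in
    ∃[ σ ] ∃[ t ] (P ⊢ encode I ⇓ σ in-time t)
    × Correct (decode n σ)
    × t ≤ a * k ^ (b * k) * suc n ^ c)
algorithm {s₁} {s₂} eq₁ eq₂ (a , b , c , bound) = mainProgram s₁ s₂ EE OK W , a , b , c , λ I → result I (simulate s₁ s₂ EE OK W I)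
  where
  result : (I : Instance) → Simulated s₁ s₂ EE OK W I → let open Instance I in
    ∃[ σ ] ∃[ t ] (mainProgram s₁ s₂ EE OK W ⊢ encode I ⇓ σ in-time t) × Correct (decode n σ) × t ≤ a * k ^ (b * k) * suc n ^ c
  result I S = let O = outcome-of I eq₁ eq₂ S in Simulated.σ S , Simulated.t S , Simulated.exec S , proj₁ O ,
    ≤-trans (Simulated.bound S) (bound (Instance.n I) (Instance.k I) (Simulated.E S) (≤-reflexive (proj₂ O)))

theorem13 : ∃[ P ] ∃[ a ] ∃[ b ] ∃[ c ] ((I : Instance) → let open Instance I in
    ∃[ σ ] ∃[ t ] (P ⊢ encode I ⇓ σ in-time t)
    × Correct (decode n σ)
    × t ≤ a * k ^ (b * k) * suc n ^ c)
theorem13 = algorithm {POWER} {SOLVE} refl refl (final-bound POWER SOLVE)
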